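{- Fix a graph $H$, a set of positive rational weights $\Lambda=\{\lambda_i : i\in V(H)\}$, and an even integer $m\ge 2$. Then (for each $d$) there is a partition of $\mathrm{Hom}(T_{m,d},H)$ into $|\mathcal{M}_\Lambda(H)|+1$ classes, $$\mathrm{Hom}(T_{m,d},H)=D_\Lambda(0)\cup\bigcup_{(A,B)\in\mathcal{M}_\Lambda(H)} D_\Lambda(A,B),$$ with the following properties: 1. $w_\Lambda(D_\Lambda(0))\le 2^{ -\Omega(d)}Z_\Lambda(T_{m,d},H)$. 2. For each $(A,B)\in\mathcal{M}_\Lambda(H)$ and each $f\in D_\Lambda(A,B)$, the number of vertices $v\in\mathcal{E}$ with $f(v)\notin A$ is at most $(m-\Omega(1))^d$, and the number of vertices $v\in\mathcal{O}$ with $f(v)\notin B$ is at most $(m-\Omega(1))^d$; moreover, all but at most $(m-\Omega(1))^d$ vertices $w\in\mathcal{O}$ have the property that every color of $A$ appears in $\{f(z):z\in N_w\}$, and all but at most $(m-\Omega(1))^d$ vertices $w\in\mathcal{E}$ have the property that every color of $B$ appears in $\{f(z):z\in N_w\}$.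
   Context: For $d\ge1$ and even $m\ge 2$, the even discrete torus $T_{m,d}$ is the graph with vertex set $V=\{0,1,\dots,m-1\}^d$ in which two strings are adjacent iff they differ by exactly $1$ (mod $m$) in exactly one coordinate and agree in all others. It is bipartite with classes $\mathcal{E}$ (strings with even coordinate sum) and $\mathcal{O}$ (odd coordinate sum). $N_x$ denotes the set of neighbors of a vertex $x$. $H$ is a finite graph without multiple edges, possibly with loops. An $H$-coloring of $G$ is a map $f:V(G)\to V(H)$ with $f(u)f(v)\in E(H)$ whenever $uv\in E(G)$; $\mathrm{Hom}(G,H)$ is the set of these. Given positive weights $\Lambda=\{\lambda_i:i\in V(H)\}$, set $w_\Lambda(f)=\prod_{v\in V}\lambda_{f(v)}$ for $f\in\mathrm{Hom}(T_{m,d},H)$, $w_\Lambda(S)=\sum_{f\in S}w_\Lambda(f)$, $Z_\Lambda(T_{m,d},H)=w_\Lambda(\mathrm{Hom}(T_{m,d},H))$, and $\lambda_T=\sum_{k\in T}\lambda_k$ for $T\subseteq V(H)$. For $A,B\subseteq V(H)$, write $A\sim B$ if every vertex of $A$ is adjacent in $H$ to every vertex of $B$. Let $\eta_\Lambda(H)=\max\{\lambda_A\lambda_B: A,B\subseteq V(H), A\sim B\}$ and $\mathcal{M}_\Lambda(H)=\{(A,B): A,B\subseteq V(H), A\sim B, \lambda_A\lambda_B=\eta_\Lambda(H)\}$. Asymptotic notation refers to $d\to\infty$ with $m,H,\Lambda$ fixed: $2^{ -\Omega(d)}$ denotes a quantity at most $2^{ -cd}$ and $(m-\Omega(1))^d$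 a quantity at most $(m-c)^d$, for some constant $c>0$ depending only on $m,H,\Lambda$, valid for all sufficiently large $d$. -}

module Defs where

open import Data.Bool using (T?; Bool; true; false; _∧_; _∨_; not; T; if_then_else_)
open import Data.Nat using (ℕ; zero; suc; _+_; _%_; _≡ᵇ_)
open import Data.Fin using (Fin; zero; suc; toℕ)
open import Data.Vec using (Vec; []; _∷_; lookup)
open import Data.List using (List; []; _∷_; [_]; map; concatMap; allFin; foldr; filter; length)
open import Data.Bool.ListAction using (all; any)
open import Data.Maybe using (Maybe; just; nothing; is-nothing)
open import Data.Product using (_×_; _,_)
open import Data.Fin.Subset using (Subset)
open import Data.Rational using (ℚ; 0ℚ; 1ℚ; _≤_)
import Data.Rational as ℚ
open import Relation.Nullary.Decidable using (does)
open import Relation.Binary.PropositionalEquality using (_≡_)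

-- The target graph H: vertex set Fin n, adjacency given by a Boolean
-- relation (loops allowed, no multiple edges).  Symmetry is assumed
-- separately in the theorem.

Adj : ℕ → Set
Adj n = Fin n → Fin n → Bool

Vertex : ℕ → ℕ → Set
Vertex m d = Vec (Fin m) d

allVerts : ∀ m d → List (Vertex m d)
allVerts m zero    = [ [] ]
allVerts m (suc d) = concatMap (λ x → map (x ∷_) (allVerts m d)) (allFin m)

diff1 : ∀ {m} → Fin m → Fin m → Bool
diff1 {suc k} a b = ((suc (toℕ a) % suc k) ≡ᵇ toℕ b) ∨ ((suc (toℕ b) % suc k) ≡ᵇ toℕ a)

eqFin : ∀ {m} → Fin m → Fin m → Bool
eqFin a b = toℕ a ≡ᵇ toℕ b

allEqOrDiff1 : ∀ {m d} → Vertex m d → Vertex m d → Bool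
allEqOrDiff1 []       []       = true
allEqOrDiff1 (x ∷ xs) (y ∷ ys) = (eqFin x y ∨ diff1 x y) ∧ allEqOrDiff1 xs ys

numDiff : ∀ {m d} → Vertex m d → Vertex m d → ℕ
numDiff []       []       = 0
numDiff (x ∷ xs) (y ∷ ys) = (if eqFin x y then 0 else 1) + numDiff xs ys

torusAdj : ∀ {m d} → Vertex m d → Vertex m d → Bool
torusAdj u v = allEqOrDiff1 u v ∧ (numDiff u v ≡ᵇ 1)

coordSum : ∀ {m d} → Vertex m d → ℕ
coordSum []       = 0
coordSum (x ∷ xs) = toℕ x + coordSum xs

isEven : ∀ {m d} → Vertex m d → Bool
isEven v = (coordSum v % 2) ≡ᵇ 0

isOdd : ∀ {m d} → Vertex m d → Bool
isOdd v = not (isEven v)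

Coloring : ℕ → ℕ → ℕ → Set
Coloring n m d = Vertex m d → Fin n

allFinFuns : ∀ k {Y : Set} → List Y → List (Fin k → Y)
allFinFuns zero    ys = [ (λ ()) ]
allFinFuns (suc k) ys =
  concatMap (λ y → map (λ g → λ { zero → y ; (suc i) → g i }) (allFinFuns k ys)) ys

allColorings : ∀ n m d → List (Coloring n m d)
allColorings n m zero    = map (λ c → λ _ → c) (allFin n)
allColorings n m (suc d) =
  map (λ g → λ { (x ∷ xs) → g x xs }) (allFinFuns m (allColorings n m d))

isHom : ∀ {n} (H : Adj n) m d → Coloring n m d → Bool
isHom H m d f =
  all (λ u → all (λ v → not (torusAdj u v) ∨ H (f u) (f v)) (allVerts m d)) (allVerts m d)

sumℚ : List ℚ → ℚ
sumℚ = foldr ℚ._+_ 0ℚ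

prodℚ : List ℚ → ℚ
prodℚ = foldr ℚ._*_ 1ℚ

powℚ : ℚ → ℕ → ℚ
powℚ q zero    = 1ℚ
powℚ q (suc k) = q ℚ.* powℚ q k

wt : ∀ {n} (lam : Fin n → ℚ) m d → Coloring n m d → ℚ
wt lam m d f = prodℚ (map (λ v → lam (f v)) (allVerts m d))

wtHom : ∀ {n} (H : Adj n) (lam : Fin n → ℚ) m d → (Coloring n m d → Bool) → ℚ
wtHom H lam m d P =
  sumℚ (map (wt lam m d) (filter (λ f → T? ((isHom H m d f ∧ P f)))
                                   (allColorings _ m d)))

Z : ∀ {n} (H : Adj n) (lam : Fin n → ℚ) m d → ℚ
Z H lam m d = wtHom H lam m d (λ _ → true)

lamS : ∀ {n} (lam : Fin n → ℚ) → Subset n → ℚ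
lamS {n} lam A = sumℚ (map lam (filter (λ i → T? ((lookup A i))) (allFin n)))

_∼[_]_ : ∀ {n} → Subset n → Adj n → Subset n → Set
A ∼[ H ] B = ∀ a b → lookup A a ≡ true → lookup B b ≡ true → H a b ≡ true

-- (A,B) ∈ M_Λ(H): A ∼ B and λ_A λ_B = η_Λ(H), i.e. λ_A λ_B attains the
-- maximum of λ_{A'} λ_{B'} over all pairs A' ∼ B'
InM : ∀ {n} (H : Adj n) (lam : Fin n → ℚ) → Subset n × Subset n → Set
InM H lam (A , B) =
  (A ∼[ H ] B) ×
  (∀ A' B' → A' ∼[ H ] B' → lamS lam A' ℚ.* lamS lam B' ≤ lamS lam A ℚ.* lamS lam B)

countV : ∀ m d → (Vertex m d → Bool) → ℕ
countV m d P = length (filter (λ v → T? ((P v))) (allVerts m d))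

allColorsAppear : ∀ {n m d} → Subset n → Coloring n m d → Vertex m d → Bool
allColorsAppear {n} {m} {d} A f w =
  all (λ a → not (lookup A a) ∨ any (λ z → torusAdj w z ∧ eqFin (f z) a) (allVerts m d))
      (allFin n)

-- Clear denominators, so that all weights are natural numbers.  Order the even vertices by a height
-- on the torus that ignores one coordinate.  A version of Finner's inequality, in which the factor at
-- a vertex may depend on what lies two levels or more below, bounds Z by η^(|V| / 2) even after the
-- weight of f is tilted by a factor for each odd v, which favours palettes A = f(N_v) that are not
-- optimal or differ from the palettes predicted from below.  As η^(|V| / 2) ≤ Z, all colourings but an
-- exponentially small part have a small tilt.  If this holds for the orders from below and from above,
-- the gain for a change from A to A′ in one order and the loss for the change back in the other do not
-- cancel, so nearly all palettes are optimal and agree between nearby odd vertices; along coordinate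
-- lines this forces a single palette A at all but (m - c)^d odd vertices.  The second class is the
-- common neighbourhood B of A, and that all its colours appear around most even vertices is the
-- Markov inequality, applied to the independent choices of the odd colours given the even ones.

module Submission where

open import Defs
open import Data.Nat using (ℕ; zero; suc; _+_; _*_; _∸_; _^_; _⊔_; _≤_; _<_; z≤n; s≤s; _≡ᵇ_; _≤ᵇ_; _<ᵇ_; _≤?_; _⊓_; _/_; _%_; >-nonZero)
open import Data.Nat.Properties hiding (_≟_)
open import Data.Nat.Tactic.RingSolver using (solve-∀)
open import Data.Nat.Divisibility using (_∣_; divides)
open import Data.Bool using (Bool; true; false; if_then_else_; _∧_; _∨_; not; T; T?)
open import Data.Fin using (Fin; zero; suc; toℕ; fromℕ; fromℕ<; inject₁)
import Data.Fin.Properties as Fin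
open import Data.Fin.Subset using (Subset)
open import Data.Vec using (Vec; []; _∷_; lookup; tabulate)
import Data.Vec.Properties as Vec
open import Data.List using (List; []; _∷_; [_]; map; concatMap; allFin; filter; length; _++_; findᵇ)
import Data.List.Properties
import Data.Bool.Properties
open import Data.Bool.ListAction using (all; any)
open import Data.Maybe using (Maybe; just; nothing; is-nothing; maybe′)
open import Data.Product using (Σ; _×_; _,_; proj₁; proj₂; ∃-syntax)
open import Data.Sum using (_⊎_; inj₁; inj₂) renaming (swap to swap⊎)
open import Data.Empty using (⊥; ⊥-elim)
open import Data.Unit using (tt)
open import Function using (_∘_; id; case_of_)
open import Relation.Nullary using (¬_; Dec; yes; no; does)
open import Relation.Nullary.Decidable using (dec-true; dec-false)
open import Relation.Binary.Definitions using (DecidableEquality)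
open import Relation.Binary.PropositionalEquality using (_≡_; _≢_; refl; sym; trans; ≢-sym; resp₂; cong; cong₂; subst; module ≡-Reasoning)
open import Data.Rational using (ℚ; 0ℚ)
import Data.Rational as ℚ
open import Data.List.Membership.Propositional using (_∈_; _∉_; lose)
open import Data.List.Membership.Propositional.Properties using (∈-filter⁺; ∈-filter⁻; ∈-allFin; ∈-map⁺; ∈-concatMap⁺)
open import Data.List.Relation.Unary.Any using (here; there)
import Data.List.Relation.Unary.All as All
open import Data.List.Relation.Unary.AllPairs using (AllPairs; []; _∷_)
open import Data.List.Relation.Unary.Unique.Propositional using (Unique)
open import Data.List.Relation.Binary.Permutation.Propositional using (_↭_; ↭-sym; ↭⇒↭ₛ)
open import Data.List.Relation.Binary.Permutation.Propositional.Properties using (∈-resp-↭)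
import Data.List.Relation.Binary.Permutation.Setoid.Properties as Permₛ
import Data.List.Relation.Unary.Unique.Propositional.Properties as Unique
import Data.List.Relation.Unary.Sorted.TotalOrder.Properties as Sorted
import Data.List.Sort as Sort
open import Relation.Binary.Bundles using (DecTotalOrder)
import Relation.Binary.Construct.On as On
import Relation.Binary.PropositionalEquality.Properties as ≡
open import Data.Nat.DivMod using ([m+n]%n≡m%n; m%n<n; m<n⇒m%n≡m; n%n≡0; m/n*n≤m; m≡m%n+[m/n]*n; m*n/n≡m; /-monoˡ-≤)
import Data.Rational.Properties as ℚ
import Data.Rational.Unnormalised as ℚᵘ
import Data.Rational.Unnormalised.Properties as ℚᵘ
import Data.Integer as ℤ
import Data.Integer.Properties as ℤ

-- To see that palettes agree, the factor of an odd `v` must read palettes elsewhere, which would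
-- destroy the product form behind Finner's inequality. The ignored coordinate repairs this: it
-- matches an even `u` with an odd `π u` on the same level, so what `π u` sees from below is fixed
-- two levels under any `v` above `u` and can serve as a prediction for `v`. Averaged over a palette
-- a failed prediction never pays. But the colour of `u` actually lies in the palette of `π u`, so
-- gaining a colour pays `K + 2`, only losing colours pays `K - 1`, and `(K - 1) (K + 2) > K ^ 2`.
-- The constants form a hierarchy. `P` exceeds `Λ κ`, so that the reward `(P + 1) / P` to the power
-- `δ` is paid for by losing one colour on at least `δ / κ` lower neighbours. `K` exceeds `Λ P`, so
-- that the penalties `q / K` around a bad vertex stay below its reward. `R` provides one common
-- rate `R′ / R` for all losses. A second pair of orders uses the inverse matching: each pair
-- reaches only the edges with one of the two parities at the upper end.

private variable
  X Y : Set


-- Finite sums and products, enumerations without repetition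

∑ : List X → (X → ℕ) → ℕ
∑ []       f = 0
∑ (x ∷ xs) f = f x + ∑ xs f

∏ : List X → (X → ℕ) → ℕ
∏ []       f = 1
∏ (x ∷ xs) f = f x * ∏ xs f

⟦_⟧ : Bool → ℕ
⟦ true ⟧  = 1
⟦ false ⟧ = 0

∑-cong : ∀ (xs : List X) {f g : X → ℕ} → (∀ x → f x ≡ g x) → ∑ xs f ≡ ∑ xs g
∑-cong []       e = refl
∑-cong (x ∷ xs) e = cong₂ _+_ (e x) (∑-cong xs e)

∏-cong : ∀ (xs : List X) {f g : X → ℕ} → (∀ x → f x ≡ g x) → ∏ xs f ≡ ∏ xs g
∏-cong []       e = refl
∏-cong (x ∷ xs) e = cong₂ _*_ (e x) (∏-cong xs e)

∑-mono : ∀ (xs : List X) {f g : X → ℕ} → (∀ x → f x ≤ g x) → ∑ xs f ≤ ∑ xs g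
∑-mono []       e = z≤n
∑-mono (x ∷ xs) e = +-mono-≤ (e x) (∑-mono xs e)

∏-mono : ∀ (xs : List X) {f g : X → ℕ} → (∀ x → f x ≤ g x) → ∏ xs f ≤ ∏ xs g
∏-mono []       e = ≤-refl
∏-mono (x ∷ xs) e = *-mono-≤ (e x) (∏-mono xs e)

∑-+ : ∀ (xs : List X) (f g : X → ℕ) → ∑ xs (λ x → f x + g x) ≡ ∑ xs f + ∑ xs g
∑-+ []       f g = refl
∑-+ (x ∷ xs) f g rewrite ∑-+ xs f g = lem (f x) (g x) (∑ xs f) (∑ xs g)
  where
  lem : ∀ a b c d → a + b + (c + d) ≡ a + c + (b + d)
  lem = solve-∀

∏-* : ∀ (xs : List X) (f g : X → ℕ) → ∏ xs (λ x → f x * g x) ≡ ∏ xs f * ∏ xs g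
∏-* []       f g = refl
∏-* (x ∷ xs) f g rewrite ∏-* xs f g = lem (f x) (g x) (∏ xs f) (∏ xs g)
  where
  lem : ∀ a b c d → a * b * (c * d) ≡ a * c * (b * d)
  lem = solve-∀

∑-*ˡ : ∀ (xs : List X) c (f : X → ℕ) → ∑ xs (λ x → c * f x) ≡ c * ∑ xs f
∑-*ˡ []       c f = sym (*-zeroʳ c)
∑-*ˡ (x ∷ xs) c f rewrite ∑-*ˡ xs c f = sym (*-distribˡ-+ c (f x) (∑ xs f))

∑-*ʳ : ∀ (xs : List X) c (f : X → ℕ) → ∑ xs (λ x → f x * c) ≡ ∑ xs f * c
∑-*ʳ xs c f = trans (∑-cong xs (λ x → *-comm (f x) c)) (trans (∑-*ˡ xs c f) (*-comm c _))

∑-0 : ∀ (xs : List X) → ∑ xs (λ _ → 0) ≡ 0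
∑-0 []       = refl
∑-0 (x ∷ xs) = ∑-0 xs

∏-1 : ∀ (xs : List X) → ∏ xs (λ _ → 1) ≡ 1
∏-1 []       = refl
∏-1 (x ∷ xs) = trans (+-identityʳ _) (∏-1 xs)

∑-const : ∀ (xs : List X) c → ∑ xs (λ _ → c) ≡ length xs * c
∑-const []       c = refl
∑-const (x ∷ xs) c = cong (_+_ c) (∑-const xs c)

∑-swap : ∀ (xs : List X) (ys : List Y) (f : X → Y → ℕ) →
         ∑ xs (λ x → ∑ ys (f x)) ≡ ∑ ys (λ y → ∑ xs (λ x → f x y))
∑-swap []       ys f = sym (∑-0 ys)
∑-swap (x ∷ xs) ys f = trans (cong (_+_ (∑ ys (f x))) (∑-swap xs ys f))
                             (sym (∑-+ ys (f x) (λ y → ∑ xs (λ x → f x y))))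

∏-swap : ∀ (xs : List X) (ys : List Y) (f : X → Y → ℕ) →
         ∏ xs (λ x → ∏ ys (f x)) ≡ ∏ ys (λ y → ∏ xs (λ x → f x y))
∏-swap []       ys f = sym (∏-1 ys)
∏-swap (x ∷ xs) ys f = trans (cong (_*_ (∏ ys (f x))) (∏-swap xs ys f))
                             (sym (∏-* ys (f x) (λ y → ∏ xs (λ x → f x y))))

∑-++ : ∀ (xs ys : List X) (f : X → ℕ) → ∑ (xs ++ ys) f ≡ ∑ xs f + ∑ ys f
∑-++ []       ys f = refl
∑-++ (x ∷ xs) ys f = trans (cong (_+_ (f x)) (∑-++ xs ys f)) (sym (+-assoc (f x) _ _))

∏-++ : ∀ (xs ys : List X) (f : X → ℕ) → ∏ (xs ++ ys) f ≡ ∏ xs f * ∏ ys f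
∏-++ []       ys f = sym (+-identityʳ _)
∏-++ (x ∷ xs) ys f = trans (cong (_*_ (f x)) (∏-++ xs ys f)) (sym (*-assoc (f x) _ _))

∑-map : ∀ (h : Y → X) ys (f : X → ℕ) → ∑ (map h ys) f ≡ ∑ ys (f ∘ h)
∑-map h []       f = refl
∑-map h (y ∷ ys) f = cong (_+_ (f (h y))) (∑-map h ys f)

∏-map : ∀ (h : Y → X) ys (f : X → ℕ) → ∏ (map h ys) f ≡ ∏ ys (f ∘ h)
∏-map h []       f = refl
∏-map h (y ∷ ys) f = cong (_*_ (f (h y))) (∏-map h ys f)

∑-concatMap : ∀ (h : Y → List X) ys (f : X → ℕ) → ∑ (concatMap h ys) f ≡ ∑ ys (λ y → ∑ (h y) f)
∑-concatMap h []       f = refl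
∑-concatMap h (y ∷ ys) f = trans (∑-++ (h y) _ f) (cong (_+_ (∑ (h y) f)) (∑-concatMap h ys f))

∏-concatMap : ∀ (h : Y → List X) ys (f : X → ℕ) → ∏ (concatMap h ys) f ≡ ∏ ys (λ y → ∏ (h y) f)
∏-concatMap h []       f = refl
∏-concatMap h (y ∷ ys) f = trans (∏-++ (h y) _ f) (cong (_*_ (∏ (h y) f)) (∏-concatMap h ys f))

*-^ : ∀ a b k → (a * b) ^ k ≡ a ^ k * b ^ k
*-^ a b zero    = refl
*-^ a b (suc k) rewrite *-^ a b k = lem a b (a ^ k) (b ^ k)
  where
  lem : ∀ a b c d → a * b * (c * d) ≡ a * c * (b * d)
  lem = solve-∀

∏-^ : ∀ (xs : List X) (f : X → ℕ) k → ∏ xs f ^ k ≡ ∏ xs (λ x → f x ^ k)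
∏-^ []       f k = ^-zeroˡ k
∏-^ (x ∷ xs) f k = trans (*-^ (f x) (∏ xs f) k) (cong (_*_ (f x ^ k)) (∏-^ xs f k))

∏-pow : ∀ (xs : List X) c (f : X → ℕ) → ∏ xs (λ x → c ^ f x) ≡ c ^ ∑ xs f
∏-pow []       c f = refl
∏-pow (x ∷ xs) c f = trans (cong (_*_ (c ^ f x)) (∏-pow xs c f)) (sym (^-distribˡ-+-* c (f x) (∑ xs f)))

∏-filter : ∀ (b : X → Bool) xs (f : X → ℕ) →
           ∏ (filter (λ x → T? (b x)) xs) f ≡ ∏ xs (λ x → if b x then f x else 1)
∏-filter b []       f = refl
∏-filter b (x ∷ xs) f with b x
... | true  = cong (_*_ (f x)) (∏-filter b xs f)
... | false = trans (∏-filter b xs f) (sym (+-identityʳ _))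

length-filter : ∀ (b : X → Bool) xs → length (filter (λ x → T? (b x)) xs) ≡ ∑ xs (λ x → ⟦ b x ⟧)
length-filter b []       = refl
length-filter b (x ∷ xs) with b x
... | true  = cong suc (length-filter b xs)
... | false = length-filter b xs

∏-if-const : ∀ (xs : List X) (b : X → Bool) c →
             ∏ xs (λ x → if b x then c else 1) ≡ c ^ ∑ xs (λ x → ⟦ b x ⟧)
∏-if-const []       b c = refl
∏-if-const (x ∷ xs) b c with b x
... | true  = cong (_*_ c) (∏-if-const xs b c)
... | false = trans (+-identityʳ _) (∏-if-const xs b c)

⟦⟧≤1 : ∀ b → ⟦ b ⟧ ≤ 1
⟦⟧≤1 true  = ≤-refl
⟦⟧≤1 false = z≤n

1≤∏ : ∀ (xs : List X) {f : X → ℕ} → (∀ x → 1 ≤ f x) → 1 ≤ ∏ xs f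
1≤∏ xs e = ≤-trans (≤-reflexive (sym (∏-1 xs))) (∏-mono xs e)

-- Completeness and absence of repetition are one statement about multiplicities, so that delta sums
-- and reindexing become plain computations with `∑`.
record Enum (X : Set) : Set where
  field
    _≟_  : DecidableEquality X
    elts : List X
    once : ∀ x → ∑ elts (λ y → ⟦ does (y ≟ x) ⟧) ≡ 1

module _ (E : Enum X) where
  open Enum E

  ∑-δ : ∀ (f : X → ℕ) x → ∑ elts (λ y → ⟦ does (y ≟ x) ⟧ * f y) ≡ f x
  ∑-δ f x = trans (∑-cong elts pt) (trans (∑-*ʳ elts (f x) _) (trans (cong (_* f x) (once x)) (+-identityʳ (f x))))
    where
    pt : ∀ y → ⟦ does (y ≟ x) ⟧ * f y ≡ ⟦ does (y ≟ x) ⟧ * f x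
    pt y with y ≟ x
    ... | yes refl = refl
    ... | no _     = refl

  ≤∑ : ∀ (f : X → ℕ) x → f x ≤ ∑ elts f
  ≤∑ f x = ≤-trans (≤-reflexive (sym (∑-δ f x))) (∑-mono elts pt)
    where
    pt : ∀ y → ⟦ does (y ≟ x) ⟧ * f y ≤ f y
    pt y = ≤-trans (*-monoˡ-≤ (f y) (⟦⟧≤1 (does (y ≟ x)))) (≤-reflexive (+-identityʳ (f y)))

  -- Each `f (ρ x)` is expanded into a delta sum; after the sums are exchanged, the delta is read in
  -- the other variable.
  ∑-reindex : ∀ (ρ ρ⁻¹ : X → X) → (∀ x → ρ (ρ⁻¹ x) ≡ x) → (∀ x → ρ⁻¹ (ρ x) ≡ x) →
              ∀ f → ∑ elts (λ x → f (ρ x)) ≡ ∑ elts f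
  ∑-reindex ρ ρ⁻¹ l r f = begin
    ∑ elts (λ x → f (ρ x))                                         ≡⟨ ∑-cong elts (λ x → sym (∑-δ f (ρ x))) ⟩
    ∑ elts (λ x → ∑ elts (λ y → ⟦ does (y ≟ ρ x) ⟧ * f y))         ≡⟨ ∑-swap elts elts _ ⟩
    ∑ elts (λ y → ∑ elts (λ x → ⟦ does (y ≟ ρ x) ⟧ * f y))         ≡⟨ ∑-cong elts (λ y → ∑-cong elts (λ x → cong (λ b → ⟦ b ⟧ * f y) (eqv x y))) ⟩
    ∑ elts (λ y → ∑ elts (λ x → ⟦ does (x ≟ ρ⁻¹ y) ⟧ * f y))       ≡⟨ ∑-cong elts (λ y → trans (∑-*ʳ elts (f y) _) (trans (cong (_* f y) (once (ρ⁻¹ y))) (+-identityʳ _))) ⟩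
    ∑ elts f ∎
    where
    open ≡-Reasoning
    eqv : ∀ x y → does (y ≟ ρ x) ≡ does (x ≟ ρ⁻¹ y)
    eqv x y with y ≟ ρ x | x ≟ ρ⁻¹ y
    ... | yes _ | yes _ = refl
    ... | no _  | no _  = refl
    ... | yes p | no q  = ⊥-elim (q (trans (sym (r x)) (cong ρ⁻¹ (sym p))))
    ... | no p  | yes q = ⊥-elim (p (trans (sym (l y)) (cong ρ (sym q))))

  occ-split : ∀ xs x → 1 ≤ ∑ xs (λ y → ⟦ does (y ≟ x) ⟧) →
              ∃[ ys ] ∃[ zs ] (xs ≡ ys ++ x ∷ zs)
  occ-split (y ∷ xs) x p with y ≟ x
  ... | yes refl = [] , xs , refl
  ... | no _     with occ-split xs x p
  ...   | ys , zs , refl = y ∷ ys , zs , refl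

  occ-0 : ∀ xs x (f g : X → ℕ) → ∑ xs (λ y → ⟦ does (y ≟ x) ⟧) ≡ 0 → (∀ y → y ≢ x → f y ≡ g y) → ∏ xs f ≡ ∏ xs g
  occ-0 []       x f g o e = refl
  occ-0 (y ∷ xs) x f g o e with y ≟ x
  ... | no q = cong₂ _*_ (e y q) (occ-0 xs x f g o e)

  -- A product in ℕ cannot be divided by its factor at `x`, so the list `R` of the remaining points
  -- is produced; as `x` is absent from it, the value there does not matter.
  ∏-isolate : ∀ x → ∃[ R ] (∀ f → ∏ elts f ≡ f x * ∏ R f)
              × (∀ f g → (∀ y → y ≢ x → f y ≡ g y) → ∏ R f ≡ ∏ R g)
  ∏-isolate x with occ-split elts x (≤-reflexive (sym (once x)))
  ... | ys , zs , e = ys ++ zs , eq , λ f g → occ-0 (ys ++ zs) x f g o0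
    where
    eq : ∀ f → ∏ elts f ≡ f x * ∏ (ys ++ zs) f
    eq f = trans (cong (λ l → ∏ l f) e) (trans (∏-++ ys (x ∷ zs) f)
             (trans (lem (∏ ys f) (f x) (∏ zs f)) (cong (f x *_) (sym (∏-++ ys zs f)))))
      where
      lem : ∀ a b c → a * (b * c) ≡ b * (a * c)
      lem = solve-∀
    χ : X → ℕ
    χ y = ⟦ does (y ≟ x) ⟧
    χx : χ x ≡ 1
    χx with x ≟ x
    ... | yes _ = refl
    ... | no q  = ⊥-elim (q refl)
    o0 : ∑ (ys ++ zs) χ ≡ 0
    o0 = suc-injective (begin
      suc (∑ (ys ++ zs) χ)           ≡⟨ cong suc (∑-++ ys zs χ) ⟩
      suc (∑ ys χ + ∑ zs χ)          ≡⟨ sym (+-suc (∑ ys χ) (∑ zs χ)) ⟩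
      ∑ ys χ + (1 + ∑ zs χ)          ≡⟨ cong (λ t → ∑ ys χ + (t + ∑ zs χ)) (sym χx) ⟩
      ∑ ys χ + ∑ (x ∷ zs) χ          ≡⟨ sym (∑-++ ys (x ∷ zs) χ) ⟩
      ∑ (ys ++ x ∷ zs) χ             ≡⟨ cong (λ l → ∑ l χ) (sym e) ⟩
      ∑ elts χ                       ≡⟨ once x ⟩
      1 ∎)
      where open ≡-Reasoning



-- Elementary inequalities: Young, AM-GM, Hölder, exponential bounds

1≤^ : ∀ {a} k → 1 ≤ a → 1 ≤ a ^ k
1≤^ k 1≤a = ≤-trans (≤-reflexive (sym (^-zeroˡ k))) (^-monoˡ-≤ k 1≤a)

*-cancelˡ : ∀ {a b} c → 1 ≤ c → c * a ≤ c * b → a ≤ b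
*-cancelˡ {a} {b} (suc c) _ = *-cancelˡ-≤ (suc c)

^-cancel-< : ∀ {a b} k → a ^ k < b ^ k → a < b
^-cancel-< {a} {b} k lt with b ≤? a
... | yes b≤a = ⊥-elim (<⇒≱ lt (^-monoˡ-≤ k b≤a))
... | no b≰a  = ≰⇒> b≰a

^-cancel-≤ : ∀ {a b} k → a ^ suc k ≤ b ^ suc k → a ≤ b
^-cancel-≤ {a} {b} k le with a ≤? b
... | yes p = p
... | no p  = ⊥-elim (<⇒≱ (^-monoˡ-< (suc k) (≰⇒> p)) le)

-- The two sides differ by `(b - a) (q - p)`.
rearrange : ∀ {a b p q} → a ≤ b → p ≤ q → a * q + b * p ≤ a * p + b * q
rearrange {a} {b} {p} {q} a≤b p≤q with m≤n⇒∃[o]m+o≡n a≤b | m≤n⇒∃[o]m+o≡n p≤q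
... | s , refl | t , refl = ≤-trans (m≤m+n _ (s * t)) (≤-reflexive (lem a s p t))
  where
  lem : ∀ a s p t → a * (p + t) + (a + s) * p + s * t ≡ a * p + (a + s) * (p + t)
  lem = solve-∀

-- Weighted AM-GM for `p ^ (j + 1)` against `j` copies of `q ^ (j + 1)`. The induction multiplies by
-- `q` and rearranges powers of `p` and `q`. Many numerical bounds below are instances.
young : ∀ j p q → suc j * p * q ^ j ≤ p ^ suc j + j * q ^ suc j
young zero    p q = ≤-reflexive (lem p)
  where
  lem : ∀ p → 1 * p * 1 ≡ p * 1 + 0
  lem = solve-∀
young (suc j) p q = begin
  suc (suc j) * p * (q * b)          ≡⟨ e₁ j p q b ⟩
  suc j * p * b * q + p * (q * b)    ≤⟨ +-monoˡ-≤ _ (*-monoˡ-≤ q (young j p q)) ⟩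
  (p * a + j * (q * b)) * q + p * (q * b) ≡⟨ e₂ j p q a b ⟩
  (p * a) * q + (q * b) * p + j * (q * (q * b)) ≤⟨ +-monoˡ-≤ _ rea ⟩
  (p * a) * p + (q * b) * q + j * (q * (q * b)) ≡⟨ e₃ j p q a b ⟩
  p * (p * a) + suc j * (q * (q * b)) ∎
  where
  open ≤-Reasoning
  a = p ^ j
  b = q ^ j
  e₁ : ∀ j p q b → suc (suc j) * p * (q * b) ≡ suc j * p * b * q + p * (q * b)
  e₁ = solve-∀
  e₂ : ∀ j p q a b → (p * a + j * (q * b)) * q + p * (q * b) ≡ (p * a) * q + (q * b) * p + j * (q * (q * b))
  e₂ = solve-∀
  e₃ : ∀ j p q a b → (p * a) * p + (q * b) * q + j * (q * (q * b)) ≡ p * (p * a) + suc j * (q * (q * b))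
  e₃ = solve-∀
  rea : (p * a) * q + (q * b) * p ≤ (p * a) * p + (q * b) * q
  rea with ≤-total p q
  ... | inj₁ p≤q = rearrange (^-monoˡ-≤ (suc j) p≤q) p≤q
  ... | inj₂ q≤p = ≤-trans (≤-reflexive (+-comm ((p * a) * q) _))
                    (≤-trans (rearrange (^-monoˡ-≤ (suc j) q≤p) q≤p) (≤-reflexive (+-comm ((q * b) * q) _)))

-- Young's inequality for `n (x + S)` and `(n + 1) S`, after which a common term cancels.
amgm-step : ∀ n x S → suc n ^ suc n * (x * S ^ n) ≤ n ^ n * (x + S) ^ suc n
amgm-step zero    x S = ≤-trans (≤-reflexive (lem x)) (≤-trans (m≤m+n x S) (≤-reflexive (lem′ (x + S))))
  where
  lem : ∀ x → 1 * 1 * (x * 1) ≡ x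
  lem = solve-∀
  lem′ : ∀ x → x ≡ 1 * (x * 1)
  lem′ = solve-∀
amgm-step n@(suc _) x S = *-cancelˡ n (s≤s z≤n) (+-cancelʳ-≤ (n * q ^ suc n) _ _ main)
  where
  t = x + S
  q = suc n * S
  open ≤-Reasoning
  e₁ : ∀ n x S s c → n * (suc n * c * (x * s)) + n * (suc n * S * (c * s)) ≡ suc n * (n * (x + S)) * (c * s)
  e₁ = solve-∀
  e₂ : ∀ a b c d → a * b * (c * d) ≡ a * (c * (b * d))
  e₂ = solve-∀
  main : n * (suc n ^ suc n * (x * S ^ n)) + n * q ^ suc n ≤ n * (n ^ n * t ^ suc n) + n * q ^ suc n
  main = begin
    n * (suc n ^ suc n * (x * S ^ n)) + n * q ^ suc n
      ≡⟨ cong (λ t → n * (suc n ^ suc n * (x * S ^ n)) + n * (q * t)) (*-^ (suc n) S n) ⟩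
    n * (suc n * suc n ^ n * (x * S ^ n)) + n * (suc n * S * (suc n ^ n * S ^ n))
      ≡⟨ e₁ n x S (S ^ n) (suc n ^ n) ⟩
    suc n * (n * t) * (suc n ^ n * S ^ n)
      ≡⟨ cong (suc n * (n * t) *_) (sym (*-^ (suc n) S n)) ⟩
    suc n * (n * t) * q ^ n
      ≤⟨ young n (n * t) q ⟩
    (n * t) ^ suc n + n * q ^ suc n
      ≡⟨ cong (_+ n * q ^ suc n) (trans (cong (n * t *_) (*-^ n t n)) (e₂ n t (n ^ n) (t ^ n))) ⟩
    n * (n ^ n * t ^ suc n) + n * q ^ suc n ∎

amgm : ∀ (xs : List X) (f : X → ℕ) → length xs ^ length xs * ∏ xs f ≤ ∑ xs f ^ length xs
amgm []       f = ≤-refl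
amgm (x ∷ xs) f = *-cancelˡ (n ^ n) pos (begin
  n ^ n * (suc n ^ suc n * (f x * ∏ xs f)) ≡⟨ lem (n ^ n) (suc n ^ suc n) (f x) (∏ xs f) ⟩
  suc n ^ suc n * f x * (n ^ n * ∏ xs f)   ≤⟨ *-monoʳ-≤ (suc n ^ suc n * f x) (amgm xs f) ⟩
  suc n ^ suc n * f x * ∑ xs f ^ n         ≡⟨ *-assoc (suc n ^ suc n) (f x) _ ⟩
  suc n ^ suc n * (f x * ∑ xs f ^ n)       ≤⟨ amgm-step n (f x) (∑ xs f) ⟩
  n ^ n * (f x + ∑ xs f) ^ suc n ∎)
  where
  open ≤-Reasoning
  n = length xs
  lem : ∀ a b c d → a * (b * (c * d)) ≡ b * c * (a * d)
  lem = solve-∀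
  pos : 1 ≤ n ^ n
  pos with n
  ... | zero  = ≤-refl
  ... | suc k = 1≤^ (suc k) (s≤s z≤n)

module _ (s : X → ℕ) where

  -- The terms A i ∏_{j≠i} s j, that is, the fractions A i / s i over a common denominator.
  cleared : (X → ℕ) → List X → List ℕ
  cleared A []       = []
  cleared A (v ∷ vs) = A v * ∏ vs s ∷ map (s v *_) (cleared A vs)

  length-cleared : ∀ A vs → length (cleared A vs) ≡ length vs
  length-cleared A []       = refl
  length-cleared A (v ∷ vs) = cong suc (trans (Data.List.Properties.length-map (s v *_) (cleared A vs)) (length-cleared A vs))

  ∑-cleared : ∀ A B → (∀ v → A v + B v ≡ s v) → ∀ vs →
              ∑ (cleared A vs) id + ∑ (cleared B vs) id ≡ length vs * ∏ vs s
  ∑-cleared A B e []       = refl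
  ∑-cleared A B e (v ∷ vs) = begin
    A v * Π + ∑ (map (s v *_) (cleared A vs)) id + (B v * Π + ∑ (map (s v *_) (cleared B vs)) id)
      ≡⟨ cong₂ (λ p q → A v * Π + p + (B v * Π + q)) (sc A) (sc B) ⟩
    A v * Π + s v * a + (B v * Π + s v * b)
      ≡⟨ lem₁ (A v) (B v) Π (s v) a b ⟩
    (A v + B v) * Π + s v * (a + b)
      ≡⟨ cong₂ (λ p q → p * Π + s v * q) (e v) (∑-cleared A B e vs) ⟩
    s v * Π + s v * (length vs * Π)
      ≡⟨ lem₂ (s v) Π (length vs) ⟩
    suc (length vs) * (s v * Π) ∎
    where
    open ≡-Reasoning
    Π = ∏ vs s
    a = ∑ (cleared A vs) id
    b = ∑ (cleared B vs) id
    sc : ∀ A → ∑ (map (s v *_) (cleared A vs)) id ≡ s v * ∑ (cleared A vs) id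
    sc A = trans (∑-map (s v *_) (cleared A vs) id) (∑-*ˡ (cleared A vs) (s v) id)
    lem₁ : ∀ A B Π s a b → A * Π + s * a + (B * Π + s * b) ≡ (A + B) * Π + s * (a + b)
    lem₁ = solve-∀
    lem₂ : ∀ s Π l → s * Π + s * (l * Π) ≡ suc l * (s * Π)
    lem₂ = solve-∀

  ∏-cleared : ∀ A vs → ∏ (cleared A vs) id * ∏ vs s ≡ ∏ vs A * ∏ vs s ^ length vs
  ∏-cleared A []       = refl
  ∏-cleared A (v ∷ vs) = begin
    A v * Π * ∏ (map (s v *_) (cleared A vs)) id * (s v * Π)
      ≡⟨ cong (λ t → A v * Π * t * (s v * Π)) sc ⟩
    A v * Π * (s v ^ k * c) * (s v * Π)
      ≡⟨ lem₁ (A v) Π (s v ^ k) c (s v) ⟩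
    A v * (s v * s v ^ k) * Π * (c * Π)
      ≡⟨ cong (A v * (s v * s v ^ k) * Π *_) (∏-cleared A vs) ⟩
    A v * (s v * s v ^ k) * Π * (∏ vs A * Π ^ k)
      ≡⟨ lem₂ (A v) (s v) (s v ^ k) Π (∏ vs A) (Π ^ k) ⟩
    A v * ∏ vs A * (s v * Π * (s v ^ k * Π ^ k))
      ≡⟨ cong (λ t → A v * ∏ vs A * (s v * Π * t)) (sym (*-^ (s v) Π k)) ⟩
    A v * ∏ vs A * (s v * Π) ^ suc k ∎
    where
    open ≡-Reasoning
    Π = ∏ vs s
    k = length vs
    c = ∏ (cleared A vs) id
    sc : ∏ (map (s v *_) (cleared A vs)) id ≡ s v ^ k * c
    sc = trans (∏-map (s v *_) (cleared A vs) id) (trans (∏-* (cleared A vs) (λ _ → s v) id)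
           (cong (_* c) (trans (∏-cst (cleared A vs)) (cong (s v ^_) (length-cleared A vs)))))
      where
      ∏-cst : ∀ (l : List ℕ) → ∏ l (λ _ → s v) ≡ s v ^ length l
      ∏-cst []      = refl
      ∏-cst (_ ∷ l) = cong (s v *_) (∏-cst l)
    lem₁ : ∀ A Π p c s → A * Π * (p * c) * (s * Π) ≡ A * (s * p) * Π * (c * Π)
    lem₁ = solve-∀
    lem₂ : ∀ A s p Π a π → A * (s * p) * Π * (a * π) ≡ A * a * (s * Π * (p * π))
    lem₂ = solve-∀

-- Superadditivity of the geometric mean, with the δ-th roots cleared.
mahler : ∀ (vs : List X) (A B : X → ℕ) c D a b → 1 ≤ length vs →
         c * a ^ length vs ≤ D * ∏ vs A → c * b ^ length vs ≤ D * ∏ vs B →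
         c * (a + b) ^ length vs ≤ D * ∏ vs (λ v → A v + B v)
mahler vs A B c D zero b 1≤δ hA hB =
  ≤-trans hB (*-monoʳ-≤ D (∏-mono vs (λ v → m≤n+m (B v) (A v))))
mahler vs A B c D a@(suc _) zero 1≤δ hA hB rewrite +-identityʳ a =
  ≤-trans hA (*-monoʳ-≤ D (∏-mono vs (λ v → m≤m+n (A v) (B v))))
mahler vs A B zero D (suc _) (suc _) 1≤δ hA hB = z≤n
mahler {X} vs A B c@(suc _) D a@(suc _) b@(suc _) 1≤δ hA hB with c * (a + b) ^ length vs ≤? D * ∏ vs (λ v → A v + B v)
... | yes p = p
-- If the claim failed, AM-GM for the fractions `A i / s i` would make their mean exceed
-- `a / (a + b)`, and likewise for `B` and `b`. But the two means add up to 1.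
... | no ¬p = ⊥-elim (<-irrefl tot (+-mono-< (half A a hA (s≤s z≤n) Apos) (half B b hB (s≤s z≤n) Bpos)))
  where
  open ≤-Reasoning
  δ = length vs
  s : _ → ℕ
  s v = A v + B v
  Π = ∏ vs s
  tot : δ * a * Π + δ * b * Π ≡ (a + b) * ∑ (cleared s A vs) id + (a + b) * ∑ (cleared s B vs) id
  tot = trans (l₁ δ a b Π) (trans (cong ((a + b) *_) (sym (∑-cleared s A B (λ _ → refl) vs))) (*-distribˡ-+ (a + b) (∑ (cleared s A vs) id) (∑ (cleared s B vs) id)))
    where
    l₁ : ∀ δ a b Π → δ * a * Π + δ * b * Π ≡ (a + b) * (δ * Π)
    l₁ = solve-∀
  pos : ∀ (P : X → ℕ) x → 1 ≤ x → c * x ^ δ ≤ D * ∏ vs P → 1 ≤ ∏ vs P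
  pos P x 1≤x h with ∏ vs P
  ... | suc _ = s≤s z≤n
  ... | zero  = ⊥-elim (<⇒≱ (≤-trans (*-mono-≤ {1} {c} (s≤s z≤n) (1≤^ δ 1≤x)) h) (≤-reflexive (*-zeroʳ D)))
  Apos = pos A a (s≤s z≤n) hA
  Bpos = pos B b (s≤s z≤n) hB
  half : ∀ P x → c * x ^ δ ≤ D * ∏ vs P → 1 ≤ x → 1 ≤ ∏ vs P → δ * x * Π < (a + b) * ∑ (cleared s P vs) id
  half P x h 1≤x 1≤P = ^-cancel-< δ (*-cancelˡ-< c _ _ (begin-strict
    c * (δ * x * Π) ^ δ             ≡⟨ cong (c *_) (trans (*-^ (δ * x) Π δ) (cong (_* Π ^ δ) (*-^ δ x δ))) ⟩
    c * (δ ^ δ * x ^ δ * Π ^ δ)     ≡⟨ l₁ c (δ ^ δ) (x ^ δ) (Π ^ δ) ⟩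
    c * x ^ δ * (δ ^ δ * Π ^ δ)     ≤⟨ *-monoˡ-≤ _ h ⟩
    D * ∏ vs P * (δ ^ δ * Π ^ δ)    ≡⟨ l₂ D (∏ vs P) (δ ^ δ) (Π ^ δ) ⟩
    D * (δ ^ δ * (∏ vs P * Π ^ δ))  ≡⟨ cong (λ t → D * (δ ^ δ * t)) (sym (∏-cleared s P vs)) ⟩
    D * (δ ^ δ * (∏ (cleared s P vs) id * Π)) ≡⟨ l₃ D (δ ^ δ) _ Π ⟩
    D * Π * (δ ^ δ * ∏ (cleared s P vs) id)   ≤⟨ *-monoʳ-≤ (D * Π) am ⟩
    D * Π * σ ^ δ                    <⟨ *-monoˡ-< (σ ^ δ) {{>-nonZero σpos}} (≰⇒> ¬p) ⟩
    c * (a + b) ^ δ * σ ^ δ          ≡⟨ *-assoc c ((a + b) ^ δ) (σ ^ δ) ⟩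
    c * ((a + b) ^ δ * σ ^ δ)        ≡⟨ cong (c *_) (sym (*-^ (a + b) σ δ)) ⟩
    c * ((a + b) * σ) ^ δ ∎))
    where
    σ = ∑ (cleared s P vs) id
    am : δ ^ δ * ∏ (cleared s P vs) id ≤ σ ^ δ
    am = subst (λ l → l ^ l * ∏ (cleared s P vs) id ≤ σ ^ l) (length-cleared s P vs) (amgm (cleared s P vs) id)
    Πpos : 1 ≤ Π
    Πpos = ≤-trans Apos (∏-mono vs (λ v → m≤m+n (A v) (B v)))
    σpos : 1 ≤ σ ^ δ
    σpos with σ ^ δ | am
    ... | suc _ | _ = s≤s z≤n
    ... | zero  | r = ⊥-elim (<⇒≱ (≤-trans (*-mono-≤ (*-mono-≤ (1≤^ δ 1≤δ) 1≤P) (1≤^ δ Πpos))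
                       (≤-trans (≤-reflexive (trans (*-assoc (δ ^ δ) _ _) (trans (cong (δ ^ δ *_) (sym (∏-cleared s P vs))) (sym (*-assoc (δ ^ δ) _ Π))))) (*-monoˡ-≤ Π r))) z≤n)
    l₁ : ∀ c p q r → c * (p * q * r) ≡ c * q * (p * r)
    l₁ = solve-∀
    l₂ : ∀ D a p q → D * a * (p * q) ≡ D * (p * (a * q))
    l₂ = solve-∀
    l₃ : ∀ D a p q → D * (a * (p * q)) ≡ D * q * (a * p)
    l₃ = solve-∀

∏-if : ∀ (vs : List X) (t : X → Bool) (A D : X → ℕ) →
       ∏ vs (λ v → if t v then A v else D v)
       ≡ ∏ (filter (λ v → T? (not (t v))) vs) D * ∏ (filter (λ v → T? (t v)) vs) A
∏-if vs t A D = trans (∏-cong vs pt) (trans (∏-* vs _ _)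
                  (cong₂ _*_ (sym (∏-filter (not ∘ t) vs D)) (sym (∏-filter t vs A))))
  where
  pt : ∀ v → (if t v then A v else D v) ≡ (if not (t v) then D v else 1) * (if t v then A v else 1)
  pt v with t v
  ... | true  = sym (+-identityʳ _)
  ... | false = sym (*-identityʳ _)

module _ {C : Set} (vs : List X) (t : X → Bool) (δ : ℕ) (∑t : ∑ vs (λ v → ⟦ t v ⟧) ≡ suc δ)
         (c : ℕ) (D : X → ℕ) where

  -- Superadditivity is used once per colour. The exponent equals the number of factors in `t`; the
  -- others are bounded by `D` for all colours and act as a constant.
  hölder : ∀ (cs : List C) (F : C → ℕ) (g : X → C → ℕ) →
           (∀ e → c * F e ^ suc δ ≤ ∏ vs (λ v → g v e)) →
           (∀ v → t v ≡ false → ∀ e → g v e ≤ D v) →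
           c * ∑ cs F ^ suc δ ≤ ∏ vs (λ v → if t v then ∑ cs (g v) else D v)
  hölder cs F g h nt = ≤-trans (go cs) (≤-reflexive (sym (∏-if vs t _ D)))
    where
    ts = filter (λ v → T? (t v)) vs
    Δ = ∏ (filter (λ v → T? (not (t v))) vs) D
    len : length ts ≡ suc δ
    len = trans (length-filter t vs) ∑t
    h′ : ∀ e → c * F e ^ suc δ ≤ Δ * ∏ ts (λ v → g v e)
    h′ e = ≤-trans (h e) (≤-trans (∏-mono vs pt) (≤-reflexive (∏-if vs t _ D)))
      where
      pt : ∀ v → g v e ≤ (if t v then g v e else D v)
      pt v with t v in eq
      ... | true  = ≤-refl
      ... | false = nt v eq e
    go : ∀ cs → c * ∑ cs F ^ suc δ ≤ Δ * ∏ ts (λ v → ∑ cs (g v))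
    go []       = ≤-trans (≤-reflexive (*-zeroʳ c)) z≤n
    go (e ∷ cs) = subst (λ l → c * (F e + ∑ cs F) ^ l ≤ Δ * ∏ ts (λ v → g v e + ∑ cs (g v))) len
      (mahler ts (λ v → g v e) (λ v → ∑ cs (g v)) c Δ (F e) (∑ cs F) (≤-trans (s≤s z≤n) (≤-reflexive (sym len)))
        (subst (λ l → c * F e ^ l ≤ Δ * ∏ ts (λ v → g v e)) (sym len) (h′ e))
        (subst (λ l → c * ∑ cs F ^ l ≤ Δ * ∏ ts (λ v → ∑ cs (g v))) (sym len) (go cs)))

-- This is `(1 + 1 / N) ^ N ≥ 2` for `N = k + 1`, from Young's inequality with `p = N + 1` and
-- `q = N`.
double-≤ : ∀ k → 2 * suc k ^ suc k ≤ suc (suc k) ^ suc k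
double-≤ k = +-cancelʳ-≤ (k * suc k ^ suc k) _ _ (≤-trans (≤-reflexive (lem k (suc k ^ k))) (young k (suc (suc k)) (suc k)))
  where
  lem : ∀ k p → 2 * (suc k * p) + k * (suc k * p) ≡ suc k * suc (suc k) * p
  lem = solve-∀

-- Bernoulli's inequality `1 + E / N ≤ (1 + 1 / N) ^ E`, cleared of denominators.
bernoulli : ∀ N E → N ^ E * (N + E) ≤ N * suc N ^ E
bernoulli N zero    = ≤-reflexive (lem N)
  where
  lem : ∀ N → 1 * (N + 0) ≡ N * 1
  lem = solve-∀
bernoulli N (suc E) = begin
  N * N ^ E * (N + suc E)        ≡⟨ l₁ N (N ^ E) E ⟩
  N ^ E * (N + E) * N + N ^ E * N ≤⟨ +-monoʳ-≤ (N ^ E * (N + E) * N) (*-monoʳ-≤ (N ^ E) (m≤m+n N E)) ⟩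
  N ^ E * (N + E) * N + N ^ E * (N + E) ≡⟨ l₂ (N ^ E * (N + E)) N ⟩
  N ^ E * (N + E) * suc N        ≤⟨ *-monoˡ-≤ (suc N) (bernoulli N E) ⟩
  N * suc N ^ E * suc N          ≡⟨ l₃ N (suc N ^ E) (suc N) ⟩
  N * (suc N * suc N ^ E) ∎
  where
  open ≤-Reasoning
  l₁ : ∀ N p E → N * p * (N + suc E) ≡ p * (N + E) * N + p * N
  l₁ = solve-∀
  l₂ : ∀ p N → p * N + p ≡ p * suc N
  l₂ = solve-∀
  l₃ : ∀ N p q → N * p * q ≡ N * (q * p)
  l₃ = solve-∀

-- This is `(1 + 1 / (2 N)) ^ N ≤ 2`. Young's inequality for `2 N` and `2 N + 1` leaves the
-- coefficient `N (2 N) - k (2 N + 1) = N + 1` on the larger power.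
growth-half : ∀ k → suc (2 * suc k) ^ suc k ≤ 2 * (2 * suc k) ^ suc k
growth-half k = *-cancelˡ (suc N) (s≤s z≤n) (+-cancelʳ-≤ (k * Q * q) _ _ (begin
  suc N * Q + k * Q * q                  ≡⟨ l₁ k (q ^ k) ⟩
  q * (N * p * q ^ k)                    ≤⟨ *-monoʳ-≤ q (young k p q) ⟩
  q * (p ^ N + k * Q)                    ≡⟨ l₂ q (p ^ N) k Q ⟩
  q * p ^ N + k * Q * q                  ≤⟨ +-monoˡ-≤ _ (*-monoˡ-≤ (p ^ N) q≤) ⟩
  2 * suc N * p ^ N + k * Q * q          ≡⟨ cong (_+ k * Q * q) (l₃ (suc N) (p ^ N)) ⟩
  suc N * (2 * p ^ N) + k * Q * q ∎))
  where
  open ≤-Reasoning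
  N = suc k
  p = 2 * N
  q = suc p
  Q = q ^ N
  l₁ : ∀ k x → suc (suc k) * (suc (2 * suc k) * x) + k * (suc (2 * suc k) * x) * suc (2 * suc k)
             ≡ suc (2 * suc k) * (suc k * (2 * suc k) * x)
  l₁ = solve-∀
  l₂ : ∀ q P k Q → q * (P + k * Q) ≡ q * P + k * Q * q
  l₂ = solve-∀
  l₃ : ∀ n P → 2 * n * P ≡ n * (2 * P)
  l₃ = solve-∀
  l₄ : ∀ k → 2 * suc (suc k) ≡ suc (suc (2 * suc k))
  l₄ = solve-∀
  q≤ : q ≤ 2 * suc N
  q≤ = ≤-trans (n≤1+n q) (≤-reflexive (sym (l₄ k)))

-- As `1 + 1 / N ≤ (1 + 1 / (2 N)) ^ 2`, the `N`-th power is at most the square of the previous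
-- bound.
growth-≤4 : ∀ k → suc (suc k) ^ suc k ≤ 4 * suc k ^ suc k
growth-≤4 k = *-cancelˡ ((4 * N) ^ N) (1≤^ N (s≤s z≤n)) (begin
  (4 * N) ^ N * suc N ^ N           ≡⟨ sym (*-^ (4 * N) (suc N) N) ⟩
  (4 * N * suc N) ^ N               ≤⟨ ^-monoˡ-≤ N (≤-trans (n≤1+n _) (≤-reflexive (l₁ k))) ⟩
  (suc (2 * N) * suc (2 * N)) ^ N   ≡⟨ *-^ (suc (2 * N)) (suc (2 * N)) N ⟩
  suc (2 * N) ^ N * suc (2 * N) ^ N ≤⟨ *-mono-≤ (growth-half k) (growth-half k) ⟩
  2 * (2 * N) ^ N * (2 * (2 * N) ^ N) ≡⟨ l₂ ((2 * N) ^ N) ⟩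
  4 * ((2 * N) ^ N * (2 * N) ^ N)   ≡⟨ cong (4 *_) (trans (sym (*-^ (2 * N) (2 * N) N)) (cong (_^ N) (l₃ N))) ⟩
  4 * (4 * N * N) ^ N               ≡⟨ cong (4 *_) (*-^ (4 * N) N N) ⟩
  4 * ((4 * N) ^ N * N ^ N)         ≡⟨ l₄ ((4 * N) ^ N) (N ^ N) ⟩
  (4 * N) ^ N * (4 * N ^ N) ∎)
  where
  open ≤-Reasoning
  N = suc k
  l₁ : ∀ k → suc (4 * suc k * suc (suc k)) ≡ suc (2 * suc k) * suc (2 * suc k)
  l₁ = solve-∀
  l₂ : ∀ x → 2 * x * (2 * x) ≡ 4 * (x * x)
  l₂ = solve-∀
  l₃ : ∀ N → 2 * N * (2 * N) ≡ 4 * N * N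
  l₃ = solve-∀
  l₄ : ∀ a b → 4 * (a * b) ≡ a * (4 * b)
  l₄ = solve-∀

-- A substitute for `1 + x ≤ exp x` with base 4: Bernoulli gives `1 + E / N ≤ (1 + 1 / N) ^ E`, and
-- the `N`-th power of `1 + 1 / N` is at most 4.
exp-bound : ∀ N X Y E → N * X ≤ E * Y → (Y + X) ^ N ≤ 4 ^ E * Y ^ N
exp-bound zero      X Y E h = ≤-trans (1≤^ E (s≤s z≤n)) (≤-reflexive (sym (*-identityʳ _)))
exp-bound N@(suc k) X Y E h = *-cancelˡ (N ^ N) (1≤^ N (s≤s z≤n)) (begin
  N ^ N * (Y + X) ^ N       ≡⟨ sym (*-^ N (Y + X) N) ⟩
  (N * (Y + X)) ^ N         ≤⟨ ^-monoˡ-≤ N (≤-trans (≤-reflexive (*-distribˡ-+ N Y X)) (≤-trans (+-monoʳ-≤ (N * Y) h) (≤-reflexive (sym (*-distribʳ-+ Y N E))))) ⟩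
  ((N + E) * Y) ^ N         ≡⟨ *-^ (N + E) Y N ⟩
  (N + E) ^ N * Y ^ N       ≤⟨ *-monoˡ-≤ (Y ^ N) ne ⟩
  N ^ N * 4 ^ E * Y ^ N     ≡⟨ *-assoc (N ^ N) _ _ ⟩
  N ^ N * (4 ^ E * Y ^ N) ∎)
  where
  open ≤-Reasoning
  ne : (N + E) ^ N ≤ N ^ N * 4 ^ E
  ne = *-cancelˡ ((N ^ E) ^ N) (1≤^ N (1≤^ E (s≤s z≤n))) (begin
    (N ^ E) ^ N * (N + E) ^ N    ≡⟨ sym (*-^ (N ^ E) (N + E) N) ⟩
    (N ^ E * (N + E)) ^ N        ≤⟨ ^-monoˡ-≤ N (bernoulli N E) ⟩
    (N * suc N ^ E) ^ N          ≡⟨ *-^ N (suc N ^ E) N ⟩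
    N ^ N * (suc N ^ E) ^ N      ≡⟨ cong (N ^ N *_) (flip (suc N)) ⟩
    N ^ N * (suc N ^ N) ^ E      ≤⟨ *-monoʳ-≤ (N ^ N) (^-monoˡ-≤ E (growth-≤4 k)) ⟩
    N ^ N * (4 * N ^ N) ^ E      ≡⟨ cong (N ^ N *_) (trans (*-^ 4 (N ^ N) E) (cong (4 ^ E *_) (sym (flip N)))) ⟩
    N ^ N * (4 ^ E * (N ^ E) ^ N) ≡⟨ l₁ (N ^ N) (4 ^ E) ((N ^ E) ^ N) ⟩
    (N ^ E) ^ N * (N ^ N * 4 ^ E) ∎)
    where
    flip : ∀ z → (z ^ E) ^ N ≡ (z ^ N) ^ E
    flip z = trans (^-*-assoc z E N) (trans (cong (z ^_) (*-comm E N)) (sym (^-*-assoc z N E)))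
    l₁ : ∀ a b c → a * (b * c) ≡ c * (a * b)
    l₁ = solve-∀


-- Enumerations of vertices and palettes, sums over colourings

⟦∧⟧ : ∀ a b → ⟦ a ∧ b ⟧ ≡ ⟦ a ⟧ * ⟦ b ⟧
⟦∧⟧ true  b = sym (+-identityʳ _)
⟦∧⟧ false b = refl

∑-allFin : ∀ n (f : Fin (suc n) → ℕ) → ∑ (allFin (suc n)) f ≡ f zero + ∑ (allFin n) (f ∘ suc)
∑-allFin n f = cong (f zero +_) (trans (cong (λ l → ∑ l f) (sym (Data.List.Properties.map-tabulate id suc))) (∑-map suc (allFin n) f))

∏-allFin : ∀ n (f : Fin (suc n) → ℕ) → ∏ (allFin (suc n)) f ≡ f zero * ∏ (allFin n) (f ∘ suc)
∏-allFin n f = cong (f zero *_) (trans (cong (λ l → ∏ l f) (sym (Data.List.Properties.map-tabulate id suc))) (∏-map suc (allFin n) f))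

once-allFin : ∀ n (x : Fin n) → ∑ (allFin n) (λ y → ⟦ does (y Fin.≟ x) ⟧) ≡ 1
once-allFin (suc n) zero    = trans (∑-allFin n (λ y → ⟦ does (y Fin.≟ zero) ⟧)) (cong suc (∑-0 (allFin n)))
once-allFin (suc n) (suc x) = trans (∑-allFin n (λ y → ⟦ does (y Fin.≟ suc x) ⟧)) (trans (∑-cong (allFin n) pt) (once-allFin n x))
  where
  pt : ∀ y → ⟦ does (suc y Fin.≟ suc x) ⟧ ≡ ⟦ does (y Fin.≟ x) ⟧
  pt y with y Fin.≟ x
  ... | yes _ = refl
  ... | no _  = refl

FinEnum : ∀ n → Enum (Fin n)
FinEnum n = record { _≟_ = Fin._≟_ ; elts = allFin n ; once = once-allFin n }

once-∷ : ∀ {d} (E : Enum X) (l : List (Vec X d)) →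
         (∀ v → ∑ l (λ y → ⟦ does (Vec.≡-dec (Enum._≟_ E) y v) ⟧) ≡ 1) →
         ∀ v → ∑ (concatMap (λ x → map (x ∷_) l) (Enum.elts E)) (λ y → ⟦ does (Vec.≡-dec (Enum._≟_ E) y v) ⟧) ≡ 1
once-∷ E l o (a ∷ as) = begin
  ∑ (concatMap (λ x → map (x ∷_) l) elts) (λ y → ⟦ does (y ≟v (a ∷ as)) ⟧)
    ≡⟨ ∑-concatMap (λ x → map (x ∷_) l) elts _ ⟩
  ∑ elts (λ x → ∑ (map (x ∷_) l) (λ y → ⟦ does (y ≟v (a ∷ as)) ⟧))
    ≡⟨ ∑-cong elts (λ x → trans (∑-map (x ∷_) l _) (trans (∑-cong l (λ ys → ⟦∧⟧ (does (x ≟ a)) (does (ys ≟v as)))) (trans (∑-*ˡ l ⟦ does (x ≟ a) ⟧ (λ ys → ⟦ does (ys ≟v as) ⟧)) (cong (⟦ does (x ≟ a) ⟧ *_) (o as))))) ⟩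
  ∑ elts (λ x → ⟦ does (x ≟ a) ⟧ * 1)
    ≡⟨ ∑-cong elts (λ x → *-identityʳ _) ⟩
  ∑ elts (λ x → ⟦ does (x ≟ a) ⟧)
    ≡⟨ once a ⟩
  1 ∎
  where
  open ≡-Reasoning
  open Enum E
  _≟v_ : ∀ {d} → DecidableEquality (Vec _ d)
  _≟v_ = Vec.≡-dec _≟_

VertexEnum : ∀ m d → Enum (Vertex m d)
VertexEnum m d = record { _≟_ = Vec.≡-dec Fin._≟_ ; elts = allVerts m d ; once = go d }
  where
  go : ∀ d (v : Vertex m d) → ∑ (allVerts m d) (λ y → ⟦ does (Vec.≡-dec Fin._≟_ y v) ⟧) ≡ 1
  go zero    [] = refl
  go (suc d) v  = once-∷ (FinEnum m) (allVerts m d) (go d) v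

BoolEnum : Enum Bool
BoolEnum = record { _≟_ = Data.Bool.Properties._≟_ ; elts = true ∷ false ∷ [] ; once = λ { true → refl ; false → refl } }

SubsetEnum : ∀ n → Enum (Subset n)
SubsetEnum n = record { _≟_ = Vec.≡-dec Data.Bool.Properties._≟_ ; elts = els n ; once = go n }
  where
  els : ∀ n → List (Subset n)
  els zero    = [ [] ]
  els (suc n) = concatMap (λ x → map (x ∷_) (els n)) (true ∷ false ∷ [])
  go : ∀ n (v : Subset n) → ∑ (els n) (λ y → ⟦ does (Vec.≡-dec Data.Bool.Properties._≟_ y v) ⟧) ≡ 1
  go zero    [] = refl
  go (suc n) v  = once-∷ BoolEnum (els n) (go n) v

module _ (E : Enum X) where
  open Enum E

  occ-pos : ∀ l {x} → x ∈ l → 1 ≤ ∑ l (λ y → ⟦ does (y ≟ x) ⟧)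
  occ-pos (y ∷ l) {x} p with y ≟ x | p
  ... | yes _ | _       = s≤s z≤n
  ... | no q  | here e  = ⊥-elim (q (sym e))
  ... | no _  | there r = occ-pos l r

  occ-∈ : ∀ l {x} → 1 ≤ ∑ l (λ y → ⟦ does (y ≟ x) ⟧) → x ∈ l
  occ-∈ (y ∷ l) {x} p with y ≟ x
  ... | yes refl = here refl
  ... | no _     = there (occ-∈ l p)

  ∈-elts : ∀ x → x ∈ elts
  ∈-elts x = occ-∈ elts (≤-reflexive (sym (once x)))

  unique-elts : Unique elts
  unique-elts = go elts (λ x → ≤-reflexive (once x))
    where
    go : ∀ l → (∀ x → ∑ l (λ y → ⟦ does (y ≟ x) ⟧) ≤ 1) → Unique l
    go []      h = []
    go (y ∷ l) h = All.tabulate ne ∷ go l (λ x → ≤-trans (m≤n+m _ ⟦ does (y ≟ x) ⟧) (h x))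
      where
      ne : ∀ {z} → z ∈ l → y ≢ z
      ne z∈ refl with y ≟ y | h y
      ... | yes _ | q = <⇒≱ (occ-pos l z∈) (≤-pred q)
      ... | no r  | _ = r refl

module Colourings (E : Enum X) (n : ℕ) where
  open Enum E

  Col : Set
  Col = X → Fin n

  upd : Col → X → Fin n → Col
  upd f u c v = if does (v ≟ u) then c else f v

  upd-same : ∀ f u c → upd f u c u ≡ c
  upd-same f u c with u ≟ u
  ... | yes _ = refl
  ... | no q  = ⊥-elim (q refl)

  upd-other : ∀ f u c {v} → v ≢ u → upd f u c v ≡ f v
  upd-other f u c {v} v≢u with v ≟ u
  ... | yes p = ⊥-elim (v≢u p)
  ... | no _  = refl

  -- Colourings are functions, and pointwise equal ones need not be propositionally equal, so
  -- invariance is required explicitly.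
  Ext : ∀ {Y : Set} → (Col → Y) → Set
  Ext F = ∀ f g → (∀ v → f v ≡ g v) → F f ≡ F g

  -- The sum over all recolourings of a list of vertices, against a background colouring. The
  -- nesting by vertices is what allows an elimination one vertex at a time.
  S : List X → (Col → ℕ) → Col → ℕ
  S []       F f = F f
  S (u ∷ us) F f = ∑ (allFin n) (λ c → S us F (upd f u c))

  S-mono : ∀ us {F G : Col → ℕ} → (∀ h → F h ≤ G h) → ∀ f → S us F f ≤ S us G f
  S-mono []       e f = e f
  S-mono (u ∷ us) e f = ∑-mono (allFin n) (λ c → S-mono us e (upd f u c))

  S-cong : ∀ us {F G : Col → ℕ} → (∀ h → F h ≡ G h) → ∀ f → S us F f ≡ S us G f
  S-cong []       e f = e f
  S-cong (u ∷ us) e f = ∑-cong (allFin n) (λ c → S-cong us e (upd f u c))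

  S-∑ : ∀ us (l : List Y) (F : Y → Col → ℕ) f → S us (λ h → ∑ l (λ y → F y h)) f ≡ ∑ l (λ y → S us (F y) f)
  S-∑ []       l F f = refl
  S-∑ (u ∷ us) l F f = trans (∑-cong (allFin n) (λ c → S-∑ us l F (upd f u c))) (∑-swap (allFin n) l _)

  S-*ˡ : ∀ us k (F : Col → ℕ) f → S us (λ h → k * F h) f ≡ k * S us F f
  S-*ˡ []       k F f = refl
  S-*ˡ (u ∷ us) k F f = trans (∑-cong (allFin n) (λ c → S-*ˡ us k F (upd f u c))) (∑-*ˡ (allFin n) k _)

  S-++ : ∀ us ws (F : Col → ℕ) f → S (us ++ ws) F f ≡ S us (S ws F) f
  S-++ []       ws F f = refl
  S-++ (u ∷ us) ws F f = ∑-cong (allFin n) (λ c → S-++ us ws F (upd f u c))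

  -- Distributivity: neither `Q` nor the dependence of `φ` on the colouring sees the summed
  -- vertices, so the colours are chosen independently.
  S-factor : ∀ us → Unique us → (Q : Col → ℕ) (φ : X → Col → Fin n → ℕ) →
             (∀ u → u ∈ us → ∀ h c → Q (upd h u c) ≡ Q h) →
             (∀ u → u ∈ us → ∀ v h c e → φ v (upd h u c) e ≡ φ v h e) →
             ∀ f → S us (λ h → Q h * ∏ us (λ v → φ v h (h v))) f ≡ Q f * ∏ us (λ v → ∑ (allFin n) (φ v f))
  S-factor []       _         Q φ iQ iφ f = refl
  S-factor (u ∷ us) (u∉ ∷ un) Q φ iQ iφ f = begin
    ∑ (allFin n) (λ c → S us (λ h → Q h * (φ u h (h u) * ∏ us (λ v → φ v h (h v)))) (upd f u c))
      ≡⟨ ∑-cong (allFin n) (λ c → S-cong us (λ h → sym (*-assoc (Q h) (φ u h (h u)) _)) (upd f u c)) ⟩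
    ∑ (allFin n) (λ c → S us (λ h → Q′ h * ∏ us (λ v → φ v h (h v))) (upd f u c))
      ≡⟨ ∑-cong (allFin n) (λ c → S-factor us un Q′ φ iQ′ (λ w w∈ → iφ w (there w∈)) (upd f u c)) ⟩
    ∑ (allFin n) (λ c → Q′ (upd f u c) * ∏ us (λ v → ∑ (allFin n) (φ v (upd f u c))))
      ≡⟨ ∑-cong (allFin n) (λ c → cong₂ _*_ (q c) (∏-cong us (λ v → ∑-cong (allFin n) (iφ u (here refl) v f c)))) ⟩
    ∑ (allFin n) (λ c → Q f * φ u f c * ∏ us (λ v → ∑ (allFin n) (φ v f)))
      ≡⟨ ∑-*ʳ (allFin n) _ _ ⟩
    ∑ (allFin n) (λ c → Q f * φ u f c) * ∏ us (λ v → ∑ (allFin n) (φ v f))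
      ≡⟨ cong (_* ∏ us (λ v → ∑ (allFin n) (φ v f))) (∑-*ˡ (allFin n) (Q f) (φ u f)) ⟩
    Q f * ∑ (allFin n) (φ u f) * ∏ us (λ v → ∑ (allFin n) (φ v f))
      ≡⟨ *-assoc (Q f) _ _ ⟩
    Q f * (∑ (allFin n) (φ u f) * ∏ us (λ v → ∑ (allFin n) (φ v f))) ∎
    where
    open ≡-Reasoning
    Q′ : Col → ℕ
    Q′ h = Q h * φ u h (h u)
    iQ′ : ∀ w → w ∈ us → ∀ h c → Q′ (upd h w c) ≡ Q′ h
    iQ′ w w∈ h c = cong₂ _*_ (iQ w (there w∈) h c)
      (trans (cong (φ u (upd h w c)) (upd-other h w c (All.lookup u∉ w∈))) (iφ w (there w∈) u h c (h u)))
    q : ∀ c → Q′ (upd f u c) ≡ Q f * φ u f c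
    q c = cong₂ _*_ (iQ u (here refl) f c) (trans (cong (φ u (upd f u c)) (upd-same f u c)) (iφ u (here refl) u f c c))

  agree : Col → Col → ℕ
  agree g h = ∏ elts (λ v → ⟦ does (h v Fin.≟ g v) ⟧)

  agree-zero : ∀ g h → agree g h ≡ 0 ⊎ (∀ v → g v ≡ h v)
  agree-zero g h with agree g h in e
  ... | zero  = inj₁ refl
  ... | suc k = inj₂ pt
    where
    pt : ∀ v → g v ≡ h v
    pt v with ∏-isolate E v | h v Fin.≟ g v in q
    ... | R , eq , _ | yes p = sym p
    ... | R , eq , _ | no _  = ⊥-elim (0≢1+n (trans (sym (trans (eq _) (cong (λ b → ⟦ does b ⟧ * ∏ R (λ v → ⟦ does (h v Fin.≟ g v) ⟧)) q))) e))

  -- Both sides run over all colourings once. The weight `agree f h`, equal to 1 exactly when the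
  -- two colourings coincide, converts one enumeration into the other.
  transfer : ∀ (fs : List Col) us → Unique us → (∀ φ → ∏ us φ ≡ ∏ elts φ) →
             (∀ h → ∑ fs (λ f → agree f h) ≡ 1) →
             ∀ F → Ext F → ∀ f₀ → ∑ fs F ≡ S us F f₀
  transfer fs us un perm tot F ext f₀ = begin
    ∑ fs F
      ≡⟨ ∑-cong fs (λ f → trans (sym (*-identityʳ (F f))) (cong (F f *_) (sym (one f)))) ⟩
    ∑ fs (λ f → F f * S us (agree f) f₀)
      ≡⟨ ∑-cong fs (λ f → sym (S-*ˡ us (F f) (agree f) f₀)) ⟩
    ∑ fs (λ f → S us (λ h → F f * agree f h) f₀)
      ≡⟨ sym (S-∑ us fs (λ f h → F f * agree f h) f₀) ⟩
    S us (λ h → ∑ fs (λ f → F f * agree f h)) f₀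
      ≡⟨ S-cong us (λ h → trans (∑-cong fs (λ f → sw f h)) (trans (∑-*ˡ fs (F h) _) (trans (cong (F h *_) (tot h)) (*-identityʳ _)))) f₀ ⟩
    S us F f₀ ∎
    where
    open ≡-Reasoning
    sw : ∀ f h → F f * agree f h ≡ F h * agree f h
    sw f h with agree-zero f h
    ... | inj₁ e rewrite e = trans (*-zeroʳ (F f)) (sym (*-zeroʳ (F h)))
    ... | inj₂ p = cong (_* agree f h) (ext f h p)
    one : ∀ f → S us (agree f) f₀ ≡ 1
    one f = begin
      S us (agree f) f₀
        ≡⟨ S-cong us (λ h → trans (sym (perm _)) (sym (+-identityʳ _))) f₀ ⟩
      S us (λ h → 1 * ∏ us (λ v → ⟦ does (h v Fin.≟ f v) ⟧)) f₀
        ≡⟨ S-factor us un (λ _ → 1) (λ v _ c → ⟦ does (c Fin.≟ f v) ⟧) (λ _ _ _ _ → refl) (λ _ _ _ _ _ _ → refl) f₀ ⟩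
      1 * ∏ us (λ v → ∑ (allFin n) (λ c → ⟦ does (c Fin.≟ f v) ⟧))
        ≡⟨ trans (+-identityʳ _) (trans (∏-cong us (λ v → once-allFin n (f v))) (∏-1 us)) ⟩
      1 ∎

-- Stated for any `h` with the two equations of a cons, since the pattern-matching lambda inside
-- `allFinFuns` has no name and cannot be written again.
∑-cons : ∀ {k} (h : Y → (Fin k → Y) → Fin (suc k) → Y) → (∀ y g → h y g zero ≡ y) → (∀ y g i → h y g (suc i) ≡ g i) →
         ∀ ys gs (ψ : Fin (suc k) → Y → ℕ) →
         ∑ (concatMap (λ y → map (h y) gs) ys) (λ g → ∏ (allFin (suc k)) (λ i → ψ i (g i)))
         ≡ ∑ ys (ψ zero) * ∑ gs (λ g → ∏ (allFin k) (λ i → ψ (suc i) (g i)))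
∑-cons {k = k} h h0 hs ys gs ψ = begin
  ∑ (concatMap (λ y → map (h y) gs) ys) (λ g → ∏ (allFin (suc k)) (λ i → ψ i (g i)))
    ≡⟨ ∑-concatMap (λ y → map (h y) gs) ys _ ⟩
  ∑ ys (λ y → ∑ (map (h y) gs) (λ g → ∏ (allFin (suc k)) (λ i → ψ i (g i))))
    ≡⟨ ∑-cong ys (λ y → trans (∑-map (h y) gs _) (trans (∑-cong gs (pt y)) (∑-*ˡ gs (ψ zero y) (λ g → ∏ (allFin k) (λ i → ψ (suc i) (g i)))))) ⟩
  ∑ ys (λ y → ψ zero y * ∑ gs (λ g → ∏ (allFin k) (λ i → ψ (suc i) (g i))))
    ≡⟨ ∑-*ʳ ys _ (ψ zero) ⟩
  ∑ ys (ψ zero) * ∑ gs (λ g → ∏ (allFin k) (λ i → ψ (suc i) (g i))) ∎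
  where
  open ≡-Reasoning
  pt : ∀ y g → ∏ (allFin (suc k)) (λ i → ψ i (h y g i)) ≡ ψ zero y * ∏ (allFin k) (λ i → ψ (suc i) (g i))
  pt y g = trans (∏-allFin k (λ i → ψ i (h y g i)))
    (cong₂ _*_ (cong (ψ zero) (h0 y g)) (∏-cong (allFin k) (λ i → cong (ψ (suc i)) (hs y g i))))

∑-allFinFuns : ∀ k (ys : List Y) (ψ : Fin k → Y → ℕ) →
               ∑ (allFinFuns k ys) (λ g → ∏ (allFin k) (λ i → ψ i (g i))) ≡ ∏ (allFin k) (λ i → ∑ ys (ψ i))
∑-allFinFuns zero    ys ψ = refl
∑-allFinFuns (suc k) ys ψ = trans (∑-cons _ (λ _ _ → refl) (λ _ _ _ → refl) ys (allFinFuns k ys) ψ)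
  (trans (cong (∑ ys (ψ zero) *_) (∑-allFinFuns k ys (ψ ∘ suc))) (sym (∏-allFin k (λ i → ∑ ys (ψ i)))))

allColorings-once : ∀ n m d (h : Coloring n m d) →
                    ∑ (allColorings n m d) (λ f → Colourings.agree (VertexEnum m d) n f h) ≡ 1
allColorings-once n m zero h = trans (∑-map _ (allFin n) _)
  (trans (∑-cong (allFin n) (λ c → trans (*-identityʳ _) (sy c (h [])))) (once-allFin n (h [])))
  where
  sy : ∀ c e → ⟦ does (e Fin.≟ c) ⟧ ≡ ⟦ does (c Fin.≟ e) ⟧
  sy c e with e Fin.≟ c | c Fin.≟ e
  ... | yes _ | yes _ = refl
  ... | no _  | no _  = refl
  ... | yes p | no q  = ⊥-elim (q (sym p))
  ... | no p  | yes q = ⊥-elim (p (sym q))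
allColorings-once n m (suc d) h = begin
  ∑ (allColorings n m (suc d)) (λ f → Colourings.agree (VertexEnum m (suc d)) n f h)
    ≡⟨ ∑-map _ (allFinFuns m (allColorings n m d)) _ ⟩
  ∑ (allFinFuns m (allColorings n m d)) (λ g → ∏ (allVerts m (suc d)) (λ v → ⟦ does (h v Fin.≟ _) ⟧))
    ≡⟨ ∑-cong (allFinFuns m (allColorings n m d)) (λ g → trans (∏-concatMap (λ x → map (x ∷_) (allVerts m d)) (allFin m) _)
          (∏-cong (allFin m) (λ x → ∏-map (x ∷_) (allVerts m d) _))) ⟩
  ∑ (allFinFuns m (allColorings n m d)) (λ g → ∏ (allFin m) (λ x → Colourings.agree (VertexEnum m d) n (g x) (h ∘ (x ∷_))))
    ≡⟨ ∑-allFinFuns m (allColorings n m d) (λ x g → Colourings.agree (VertexEnum m d) n g (h ∘ (x ∷_))) ⟩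
  ∏ (allFin m) (λ x → ∑ (allColorings n m d) (λ g → Colourings.agree (VertexEnum m d) n g (h ∘ (x ∷_))))
    ≡⟨ trans (∏-cong (allFin m) (λ x → allColorings-once n m d (h ∘ (x ∷_)))) (∏-1 (allFin m)) ⟩
  1 ∎
  where open ≡-Reasoning


-- Boolean tests and their meaning

∧-true : ∀ {a b} → a ∧ b ≡ true → a ≡ true × b ≡ true
∧-true {true} {true} _ = refl , refl

true≢false : ∀ {b} → b ≡ true → b ≡ false → ⊥
true≢false refl ()

¬true : ∀ {b} → ¬ (b ≡ true) → b ≡ false
¬true {true}  h = ⊥-elim (h refl)
¬true {false} h = refl

not-true : ∀ {b} → not b ≡ true → b ≡ false
not-true {false} _ = refl

T⇒≡ : ∀ {b} → T b → b ≡ true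
T⇒≡ {true} _ = refl

≡⇒T : ∀ {b} → b ≡ true → T b
≡⇒T refl = tt

<ᵇ-true : ∀ {m n} → (m <ᵇ n) ≡ true → m < n
<ᵇ-true e = <ᵇ⇒< _ _ (≡⇒T e)

≡ᵇ-true : ∀ {m n} → (m ≡ᵇ n) ≡ true → m ≡ n
≡ᵇ-true e = ≡ᵇ⇒≡ _ _ (≡⇒T e)

<⇒<ᵇ≡ : ∀ {m n} → m < n → (m <ᵇ n) ≡ true
<⇒<ᵇ≡ p = T⇒≡ (<⇒<ᵇ p)

≡⇒≡ᵇ≡ : ∀ {m n} → m ≡ n → (m ≡ᵇ n) ≡ true
≡⇒≡ᵇ≡ p = T⇒≡ (≡⇒≡ᵇ _ _ p)

any-true⁻ : ∀ (p : X → Bool) xs → any p xs ≡ true → ∃[ x ] (x ∈ xs × p x ≡ true)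
any-true⁻ p (x ∷ xs) e with p x in q
... | true  = x , here refl , q
... | false with any-true⁻ p xs e
...   | y , y∈ , r = y , there y∈ , r

any-true⁺ : ∀ (p : X → Bool) {xs x} → x ∈ xs → p x ≡ true → any p xs ≡ true
any-true⁺ p (here refl) e rewrite e = refl
any-true⁺ p {y ∷ _} (there m) e with p y
... | true  = refl
... | false = any-true⁺ p m e

all-true⁻ : ∀ (p : X → Bool) {xs x} → all p xs ≡ true → x ∈ xs → p x ≡ true
all-true⁻ p {y ∷ _} e m with p y in q
all-true⁻ p e (here refl) | true = q
all-true⁻ p e (there m)   | true = all-true⁻ p e m

all-true⁺ : ∀ (p : X → Bool) xs → (∀ x → x ∈ xs → p x ≡ true) → all p xs ≡ true
all-true⁺ p []       h = refl
all-true⁺ p (x ∷ xs) h rewrite h x (here refl) = all-true⁺ p xs (λ y m → h y (there m))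

all-false⁻ : ∀ (p : X → Bool) xs → all p xs ≡ false → ∃[ x ] (x ∈ xs × p x ≡ false)
all-false⁻ p (x ∷ xs) e with p x in q
... | false = x , here refl , q
... | true  with all-false⁻ p xs e
...   | y , m , r = y , there m , r

any-cong : ∀ {p q : X → Bool} xs → (∀ x → p x ≡ q x) → any p xs ≡ any q xs
any-cong []       e = refl
any-cong (x ∷ xs) e = cong₂ _∨_ (e x) (any-cong xs e)

if-true : ∀ {A : Set} {b} {x y : A} → b ≡ true → (if b then x else y) ≡ x
if-true refl = refl

if-false : ∀ {A : Set} {b} {x y : A} → b ≡ false → (if b then x else y) ≡ y
if-false refl = refl

-- Regular bipartite systems and elimination of the even vertices

record System : Set₁ where
  field
    V       : Set
    E       : Enum V
    n       : ℕ
    H       : Adj n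
    H-sym   : ∀ i j → H i j ≡ H j i
    wgt     : Fin n → ℕ
    1≤wgt   : ∀ c → 1 ≤ wgt c
    adj     : V → V → Bool
    adj-sym : ∀ u v → adj u v ≡ adj v u
    odd     : V → Bool
    adj-odd : ∀ {u v} → adj u v ≡ true → odd u ≡ not (odd v)
    deg-1   : ℕ
    deg     : ∀ v → ∑ (Enum.elts E) (λ u → ⟦ adj v u ⟧) ≡ suc deg-1

  open Enum E public renaming (elts to vs)
  open Colourings E n public

  δ : ℕ
  δ = suc deg-1

  lower : (V → ℕ) → V → V → Bool
  lower lev v u = adj v u ∧ (suc (lev u) ≡ᵇ lev v)

  ∏-update : ∀ u (h : Fin n → V → ℕ) (h′ : V → ℕ) →
             (∀ c y → y ≢ u → h c y ≡ h′ y) → h′ u ≡ ∑ (allFin n) (λ c → h c u) →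
             ∑ (allFin n) (λ c → ∏ vs (h c)) ≡ ∏ vs h′
  ∏-update u h h′ e eu with ∏-isolate E u
  ... | R , eq , cg = begin
    ∑ (allFin n) (λ c → ∏ vs (h c))          ≡⟨ ∑-cong (allFin n) (λ c → trans (eq (h c)) (cong (h c u *_) (cg (h c) h′ (e c)))) ⟩
    ∑ (allFin n) (λ c → h c u * ∏ R h′)      ≡⟨ ∑-*ʳ (allFin n) (∏ R h′) (λ c → h c u) ⟩
    ∑ (allFin n) (λ c → h c u) * ∏ R h′      ≡⟨ cong (_* ∏ R h′) (sym eu) ⟩
    h′ u * ∏ R h′                            ≡⟨ sym (eq h′) ⟩
    ∏ vs h′ ∎
    where open ≡-Reasoning

-- Finner's inequality along an elimination order, where the factor attached to v may
-- depend on the colours two levels or more below v.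
module Finner (Sys : System) where
  open System Sys

  module _ (lev : V → ℕ) (lev-adj : ∀ {v u} → adj v u ≡ true → lev v ≤ suc (lev u))
           (types : List Y) (φ : Y → V → V → Col → Fin n → ℕ)
           (φ-past : ∀ t v y f u c e → lev v ≤ suc (lev u) → φ t v y (upd f u c) e ≡ φ t v y f e)
           (bnd : V → ℕ)
           where

    summed : V → Col → ℕ
    summed v f = ∑ types (λ t → ∏ vs (λ y → if adj v y then ∑ (allFin n) (φ t v y f) else 1))

    pointwise : V → Col → ℕ
    pointwise v f = ∑ types (λ t → ∏ vs (λ y → if adj v y then φ t v y f (f y) else 1))

    mem : List V → V → Bool
    mem us y = any (λ u → does (u ≟ y)) us

    mem-∈ : ∀ us {y} → y ∈ us → mem us y ≡ true
    mem-∈ us {y} m = any-true⁺ _ m (dec-true (y ≟ y) refl)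

    partial : List V → V → Col → ℕ
    partial us v f = ∑ types (λ t → ∏ vs (λ y →
      if adj v y then (if mem us y then ∑ (allFin n) (φ t v y f) else φ t v y f (f y)) else 1))

    below : List V → V → Bool
    below us v = any (λ u → suc (lev u) <ᵇ lev v) us

    -- Once a vertex two levels or more below `v` has been summed, the factor of `v` depends on a
    -- summed colour and is no longer a product. By then all neighbours of `v` have been summed, so
    -- the uniform bound can take over.
    stage : List V → V → Col → ℕ
    stage us v f = if odd v then (if below us v then bnd v else partial us v f) else 1

    partial-all : ∀ us v f → (∀ y → adj v y ≡ true → y ∈ us) → partial us v f ≡ summed v f
    partial-all us v f h = ∑-cong types (λ t → ∏-cong vs (pt t))
      where
      pt : ∀ t y → (if adj v y then (if mem us y then ∑ (allFin n) (φ t v y f) else φ t v y f (f y)) else 1)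
                 ≡ (if adj v y then ∑ (allFin n) (φ t v y f) else 1)
      pt t y with adj v y in a
      ... | false = refl
      ... | true rewrite mem-∈ us (h y a) = refl

    module _ {u : V} {us : List V} (u∉us : u ∉ us) where

      mem-tail : ∀ {y} → y ≢ u → mem (u ∷ us) y ≡ mem us y
      mem-tail {y} y≢u with u ≟ y
      ... | yes p = ⊥-elim (y≢u (sym p))
      ... | no _  = refl

      mem-head : mem us u ≡ false
      mem-head = ¬true (λ e → let (z , z∈ , p) = any-true⁻ _ us e in hlp z z∈ p)
        where
        hlp : ∀ z → z ∈ us → does (z ≟ u) ≡ true → ⊥
        hlp z z∈ p with z ≟ u
        ... | yes refl = u∉us z∈

      -- At most one level separates `v` from `u`, so no `φ` of `v` reads the colour of `u`; the sum
      -- over that colour meets the single factor at `u`.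
      partial-touch : ∀ v f → lev v ≤ suc (lev u) → adj v u ≡ true →
                      ∑ (allFin n) (λ c → partial us v (upd f u c)) ≡ partial (u ∷ us) v f
      partial-touch v f l a = trans (∑-swap (allFin n) types _) (∑-cong types (λ t →
        ∏-update u (h t) (h′ t) (e t) (eu t)))
        where
        h : Y → Fin n → V → ℕ
        h t c y = if adj v y then (if mem us y then ∑ (allFin n) (φ t v y (upd f u c)) else φ t v y (upd f u c) (upd f u c y)) else 1
        h′ : Y → V → ℕ
        h′ t y = if adj v y then (if mem (u ∷ us) y then ∑ (allFin n) (φ t v y f) else φ t v y f (f y)) else 1
        e : ∀ t c y → y ≢ u → h t c y ≡ h′ t y
        e t c y y≢u rewrite mem-tail y≢u | upd-other f u c y≢u with adj v y | mem us y
        ... | false | _     = refl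
        ... | true  | true  = ∑-cong (allFin n) (λ x → φ-past t v y f u c x l)
        ... | true  | false = φ-past t v y f u c (f y) l
        eu : ∀ t → h′ t u ≡ ∑ (allFin n) (λ c → h t c u)
        eu t rewrite a | mem-head | dec-true (u ≟ u) refl =
          ∑-cong (allFin n) (λ c → sym (φ-past t v u f u c c l))

      partial-miss : ∀ v f c → lev v ≤ suc (lev u) → adj v u ≡ false →
                     partial us v (upd f u c) ≡ partial (u ∷ us) v f
      partial-miss v f c l a = ∑-cong types (λ t → ∏-cong vs (pt t))
        where
        pt : ∀ t y → (if adj v y then (if mem us y then ∑ (allFin n) (φ t v y (upd f u c)) else φ t v y (upd f u c) (upd f u c y)) else 1)
                   ≡ (if adj v y then (if mem (u ∷ us) y then ∑ (allFin n) (φ t v y f) else φ t v y f (f y)) else 1)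
        pt t y with adj v y in b
        ... | false = refl
        ... | true  with y ≟ u
        ...   | yes refl = ⊥-elim (true≢false b a)
        ...   | no y≢u rewrite mem-tail y≢u with mem us y
        ...     | true  = ∑-cong (allFin n) (λ x → φ-past t v y f u c x l)
        ...     | false = φ-past t v y f u c (f y) l

    module _ (C₀ : ℕ) (F : Col → ℕ) (F≤ : ∀ f → C₀ * F f ^ δ ≤ ∏ vs (λ v → if odd v then pointwise v f else 1))
             (bnd≥ : ∀ v f → odd v ≡ true → summed v f ≤ bnd v) where

      -- The list increases in level and its tail is summed first, so elimination proceeds from the
      -- top down. Exactly `δ` odd vertices are adjacent to `u`, and Hölder's inequality with
      -- exponent `δ` distributes the sum over them; every other factor is bounded for all colours
      -- of `u`.
      finner-stage : ∀ us → Unique us → AllPairs (λ a b → lev a ≤ lev b) us →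
                     (∀ u → u ∈ us → odd u ≡ false) →
                     (∀ y u → odd y ≡ false → y ∉ us → u ∈ us → lev y ≤ lev u) →
                     ∀ f → C₀ * S us F f ^ δ ≤ ∏ vs (λ v → stage us v f)
      finner-stage []       _ _ _ _ f = F≤ f
      finner-stage (u ∷ us) (u≢ ∷ un) (u≤ ∷ so) ev top f =
        ≤-trans (hölder vs t deg-1 ∑t C₀ (λ v → stage (u ∷ us) v f) (allFin n)
                   (λ c → S us F (upd f u c)) (λ v c → stage us v (upd f u c))
                   (λ c → finner-stage us un so (λ w m → ev w (there m)) top′ (upd f u c))
                   miss)
                (∏-mono vs touch)
        where
        u∉us : u ∉ us
        u∉us m = All.lookup u≢ m refl
        t : V → Bool
        t v = odd v ∧ adj v u
        ∑t : ∑ vs (λ v → ⟦ t v ⟧) ≡ δ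
        ∑t = trans (∑-cong vs (λ v → cong ⟦_⟧ (pt v))) (deg u)
          where
          pt : ∀ v → odd v ∧ adj v u ≡ adj u v
          pt v rewrite adj-sym v u with adj u v in a
          ... | false = Data.Bool.Properties.∧-zeroʳ (odd v)
          ... | true with odd v in o
          ...   | true  = refl
          ...   | false = ⊥-elim (true≢false (trans (adj-odd a) (cong not o)) (ev u (here refl)))
        top′ : ∀ y w → odd y ≡ false → y ∉ us → w ∈ us → lev y ≤ lev w
        top′ y w oy y∉ w∈ with y ≟ u
        ... | yes refl = All.lookup u≤ w∈
        ... | no y≢u   = top y w oy (λ { (here e) → y≢u e ; (there m) → y∉ m }) (there w∈)
        not-below : ∀ v → lev v ≤ suc (lev u) → below (u ∷ us) v ≡ false
        not-below v l = ¬true (λ e → let (z , z∈ , p) = any-true⁻ _ (u ∷ us) e in hlp z z∈ (<ᵇ-true p))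
          where
          hlp : ∀ z → z ∈ u ∷ us → suc (lev z) < lev v → ⊥
          hlp z (here refl) p = <⇒≱ p l
          hlp z (there m)   p = <⇒≱ p (≤-trans l (s≤s (All.lookup u≤ m)))
        below-tail : ∀ v → below (u ∷ us) v ≡ false → below us v ≡ false
        below-tail v e = go (suc (lev u) <ᵇ lev v) e
          where
          go : ∀ a {b} → a ∨ b ≡ false → b ≡ false
          go false q = q
        touch : ∀ v → (if t v then ∑ (allFin n) (λ c → stage us v (upd f u c)) else stage (u ∷ us) v f) ≤ stage (u ∷ us) v f
        touch v with odd v
        ... | false = ≤-refl
        ... | true with adj v u in a
        ...   | false = ≤-refl
        ...   | true rewrite not-below v (lev-adj a) | below-tail v (not-below v (lev-adj a)) =
                  ≤-reflexive (partial-touch u∉us v f (lev-adj a) a)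
        miss : ∀ v → t v ≡ false → ∀ c → stage us v (upd f u c) ≤ stage (u ∷ us) v f
        miss v tv c with odd v in o
        ... | false = ≤-refl
        ... | true with below us v in bl
        ...   | true rewrite Data.Bool.Properties.∨-zeroʳ (suc (lev u) <ᵇ lev v) = ≤-refl
        ...   | false with suc (lev u) <ᵇ lev v in lo
        -- Here `u` is the first summed vertex two levels below `v`. Each neighbour of `v` lies
        -- strictly above the level of `u` and is already summed, so the factor is complete and
        -- `bnd` applies.
        ...     | true  = ≤-trans (≤-reflexive (partial-all us v (upd f u c) all∈)) (bnd≥ v _ o)
          where
          all∈ : ∀ y → adj v y ≡ true → y ∈ us
          all∈ y a with mem us y in me
          ... | true = let (z , z∈ , p) = any-true⁻ _ us me in hlp z z∈ p
            where
            hlp : ∀ z → z ∈ us → does (z ≟ y) ≡ true → y ∈ us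
            hlp z z∈ p with z ≟ y
            ... | yes refl = z∈
          ... | false = ⊥-elim (<⇒≱ (<ᵇ-true lo) (≤-trans (lev-adj a) (s≤s
                  (top y u (not-true (trans (sym (adj-odd a)) o)) y∉ (here refl)))))
            where
            y∉ : y ∉ u ∷ us
            y∉ (here refl) = true≢false a tv
            y∉ (there m)   = true≢false (mem-∈ us m) me
        ...     | false = ≤-reflexive (partial-miss u∉us v f c (≮⇒≥ (λ p → true≢false (<⇒<ᵇ≡ p) lo)) tv)

      finner : ∀ us → Unique us → AllPairs (λ a b → lev a ≤ lev b) us →
               (∀ u → u ∈ us → odd u ≡ false) → (∀ u → odd u ≡ false → u ∈ us) →
               ∀ f → C₀ * S us F f ^ δ ≤ ∏ vs (λ v → if odd v then bnd v else 1)
      finner us un so ev full f =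
        ≤-trans (finner-stage us un so ev (λ y u oy y∉ _ → ⊥-elim (y∉ (full y oy))) f) (∏-mono vs pt)
        where
        pt : ∀ v → stage us v f ≤ (if odd v then bnd v else 1)
        pt v with odd v in o
        ... | false = ≤-refl
        ... | true with below us v
        ...   | true  = ≤-refl
        ...   | false = ≤-trans (≤-reflexive (partial-all us v f (λ y a → full y (not-true (trans (sym (adj-odd a)) o))))) (bnd≥ v f o)


-- Palettes, rewards and the constants

maximum : List X → (X → ℕ) → ℕ
maximum []       f = 0
maximum (x ∷ xs) f = f x ⊔ maximum xs f

≤-maximum : ∀ {xs : List X} {x} f → x ∈ xs → f x ≤ maximum xs f
≤-maximum {xs = y ∷ xs} f (here refl) = m≤m⊔n (f y) (maximum xs f)
≤-maximum {xs = y ∷ xs} f (there m)   = ≤-trans (≤-maximum f m) (m≤n⊔m (f y) (maximum xs f))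

maximum-attained : ∀ (x : X) xs f → ∃[ y ] maximum (x ∷ xs) f ≡ f y
maximum-attained x []       f = x , ⊔-identityʳ (f x)
maximum-attained x (y ∷ xs) f with maximum-attained y xs f | ⊔-sel (f x) (maximum (y ∷ xs) f)
... | _ , _ | inj₁ e = x , e
... | z , p | inj₂ e = z , trans e p

⇒-false : ∀ {a b} → not a ∨ b ≡ false → a ≡ true × b ≡ false
⇒-false {true} p = refl , p

module Colours (n : ℕ) (H : Adj n) (wgt : Fin n → ℕ) (1≤wgt : ∀ c → 1 ≤ wgt c) (κ : ℕ) where

  subsets : List (Subset n)
  subsets = Enum.elts (SubsetEnum n)

  _≟ˢ_ : DecidableEquality (Subset n)
  _≟ˢ_ = Enum._≟_ (SubsetEnum n)

  sel : (Fin n → Bool) → (Fin n → ℕ) → ℕ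
  sel b g = ∑ (allFin n) (λ c → if b c then g c else 0)

  σ : Subset n → ℕ
  σ a = sel (lookup a) wgt

  comm : Subset n → Subset n
  comm a = tabulate (λ b → all (λ i → not (lookup a i) ∨ H i b) (allFin n))

  comm-adj : ∀ a {i b} → lookup a i ≡ true → lookup (comm a) b ≡ true → H i b ≡ true
  comm-adj a {i} {b} ai cb with all-true⁻ _ (trans (sym (Vec.lookup∘tabulate _ b)) cb) (∈-allFin i)
  ... | e rewrite ai = e

  comm-complete : ∀ a b → (∀ i → lookup a i ≡ true → H i b ≡ true) → lookup (comm a) b ≡ true
  comm-complete a b h = trans (Vec.lookup∘tabulate _ b) (all-true⁺ _ (allFin n) pt)
    where
    pt : ∀ i → i ∈ allFin n → not (lookup a i) ∨ H i b ≡ true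
    pt i _ with lookup a i in e
    ... | true  = h i e
    ... | false = refl

  abstract
    -- Pairs `(a , comm a)` suffice for the maximum: enlarging the second set to the common
    -- neighbourhood of the first only increases the product.
    η : ℕ
    η = maximum subsets (λ a → σ a * σ (comm a))

    σσ≤η : ∀ a → σ a * σ (comm a) ≤ η
    σσ≤η a = ≤-maximum (λ a → σ a * σ (comm a)) (∈-elts (SubsetEnum n) a)

    η-attained : ∃[ a ] η ≡ σ a * σ (comm a)
    η-attained = go subsets (∈-elts (SubsetEnum n) (tabulate (λ _ → true)))
      where
      go : ∀ l {x} → x ∈ l → ∃[ a ] maximum l (λ a → σ a * σ (comm a)) ≡ σ a * σ (comm a)
      go (x ∷ l) _ = maximum-attained x l (λ a → σ a * σ (comm a))

  σ-mono : ∀ a b → (∀ c → lookup a c ≡ true → lookup b c ≡ true) → σ a ≤ σ b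
  σ-mono a b h = ∑-mono (allFin n) pt
    where
    pt : ∀ c → (if lookup a c then wgt c else 0) ≤ (if lookup b c then wgt c else 0)
    pt c with lookup a c in e
    ... | true rewrite h c e = ≤-refl
    ... | false = z≤n

  σσ≤η′ : ∀ a b → (∀ i j → lookup a i ≡ true → lookup b j ≡ true → H i j ≡ true) → σ a * σ b ≤ η
  σσ≤η′ a b h = ≤-trans (*-monoʳ-≤ (σ a) (σ-mono b (comm a) (λ c bc → comm-complete a c (λ i ai → h i c ai bc)))) (σσ≤η a)

  optimal : Subset n → Bool
  optimal a = σ a * σ (comm a) ≡ᵇ η

  optimal⇒ : ∀ {a} → optimal a ≡ true → σ a * σ (comm a) ≡ η
  optimal⇒ {a} o = ≡ᵇ-true {σ a * σ (comm a)} {η} o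

  ⇒optimal : ∀ {a} → σ a * σ (comm a) ≡ η → optimal a ≡ true
  ⇒optimal {a} e = ≡⇒≡ᵇ≡ {σ a * σ (comm a)} {η} e

  abstract
    L : ℕ
    L = ∑ (allFin n) wgt

    ∑wgt≤L : ∑ (allFin n) wgt ≤ L
    ∑wgt≤L = ≤-refl

  -- One more than the total weight, so that `L / Λ` bounds the conditional probability of avoiding
  -- one given available colour.
  Λ : ℕ
  Λ = suc L

  σ≤Λ : ∀ a → σ a ≤ Λ
  σ≤Λ a = ≤-trans (∑-mono (allFin n) pt) (≤-trans ∑wgt≤L (n≤1+n L))
    where
    pt : ∀ c → (if lookup a c then wgt c else 0) ≤ wgt c
    pt c with lookup a c
    ... | true  = ≤-refl
    ... | false = z≤n

  -- P, K and R are large compared with κ Λ + η, with Λ P and with K + η P; they stay abstract to keep terms small.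
  abstract
    P K′ q e R′ : ℕ
    P  = 4 * Λ * κ + η
    K′ = 6 * Λ * suc P
    q  = 3 * Λ + 6 * Λ * P + 1
    e  = 2 * Λ + 6 * Λ * P + 1 + η * P
    R′ = K′ + η * P

    P≡ : P ≡ 4 * Λ * κ + η
    P≡ = refl

    K′≡ : K′ ≡ 6 * Λ * suc P
    K′≡ = refl

    q≡ : q ≡ 3 * Λ + 6 * Λ * P + 1
    q≡ = refl

    R′≡ : R′ ≡ K′ + η * P
    R′≡ = refl

    R≡ : suc R′ ≡ 4 * Λ + e
    R≡ = lem Λ P η
      where
      lem : ∀ l p h → suc (6 * l * suc p + h * p) ≡ 4 * l + (2 * l + 6 * l * p + 1 + h * p)
      lem = solve-∀

    K≡q : suc K′ ≡ q + 3 * Λ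
    K≡q = lem Λ P
      where
      lem : ∀ l p → suc (6 * l * suc p) ≡ 3 * l + 6 * l * p + 1 + 3 * l
      lem = solve-∀

    4Λ≤K : 4 * Λ ≤ suc K′
    4Λ≤K = ≤-trans (m≤m+n (4 * Λ) (2 * Λ + 6 * Λ * P + 1)) (≤-reflexive (lem Λ P))
      where
      lem : ∀ l p → 4 * l + (2 * l + 6 * l * p + 1) ≡ suc (6 * l * suc p)
      lem = solve-∀

  K R : ℕ
  K = suc K′
  R = suc R′

  sub : Subset n → Subset n → Bool
  sub a b = all (λ c → not (lookup a c) ∨ lookup b c) (allFin n)

  -- The reward (relative to K) for the set a following the set b predicted from below, y being the
  -- colour of the vertex in between.  Rewards and penalties balance on average over y ∈ a.
  τ : Subset n → Subset n → Fin n → ℕ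
  τ a b y = if does (a ≟ˢ b) then K else (if sub a b then K′ else (if lookup b y then 2 + K else q))

  k : Subset n → Subset n → ℕ
  k a b = if does (a ≟ˢ b) then K else K′

  K′≤K : K′ ≤ K
  K′≤K = n≤1+n K′

  q≤K : q ≤ K
  q≤K = ≤-trans (m≤m+n q (3 * Λ)) (≤-reflexive (sym K≡q))

  τ≤ : ∀ a b y → τ a b y ≤ 2 + K
  τ≤ a b y with does (a ≟ˢ b)
  ... | true = m≤n+m K 2
  ... | false with sub a b
  ...   | true = ≤-trans K′≤K (m≤n+m K 2)
  ...   | false with lookup b y
  ...     | true  = ≤-refl
  ...     | false = ≤-trans q≤K (m≤n+m K 2)

  sel-drop : ∀ (a : Subset n) (b : Fin n → Bool) (g : Fin n → ℕ) B z m → lookup a z ≡ true →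
             (∀ c → b c ≡ true → lookup a c ≡ true) →
             (∀ c → g c ≤ wgt c * B) → (if b z then g z else 0) + m ≤ wgt z * B →
             sel b g + m ≤ σ a * B
  sel-drop a b g B z m az b⊆a g≤ gz = begin
    sel b g + m
      ≡⟨ cong (sel b g +_) (sym (∑-δ (FinEnum n) (λ _ → m) z)) ⟩
    sel b g + ∑ (allFin n) (λ c → ⟦ does (c Fin.≟ z) ⟧ * m)
      ≡⟨ sym (∑-+ (allFin n) _ _) ⟩
    ∑ (allFin n) (λ c → (if b c then g c else 0) + ⟦ does (c Fin.≟ z) ⟧ * m)
      ≤⟨ ∑-mono (allFin n) pt ⟩
    ∑ (allFin n) (λ c → (if lookup a c then wgt c else 0) * B)
      ≡⟨ ∑-*ʳ (allFin n) B _ ⟩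
    σ a * B ∎
    where
    open ≤-Reasoning
    pt : ∀ c → (if b c then g c else 0) + ⟦ does (c Fin.≟ z) ⟧ * m ≤ (if lookup a c then wgt c else 0) * B
    pt c with c Fin.≟ z
    ... | yes refl rewrite az | +-identityʳ m = gz
    ... | no _ with b c in bc
    ...   | false = z≤n
    ...   | true rewrite b⊆a c bc | +-identityʳ (g c) = g≤ c

  -- In the last case some `z` of `a` is outside `b`. The drop of `3 Λ + 2` at this one colour
  -- outweighs the gain of 3 over `K′` per unit of weight, since `σ a ≤ Λ`.
  ∑τ≤ : ∀ a b → sel (lookup a) (λ c → wgt c * τ a b c) ≤ σ a * k a b
  ∑τ≤ a b with does (a ≟ˢ b)
  ... | true  = ≤-reflexive (trans (∑-cong (allFin n) pt) (∑-*ʳ (allFin n) K _))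
    where
    pt : ∀ c → (if lookup a c then wgt c * K else 0) ≡ (if lookup a c then wgt c else 0) * K
    pt c with lookup a c
    ... | true  = refl
    ... | false = refl
  ... | false with sub a b in s
  ...   | true  = ≤-reflexive (trans (∑-cong (allFin n) pt) (∑-*ʳ (allFin n) K′ _))
    where
    pt : ∀ c → (if lookup a c then wgt c * K′ else 0) ≡ (if lookup a c then wgt c else 0) * K′
    pt c with lookup a c
    ... | true  = refl
    ... | false = refl
  ...   | false with all-false⁻ _ (allFin n) s
  ...     | z , _ , p = +-cancelʳ-≤ (3 * Λ + 2) _ _ (≤-trans
      (sel-drop a (lookup a) _ (2 + K) z (3 * Λ + 2) az (λ _ h → h) (λ c → *-monoʳ-≤ (wgt c) (t≤ c)) atz) fin)
    where
    az : lookup a z ≡ true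
    az = proj₁ (⇒-false p)
    bz : lookup b z ≡ false
    bz = proj₂ (⇒-false p)
    t≤ : ∀ c → (if lookup b c then 2 + K else q) ≤ 2 + K
    t≤ c with lookup b c
    ... | true  = ≤-refl
    ... | false = ≤-trans q≤K (m≤n+m K 2)
    atz : (if lookup a z then wgt z * (if lookup b z then 2 + K else q) else 0) + (3 * Λ + 2) ≤ wgt z * (2 + K)
    atz rewrite az | bz = begin
      wgt z * q + (3 * Λ + 2)               ≤⟨ +-monoʳ-≤ (wgt z * q) (m≤m*n (3 * Λ + 2) (wgt z) {{>-nonZero (1≤wgt z)}}) ⟩
      wgt z * q + (3 * Λ + 2) * wgt z       ≡⟨ lem (wgt z) q Λ ⟩
      wgt z * (2 + (q + 3 * Λ))             ≡⟨ cong (λ t → wgt z * (2 + t)) (sym K≡q) ⟩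
      wgt z * (2 + K) ∎
      where
      open ≤-Reasoning
      lem : ∀ w q l → w * q + (3 * l + 2) * w ≡ w * (2 + (q + 3 * l))
      lem = solve-∀
    fin : σ a * (2 + K) ≤ σ a * K′ + (3 * Λ + 2)
    fin = begin
      σ a * (3 + K′)            ≡⟨ lem (σ a) K′ ⟩
      σ a * K′ + 3 * σ a        ≤⟨ +-monoʳ-≤ (σ a * K′) (≤-trans (*-monoʳ-≤ 3 (σ≤Λ a)) (m≤m+n (3 * Λ) 2)) ⟩
      σ a * K′ + (3 * Λ + 2) ∎
      where
      open ≤-Reasoning
      lem : ∀ s k → s * (3 + k) ≡ s * k + 3 * s
      lem = solve-∀

  -- Leaving out `z` loses a share of at least `1 / Λ`. As `K ≥ 4 Λ`, half of it pays for rewards of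
  -- `K + 2` instead of `K`, and the factor `(2 Λ - 1) / (2 Λ)` remains.
  ∑τ-drop≤ : ∀ a b z → lookup a z ≡ true →
             2 * Λ * sel (λ c → lookup a c ∧ not (eqFin c z)) (λ c → wgt c * τ a b c) ≤ suc (2 * L) * σ a * K
  ∑τ-drop≤ a b z az = +-cancelʳ-≤ (2 * Λ * (2 + K)) _ _ (begin
    2 * Λ * s + 2 * Λ * (2 + K)            ≡⟨ sym (*-distribˡ-+ (2 * Λ) s (2 + K)) ⟩
    2 * Λ * (s + (2 + K))                  ≤⟨ *-monoʳ-≤ (2 * Λ) d ⟩
    2 * Λ * (σ a * (2 + K))                ≡⟨ l₁ L (σ a) K ⟩
    suc (2 * L) * σ a * K + (4 * Λ * σ a + σ a * K)
      ≤⟨ +-monoʳ-≤ (suc (2 * L) * σ a * K) (+-mono-≤ (*-mono-≤ 4Λ≤K (σ≤Λ a)) (*-monoˡ-≤ K (σ≤Λ a))) ⟩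
    suc (2 * L) * σ a * K + (K * Λ + Λ * K)
      ≤⟨ +-monoʳ-≤ (suc (2 * L) * σ a * K) (≤-trans (m≤m+n _ (4 * Λ)) (≤-reflexive (l₂ K Λ))) ⟩
    suc (2 * L) * σ a * K + 2 * Λ * (2 + K) ∎)
    where
    open ≤-Reasoning
    s = sel (λ c → lookup a c ∧ not (eqFin c z)) (λ c → wgt c * τ a b c)
    zz : lookup a z ∧ not (eqFin z z) ≡ false
    zz rewrite az | ≡⇒≡ᵇ≡ {toℕ z} refl = refl
    d : s + (2 + K) ≤ σ a * (2 + K)
    d = sel-drop a _ _ (2 + K) z (2 + K) az (λ c h → proj₁ (∧-true h)) (λ c → *-monoʳ-≤ (wgt c) (τ≤ a b c))
          (≤-trans (≤-reflexive (cong (_+ (2 + K)) (if-false zz))) (≤-trans (≤-reflexive (sym (+-identityʳ (2 + K)))) (*-monoˡ-≤ (2 + K) (1≤wgt z))))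
    l₁ : ∀ l s k → 2 * suc l * (s * (2 + k)) ≡ suc (2 * l) * s * k + (4 * suc l * s + s * k)
    l₁ = solve-∀
    l₂ : ∀ k l → k * l + l * k + 4 * l ≡ 2 * l * (2 + k)
    l₂ = solve-∀

module Core (Sys : System) (κ : ℕ) where
  open System Sys
  open Colours n H wgt 1≤wgt κ public

  -- With `adj` for `r` this is the full palette of `v`, with the lower relation the part seen from
  -- below.
  pal : (V → V → Bool) → Col → V → Subset n
  pal r f v = tabulate (λ c → any (λ u → r v u ∧ eqFin (f u) c) vs)

  pal-∈ : ∀ r f {v u} → r v u ≡ true → lookup (pal r f v) (f u) ≡ true
  pal-∈ r f {v} {u} ru = trans (Vec.lookup∘tabulate _ (f u)) (any-true⁺ _ (∈-elts E u) pf)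
    where
    pf : r v u ∧ eqFin (f u) (f u) ≡ true
    pf rewrite ru = ≡⇒≡ᵇ≡ {toℕ (f u)} refl

  pal-∋ : ∀ r f v c → lookup (pal r f v) c ≡ true → ∃[ u ] (r v u ≡ true × f u ≡ c)
  pal-∋ r f v c p with any-true⁻ _ vs (trans (sym (Vec.lookup∘tabulate _ c)) p)
  ... | u , _ , h with ∧-true h
  ...   | ru , eq = u , ru , Fin.toℕ-injective (≡ᵇ-true eq)

  pal-cong : ∀ r f g v → (∀ u → r v u ≡ true → f u ≡ g u) → pal r f v ≡ pal r g v
  pal-cong r f g v h = Vec.tabulate-cong (λ c → any-cong vs (pt c))
    where
    pt : ∀ c u → r v u ∧ eqFin (f u) c ≡ r v u ∧ eqFin (g u) c
    pt c u with r v u in ru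
    ... | false = refl
    ... | true  = cong (λ x → eqFin x c) (h u ru)

  size : (V → V → Bool) → V → ℕ
  size r v = ∑ vs (λ y → ⟦ r v y ⟧)

  ∏-adj : ∀ (r : V → V → Bool) v g (l X : V → ℕ) → (∀ y → r v y ≡ true → adj v y ≡ true) →
          (∀ y → adj v y ≡ true → X y ≤ g * (if r v y then l y else 1)) →
          ∏ vs (λ y → if adj v y then X y else 1) ≤ g ^ δ * ∏ vs (λ y → if r v y then l y else 1)
  ∏-adj r v g l X r⊆ h = ≤-trans (∏-mono vs pt) (≤-reflexive (trans (∏-* vs _ _)
      (cong (_* ∏ vs (λ y → if r v y then l y else 1)) (trans (∏-if-const vs (adj v) g) (cong (g ^_) (deg v))))))
    where
    pt : ∀ y → (if adj v y then X y else 1) ≤ (if adj v y then g else 1) * (if r v y then l y else 1)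
    pt y with adj v y in a
    ... | true  = h y a
    ... | false with r v y in ry
    ...   | false = ≤-refl
    ...   | true  = ⊥-elim (true≢false (r⊆ y ry) a)

  -- The worst case is that all predictions coincide. In the step, `β` contributes only for
  -- `a = b y`, where the remaining product is at most `(α + β) ^ J`.
  ∑∏-predicted : ∀ (r : V → Bool) (b : V → Subset n) α β (ys : List V) →
    ∑ subsets (λ a → ∏ ys (λ y → if r y then (if does (a ≟ˢ b y) then α + β else α) else 1))
    ≤ (α + β) ^ ∑ ys (λ y → ⟦ r y ⟧) + length subsets * α ^ ∑ ys (λ y → ⟦ r y ⟧)
  ∑∏-predicted r b α β [] = ≤-trans (≤-reflexive (∑-const subsets 1)) (m≤n+m _ 1)
  ∑∏-predicted r b α β (y ∷ ys) with r y
  ... | false = ≤-trans (≤-reflexive (∑-cong subsets (λ a → +-identityʳ _))) (∑∏-predicted r b α β ys)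
  ... | true  = begin
    ∑ subsets (λ a → (if does (a ≟ˢ b y) then α + β else α) * g a)
      ≡⟨ ∑-cong subsets pt ⟩
    ∑ subsets (λ a → α * g a + β * (⟦ does (a ≟ˢ b y) ⟧ * g a))
      ≡⟨ trans (∑-+ subsets _ _) (cong₂ _+_ (∑-*ˡ subsets α g) (trans (∑-*ˡ subsets β _) (cong (β *_) (∑-δ (SubsetEnum n) g (b y))))) ⟩
    α * ∑ subsets g + β * g (b y)
      ≤⟨ +-mono-≤ (*-monoʳ-≤ α (∑∏-predicted r b α β ys)) (*-monoʳ-≤ β g≤) ⟩
    α * ((α + β) ^ J + M * α ^ J) + β * (α + β) ^ J
      ≡⟨ lem α β ((α + β) ^ J) M (α ^ J) ⟩
    (α + β) * (α + β) ^ J + M * (α * α ^ J) ∎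
    where
    open ≤-Reasoning
    J = ∑ ys (λ y → ⟦ r y ⟧)
    M = length subsets
    g : Subset n → ℕ
    g a = ∏ ys (λ y → if r y then (if does (a ≟ˢ b y) then α + β else α) else 1)
    pt : ∀ a → (if does (a ≟ˢ b y) then α + β else α) * g a ≡ α * g a + β * (⟦ does (a ≟ˢ b y) ⟧ * g a)
    pt a with does (a ≟ˢ b y)
    ... | true  = lem′ α β (g a)
      where
      lem′ : ∀ α β g → (α + β) * g ≡ α * g + β * (1 * g)
      lem′ = solve-∀
    ... | false = lem′ α β (g a)
      where
      lem′ : ∀ α β g → α * g ≡ α * g + β * 0
      lem′ = solve-∀
    g≤ : g (b y) ≤ (α + β) ^ J
    g≤ = ≤-trans (∏-mono ys p) (≤-reflexive (∏-if-const ys r (α + β)))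
      where
      p : ∀ z → (if r z then (if does (b y ≟ˢ b z) then α + β else α) else 1) ≤ (if r z then α + β else 1)
      p z with r z
      ... | false = ≤-refl
      ... | true with does (b y ≟ˢ b z)
      ...   | true  = ≤-refl
      ...   | false = m≤m+n α β
    lem : ∀ α β x M y → α * (x + M * y) + β * x ≡ (α + β) * x + M * (α * y)
    lem = solve-∀


-- The tilted factor of an odd vertex and its bound

record Ordering (Sys : System) : Set where
  open System Sys
  field
    lev     : V → ℕ
    lev-adj : ∀ {v u} → adj v u ≡ true → lev v ≤ suc (lev u)
    -- The neighbour on the same level. For an even `y` just below `v`, the odd vertex `π y` stands
    -- beside `y`, and its lower palette is decided two levels below `v`.
    π       : V → V
    lev-π   : ∀ u → lev (π u) ≡ lev u
    adj-π   : ∀ u → adj u (π u) ≡ true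

module Run (Sys : System) (κ-1 : ℕ) (O : Ordering Sys) where
  open System Sys
  open Core Sys (suc κ-1)
  open Ordering O

  κ : ℕ
  κ = suc κ-1

  low : V → V → Bool
  low = lower lev

  low⇒adj : ∀ {v y} → low v y ≡ true → adj v y ≡ true
  low⇒adj h = proj₁ (∧-true h)

  low-lev : ∀ {v y} → low v y ≡ true → suc (lev y) ≡ lev v
  low-lev h = ≡ᵇ-true (proj₂ (∧-true h))

  -- The colours on the lower neighbours alone: the prediction of the palette at `v`.
  hd : V → Col → Subset n
  hd v f = pal low f v

  -- The possible explanations of the factor at `v`, over which a union bound is taken:
  -- `(a , nothing)` for the palette `a`, and `(a , just z)` for the palette `a` whose colour `z` is
  -- absent from the lower neighbours, so that the prediction fails.
  Kind : Set
  Kind = Subset n × Maybe (Fin n)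

  kinds : List Kind
  kinds = concatMap (λ a → (a , nothing) ∷ map (λ z → (a , just z)) (allFin n)) subsets

  ∑-kinds : ∀ (g : Kind → ℕ) → ∑ kinds g ≡ ∑ subsets (λ a → g (a , nothing) + ∑ (allFin n) (λ z → g (a , just z)))
  ∑-kinds g = trans (∑-concatMap _ subsets g)
    (∑-cong subsets (λ a → cong (g (a , nothing) +_) (∑-map (λ z → (a , just z)) (allFin n) g)))

  allow : Kind → V → V → Fin n → Bool
  allow (a , nothing) v y c = lookup a c
  allow (a , just z)  v y c = lookup a z ∧ (lookup a c ∧ not (low v y ∧ eqFin c z))

  pf : Kind → ℕ
  pf (a , nothing) = if optimal a then P else suc P
  pf (a , just _)  = suc P

  -- The factor `R` occurs in the normalisation as well and cancels against it; it lets every loss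
  -- be measured by the integer ratio of `R′` to `R`.
  rw : Subset n → V → V → Col → Fin n → ℕ
  rw a v y f c = if low v y then R * τ a (hd (π y) f) c else 1

  φ : Kind → V → V → Col → Fin n → ℕ
  φ t v y f c = if allow t v y c then wgt c * σ (comm (proj₁ t)) * pf t * rw (proj₁ t) v y f c else 0

  -- The prediction at `π y` reads colours one level below `y`, hence two below `v`.
  rw-past : ∀ a v y f u c z → lev v ≤ suc (lev u) → rw a v y (upd f u c) z ≡ rw a v y f z
  rw-past a v y f u c z l with low v y in ly
  ... | false = refl
  ... | true  = cong (λ b → R * τ a b z) (pal-cong low (upd f u c) f (π y) (λ w lw → upd-other f u c (ne w lw)))
    where
    ne : ∀ w → low (π y) w ≡ true → w ≢ u
    ne w lw refl = <⇒≱ (≤-reflexive (cong suc (trans (low-lev lw) (lev-π y)))) (≤-trans (≤-reflexive (low-lev ly)) l)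

  φ-past : ∀ t v y f u c z → lev v ≤ suc (lev u) → φ t v y (upd f u c) z ≡ φ t v y f z
  φ-past t v y f u c z l = cong (λ x → if allow t v y z then wgt z * σ (comm (proj₁ t)) * pf t * x else 0)
                                (rw-past (proj₁ t) v y f u c z l)

  J : V → ℕ
  J = size low

  C : ℕ
  C = length subsets * (n + 2)

  -- With at least `δ / κ` lower neighbours, everything except the ideal palette is damped by
  -- `(R′ / R) ^ J v`. Otherwise a crude bound is used; such vertices will be rare.
  bnd : V → ℕ
  bnd v = if δ ≤ᵇ κ * J v then (η * P) ^ δ * K ^ J v * (R ^ J v + C * R′ ^ J v)
                          else (η * suc P) ^ δ * (K * R) ^ J v * C

  sel-cong : ∀ {b b′ : Fin n → Bool} {g g′ : Fin n → ℕ} → (∀ c → b c ≡ b′ c) → (∀ c → g c ≡ g′ c) → sel b g ≡ sel b′ g′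
  sel-cong eb eg = ∑-cong (allFin n) (λ c → cong₂ (λ x y → if x then y else 0) (eb c) (eg c))

  sel-* : ∀ (b : Fin n → Bool) m (g : Fin n → ℕ) → sel b (λ c → m * g c) ≡ m * sel b g
  sel-* b m g = trans (∑-cong (allFin n) pt) (∑-*ˡ (allFin n) m _)
    where
    pt : ∀ c → (if b c then m * g c else 0) ≡ m * (if b c then g c else 0)
    pt c with b c
    ... | true  = refl
    ... | false = sym (*-zeroʳ m)

  sel-mono : ∀ {b b′ : Fin n → Bool} (g : Fin n → ℕ) → (∀ c → b c ≡ true → b′ c ≡ true) → sel b g ≤ sel b′ g
  sel-mono {b} {b′} g h = ∑-mono (allFin n) pt
    where
    pt : ∀ c → (if b c then g c else 0) ≤ (if b′ c then g c else 0)
    pt c with b c in e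
    ... | false = z≤n
    ... | true rewrite h c e = ≤-refl

  ∑φ : ∀ t v y f → ∑ (allFin n) (φ t v y f) ≡
       σ (comm (proj₁ t)) * pf t * (if low v y then R * sel (allow t v y) (λ c → wgt c * τ (proj₁ t) (hd (π y) f) c) else sel (allow t v y) wgt)
  ∑φ t v y f with low v y
  ... | true  = trans (sel-cong {g = λ c → wgt c * S₁ * pf t * (R * τ (proj₁ t) (hd (π y) f) c)} (λ _ → refl)
                   (λ c → l₁ (wgt c) S₁ (pf t) R (τ (proj₁ t) (hd (π y) f) c)))
                  (trans (sel-* _ (S₁ * pf t * R) _) (*-assoc (S₁ * pf t) R _))
    where
    S₁ = σ (comm (proj₁ t))
    l₁ : ∀ w s p r x → w * s * p * (r * x) ≡ s * p * r * (w * x)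
    l₁ = solve-∀
  ... | false = trans (sel-cong {g = λ c → wgt c * S₁ * pf t * 1} (λ _ → refl) (λ c → l₁ (wgt c) S₁ (pf t)))
                  (sel-* _ (S₁ * pf t) wgt)
    where
    S₁ = σ (comm (proj₁ t))
    l₁ : ∀ w s p → w * s * p * 1 ≡ s * p * w
    l₁ = solve-∀

  k≤K : ∀ a b → k a b ≤ K
  k≤K a b with does (a ≟ˢ b)
  ... | true  = ≤-refl
  ... | false = K′≤K

  allow⊆ : ∀ t v y c → allow t v y c ≡ true → lookup (proj₁ t) c ≡ true
  allow⊆ (a , nothing) v y c h = h
  allow⊆ (a , just z)  v y c h = proj₁ (∧-true (proj₂ (∧-true {lookup a z} h)))

  pf≤ : ∀ t → pf t ≤ suc P
  pf≤ (a , nothing) with optimal a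
  ... | true  = n≤1+n P
  ... | false = ≤-refl
  pf≤ (a , just _) = ≤-refl

  sτ≤ : ∀ t v y b → sel (allow t v y) (λ c → wgt c * τ (proj₁ t) b c) ≤ σ (proj₁ t) * K
  sτ≤ t v y b = ≤-trans (sel-mono _ (allow⊆ t v y)) (≤-trans (∑τ≤ (proj₁ t) b) (*-monoʳ-≤ (σ (proj₁ t)) (k≤K (proj₁ t) b)))

  coarse : ∀ t v y f → ∑ (allFin n) (φ t v y f) ≤ η * suc P * (if low v y then K * R else 1)
  coarse t@(a , _) v y f = ≤-trans (≤-reflexive (∑φ t v y f)) go
    where
    open ≤-Reasoning
    l₁ : ∀ c p r s k → c * p * (r * (s * k)) ≡ s * c * p * (k * r)
    l₁ = solve-∀
    l₂ : ∀ c p s → c * p * s ≡ s * c * p * 1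
    l₂ = solve-∀
    go : σ (comm a) * pf t * (if low v y then R * sel (allow t v y) (λ c → wgt c * τ a (hd (π y) f) c) else sel (allow t v y) wgt)
         ≤ η * suc P * (if low v y then K * R else 1)
    go with low v y in ly
    ... | true  = begin
      σ (comm a) * pf t * (R * sel (allow t v y) (λ c → wgt c * τ a (hd (π y) f) c))
        ≤⟨ *-monoʳ-≤ (σ (comm a) * pf t) (*-monoʳ-≤ R (sτ≤ t v y (hd (π y) f))) ⟩
      σ (comm a) * pf t * (R * (σ a * K))
        ≡⟨ l₁ (σ (comm a)) (pf t) R (σ a) K ⟩
      σ a * σ (comm a) * pf t * (K * R)
        ≤⟨ *-monoˡ-≤ (K * R) (*-mono-≤ (σσ≤η a) (pf≤ t)) ⟩
      η * suc P * (K * R) ∎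
    ... | false = begin
      σ (comm a) * pf t * sel (allow t v y) wgt
        ≤⟨ *-monoʳ-≤ (σ (comm a) * pf t) (sel-mono wgt (allow⊆ t v y)) ⟩
      σ (comm a) * pf t * σ a
        ≡⟨ l₂ (σ (comm a)) (pf t) (σ a) ⟩
      σ a * σ (comm a) * pf t * 1
        ≤⟨ *-monoˡ-≤ 1 (*-mono-≤ (σσ≤η a) (pf≤ t)) ⟩
      η * suc P * 1 ∎

  fine-optimal : ∀ a v y f → optimal a ≡ true →
                 ∑ (allFin n) (φ (a , nothing) v y f) ≤ η * P * (if low v y then R * k a (hd (π y) f) else 1)
  fine-optimal a v y f o = ≤-trans (≤-reflexive (∑φ (a , nothing) v y f)) go
    where
    open ≤-Reasoning
    l₁ : ∀ c p r s k → c * p * (r * (s * k)) ≡ s * c * p * (r * k)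
    l₁ = solve-∀
    l₂ : ∀ c p s → c * p * s ≡ s * c * p * 1
    l₂ = solve-∀
    go : σ (comm a) * pf (a , nothing) * (if low v y then R * sel (lookup a) (λ c → wgt c * τ a (hd (π y) f) c) else sel (lookup a) wgt)
         ≤ η * P * (if low v y then R * k a (hd (π y) f) else 1)
    go rewrite if-true {x = P} {y = suc P} o with low v y
    ... | true  = begin
      σ (comm a) * P * (R * sel (lookup a) (λ c → wgt c * τ a (hd (π y) f) c))
        ≤⟨ *-monoʳ-≤ (σ (comm a) * P) (*-monoʳ-≤ R (∑τ≤ a (hd (π y) f))) ⟩
      σ (comm a) * P * (R * (σ a * k a (hd (π y) f)))
        ≡⟨ l₁ (σ (comm a)) P R (σ a) (k a (hd (π y) f)) ⟩
      σ a * σ (comm a) * P * (R * k a (hd (π y) f))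
        ≡⟨ cong (λ x → x * P * (R * k a (hd (π y) f))) (optimal⇒ {a} o) ⟩
      η * P * (R * k a (hd (π y) f)) ∎
    ... | false = ≤-reflexive (trans (l₂ (σ (comm a)) P (σ a)) (cong (λ x → x * P * 1) (optimal⇒ {a} o)))

  -- By integrality a palette that is not optimal has product at most `η - 1`, and `P ≥ η` makes
  -- this deficit larger than the reward `(P + 1) / P`.
  nonoptimal-gap : ∀ a → optimal a ≡ false → suc (σ a * σ (comm a) * suc P) ≤ η * P
  nonoptimal-gap a o = ≤-trans (s≤s (*-monoˡ-≤ (suc P) (≤-pred s<η))) (go η s<η refl)
    where
    s<η : σ a * σ (comm a) < suc (η ∸ 1)
    s<η = ≤-trans (≤∧≢⇒< (σσ≤η a) (λ e → true≢false (⇒optimal {a} e) o)) (m≤n+m∸n η 1)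
    go : ∀ h → σ a * σ (comm a) < suc (η ∸ 1) → h ≡ η → suc ((η ∸ 1) * suc P) ≤ η * P
    go zero    _ e = ⊥-elim (<⇒≱ (≤∧≢⇒< (σσ≤η a) (λ e → true≢false (⇒optimal {a} e) o)) (≤-trans (≤-reflexive (sym e)) z≤n))
    go (suc h) _ e = subst (λ t → suc ((t ∸ 1) * suc P) ≤ t * P) e
      (≤-trans (≤-reflexive (l₁ h P)) (+-monoˡ-≤ (h * P) (≤-trans (≤-reflexive e) (≤-trans (m≤n+m η (4 * Λ * κ)) (≤-reflexive (sym P≡))))))
      where
      l₁ : ∀ h p → suc (h * suc p) ≡ suc h + h * p
      l₁ = solve-∀

  fine-nonoptimal : ∀ a v y f → optimal a ≡ false →
                    ∑ (allFin n) (φ (a , nothing) v y f) ≤ η * P * (if low v y then K * R′ else 1)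
  fine-nonoptimal a v y f o = ≤-trans (≤-reflexive (∑φ (a , nothing) v y f)) go
    where
    open ≤-Reasoning
    g = σ a * σ (comm a) * suc P
    l₁ : ∀ c p r s k → c * p * (r * (s * k)) ≡ s * c * p * r * k
    l₁ = solve-∀
    l₂ : ∀ c p s → c * p * s ≡ s * c * p
    l₂ = solve-∀
    l₃ : ∀ g p k r → g * p * r * k ≡ g * p * (k * r)
    l₃ = solve-∀
    -- From `g + 1 ≤ η P ≤ R′` one gets `g R = g R′ + g ≤ (g + 1) R′`.
    gR : g * R ≤ η * P * R′
    gR = ≤-trans (≤-reflexive (*-suc g R′)) (≤-trans (+-monoˡ-≤ (g * R′) (≤-trans (n≤1+n g) (≤-trans (nonoptimal-gap a o) (≤-trans (m≤n+m (η * P) K′) (≤-reflexive (sym R′≡)))))) (*-monoˡ-≤ R′ (nonoptimal-gap a o)))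
    go : σ (comm a) * pf (a , nothing) * (if low v y then R * sel (lookup a) (λ c → wgt c * τ a (hd (π y) f) c) else sel (lookup a) wgt)
         ≤ η * P * (if low v y then K * R′ else 1)
    go rewrite if-false {x = P} {y = suc P} o with low v y
    ... | true  = begin
      σ (comm a) * suc P * (R * sel (lookup a) (λ c → wgt c * τ a (hd (π y) f) c))
        ≤⟨ *-monoʳ-≤ (σ (comm a) * suc P) (*-monoʳ-≤ R (sτ≤ (a , nothing) v y (hd (π y) f))) ⟩
      σ (comm a) * suc P * (R * (σ a * K))
        ≡⟨ l₁ (σ (comm a)) (suc P) R (σ a) K ⟩
      g * R * K
        ≤⟨ *-monoˡ-≤ K gR ⟩
      η * P * R′ * K
        ≡⟨ l₃ η P K R′ ⟩
      η * P * (K * R′) ∎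
    ... | false = ≤-trans (≤-reflexive (l₂ (σ (comm a)) (suc P) (σ a))) (≤-trans (n≤1+n g) (≤-trans (nonoptimal-gap a o) (≤-reflexive (sym (*-identityʳ (η * P))))))

  -- On lower neighbours both sides carry the saved fraction `(2 L + 1) / (2 Λ)` of the missing
  -- colour, with its denominator cleared.
  fine-missing : ∀ a z v y f →
                 (if low v y then 2 * Λ * ∑ (allFin n) (φ (a , just z) v y f) else ∑ (allFin n) (φ (a , just z) v y f))
                 ≤ η * suc P * (if low v y then suc (2 * L) * (K * R) else 1)
  fine-missing a z v y f with lookup a z in az
  ... | false rewrite ∑-0 (allFin n) with low v y
  ...   | true  = ≤-trans (≤-reflexive (*-zeroʳ (2 * Λ))) z≤n
  ...   | false = z≤n
  fine-missing a z v y f | true with low v y in ly | coarse (a , just z) v y f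
  ... | false | co rewrite az = co
  ... | true  | _ = begin
    2 * Λ * ∑ (allFin n) (λ c → if b c then wgt c * S₁ * suc P * (R * τ a B c) else 0)
      ≡⟨ cong (2 * Λ *_) (trans (sel-cong {b = b} (λ _ → refl) (λ c → l₀ (wgt c) S₁ (suc P) R (τ a B c))) (sel-* b (S₁ * suc P * R) _)) ⟩
    2 * Λ * (S₁ * suc P * R * sel b (λ c → wgt c * τ a B c))
      ≡⟨ l₁ (2 * Λ) (S₁ * suc P * R) _ ⟩
    S₁ * suc P * R * (2 * Λ * sel b (λ c → wgt c * τ a B c))
      ≤⟨ *-monoʳ-≤ (S₁ * suc P * R) (∑τ-drop≤ a B z az) ⟩
    S₁ * suc P * R * (suc (2 * L) * σ a * K)
      ≡⟨ l₂ S₁ (suc P) R (suc (2 * L)) (σ a) K ⟩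
    σ a * S₁ * suc P * (suc (2 * L) * (K * R))
      ≤⟨ *-monoˡ-≤ (suc (2 * L) * (K * R)) (*-monoˡ-≤ (suc P) (σσ≤η a)) ⟩
    η * suc P * (suc (2 * L) * (K * R)) ∎
    where
    open ≤-Reasoning
    S₁ = σ (comm a)
    B = hd (π y) f
    b : Fin n → Bool
    b c = lookup a c ∧ not (eqFin c z)
    l₀ : ∀ w s p r x → w * s * p * (r * x) ≡ s * p * r * (w * x)
    l₀ = solve-∀
    l₁ : ∀ m p s → m * (p * s) ≡ p * (m * s)
    l₁ = solve-∀
    l₂ : ∀ c p r m s k → c * p * r * (m * s * k) ≡ s * c * p * (m * (k * r))
    l₂ = solve-∀


≤∑-∈ : ∀ {l : List X} {x} (g : X → ℕ) → x ∈ l → g x ≤ ∑ l g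
≤∑-∈ {l = y ∷ l} g (here refl) = m≤m+n (g y) (∑ l g)
≤∑-∈ {l = y ∷ l} g (there m)   = ≤-trans (≤∑-∈ g m) (m≤n+m (∑ l g) (g y))

∑-constF : ∀ n c → ∑ (allFin n) (λ _ → c) ≡ n * c
∑-constF n c = trans (∑-const (allFin n) c) (cong (_* c) (Data.List.Properties.length-tabulate {n = n} id))

-- 1 - (j + 1) / (p + 1) ≤ (1 - 1 / (p + 1))^(j + 1), the left side being D / (p + 1).
bernoulli-down : ∀ j p D → suc p ≡ suc j + D → suc p ^ suc j * D ≤ suc p * p ^ suc j
bernoulli-down j p D e = +-cancelʳ-≤ (j * suc p * Q) _ _ (begin
  Q * D + j * suc p * Q             ≡⟨ l₁ Q D j (suc p) ⟩
  (D + j * suc p) * Q               ≡⟨ cong (_* Q) (trans (l₂ D j p) (cong (_+ j * p) (sym (suc-injective e)))) ⟩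
  suc j * p * Q                     ≡⟨ l₄ (suc j * p) (suc p) (suc p ^ j) ⟩
  suc p * (suc j * p * suc p ^ j)   ≤⟨ *-monoʳ-≤ (suc p) (young j p (suc p)) ⟩
  suc p * (p ^ suc j + j * Q)       ≡⟨ l₅ (suc p) (p ^ suc j) j Q ⟩
  suc p * p ^ suc j + j * suc p * Q ∎)
  where
  open ≤-Reasoning
  Q = suc p ^ suc j
  l₁ : ∀ q d j p → q * d + j * p * q ≡ (d + j * p) * q
  l₁ = solve-∀
  l₂ : ∀ d j p → d + j * suc p ≡ (j + d) + j * p
  l₂ = solve-∀
  l₄ : ∀ a p q → a * (p * q) ≡ p * (a * q)
  l₄ = solve-∀
  l₅ : ∀ p x j q → p * (x + j * q) ≡ p * x + j * p * q
  l₅ = solve-∀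

module LocalBound (Sys : System) (κ-1 : ℕ) (O : Ordering Sys) where
  open System Sys
  open Core Sys (suc κ-1)
  open Ordering O
  open Run Sys κ-1 O

  κ≤P : suc P ≡ κ + ((4 * L + 3) * κ + η + 1)
  κ≤P = trans (cong suc P≡) (lem L κ η)
    where
    lem : ∀ l k h → suc (4 * suc l * k + h) ≡ k + ((4 * l + 3) * k + h + 1)
    lem = solve-∀

  1≤P : 1 ≤ P
  1≤P = ≤-trans (s≤s z≤n) (≤-trans (≤-reflexive (sym (lem L κ-1))) (≤-trans (m≤m+n (4 * Λ * κ) η) (≤-reflexive (sym P≡))))
    where
    lem : ∀ l k → 4 * suc l * suc k ≡ 1 + (3 + 4 * l + 4 * k + 4 * l * k)
    lem = solve-∀

  -- One lower neighbour without the colour `z` pays for the rewards on `κ` neighbours: since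
  -- `P ≥ 4 Λ κ`, the factor `(1 + 1 / P) ^ κ` uses up only part of the saving `1 / (2 Λ)`, and
  -- `R′ / R` is left over.
  gain : suc P ^ κ * (suc (2 * L) * R) ≤ P ^ κ * (2 * Λ * R′)
  gain = *-cancelˡ (suc P) (s≤s z≤n) (begin
    suc P * (Q * (suc (2 * L) * R))      ≡⟨ l₁ (suc P) Q (suc (2 * L)) R ⟩
    Q * (suc (2 * L) * R * suc P)        ≤⟨ *-monoʳ-≤ Q (≤-trans (m≤m+n _ _) (≤-reflexive (sym key))) ⟩
    Q * (2 * Λ * R′ * D)                 ≡⟨ l₂ Q (2 * Λ * R′) D ⟩
    Q * D * (2 * Λ * R′)                 ≤⟨ *-monoˡ-≤ (2 * Λ * R′) (bernoulli-down κ-1 P D κ≤P) ⟩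
    suc P * P ^ κ * (2 * Λ * R′)         ≡⟨ *-assoc (suc P) (P ^ κ) _ ⟩
    suc P * (P ^ κ * (2 * Λ * R′)) ∎)
    where
    open ≤-Reasoning
    Q = suc P ^ κ
    D = (4 * L + 3) * κ + η + 1
    l₁ : ∀ p q a r → p * (q * (a * r)) ≡ q * (a * r * p)
    l₁ = solve-∀
    l₂ : ∀ q a d → q * (a * d) ≡ q * d * a
    l₂ = solve-∀
    R′≡₄ : R′ ≡ 4 * L + 3 + e
    R′≡₄ = suc-injective (trans R≡ (lem L e))
      where
      lem : ∀ l e → 4 * suc l + e ≡ suc (4 * l + 3 + e)
      lem = solve-∀
    poly : ∀ l k h e → 2 * suc l * (4 * l + 3 + e) * ((4 * l + 3) * k + h + 1)
           ≡ suc (2 * l) * (4 * suc l + e) * suc (4 * suc l * k + h)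
             + (2 * suc l * (h + 1) + e * (h + 1) + 2 * suc l * e * k + 2 * suc l * k)
    poly = solve-∀
    rest : ℕ
    rest = 2 * suc L * (η + 1) + e * (η + 1) + 2 * suc L * e * κ + 2 * suc L * κ
    key : 2 * Λ * R′ * D ≡ suc (2 * L) * R * suc P + rest
    key = trans (cong (λ x → 2 * Λ * x * D) R′≡₄) (trans (poly L κ η e) (cong₂ (λ x p → suc (2 * L) * x * suc p + rest) (sym R≡) (sym P≡)))

  term : V → Col → Kind → ℕ
  term v f t = ∏ vs (λ y → if adj v y then ∑ (allFin n) (φ t v y f) else 1)

  private
    low-pow : ∀ v x → ∏ vs (λ y → if low v y then x else 1) ≡ x ^ J v
    low-pow v x = ∏-if-const vs (low v) x

  term-coarse : ∀ v f t → term v f t ≤ (η * suc P) ^ δ * (K * R) ^ J v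
  term-coarse v f t = ≤-trans (∏-adj low v (η * suc P) (λ _ → K * R) _ (λ y → low⇒adj) (λ y _ → coarse t v y f))
                        (≤-reflexive (cong ((η * suc P) ^ δ *_) (low-pow v (K * R))))

  -- The reward `((P + 1) / P) ^ δ` is spread over the lower neighbours, at most `κ` factors for
  -- each, and `gain` is used once per lower neighbour.
  term-missing : ∀ v f a z → δ ≤ κ * J v → term v f (a , just z) ≤ (η * P) ^ δ * (K * R′) ^ J v
  term-missing v f a z δ≤ = *-cancelˡ (P ^ (κ * j)) (1≤^ (κ * j) 1≤P) (*-cancelˡ ((2 * Λ) ^ j) (1≤^ j (s≤s z≤n)) (begin
    (2 * Λ) ^ j * (P ^ (κ * j) * T₀)
      ≡⟨ l₁ ((2 * Λ) ^ j) (P ^ (κ * j)) T₀ ⟩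
    P ^ (κ * j) * ((2 * Λ) ^ j * T₀)
      ≤⟨ *-monoʳ-≤ (P ^ (κ * j)) scaled ⟩
    P ^ (κ * j) * ((η * suc P) ^ δ * (m * (K * R)) ^ j)
      ≡⟨ cong (λ x → P ^ (κ * j) * (x * (m * (K * R)) ^ j)) (*-^ η (suc P) δ) ⟩
    P ^ (κ * j) * (η ^ δ * suc P ^ δ * (m * (K * R)) ^ j)
      ≡⟨ l₂ (P ^ (κ * j)) (η ^ δ) (suc P ^ δ) _ ⟩
    η ^ δ * (suc P ^ δ * P ^ (κ * j)) * (m * (K * R)) ^ j
      ≤⟨ *-monoˡ-≤ _ (*-monoʳ-≤ (η ^ δ) expo) ⟩
    η ^ δ * (P ^ δ * suc P ^ (κ * j)) * (m * (K * R)) ^ j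
      ≡⟨ l₃ (η ^ δ) (P ^ δ) (suc P ^ (κ * j)) _ ⟩
    η ^ δ * P ^ δ * (suc P ^ (κ * j) * (m * (K * R)) ^ j)
      ≡⟨ cong₂ _*_ (sym (*-^ η P δ)) (trans (cong (_* (m * (K * R)) ^ j) (sym (^-*-assoc (suc P) κ j))) (sym (*-^ (suc P ^ κ) (m * (K * R)) j))) ⟩
    (η * P) ^ δ * (suc P ^ κ * (m * (K * R))) ^ j
      ≤⟨ *-monoʳ-≤ ((η * P) ^ δ) (^-monoˡ-≤ j base) ⟩
    (η * P) ^ δ * (P ^ κ * (2 * Λ * (K * R′))) ^ j
      ≡⟨ cong ((η * P) ^ δ *_) (trans (*-^ (P ^ κ) _ j) (cong₂ _*_ (^-*-assoc P κ j) (*-^ (2 * Λ) (K * R′) j))) ⟩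
    (η * P) ^ δ * (P ^ (κ * j) * ((2 * Λ) ^ j * (K * R′) ^ j))
      ≡⟨ l₄ ((η * P) ^ δ) (P ^ (κ * j)) ((2 * Λ) ^ j) ((K * R′) ^ j) ⟩
    (2 * Λ) ^ j * (P ^ (κ * j) * ((η * P) ^ δ * (K * R′) ^ j)) ∎))
    where
    open ≤-Reasoning
    j = J v
    T₀ = term v f (a , just z)
    m = suc (2 * L)
    l₁ : ∀ a b c → a * (b * c) ≡ b * (a * c)
    l₁ = solve-∀
    l₂ : ∀ p h s x → p * (h * s * x) ≡ h * (s * p) * x
    l₂ = solve-∀
    l₃ : ∀ h p s x → h * (p * s) * x ≡ h * p * (s * x)
    l₃ = solve-∀
    l₄ : ∀ g p l x → g * (p * (l * x)) ≡ l * (p * (g * x))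
    l₄ = solve-∀
    l₅ : ∀ a m k r → a * (m * (k * r)) ≡ k * (a * (m * r))
    l₅ = solve-∀
    base : suc P ^ κ * (m * (K * R)) ≤ P ^ κ * (2 * Λ * (K * R′))
    base = ≤-trans (≤-reflexive (l₅ (suc P ^ κ) m K R)) (≤-trans (*-monoʳ-≤ K gain) (≤-reflexive (sym (l₅ (P ^ κ) (2 * Λ) K R′))))
    expo : suc P ^ δ * P ^ (κ * j) ≤ P ^ δ * suc P ^ (κ * j)
    expo with m≤n⇒∃[o]m+o≡n δ≤
    ... | t , eq = begin
      suc P ^ δ * P ^ (κ * j)          ≡⟨ cong (λ x → suc P ^ δ * P ^ x) (sym eq) ⟩
      suc P ^ δ * P ^ (δ + t)          ≡⟨ cong (suc P ^ δ *_) (^-distribˡ-+-* P δ t) ⟩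
      suc P ^ δ * (P ^ δ * P ^ t)      ≤⟨ *-monoʳ-≤ (suc P ^ δ) (*-monoʳ-≤ (P ^ δ) (^-monoˡ-≤ t (n≤1+n P))) ⟩
      suc P ^ δ * (P ^ δ * suc P ^ t)  ≡⟨ l₁ (suc P ^ δ) (P ^ δ) (suc P ^ t) ⟩
      P ^ δ * (suc P ^ δ * suc P ^ t)  ≡⟨ cong (P ^ δ *_) (sym (^-distribˡ-+-* (suc P) δ t)) ⟩
      P ^ δ * suc P ^ (δ + t)          ≡⟨ cong (λ x → P ^ δ * suc P ^ x) eq ⟩
      P ^ δ * suc P ^ (κ * j) ∎
    scaled : (2 * Λ) ^ j * T₀ ≤ (η * suc P) ^ δ * (m * (K * R)) ^ j
    scaled = begin
      (2 * Λ) ^ j * T₀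
        ≡⟨ cong (_* T₀) (sym (low-pow v (2 * Λ))) ⟩
      ∏ vs (λ y → if low v y then 2 * Λ else 1) * T₀
        ≡⟨ sym (∏-* vs _ _) ⟩
      ∏ vs (λ y → (if low v y then 2 * Λ else 1) * (if adj v y then ∑ (allFin n) (φ (a , just z) v y f) else 1))
        ≤⟨ ∏-mono vs pt ⟩
      ∏ vs (λ y → if adj v y then (if low v y then 2 * Λ * ∑ (allFin n) (φ (a , just z) v y f) else ∑ (allFin n) (φ (a , just z) v y f)) else 1)
        ≤⟨ ∏-adj low v (η * suc P) (λ _ → m * (K * R)) _ (λ y → low⇒adj) (λ y _ → fine-missing a z v y f) ⟩
      (η * suc P) ^ δ * ∏ vs (λ y → if low v y then m * (K * R) else 1)
        ≡⟨ cong ((η * suc P) ^ δ *_) (low-pow v (m * (K * R))) ⟩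
      (η * suc P) ^ δ * (m * (K * R)) ^ j ∎
      where
      pt : ∀ y → (if low v y then 2 * Λ else 1) * (if adj v y then ∑ (allFin n) (φ (a , just z) v y f) else 1)
               ≤ (if adj v y then (if low v y then 2 * Λ * ∑ (allFin n) (φ (a , just z) v y f) else ∑ (allFin n) (φ (a , just z) v y f)) else 1)
      pt y with low v y in ly
      ... | true rewrite low⇒adj ly = ≤-refl
      ... | false = ≤-reflexive (+-identityʳ _)

  term-plain : ∀ v f a → term v f (a , nothing) ≤
               (η * P) ^ δ * (∏ vs (λ y → if low v y then R * k a (hd (π y) f) else 1) + (K * R′) ^ J v)
  term-plain v f a = go (optimal a) refl
    where
    go : ∀ b → optimal a ≡ b → term v f (a , nothing) ≤
         (η * P) ^ δ * (∏ vs (λ y → if low v y then R * k a (hd (π y) f) else 1) + (K * R′) ^ J v)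
    go true  o = ≤-trans (∏-adj low v (η * P) (λ y → R * k a (hd (π y) f)) _ (λ y → low⇒adj) (λ y _ → fine-optimal a v y f o))
                   (*-monoʳ-≤ ((η * P) ^ δ) (m≤m+n (∏ vs (λ y → if low v y then R * k a (hd (π y) f) else 1)) ((K * R′) ^ J v)))
    go false o = ≤-trans (∏-adj low v (η * P) (λ y → K * R′) _ (λ y → low⇒adj) (λ y _ → fine-nonoptimal a v y f o))
                   (*-monoʳ-≤ ((η * P) ^ δ) (≤-trans (≤-reflexive (low-pow v (K * R′))) (m≤n+m ((K * R′) ^ J v) (∏ vs (λ y → if low v y then R * k a (hd (π y) f) else 1)))))

  -- For optimal palettes `∑∏-predicted` allows the full `(K R) ^ J` only once, as for common
  -- predictions; all further terms are damped at the rate `K R′`.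
  ∑-plain : ∀ v f → ∑ subsets (λ a → term v f (a , nothing)) ≤
            (η * P) ^ δ * (K ^ J v * (R ^ J v + (length subsets * 2) * R′ ^ J v))
  ∑-plain v f = begin
    ∑ subsets (λ a → term v f (a , nothing))
      ≤⟨ ∑-mono subsets (term-plain v f) ⟩
    ∑ subsets (λ a → (η * P) ^ δ * (Q a + (K * R′) ^ j))
      ≡⟨ trans (∑-*ˡ subsets ((η * P) ^ δ) (λ a → Q a + (K * R′) ^ j)) (cong ((η * P) ^ δ *_) (trans (∑-+ subsets Q (λ _ → (K * R′) ^ j)) (cong (∑ subsets Q +_) (∑-const subsets ((K * R′) ^ j))))) ⟩
    (η * P) ^ δ * (∑ subsets Q + M * (K * R′) ^ j)
      ≤⟨ *-monoʳ-≤ ((η * P) ^ δ) (+-monoˡ-≤ (M * (K * R′) ^ j) ∑Q) ⟩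
    (η * P) ^ δ * ((K * R) ^ j + M * (K * R′) ^ j + M * (K * R′) ^ j)
      ≡⟨ cong ((η * P) ^ δ *_) (trans (cong₂ (λ x y → x + M * y + M * y) (*-^ K R j) (*-^ K R′ j)) (l₁ (K ^ j) (R ^ j) M (R′ ^ j))) ⟩
    (η * P) ^ δ * (K ^ j * (R ^ j + M * 2 * R′ ^ j)) ∎
    where
    open ≤-Reasoning
    j = J v
    M = length subsets
    Q : Subset n → ℕ
    Q a = ∏ vs (λ y → if low v y then R * k a (hd (π y) f) else 1)
    l₁ : ∀ k r m s → k * r + m * (k * s) + m * (k * s) ≡ k * (r + m * 2 * s)
    l₁ = solve-∀
    l₂ : ∀ r k → r * k + r ≡ suc k * r
    l₂ = solve-∀
    RK′≤ : R * K′ ≤ K * R′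
    RK′≤ = ≤-trans (≤-reflexive (cong (λ x → suc x * K′) R′≡)) (≤-trans (m≤m+n (suc (K′ + η * P) * K′) (η * P)) (≤-reflexive (trans (lem K′ (η * P)) (cong (suc K′ *_) (sym R′≡)))))
      where
      lem : ∀ k x → suc (k + x) * k + x ≡ suc k * (k + x)
      lem = solve-∀
    ∑Q : ∑ subsets Q ≤ (K * R) ^ j + M * (K * R′) ^ j
    ∑Q = begin
      ∑ subsets Q
        ≡⟨ ∑-cong subsets (λ a → ∏-cong vs (pt a)) ⟩
      ∑ subsets (λ a → ∏ vs (λ y → if low v y then (if does (a ≟ˢ hd (π y) f) then R * K′ + R else R * K′) else 1))
        ≤⟨ ∑∏-predicted (low v) (λ y → hd (π y) f) (R * K′) R vs ⟩
      (R * K′ + R) ^ j + M * (R * K′) ^ j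
        ≤⟨ +-mono-≤ (≤-reflexive (cong (_^ j) (l₂ R K′))) (*-monoʳ-≤ M (^-monoˡ-≤ j RK′≤)) ⟩
      (K * R) ^ j + M * (K * R′) ^ j ∎
      where
      pt : ∀ a y → (if low v y then R * k a (hd (π y) f) else 1)
                 ≡ (if low v y then (if does (a ≟ˢ hd (π y) f) then R * K′ + R else R * K′) else 1)
      pt a y with low v y
      ... | false = refl
      ... | true with does (a ≟ˢ hd (π y) f)
      ...   | true  = trans (*-suc R K′) (+-comm R (R * K′))
      ...   | false = refl

  ∑term≤bnd : ∀ v f → ∑ kinds (term v f) ≤ bnd v
  ∑term≤bnd v f with δ ≤ᵇ κ * J v in d
  ... | true  = begin
    ∑ kinds (term v f)
      ≡⟨ trans (∑-kinds (term v f)) (∑-+ subsets _ _) ⟩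
    ∑ subsets (λ a → term v f (a , nothing)) + ∑ subsets (λ a → ∑ (allFin n) (λ z → term v f (a , just z)))
      ≤⟨ +-mono-≤ (∑-plain v f) (∑-mono subsets (λ a → ∑-mono (allFin n) (λ z → term-missing v f a z (≤ᵇ⇒≤ δ (κ * j) (≡⇒T d))))) ⟩
    (η * P) ^ δ * (K ^ j * (R ^ j + (M * 2) * R′ ^ j)) + ∑ subsets (λ a → ∑ (allFin n) (λ z → (η * P) ^ δ * (K * R′) ^ j))
      ≡⟨ cong ((η * P) ^ δ * (K ^ j * (R ^ j + (M * 2) * R′ ^ j)) +_)
           (trans (∑-const subsets (∑ (allFin n) (λ z → (η * P) ^ δ * (K * R′) ^ j))) (cong (M *_) (trans (∑-constF n ((η * P) ^ δ * (K * R′) ^ j)) (cong (λ x → n * ((η * P) ^ δ * x)) (*-^ K R′ j))))) ⟩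
    (η * P) ^ δ * (K ^ j * (R ^ j + (M * 2) * R′ ^ j)) + M * (n * ((η * P) ^ δ * (K ^ j * R′ ^ j)))
      ≡⟨ l₁ ((η * P) ^ δ) (K ^ j) (R ^ j) M (R′ ^ j) n ⟩
    (η * P) ^ δ * K ^ j * (R ^ j + M * (n + 2) * R′ ^ j) ∎
    where
    open ≤-Reasoning
    j = J v
    M = length subsets
    l₁ : ∀ g k r m s n → g * (k * (r + m * 2 * s)) + m * (n * (g * (k * s))) ≡ g * k * (r + m * (n + 2) * s)
    l₁ = solve-∀
  ... | false = begin
    ∑ kinds (term v f)
      ≤⟨ ∑-mono kinds (term-coarse v f) ⟩
    ∑ kinds (λ _ → W)
      ≡⟨ trans (∑-kinds (λ _ → W)) (trans (∑-const subsets (W + ∑ (allFin n) (λ _ → W))) (cong (λ x → M * (W + x)) (∑-constF n W))) ⟩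
    M * (W + n * W)
      ≤⟨ ≤-trans (m≤m+n _ (M * W)) (≤-reflexive (l₁ M W n)) ⟩
    W * (M * (n + 2)) ∎
    where
    open ≤-Reasoning
    M = length subsets
    W = (η * suc P) ^ δ * (K * R) ^ J v
    l₁ : ∀ m x n → m * (x + n * x) + m * x ≡ x * (m * (n + 2))
    l₁ = solve-∀

  bad : Col → V → Bool
  bad f v = not (optimal (pal adj f v) ∧ does (pal adj f v ≟ˢ hd v f))

  pfac : Col → V → ℕ
  pfac f v = if bad f v then suc P else P

  actual : V → Col → ℕ
  actual v f = ∏ vs (λ y → if adj v y then wgt (f y) * σ (comm (pal adj f v)) * pfac f v * rw (pal adj f v) v y f (f y) else 1)

  private
    point : V → Col → Kind → ℕ
    point v f t = ∏ vs (λ y → if adj v y then φ t v y f (f y) else 1)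

    via : ∀ v f t → t ∈ kinds → proj₁ t ≡ pal adj f v → pf t ≡ pfac f v →
          (∀ y → adj v y ≡ true → allow t v y (f y) ≡ true) → actual v f ≤ ∑ kinds (point v f)
    via v f t t∈ refl e h = ≤-trans (≤-reflexive (∏-cong vs pt)) (≤∑-∈ (point v f) t∈)
      where
      pt : ∀ y → (if adj v y then wgt (f y) * σ (comm (proj₁ t)) * pfac f v * rw (proj₁ t) v y f (f y) else 1)
               ≡ (if adj v y then φ t v y f (f y) else 1)
      pt y with adj v y in a
      ... | false = refl
      ... | true rewrite h y a | e = refl

    kinds-plain : ∀ a → (a , nothing) ∈ kinds
    kinds-plain a = ∈-concatMap⁺ _ (lose (∈-elts (SubsetEnum n) a) (here refl))

    kinds-just : ∀ a z → (a , just z) ∈ kinds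
    kinds-just a z = ∈-concatMap⁺ _ (lose (∈-elts (SubsetEnum n) a)
      (there (∈-map⁺ _ (∈-allFin z))))

  hd⊆pal : ∀ v f c → lookup (hd v f) c ≡ true → lookup (pal adj f v) c ≡ true
  hd⊆pal v f c h with pal-∋ low f v c h
  ... | u , lu , refl = pal-∈ adj f (low⇒adj lu)

  subset-ext : ∀ (a b : Subset n) → (∀ c → lookup a c ≡ true → lookup b c ≡ true) →
               (∀ c → lookup b c ≡ true → lookup a c ≡ true) → a ≡ b
  subset-ext a b f g = trans (sym (Vec.tabulate∘lookup a)) (trans (Vec.tabulate-cong pt) (Vec.tabulate∘lookup b))
    where
    pt : ∀ c → lookup a c ≡ lookup b c
    pt c with lookup a c in x | lookup b c in y
    ... | true  | true  = refl
    ... | false | false = refl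
    ... | true  | false = ⊥-elim (true≢false (f c x) y)
    ... | false | true  = ⊥-elim (true≢false (g c y) x)

  -- The lower palette is contained in the full one. If the palette is optimal and yet differs from
  -- its prediction, a colour `z` in the difference provides the kind `(A , just z)`; in all other
  -- cases the plain kind has the right factor.
  actual≤ : ∀ v f → actual v f ≤ ∑ kinds (point v f)
  actual≤ v f = go (optimal A) refl (A ≟ˢ hd v f) refl (sub A (hd v f)) refl
    where
    A = pal adj f v
    Goal = actual v f ≤ ∑ kinds (point v f)
    imp : ∀ {a b} → not a ∨ b ≡ true → a ≡ true → b ≡ true
    imp {true} p _ = p
    plain : pf (A , nothing) ≡ pfac f v → Goal
    plain pe = via v f (A , nothing) (kinds-plain A) refl pe (λ y a → pal-∈ adj f a)
    pfac-bad : bad f v ≡ true → pfac f v ≡ suc P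
    pfac-bad b = if-true b
    go : ∀ b → optimal A ≡ b → ∀ c → (A ≟ˢ hd v f) ≡ c → ∀ d → sub A (hd v f) ≡ d → Goal
    go false o _ _ _ _ = plain (trans (if-false {b = optimal A} o) (sym (pfac-bad (cong (λ b → not (b ∧ does (A ≟ˢ hd v f))) o))))
    go true o (yes p) eq _ _ = plain (trans (if-true {b = optimal A} o)
      (sym (if-false {b = bad f v} (cong₂ (λ b c → not (b ∧ does c)) o eq))))
    go true o (no ¬p) eq true s = ⊥-elim (¬p (subset-ext A (hd v f) (λ c h → imp (all-true⁻ _ s (∈-allFin c)) h) (hd⊆pal v f)))
    go true o (no ¬p) eq false s with all-false⁻ _ (allFin n) s
    ... | z , _ , q = via v f (A , just z) (kinds-just A z) refl
                        (sym (pfac-bad (cong₂ (λ b c → not (b ∧ does c)) o eq))) al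
      where
      al : ∀ y → adj v y ≡ true → lookup A z ∧ (lookup A (f y) ∧ not (low v y ∧ eqFin (f y) z)) ≡ true
      al y a = cong₂ _∧_ (proj₁ (⇒-false {lookup A z} q)) (cong₂ _∧_ (pal-∈ adj f a) (lowne y))
        where
        lowne : ∀ y → not (low v y ∧ eqFin (f y) z) ≡ true
        lowne y with low v y in ly
        ... | false = refl
        ... | true  = cong not (¬true (λ h → true≢false
          (trans (cong (lookup (hd v f)) (sym (Fin.toℕ-injective {i = f y} {z} (≡ᵇ-true h)))) (pal-∈ low f ly)) (proj₂ (⇒-false {lookup A z} q))))


-- Colourings with a large tilt have little weight

∏-↭ : ∀ {xs ys : List X} → xs ↭ ys → (f : X → ℕ) → ∏ xs f ≡ ∏ ys f
∏-↭ _↭_.refl                                f = refl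
∏-↭ (_↭_.prep x p)                          f = cong (f x *_) (∏-↭ p f)
∏-↭ (_↭_.swap {xs} {ys} x y p)              f = trans (cong (λ t → f x * (f y * t)) (∏-↭ p f)) (lem (f x) (f y) (∏ ys f))
  where
  lem : ∀ a b c → a * (b * c) ≡ b * (a * c)
  lem = solve-∀
∏-↭ (_↭_.trans p q)                         f = trans (∏-↭ p f) (∏-↭ q f)

module SortBy (lev : X → ℕ) where

  private
    order : DecTotalOrder _ _ _
    order = On.decTotalOrder ≤-decTotalOrder lev

  sort : List X → List X
  sort = Sort.sort order

  sort-↭ : ∀ xs → sort xs ↭ xs
  sort-↭ = Sort.sort-↭ order

  sort-↗ : ∀ xs → AllPairs (λ a b → lev a ≤ lev b) (sort xs)
  sort-↗ xs = Sorted.Sorted⇒AllPairs (DecTotalOrder.totalOrder order) (Sort.sort-↗ order xs)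

  sort-unique : ∀ {xs} → Unique xs → Unique (sort xs)
  sort-unique {xs} u = Permₛ.AllPairs-resp-↭ (≡.setoid X) ≢-sym (resp₂ _≢_) (↭⇒↭ₛ (↭-sym (sort-↭ xs))) u

module Weights (Sys : System) (κ : ℕ) where
  open System Sys
  open Core Sys κ

  nbrs : Col → V → Subset n
  nbrs f v = pal adj f v

  -- The condition at the odd vertices makes weight f vanish unless f is a homomorphism.
  weight marginal : Col → ℕ
  weight f   = ∏ vs (λ v → if odd v then (if lookup (comm (nbrs f v)) (f v) then wgt (f v) else 0) else wgt (f v))
  marginal f = ∏ vs (λ v → if odd v then σ (comm (nbrs f v)) else wgt (f v))

  odds evens : List V
  odds  = filter (λ v → T? (odd v)) vs
  evens = filter (λ v → T? (not (odd v))) vs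

  odds-odd : ∀ {v} → v ∈ odds → odd v ≡ true
  odds-odd m = T⇒≡ (proj₂ (∈-filter⁻ (λ v → T? (odd v)) {xs = vs} m))

  evens-even : ∀ {v} → v ∈ evens → odd v ≡ false
  evens-even m = not-true (T⇒≡ (proj₂ (∈-filter⁻ (λ v → T? (not (odd v))) {xs = vs} m)))

  even∈ : ∀ {v} → odd v ≡ false → v ∈ evens
  even∈ {v} o = ∈-filter⁺ (λ v → T? (not (odd v))) (∈-elts E v) (≡⇒T (cong not o))

  ∏-parity : ∀ (g h : V → ℕ) → ∏ vs (λ v → if odd v then g v else h v) ≡ ∏ evens h * ∏ odds g
  ∏-parity g h = ∏-if vs odd g h

  odd-upd : ∀ {u v} f c → odd u ≡ true → odd v ≡ true → nbrs (upd f u c) v ≡ nbrs f v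
  odd-upd {u} {v} f c ou ov = pal-cong adj (upd f u c) f v (λ w a → upd-other f u c (λ { refl →
    true≢false ou (not-true (trans (sym (adj-odd a)) ov)) }))

  EvenOnly : (Col → ℕ) → Set
  EvenOnly Q = ∀ u → odd u ≡ true → ∀ f c → Q (upd f u c) ≡ Q f

  -- Once the even colours are given, the odd colours are independent, as each condition `ok v`
  -- reads even colours and the colour of `v` only.
  S-odds-gen : ∀ (Q : Col → ℕ) (ok : V → Col → Fin n → Bool) → EvenOnly Q →
               (∀ v u f c e → odd u ≡ true → odd v ≡ true → ok v (upd f u c) e ≡ ok v f e) → ∀ f →
               S odds (λ h → Q h * ∏ vs (λ v → if odd v then (if ok v h (h v) then wgt (h v) else 0) else wgt (h v))) f
               ≡ Q f * ∏ vs (λ v → if odd v then sel (ok v f) wgt else wgt (f v))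
  S-odds-gen Q ok eo iok f = trans (S-cong odds step f)
    (trans (S-factor odds (Unique.filter⁺ _ (unique-elts E)) Q′ φ (λ u m h c → iQ u (odds-odd m) h c) (λ u m → iφ u (odds-odd m)) f)
      (trans (*-assoc (Q f) _ _) (cong (Q f *_) (sym (trans (∏-cong vs ptf) (∏-parity (λ v → ∑ (allFin n) (φ v f)) (λ v → wgt (f v))))))))
    where
    φ : V → Col → Fin n → ℕ
    φ v h c = if odd v then (if ok v h c then wgt c else 0) else 0
    Q′ : Col → ℕ
    Q′ h = Q h * ∏ evens (λ v → wgt (h v))
    pt : ∀ h v → (if odd v then (if ok v h (h v) then wgt (h v) else 0) else wgt (h v)) ≡ (if odd v then φ v h (h v) else wgt (h v))
    pt h v with odd v
    ... | true  = refl
    ... | false = refl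
    ptf : ∀ v → (if odd v then sel (ok v f) wgt else wgt (f v)) ≡ (if odd v then ∑ (allFin n) (φ v f) else wgt (f v))
    ptf v with odd v
    ... | true  = refl
    ... | false = refl
    step : ∀ h → Q h * ∏ vs (λ v → if odd v then (if ok v h (h v) then wgt (h v) else 0) else wgt (h v)) ≡ Q′ h * ∏ odds (λ v → φ v h (h v))
    step h = trans (cong (Q h *_) (trans (∏-cong vs (pt h)) (∏-parity (λ v → φ v h (h v)) (λ v → wgt (h v))))) (sym (*-assoc (Q h) _ _))
    iQ : ∀ u → odd u ≡ true → ∀ h c → Q′ (upd h u c) ≡ Q′ h
    iQ u ou h c = cong₂ _*_ (eo u ou h c) (trans (∏-filter (not ∘ odd) vs _) (trans (∏-cong vs pe) (sym (∏-filter (not ∘ odd) vs _))))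
      where
      pe : ∀ v → (if not (odd v) then wgt (upd h u c v) else 1) ≡ (if not (odd v) then wgt (h v) else 1)
      pe v with odd v in ov
      ... | true  = refl
      ... | false = cong wgt (upd-other h u c (λ { refl → true≢false ou ov }))
    iφ : ∀ u → odd u ≡ true → ∀ v h c e → φ v (upd h u c) e ≡ φ v h e
    iφ u ou v h c e with odd v in ov
    ... | true rewrite iok v u h c e ou ov = refl
    ... | false = refl

  S-odds : ∀ Q → EvenOnly Q → ∀ f → S odds (λ h → Q h * weight h) f ≡ Q f * marginal f
  S-odds Q eo f = S-odds-gen Q (λ v h c → lookup (comm (nbrs h v)) c) eo
    (λ v u f c e ou ov → cong (λ a → lookup (comm a) e) (odd-upd f c ou ov)) f

  N : ℕ
  N = ∑ vs (λ v → ⟦ odd v ⟧)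

module Tail (Sys : System) (κ-1 : ℕ) (O : Ordering Sys) where
  open System Sys
  open Core Sys (suc κ-1)
  open Ordering O
  open Run Sys κ-1 O
  open LocalBound Sys κ-1 O
  open Weights Sys (suc κ-1)
  open SortBy lev

  order : List V
  order = sort evens

  order-even : ∀ {v} → v ∈ order → odd v ≡ false
  order-even m = evens-even (∈-resp-↭ (sort-↭ evens) m)

  even∈order : ∀ {v} → odd v ≡ false → v ∈ order
  even∈order o = ∈-resp-↭ (↭-sym (sort-↭ evens)) (even∈ o)

  order-unique : Unique (order ++ odds)
  order-unique = Unique.++⁺ (sort-unique (Unique.filter⁺ _ (unique-elts E))) (Unique.filter⁺ _ (unique-elts E))
    (λ { (m , m′) → true≢false (odds-odd m′) (order-even m) })

  order-∏ : ∀ φ → ∏ (order ++ odds) φ ≡ ∏ vs φ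
  order-∏ g = trans (∏-++ order odds g) (trans (cong (_* ∏ odds g) (∏-↭ (sort-↭ evens) g))
    (sym (trans (∏-cong vs (λ v → sym (if-same (odd v)))) (∏-parity g g))))
    where
    if-same : ∀ b {x : ℕ} → (if b then x else x) ≡ x
    if-same true  = refl
    if-same false = refl

  -- On the scale of `δ`-th powers of weights, because Finner's inequality bounds the `δ`-th power
  -- of a sum.
  tilt : Col → ℕ
  tilt f = ∏ vs (λ v → if odd v then pfac f v ^ δ * ∏ vs (λ y → rw (nbrs f v) v y f (f y)) else 1)

  norm : ℕ
  norm = ∏ vs (λ v → if odd v then P ^ δ * (K * R) ^ J v else 1)

  init : V → Bool
  init v = not (δ ≤ᵇ κ * J v)

  ι : ℕ
  ι = ∑ vs (λ v → ⟦ odd v ∧ init v ⟧)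

  actual≡ : ∀ v f → actual v f ≡ ∏ vs (λ y → if adj v y then wgt (f y) else 1) * (σ (comm (nbrs f v)) ^ δ * (pfac f v ^ δ * ∏ vs (λ y → rw (nbrs f v) v y f (f y))))
  actual≡ v f = begin
    actual v f
      ≡⟨ ∏-cong vs pt ⟩
    ∏ vs (λ y → (if adj v y then wgt (f y) else 1) * ((if adj v y then s * p else 1) * r y))
      ≡⟨ trans (∏-* vs _ _) (cong (∏ vs (λ y → if adj v y then wgt (f y) else 1) *_) (∏-* vs _ r)) ⟩
    ∏ vs (λ y → if adj v y then wgt (f y) else 1) * (∏ vs (λ y → if adj v y then s * p else 1) * ∏ vs r)
      ≡⟨ cong (λ x → ∏ vs (λ y → if adj v y then wgt (f y) else 1) * (x * ∏ vs r))
           (trans (∏-if-const vs (adj v) (s * p)) (trans (cong ((s * p) ^_) (deg v)) (*-^ s p δ))) ⟩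
    ∏ vs (λ y → if adj v y then wgt (f y) else 1) * (s ^ δ * p ^ δ * ∏ vs r)
      ≡⟨ cong (∏ vs (λ y → if adj v y then wgt (f y) else 1) *_) (*-assoc (s ^ δ) (p ^ δ) (∏ vs r)) ⟩
    ∏ vs (λ y → if adj v y then wgt (f y) else 1) * (s ^ δ * (p ^ δ * ∏ vs r)) ∎
    where
    open ≡-Reasoning
    s = σ (comm (nbrs f v))
    p = pfac f v
    r : V → ℕ
    r y = rw (nbrs f v) v y f (f y)
    pt : ∀ y → (if adj v y then wgt (f y) * s * p * r y else 1) ≡ (if adj v y then wgt (f y) else 1) * ((if adj v y then s * p else 1) * r y)
    pt y = split (adj v y) r1
      where
      split : ∀ b {w r} → (b ≡ false → r ≡ 1) → (if b then w * s * p * r else 1) ≡ (if b then w else 1) * ((if b then s * p else 1) * r)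
      split true  {w} {r} _ = lem w s p r
        where
        lem : ∀ w s p r → w * s * p * r ≡ w * (s * p * r)
        lem = solve-∀
      split false h = sym (trans (+-identityʳ _) (trans (+-identityʳ _) (h refl)))
      r1 : adj v y ≡ false → r y ≡ 1
      r1 a = if-false {b = low v y} (¬true (λ ly → true≢false (low⇒adj ly) a))

  -- Every even vertex has exactly `δ` odd neighbours, each of which contributes one copy of its
  -- weight.
  even-weights : ∀ (f : Col) → ∏ vs (λ v → if odd v then ∏ vs (λ y → if adj v y then wgt (f y) else 1) else 1)
                       ≡ ∏ vs (λ y → if odd y then 1 else wgt (f y) ^ δ)
  even-weights f = trans (∏-cong vs push) (trans (∏-swap vs vs _) (∏-cong vs pt))
    where
    push : ∀ v → (if odd v then ∏ vs (λ y → if adj v y then wgt (f y) else 1) else 1)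
               ≡ ∏ vs (λ y → if odd v ∧ adj v y then wgt (f y) else 1)
    push v with odd v
    ... | true  = refl
    ... | false = sym (∏-1 vs)
    pt : ∀ y → ∏ vs (λ v → if odd v ∧ adj v y then wgt (f y) else 1) ≡ (if odd y then 1 else wgt (f y) ^ δ)
    pt y = trans (∏-if-const vs (λ v → odd v ∧ adj v y) (wgt (f y))) (h (odd y) refl)
      where
      h : ∀ b → odd y ≡ b → wgt (f y) ^ ∑ vs (λ v → ⟦ odd v ∧ adj v y ⟧) ≡ (if odd y then 1 else wgt (f y) ^ δ)
      h true o rewrite o = cong (wgt (f y) ^_) (trans (∑-cong vs z) (∑-0 vs))
        where
        z : ∀ v → ⟦ odd v ∧ adj v y ⟧ ≡ 0
        z v with adj v y in a
        ... | false = cong ⟦_⟧ (Data.Bool.Properties.∧-zeroʳ (odd v))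
        ... | true rewrite adj-odd a | o = refl
      h false o rewrite o = cong (wgt (f y) ^_) (trans (∑-cong vs z) (deg y))
        where
        z : ∀ v → ⟦ odd v ∧ adj v y ⟧ ≡ ⟦ adj y v ⟧
        z v rewrite adj-sym y v with adj v y in a
        ... | false = cong ⟦_⟧ (Data.Bool.Properties.∧-zeroʳ (odd v))
        ... | true rewrite adj-odd a | o = refl

  tilted : ∀ f → marginal f ^ δ * tilt f ≡ ∏ vs (λ v → if odd v then actual v f else 1)
  tilted f = begin
    marginal f ^ δ * tilt f
      ≡⟨ cong (_* tilt f) (trans (∏-^ vs _ δ) (trans (∏-cong vs p₁) (∏-* vs _ _))) ⟩
    ∏ vs (λ y → if odd y then 1 else wgt (f y) ^ δ) * ∏ vs (λ v → if odd v then s v else 1) * tilt f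
      ≡⟨ cong (λ x → x * ∏ vs (λ v → if odd v then s v else 1) * tilt f) (sym (even-weights f)) ⟩
    ∏ vs (λ v → if odd v then w v else 1) * ∏ vs (λ v → if odd v then s v else 1) * tilt f
      ≡⟨ trans (*-assoc (∏ vs (λ v → if odd v then w v else 1)) _ _)
           (trans (cong (∏ vs (λ v → if odd v then w v else 1) *_) (sym (∏-* vs _ _))) (sym (∏-* vs _ _))) ⟩
    ∏ vs (λ v → (if odd v then w v else 1) * ((if odd v then s v else 1) * (if odd v then t v else 1)))
      ≡⟨ ∏-cong vs p₂ ⟩
    ∏ vs (λ v → if odd v then actual v f else 1) ∎
    where
    open ≡-Reasoning
    w s t : V → ℕ
    w v = ∏ vs (λ y → if adj v y then wgt (f y) else 1)
    s v = σ (comm (nbrs f v)) ^ δ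
    t v = pfac f v ^ δ * ∏ vs (λ y → rw (nbrs f v) v y f (f y))
    p₁ : ∀ v → (if odd v then σ (comm (nbrs f v)) else wgt (f v)) ^ δ ≡ (if odd v then 1 else wgt (f v) ^ δ) * (if odd v then s v else 1)
    p₁ v with odd v
    ... | true  = sym (+-identityʳ _)
    ... | false = sym (*-identityʳ _)
    p₂ : ∀ v → (if odd v then w v else 1) * ((if odd v then s v else 1) * (if odd v then t v else 1)) ≡ (if odd v then actual v f else 1)
    p₂ v with odd v
    ... | true  = sym (actual≡ v f)
    ... | false = refl

  heavy : ℕ → Col → ℕ
  heavy Θ f = ⟦ Θ * norm ≤ᵇ tilt f ⟧

  -- A Markov inequality inside Finner's: on heavy colourings `Θ norm` is at most the tilt, and
  -- elsewhere the summand vanishes, so the tilted weight dominates.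
  finner-heavy : ∀ Θ f → Θ * norm * S order (λ h → heavy Θ h * marginal h) f ^ δ ≤ ∏ vs (λ v → if odd v then bnd v else 1)
  finner-heavy Θ = Finner.finner Sys lev lev-adj kinds φ φ-past bnd (Θ * norm) (λ h → heavy Θ h * marginal h) F≤
      (λ v f _ → ∑term≤bnd v f) order (sort-unique (Unique.filter⁺ _ (unique-elts E))) (sort-↗ evens) (λ u → order-even) (λ u → even∈order)
    where
    F≤ : ∀ f → Θ * norm * (heavy Θ f * marginal f) ^ δ ≤ ∏ vs (λ v → if odd v then ∑ kinds (λ t → ∏ vs (λ y → if adj v y then φ t v y f (f y) else 1)) else 1)
    F≤ f = h (Θ * norm ≤ᵇ tilt f) refl
      where
      pt : ∀ v → (if odd v then actual v f else 1) ≤ (if odd v then ∑ kinds (λ t → ∏ vs (λ y → if adj v y then φ t v y f (f y) else 1)) else 1)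
      pt v with odd v
      ... | true  = actual≤ v f
      ... | false = ≤-refl
      h : ∀ b → (Θ * norm ≤ᵇ tilt f) ≡ b → Θ * norm * (⟦ b ⟧ * marginal f) ^ δ ≤ ∏ vs (λ v → if odd v then ∑ kinds (λ t → ∏ vs (λ y → if adj v y then φ t v y f (f y) else 1)) else 1)
      h false _ = ≤-trans (≤-reflexive (*-zeroʳ (Θ * norm))) z≤n
      h true  e rewrite +-identityʳ (marginal f) = begin
        Θ * norm * marginal f ^ δ    ≤⟨ *-monoˡ-≤ (marginal f ^ δ) (≤ᵇ⇒≤ (Θ * norm) (tilt f) (≡⇒T e)) ⟩
        tilt f * marginal f ^ δ      ≡⟨ trans (*-comm (tilt f) _) (tilted f) ⟩
        ∏ vs (λ v → if odd v then actual v f else 1) ≤⟨ ∏-mono vs pt ⟩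
        ∏ vs (λ v → if odd v then ∑ kinds (λ t → ∏ vs (λ y → if adj v y then φ t v y f (f y) else 1)) else 1) ∎
        where open ≤-Reasoning

  -- Multiplication by `R ^ j₀` replaces the varying damping `(R′ / R) ^ J v` by its weakest value
  -- `(R′ / R) ^ j₀`. In the crude case `P + 1 ≤ 2 P` is enough.
  bnd≤ : ∀ j₀ → κ * j₀ ≤ δ → ∀ v →
         bnd v * R ^ j₀ ≤ η ^ δ * (P ^ δ * (K * R) ^ J v) * (R ^ j₀ + C * R′ ^ j₀) * (if init v then 2 ^ δ * C else 1)
  bnd≤ j₀ κj₀ v with δ ≤ᵇ κ * J v in d
  ... | true  = begin
    (η * P) ^ δ * K ^ j * (R ^ j + C * R′ ^ j) * R ^ j₀
      ≡⟨ l₁ ((η * P) ^ δ) (K ^ j) (R ^ j) C (R′ ^ j) (R ^ j₀) ⟩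
    (η * P) ^ δ * K ^ j * (R ^ j * R ^ j₀ + C * (R′ ^ j * R ^ j₀))
      ≤⟨ *-monoʳ-≤ ((η * P) ^ δ * K ^ j) (+-monoʳ-≤ (R ^ j * R ^ j₀) (*-monoʳ-≤ C R′≤)) ⟩
    (η * P) ^ δ * K ^ j * (R ^ j * R ^ j₀ + C * (R ^ j * R′ ^ j₀))
      ≡⟨ cong (λ x → x * K ^ j * (R ^ j * R ^ j₀ + C * (R ^ j * R′ ^ j₀))) (*-^ η P δ) ⟩
    η ^ δ * P ^ δ * K ^ j * (R ^ j * R ^ j₀ + C * (R ^ j * R′ ^ j₀))
      ≡⟨ l₂ (η ^ δ) (P ^ δ) (K ^ j) (R ^ j) (R ^ j₀) C (R′ ^ j₀) ⟩
    η ^ δ * (P ^ δ * (K ^ j * R ^ j)) * (R ^ j₀ + C * R′ ^ j₀) * 1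
      ≡⟨ cong (λ x → η ^ δ * (P ^ δ * x) * (R ^ j₀ + C * R′ ^ j₀) * 1) (sym (*-^ K R j)) ⟩
    η ^ δ * (P ^ δ * (K * R) ^ j) * (R ^ j₀ + C * R′ ^ j₀) * 1 ∎
    where
    open ≤-Reasoning
    j = J v
    j₀≤j : j₀ ≤ j
    j₀≤j = *-cancelˡ-≤ κ (≤-trans κj₀ (≤ᵇ⇒≤ δ (κ * j) (≡⇒T d)))
    R′≤ : R′ ^ j * R ^ j₀ ≤ R ^ j * R′ ^ j₀
    R′≤ with m≤n⇒∃[o]m+o≡n j₀≤j
    ... | t , e = begin
      R′ ^ j * R ^ j₀               ≡⟨ cong (λ x → R′ ^ x * R ^ j₀) (sym e) ⟩
      R′ ^ (j₀ + t) * R ^ j₀        ≡⟨ cong (_* R ^ j₀) (^-distribˡ-+-* R′ j₀ t) ⟩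
      R′ ^ j₀ * R′ ^ t * R ^ j₀     ≤⟨ *-monoˡ-≤ (R ^ j₀) (*-monoʳ-≤ (R′ ^ j₀) (^-monoˡ-≤ t (n≤1+n R′))) ⟩
      R′ ^ j₀ * R ^ t * R ^ j₀      ≡⟨ l₃ (R′ ^ j₀) (R ^ t) (R ^ j₀) ⟩
      R ^ j₀ * R ^ t * R′ ^ j₀      ≡⟨ cong (_* R′ ^ j₀) (sym (^-distribˡ-+-* R j₀ t)) ⟩
      R ^ (j₀ + t) * R′ ^ j₀        ≡⟨ cong (λ x → R ^ x * R′ ^ j₀) e ⟩
      R ^ j * R′ ^ j₀ ∎
      where
      l₃ : ∀ a b c → a * b * c ≡ c * b * a
      l₃ = solve-∀
    l₁ : ∀ g k r c s x → g * k * (r + c * s) * x ≡ g * k * (r * x + c * (s * x))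
    l₁ = solve-∀
    l₂ : ∀ h p k r x c y → h * p * k * (r * x + c * (r * y)) ≡ h * (p * (k * r)) * (x + c * y) * 1
    l₂ = solve-∀
  ... | false = begin
    (η * suc P) ^ δ * (K * R) ^ j * C * R ^ j₀
      ≤⟨ *-mono-≤ (*-monoˡ-≤ C (*-monoˡ-≤ ((K * R) ^ j) (^-monoˡ-≤ δ (*-monoʳ-≤ η P+1≤)))) (m≤m+n (R ^ j₀) (C * R′ ^ j₀)) ⟩
    (η * (2 * P)) ^ δ * (K * R) ^ j * C * (R ^ j₀ + C * R′ ^ j₀)
      ≡⟨ cong (λ x → x * (K * R) ^ j * C * (R ^ j₀ + C * R′ ^ j₀)) (trans (*-^ η (2 * P) δ) (cong (η ^ δ *_) (*-^ 2 P δ))) ⟩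
    η ^ δ * (2 ^ δ * P ^ δ) * (K * R) ^ j * C * (R ^ j₀ + C * R′ ^ j₀)
      ≡⟨ l₁ (η ^ δ) (2 ^ δ) (P ^ δ) ((K * R) ^ j) C (R ^ j₀ + C * R′ ^ j₀) ⟩
    η ^ δ * (P ^ δ * (K * R) ^ j) * (R ^ j₀ + C * R′ ^ j₀) * (2 ^ δ * C) ∎
    where
    open ≤-Reasoning
    j = J v
    P+1≤ : suc P ≤ 2 * P
    P+1≤ = ≤-trans (+-monoˡ-≤ P 1≤P) (≤-reflexive (cong (P +_) (sym (+-identityʳ P))))
    l₁ : ∀ h t p k c x → h * (t * p) * k * c * x ≡ h * (p * k) * x * (t * c)
    l₁ = solve-∀

  ≤2^ : ∀ m → m ≤ 2 ^ m
  ≤2^ zero    = z≤n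
  ≤2^ (suc m) = ≤-trans (+-mono-≤ (1≤^ m (s≤s z≤n)) (≤2^ m)) (≤-reflexive (cong (2 ^ m +_) (sym (+-identityʳ _))))

  1≤norm : 1 ≤ norm
  1≤norm = 1≤∏ vs pt
    where
    pt : ∀ v → 1 ≤ (if odd v then P ^ δ * (K * R) ^ J v else 1)
    pt v with odd v
    ... | true  = *-mono-≤ (1≤^ δ 1≤P) (1≤^ (J v) (s≤s z≤n))
    ... | false = ≤-refl

  ∏bnd : ∀ j₀ → κ * j₀ ≤ δ →
         ∏ vs (λ v → if odd v then bnd v else 1) * (R ^ j₀) ^ N
         ≤ (η ^ N) ^ δ * norm * (R ^ j₀ + C * R′ ^ j₀) ^ N * (2 ^ δ * C) ^ ι
  ∏bnd j₀ κj₀ = begin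
    ∏ vs (λ v → if odd v then bnd v else 1) * (R ^ j₀) ^ N
      ≡⟨ trans (cong (∏ vs (λ v → if odd v then bnd v else 1) *_) (sym (cst (R ^ j₀)))) (sym (∏-* vs (λ v → if odd v then bnd v else 1) (λ v → if odd v then R ^ j₀ else 1))) ⟩
    ∏ vs (λ v → (if odd v then bnd v else 1) * (if odd v then R ^ j₀ else 1))
      ≤⟨ ∏-mono vs pt ⟩
    ∏ vs (λ v → ((if odd v then η ^ δ else 1) * (if odd v then P ^ δ * (K * R) ^ J v else 1)) * (if odd v then R ^ j₀ + C * R′ ^ j₀ else 1) * (if odd v ∧ init v then 2 ^ δ * C else 1))
      ≡⟨ trans (∏-* vs _ _) (cong₂ _*_ (trans (∏-* vs _ _) (cong₂ _*_ (trans (∏-* vs _ _) (cong (_* norm) ηs)) (cst _)))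
           (∏-if-const vs (λ v → odd v ∧ init v) (2 ^ δ * C))) ⟩
    (η ^ N) ^ δ * norm * (R ^ j₀ + C * R′ ^ j₀) ^ N * (2 ^ δ * C) ^ ι ∎
    where
    open ≤-Reasoning
    cst : ∀ x → ∏ vs (λ v → if odd v then x else 1) ≡ x ^ N
    cst x = ∏-if-const vs odd x
    ηs : ∏ vs (λ v → if odd v then η ^ δ else 1) ≡ (η ^ N) ^ δ
    ηs = trans (cst (η ^ δ)) (trans (^-*-assoc η δ N) (trans (cong (η ^_) (*-comm δ N)) (sym (^-*-assoc η N δ))))
    pt : ∀ v → (if odd v then bnd v else 1) * (if odd v then R ^ j₀ else 1)
             ≤ ((if odd v then η ^ δ else 1) * (if odd v then P ^ δ * (K * R) ^ J v else 1)) * (if odd v then R ^ j₀ + C * R′ ^ j₀ else 1) * (if odd v ∧ init v then 2 ^ δ * C else 1)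
    pt v with odd v
    ... | true  = bnd≤ j₀ κj₀ v
    ... | false = ≤-refl

  -- The part `s δ` buys the saving `2 ^ s` after the `δ`-th root; `2 B` pays for the damped terms
  -- through `exp-bound`, and the rest for the vertices with few lower neighbours.
  excess : ℕ → ℕ → ℕ
  excess s B = s * δ + (2 * B + (δ + C) * ι)

  tail : ∀ s j₀ B → κ * j₀ ≤ δ → N * (C * R′ ^ j₀) ≤ B * R ^ j₀ → ∀ f →
         2 ^ s * S order (λ h → heavy (2 ^ excess s B) h * marginal h) f ≤ η ^ N
  tail s j₀ B κj₀ hB f = ^-cancel-≤ deg-1 (*-cancelˡ (norm * ρ * Y₀) (*-mono-≤ (*-mono-≤ 1≤norm (1≤^ N (1≤^ j₀ (s≤s z≤n)))) (1≤^ {2} (2 * B + (δ + C) * ι) (s≤s z≤n))) (begin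
    norm * ρ * Y₀ * (2 ^ s * M) ^ δ
      ≡⟨ cong (norm * ρ * Y₀ *_) (trans (*-^ (2 ^ s) M δ) (cong (_* M ^ δ) (^-*-assoc 2 s δ))) ⟩
    norm * ρ * Y₀ * (2 ^ (s * δ) * M ^ δ)
      ≡⟨ l₁ norm ρ Y₀ (2 ^ (s * δ)) (M ^ δ) ⟩
    2 ^ (s * δ) * Y₀ * norm * M ^ δ * ρ
      ≡⟨ cong (λ x → x * norm * M ^ δ * ρ) (sym (^-distribˡ-+-* 2 (s * δ) (2 * B + (δ + C) * ι))) ⟩
    2 ^ excess s B * norm * M ^ δ * ρ
      ≤⟨ *-monoˡ-≤ ρ (finner-heavy (2 ^ excess s B) f) ⟩
    ∏ vs (λ v → if odd v then bnd v else 1) * ρ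
      ≤⟨ ∏bnd j₀ κj₀ ⟩
    (η ^ N) ^ δ * norm * (R ^ j₀ + C * R′ ^ j₀) ^ N * (2 ^ δ * C) ^ ι
      ≤⟨ *-mono-≤ (*-monoʳ-≤ ((η ^ N) ^ δ * norm) (exp-bound N (C * R′ ^ j₀) (R ^ j₀) B hB)) (^-monoˡ-≤ ι (≤-trans (*-monoʳ-≤ (2 ^ δ) (≤2^ C)) (≤-reflexive (sym (^-distribˡ-+-* 2 δ C))))) ⟩
    (η ^ N) ^ δ * norm * (4 ^ B * ρ) * (2 ^ (δ + C)) ^ ι
      ≡⟨ l₂ ((η ^ N) ^ δ) norm (4 ^ B) ρ _ ⟩
    norm * ρ * (4 ^ B * (2 ^ (δ + C)) ^ ι) * (η ^ N) ^ δ
      ≡⟨ cong (λ x → norm * ρ * x * (η ^ N) ^ δ) (trans (cong₂ _*_ (^-*-assoc 2 2 B) (^-*-assoc 2 (δ + C) ι)) (sym (^-distribˡ-+-* 2 (2 * B) ((δ + C) * ι)))) ⟩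
    norm * ρ * Y₀ * (η ^ N) ^ δ ∎))
    where
    open ≤-Reasoning
    M = S order (λ h → heavy (2 ^ excess s B) h * marginal h) f
    ρ = (R ^ j₀) ^ N
    Y₀ = 2 ^ (2 * B + (δ + C) * ι)
    l₁ : ∀ n r y t m → n * r * y * (t * m) ≡ t * y * n * m * r
    l₁ = solve-∀
    l₂ : ∀ e n b r x → e * n * (b * r) * x ≡ n * r * (b * x) * e
    l₂ = solve-∀


-- Two opposite orders: few bad vertices and few palette changes

module _ (E : Enum X) where
  open Enum E

  private
    occ : X → X → ℕ
    occ x y = ⟦ does (y ≟ x) ⟧

  -- Products admit no delta expansion as sums do, so a reindexed list is compared with the original
  -- one through multiplicities.
  ∏-occ : ∀ xs ys → (∀ x → ∑ xs (occ x) ≡ ∑ ys (occ x)) → ∀ (f : X → ℕ) → ∏ xs f ≡ ∏ ys f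
  ∏-occ []       []       h f = refl
  ∏-occ []       (y ∷ ys) h f = ⊥-elim (0≢1+n (trans (h y) (cong (λ b → ⟦ b ⟧ + ∑ ys (occ y)) (dec-true (y ≟ y) refl))))
  ∏-occ (x ∷ xs) ys       h f with occ-split E ys x (≤-trans (≤-trans (≤-reflexive (cong ⟦_⟧ (sym (dec-true (x ≟ x) refl)))) (m≤m+n _ (∑ xs (occ x)))) (≤-reflexive (h x)))
  ... | as , bs , refl = begin
    f x * ∏ xs f            ≡⟨ cong (f x *_) (∏-occ xs (as ++ bs) h′ f) ⟩
    f x * ∏ (as ++ bs) f    ≡⟨ cong (f x *_) (∏-++ as bs f) ⟩
    f x * (∏ as f * ∏ bs f) ≡⟨ lem (f x) (∏ as f) (∏ bs f) ⟩
    ∏ as f * (f x * ∏ bs f) ≡⟨ sym (∏-++ as (x ∷ bs) f) ⟩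
    ∏ (as ++ x ∷ bs) f ∎
    where
    open ≡-Reasoning
    lem : ∀ a b c → a * (b * c) ≡ b * (a * c)
    lem = solve-∀
    lem′ : ∀ a b c → b + (a + c) ≡ a + (b + c)
    lem′ = solve-∀
    h′ : ∀ z → ∑ xs (occ z) ≡ ∑ (as ++ bs) (occ z)
    h′ z = +-cancelˡ-≡ (occ z x) _ _ (trans (h z) (trans (∑-++ as (x ∷ bs) (occ z))
             (trans (lem′ (occ z x) (∑ as (occ z)) (∑ bs (occ z))) (cong (occ z x +_) (sym (∑-++ as bs (occ z)))))))

  ∏-reindex : ∀ (ρ ρ⁻¹ : X → X) → (∀ x → ρ (ρ⁻¹ x) ≡ x) → (∀ x → ρ⁻¹ (ρ x) ≡ x) →
              ∀ f → ∏ elts (λ x → f (ρ x)) ≡ ∏ elts f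
  ∏-reindex ρ ρ⁻¹ l r f = trans (sym (∏-map ρ elts f))
    (∏-occ (map ρ elts) elts (λ x → trans (∑-map ρ elts (occ x)) (∑-reindex E ρ ρ⁻¹ l r (occ x))) f)

-- The edge from `v` down to `u` corresponds in the other order to the edge from `π u` down to
-- `π v`. Each comparison of two palettes thus occurs once in either order, with predictor and
-- predicted exchanged.
record Reversal {Sys : System} (O O′ : Ordering Sys) : Set where
  open System Sys
  open Ordering
  field
    π-π′ : ∀ x → π O (π O′ x) ≡ x
    π′-π : ∀ x → π O′ (π O x) ≡ x
    rev  : ∀ v u → lower (lev O′) (π O u) (π O v) ≡ lower (lev O) v u

module Pairing (Sys : System) (κ-1 : ℕ) (O O′ : Ordering Sys) (ρ : Reversal O O′) where
  open System Sys
  open Core Sys (suc κ-1)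
  open Weights Sys (suc κ-1)
  open Reversal ρ
  module O = Ordering O
  module O′ = Ordering O′

  -- For one compared pair, relative to `KK`: `D` is the guaranteed gain of a change between good
  -- vertices, and `Q` the worst loss charged to a bad one.
  KK RR Q D : ℕ
  KK = K * K
  RR = R * R
  Q  = q * q
  D  = suc KK

  -- Even after the worst loss `Q / KK`, the reward `(P + 1) / P` of a bad vertex, granted `δ`
  -- times, leaves a gain of `D / KK`. This determines the size of `K - q = 3 Λ` against `K`, which
  -- is about `6 Λ P`.
  DP≤ : D * P ≤ suc P * Q
  DP≤ = ≤-trans (≤-reflexive (cong (λ x → suc (x * x) * P) (trans K≡q (cong (_+ 3 * Λ) q≡))))
          (≤-trans (m≤m+n _ (rest L P)) (≤-reflexive (trans (poly L P) (cong (λ x → suc P * (x * x)) (sym q≡)))))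
    where
    rest : ℕ → ℕ → ℕ
    rest l p = (9 * suc l * suc l + 6 * l + 5) * p + (3 * suc l + 1) * (3 * suc l + 1)
    poly : ∀ l p → suc ((3 * suc l + 6 * suc l * p + 1 + 3 * suc l) * (3 * suc l + 6 * suc l * p + 1 + 3 * suc l)) * p
           + ((9 * suc l * suc l + 6 * l + 5) * p + (3 * suc l + 1) * (3 * suc l + 1))
           ≡ suc p * ((3 * suc l + 6 * suc l * p + 1) * (3 * suc l + 6 * suc l * p + 1))
    poly = solve-∀

  2≤K′ : 2 ≤ K′
  2≤K′ = ≤-trans (≤-trans (s≤s (s≤s z≤n)) (≤-reflexive (sym (lem L)))) (≤-trans (m≤m*n (6 * Λ) (suc P)) (≤-reflexive (sym K′≡)))
    where
    lem : ∀ l → 6 * suc l ≡ 2 + (4 + 6 * l)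
    lem = solve-∀

  τ-eq : ∀ a b y → a ≡ b → τ a b y ≡ K
  τ-eq a b y e = if-true (dec-true (a ≟ˢ b) e)

  τ-sub : ∀ a b y → a ≢ b → sub a b ≡ true → τ a b y ≡ K′
  τ-sub a b y ne s = trans (if-false (dec-false (a ≟ˢ b) ne)) (if-true {b = sub a b} s)

  τ-¬sub : ∀ a b y → a ≢ b → sub a b ≡ false → lookup b y ≡ true → τ a b y ≡ 2 + K
  τ-¬sub a b y ne s h = trans (if-false (dec-false (a ≟ˢ b) ne)) (trans (if-false {b = sub a b} s) (if-true {b = lookup b y} h))

  q≤K′ : q ≤ K′
  q≤K′ = ≤-pred (≤-trans (m<m+n q {3 * Λ} (s≤s z≤n)) (≤-reflexive (sym K≡q)))

  q≤τ : ∀ a b y → q ≤ τ a b y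
  q≤τ a b y with does (a ≟ˢ b)
  ... | true = q≤K
  ... | false with sub a b
  ...   | true = q≤K′
  ...   | false with lookup b y
  ...     | true  = ≤-trans q≤K (m≤n+m K 2)
  ...     | false = ≤-refl

  sub-antisym : ∀ a b → sub a b ≡ true → sub b a ≡ true → a ≡ b
  sub-antisym a b s t = (LocalBound.subset-ext Sys κ-1 O) a b (λ c → imp (all-true⁻ _ s (∈-allFin c))) (λ c → imp (all-true⁻ _ t (∈-allFin c)))
    where
    imp : ∀ {a b} → not a ∨ b ≡ true → a ≡ true → b ≡ true
    imp {true} p _ = p

  -- The excess in `(K - 1) (K + 2) = K ^ 2 + (K - 2)` is the reason why a change and the change
  -- back do not cancel.
  D≤K′K : D ≤ K′ * (2 + K)
  D≤K′K = lem K′ 2≤K′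
    where
    lem : ∀ k → 2 ≤ k → suc (suc k * suc k) ≤ k * (3 + k)
    lem k 2≤k = ≤-trans (+-monoˡ-≤ (k + k * suc k) 2≤k) (≤-reflexive (eq k))
      where
      eq : ∀ k → k + (k + k * suc k) ≡ k * (3 + k)
      eq = solve-∀

  -- Distinct palettes are not contained in each other both ways, so one of the rewards is `K + 2`
  -- and the other at least `K′`; the two memberships rule out the penalty `q`.
  D≤ττ : ∀ a b y y′ → a ≢ b → lookup b y ≡ true → lookup a y′ ≡ true → D ≤ τ a b y * τ b a y′
  D≤ττ a b y y′ ne hy hy′ = go (sub a b) refl (sub b a) refl
    where
    go : ∀ s → sub a b ≡ s → ∀ t → sub b a ≡ t → D ≤ τ a b y * τ b a y′
    go true  s true  t = ⊥-elim (ne (sub-antisym a b s t))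
    go true  s false t = ≤-trans D≤K′K (≤-reflexive (sym (cong₂ _*_ (τ-sub a b y ne s) (τ-¬sub b a y′ (≢-sym ne) t hy′))))
    go false s true  t = ≤-trans D≤K′K (≤-trans (≤-reflexive (*-comm K′ (2 + K))) (≤-reflexive (sym (cong₂ _*_ (τ-¬sub a b y ne s hy) (τ-sub b a y′ (≢-sym ne) t)))))
    go false s false t = ≤-trans D≤K′K (≤-trans (*-monoˡ-≤ (2 + K) (≤-trans K′≤K (m≤n+m K 2))) (≤-reflexive (sym (cong₂ _*_ (τ-¬sub a b y ne s hy) (τ-¬sub b a y′ (≢-sym ne) t hy′)))))

  module _ (f : Col) where

    A : V → Subset n
    A = nbrs f

    pr : V → V → Bool
    pr v u = odd v ∧ (Run.low Sys κ-1 O) v u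

    b⁻ b⁺ : V → Bool
    b⁻ v = (LocalBound.bad Sys κ-1 O) f v
    b⁺ v = (LocalBound.bad Sys κ-1 O′) f v

    changed : V → V → Bool
    changed v u = not (does (A v ≟ˢ A (O.π u)))

    ne : V → V → Bool
    ne v u = (not (b⁻ (O.π u)) ∧ not (b⁺ v)) ∧ changed v u

    s : V → V → ℕ
    s v u = ⟦ b⁻ (O.π u) ⟧ + ⟦ b⁺ v ⟧

    β⁻ β⁺ TR SB : ℕ
    β⁻ = ∑ vs (λ v → ⟦ odd v ∧ b⁻ v ⟧)
    β⁺ = ∑ vs (λ v → ⟦ odd v ∧ b⁺ v ⟧)
    TR = ∑ vs (λ v → ∑ vs (λ u → if pr v u then ⟦ ne v u ⟧ else 0))
    SB = ∑ vs (λ v → ∑ vs (λ u → if pr v u then s v u else 0))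

    X⁻ X⁺ : V → V → ℕ
    X⁻ v u = R * τ (A v) ((Run.hd Sys κ-1 O) (O.π u) f) (f u)
    X⁺ v u = R * τ (A (O.π u)) ((Run.hd Sys κ-1 O′) v f) (f (O.π v))

    good⁻ : ∀ w → b⁻ w ≡ false → (Run.hd Sys κ-1 O) w f ≡ A w
    good⁻ w h with A w ≟ˢ (Run.hd Sys κ-1 O) w f
    ... | yes p = sym p
    ... | no _  = ⊥-elim (true≢false (cong not (Data.Bool.Properties.∧-zeroʳ (optimal (A w)))) h)

    good⁺ : ∀ w → b⁺ w ≡ false → (Run.hd Sys κ-1 O′) w f ≡ A w
    good⁺ w h with A w ≟ˢ (Run.hd Sys κ-1 O′) w f
    ... | yes p = sym p
    ... | no _  = ⊥-elim (true≢false (cong not (Data.Bool.Properties.∧-zeroʳ (optimal (A w)))) h)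

    adj-π′ : ∀ u → adj (O.π u) u ≡ true
    adj-π′ u = trans (adj-sym (O.π u) u) (O.adj-π u)

    -- Cleared form of `X⁻ X⁺ / (KK RR) ≥ (D / KK) ^ ne (Q / KK) ^ s`. At good ends the predictions
    -- are the palettes themselves, and the colours of `u` and `π v` lie in the palettes of `π u`
    -- and `v`.
    pair : ∀ v u → D ^ ⟦ ne v u ⟧ * (KK * RR) * Q ^ s v u ≤ KK ^ ⟦ ne v u ⟧ * (X⁻ v u * X⁺ v u) * KK ^ s v u
    pair v u = cases (b⁻ w) refl (b⁺ v) refl (A v ≟ˢ A w)
      where
      open ≤-Reasoning
      w = O.π u
      Goal : Bool → ℕ → Set
      Goal x t = D ^ ⟦ x ⟧ * (KK * RR) * Q ^ t ≤ KK ^ ⟦ x ⟧ * (X⁻ v u * X⁺ v u) * KK ^ t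
      l₁ : ∀ r x y → r * x * (r * y) ≡ r * r * (x * y)
      l₁ = solve-∀
      qq : RR * Q ≤ X⁻ v u * X⁺ v u
      qq = ≤-trans (*-monoʳ-≤ RR (*-mono-≤ (q≤τ (A v) ((Run.hd Sys κ-1 O) w f) (f u)) (q≤τ (A w) ((Run.hd Sys κ-1 O′) v f) (f (O.π v)))))
             (≤-reflexive (sym (l₁ R (τ (A v) ((Run.hd Sys κ-1 O) w f) (f u)) (τ (A w) ((Run.hd Sys κ-1 O′) v f) (f (O.π v))))))
      Q≤KK : Q ≤ KK
      Q≤KK = *-mono-≤ q≤K q≤K
      bad-case : ∀ t → Goal false (suc t)
      bad-case t = begin
        1 * (KK * RR) * (Q * Q ^ t)          ≡⟨ l₂ KK RR Q (Q ^ t) ⟩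
        1 * (RR * Q) * (KK * Q ^ t)          ≤⟨ *-mono-≤ (*-monoʳ-≤ 1 qq) (*-monoʳ-≤ KK (^-monoˡ-≤ t Q≤KK)) ⟩
        1 * (X⁻ v u * X⁺ v u) * (KK * KK ^ t) ∎
        where
        l₂ : ∀ k r x y → 1 * (k * r) * (x * y) ≡ 1 * (r * x) * (k * y)
        l₂ = solve-∀
      y⁻ y⁺ : ℕ
      y⁻ = τ (A v) (A w) (f u)
      y⁺ = τ (A w) (A v) (f (O.π v))
      XX : b⁻ w ≡ false → b⁺ v ≡ false → X⁻ v u * X⁺ v u ≡ RR * (y⁻ * y⁺)
      XX g h = trans (cong₂ (λ a b → R * τ (A v) a (f u) * (R * τ (A w) b (f (O.π v)))) (good⁻ w g) (good⁺ v h)) (l₁ R y⁻ y⁺)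
      l₃ : ∀ k r → 1 * (k * r) * 1 ≡ 1 * (r * k) * 1
      l₃ = solve-∀
      l₄ : ∀ d k r → d * 1 * (k * r) * 1 ≡ k * 1 * (r * d) * 1
      l₄ = solve-∀
      cases : ∀ x → b⁻ w ≡ x → ∀ y → b⁺ v ≡ y → ∀ (d : Dec (A v ≡ A w)) → Goal ((not x ∧ not y) ∧ not (does d)) (⟦ x ⟧ + ⟦ y ⟧)
      cases true  _ true  _ _ = bad-case 1
      cases true  _ false _ _ = bad-case 0
      cases false _ true  _ _ = bad-case 0
      cases false g false h (yes p) = ≤-reflexive (trans (l₃ KK RR) (cong (λ x → 1 * x * 1)
        (sym (trans (XX g h) (cong (RR *_) (cong₂ _*_ (τ-eq (A v) (A w) (f u) p) (τ-eq (A w) (A v) (f (O.π v)) (sym p))))))))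
      cases false g false h (no ¬p) = ≤-trans (≤-reflexive (l₄ D KK RR)) (*-monoˡ-≤ 1 (*-monoʳ-≤ (KK * 1)
        (≤-trans (*-monoʳ-≤ RR (D≤ττ (A v) (A w) (f u) (f (O.π v)) ¬p (pal-∈ adj f (adj-π′ u)) (pal-∈ adj f (O.adj-π v)))) (≤-reflexive (sym (XX g h))))))

    rw⁻ : V → V → ℕ
    rw⁻ v u = if pr v u then X⁻ v u else 1
    rw⁺ : V → V → ℕ
    rw⁺ v u = if pr v u then X⁺ v u else 1

    F⁻ F⁺ : ℕ
    F⁻ = ∏ vs (λ v → if odd v then (LocalBound.pfac Sys κ-1 O) f v ^ δ else 1)
    F⁺ = ∏ vs (λ v → if odd v then (LocalBound.pfac Sys κ-1 O′) f v ^ δ else 1)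

    tilt⁻ : (Tail.tilt Sys κ-1 O) f ≡ F⁻ * ∏ vs (λ v → ∏ vs (rw⁻ v))
    tilt⁻ = trans (∏-cong vs pt) (∏-* vs (λ v → if odd v then (LocalBound.pfac Sys κ-1 O) f v ^ δ else 1) (λ v → ∏ vs (rw⁻ v)))
      where
      pt : ∀ v → (if odd v then (LocalBound.pfac Sys κ-1 O) f v ^ δ * ∏ vs (λ y → (Run.rw Sys κ-1 O) (A v) v y f (f y)) else 1) ≡ (if odd v then (LocalBound.pfac Sys κ-1 O) f v ^ δ else 1) * ∏ vs (rw⁻ v)
      pt v with odd v
      ... | true  = refl
      ... | false = sym (trans (+-identityʳ _) (∏-1 vs))

    odd-π : ∀ u → odd (O.π u) ≡ not (odd u)
    odd-π u = adj-odd (adj-π′ u)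

    pair-cond : ∀ v u → odd (O.π u) ∧ (Run.low Sys κ-1 O′) (O.π u) (O.π v) ≡ pr v u
    pair-cond v u = trans (cong₂ _∧_ (odd-π u) (rev v u)) (par ((Run.low Sys κ-1 O) v u) refl)
      where
      par : ∀ b → (Run.low Sys κ-1 O) v u ≡ b → not (odd u) ∧ b ≡ odd v ∧ b
      par false _ = trans (Data.Bool.Properties.∧-zeroʳ (not (odd u))) (sym (Data.Bool.Properties.∧-zeroʳ (odd v)))
      par true  l = cong (_∧ true) (sym (adj-odd ((Run.low⇒adj Sys κ-1 O) l)))
    -- Reindexing by `π` turns the lower pairs of the second order into those of the first, so that
    -- both tilts run over the same pairs.
    tilt⁺ : (Tail.tilt Sys κ-1 O′) f ≡ F⁺ * ∏ vs (λ v → ∏ vs (rw⁺ v))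
    tilt⁺ = trans (∏-cong vs pt) (trans (∏-* vs (λ v → if odd v then (LocalBound.pfac Sys κ-1 O′) f v ^ δ else 1) (λ w → ∏ vs (g w))) (cong (F⁺ *_) (begin
      ∏ vs (λ w → ∏ vs (g w))
        ≡⟨ sym (∏-reindex E O.π O′.π π-π′ π′-π (λ w → ∏ vs (g w))) ⟩
      ∏ vs (λ u → ∏ vs (g (O.π u)))
        ≡⟨ ∏-cong vs (λ u → sym (∏-reindex E O.π O′.π π-π′ π′-π (g (O.π u)))) ⟩
      ∏ vs (λ u → ∏ vs (λ v → g (O.π u) (O.π v)))
        ≡⟨ ∏-swap vs vs (λ u v → g (O.π u) (O.π v)) ⟩
      ∏ vs (λ v → ∏ vs (λ u → g (O.π u) (O.π v)))
        ≡⟨ ∏-cong vs (λ v → ∏-cong vs (λ u → same v u)) ⟩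
      ∏ vs (λ v → ∏ vs (rw⁺ v)) ∎)))
      where
      open ≡-Reasoning
      g : V → V → ℕ
      g w y = if odd w ∧ (Run.low Sys κ-1 O′) w y then R * τ (A w) ((Run.hd Sys κ-1 O′) (O′.π y) f) (f y) else 1
      pt : ∀ v → (if odd v then (LocalBound.pfac Sys κ-1 O′) f v ^ δ * ∏ vs (λ y → (Run.rw Sys κ-1 O′) (A v) v y f (f y)) else 1) ≡ (if odd v then (LocalBound.pfac Sys κ-1 O′) f v ^ δ else 1) * ∏ vs (g v)
      pt v with odd v
      ... | true  = refl
      ... | false = sym (trans (+-identityʳ _) (∏-1 vs))
      same : ∀ v u → g (O.π u) (O.π v) ≡ rw⁺ v u
      same v u = cong₂ (λ b x → if b then R * τ (A (O.π u)) ((Run.hd Sys κ-1 O′) x f) (f (O.π v)) else 1) (pair-cond v u) (π′-π v)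

    pairs≤ : ∀ (b c : V → Bool) → (∀ v u → pr v u ≡ true → odd v ≡ true × odd (O.π u) ≡ true) →
             ∑ vs (λ v → ∑ vs (λ u → if pr v u then ⟦ b (O.π u) ⟧ + ⟦ c v ⟧ else 0))
             ≤ δ * (∑ vs (λ v → ⟦ odd v ∧ b v ⟧) + ∑ vs (λ v → ⟦ odd v ∧ c v ⟧))
    pairs≤ b c od = begin
      ∑ vs (λ v → ∑ vs (λ u → if pr v u then ⟦ b (O.π u) ⟧ + ⟦ c v ⟧ else 0))
        ≤⟨ ∑-mono vs (λ v → ∑-mono vs (λ u → pt v u (pr v u) refl)) ⟩
      ∑ vs (λ v → ∑ vs (λ u → ⟦ adj u v ⟧ * ⟦ odd (O.π u) ∧ b (O.π u) ⟧ + ⟦ adj v u ⟧ * ⟦ odd v ∧ c v ⟧))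
        ≡⟨ trans (∑-cong vs (λ v → ∑-+ vs (λ u → ⟦ adj u v ⟧ * ⟦ odd (O.π u) ∧ b (O.π u) ⟧) (λ u → ⟦ adj v u ⟧ * ⟦ odd v ∧ c v ⟧)))
             (∑-+ vs (λ v → ∑ vs (λ u → ⟦ adj u v ⟧ * ⟦ odd (O.π u) ∧ b (O.π u) ⟧)) (λ v → ∑ vs (λ u → ⟦ adj v u ⟧ * ⟦ odd v ∧ c v ⟧))) ⟩
      ∑ vs (λ v → ∑ vs (λ u → ⟦ adj u v ⟧ * ⟦ odd (O.π u) ∧ b (O.π u) ⟧)) + ∑ vs (λ v → ∑ vs (λ u → ⟦ adj v u ⟧ * ⟦ odd v ∧ c v ⟧))
        ≡⟨ cong₂ _+_ (trans (∑-swap vs vs (λ v u → ⟦ adj u v ⟧ * ⟦ odd (O.π u) ∧ b (O.π u) ⟧)) (trans (deg-sum (λ u → ⟦ odd (O.π u) ∧ b (O.π u) ⟧)) (cong (δ *_) (∑-reindex E O.π O′.π π-π′ π′-π (λ v → ⟦ odd v ∧ b v ⟧)))))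
                     (deg-sum (λ v → ⟦ odd v ∧ c v ⟧)) ⟩
      δ * ∑ vs (λ v → ⟦ odd v ∧ b v ⟧) + δ * ∑ vs (λ v → ⟦ odd v ∧ c v ⟧)
        ≡⟨ sym (*-distribˡ-+ δ (∑ vs (λ v → ⟦ odd v ∧ b v ⟧)) (∑ vs (λ v → ⟦ odd v ∧ c v ⟧))) ⟩
      δ * (∑ vs (λ v → ⟦ odd v ∧ b v ⟧) + ∑ vs (λ v → ⟦ odd v ∧ c v ⟧)) ∎
      where
      open ≤-Reasoning
      deg-sum : ∀ (g : V → ℕ) → ∑ vs (λ u → ∑ vs (λ v → ⟦ adj u v ⟧ * g u)) ≡ δ * ∑ vs g
      deg-sum g = trans (∑-cong vs (λ u → trans (∑-*ʳ vs (g u) (λ v → ⟦ adj u v ⟧)) (cong (_* g u) (deg u)))) (∑-*ˡ vs δ g)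
      pt : ∀ v u x → pr v u ≡ x → (if x then ⟦ b (O.π u) ⟧ + ⟦ c v ⟧ else 0) ≤ ⟦ adj u v ⟧ * ⟦ odd (O.π u) ∧ b (O.π u) ⟧ + ⟦ adj v u ⟧ * ⟦ odd v ∧ c v ⟧
      pt v u false _ = z≤n
      pt v u true  h = ≤-reflexive (sym (cong₂ _+_ (cong₂ (λ x y → ⟦ x ⟧ * ⟦ y ∧ b (O.π u) ⟧) (trans (adj-sym u v) a) (proj₂ (od v u h)))
                          (cong₂ (λ x y → ⟦ x ⟧ * ⟦ y ∧ c v ⟧) a (proj₁ (od v u h))) ■ cong₂ _+_ (+-identityʳ ⟦ b (O.π u) ⟧) (+-identityʳ ⟦ c v ⟧)))
        where
        _■_ : ∀ {x y z : ℕ} → x ≡ y → y ≡ z → x ≡ z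
        _■_ = trans
        a : adj v u ≡ true
        a = (Run.low⇒adj Sys κ-1 O) (proj₂ (∧-true {odd v} h))

    pr-odd : ∀ v u → pr v u ≡ true → odd v ≡ true × odd (O.π u) ≡ true
    pr-odd v u h = o , trans (odd-π u) (trans (sym (adj-odd ((Run.low⇒adj Sys κ-1 O) (proj₂ (∧-true {odd v} h))))) o)
      where
      o = proj₁ (∧-true {odd v} h)

    SB≤ : SB ≤ δ * (β⁻ + β⁺)
    SB≤ = pairs≤ b⁻ b⁺ pr-odd

    private
      ∏∏-* : ∀ (g h : V → V → ℕ) → ∏ vs (λ v → ∏ vs (λ u → g v u * h v u)) ≡ ∏ vs (λ v → ∏ vs (g v)) * ∏ vs (λ v → ∏ vs (h v))
      ∏∏-* g h = trans (∏-cong vs (λ v → ∏-* vs (g v) (h v))) (∏-* vs (λ v → ∏ vs (g v)) (λ v → ∏ vs (h v)))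

      ∏∏-pow : ∀ c (g : V → V → ℕ) → ∏ vs (λ v → ∏ vs (λ u → if pr v u then c ^ g v u else 1)) ≡ c ^ ∑ vs (λ v → ∑ vs (λ u → if pr v u then g v u else 0))
      ∏∏-pow c g = trans (∏-cong vs (λ v → trans (∏-cong vs (λ u → pt (pr v u) (g v u))) (∏-pow vs c (λ u → if pr v u then g v u else 0))))
                         (∏-pow vs c (λ v → ∑ vs (λ u → if pr v u then g v u else 0)))
        where
        pt : ∀ b x → (if b then c ^ x else 1) ≡ c ^ (if b then x else 0)
        pt true  x = refl
        pt false x = refl

      if-*³ : ∀ b (x y z : ℕ) → (if b then x * y * z else 1) ≡ (if b then x else 1) * (if b then y else 1) * (if b then z else 1)
      if-*³ true  x y z = refl
      if-*³ false x y z = refl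

      if-* : ∀ b (x y : ℕ) → (if b then x * y else 1) ≡ (if b then x else 1) * (if b then y else 1)
      if-* true  x y = refl
      if-* false x y = refl

      ∏∏-*³ : ∀ (g h k : V → V → ℕ) → ∏ vs (λ v → ∏ vs (λ u → if pr v u then g v u * h v u * k v u else 1))
              ≡ ∏ vs (λ v → ∏ vs (λ u → if pr v u then g v u else 1)) * ∏ vs (λ v → ∏ vs (λ u → if pr v u then h v u else 1)) * ∏ vs (λ v → ∏ vs (λ u → if pr v u then k v u else 1))
      ∏∏-*³ g h k = trans (∏-cong vs (λ v → ∏-cong vs (λ u → if-*³ (pr v u) (g v u) (h v u) (k v u))))
        (trans (∏∏-* (λ v u → (if pr v u then g v u else 1) * (if pr v u then h v u else 1)) (λ v u → if pr v u then k v u else 1))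
          (cong (_* ∏ vs (λ v → ∏ vs (λ u → if pr v u then k v u else 1))) (∏∏-* (λ v u → if pr v u then g v u else 1) (λ v u → if pr v u then h v u else 1))))

    NP : ℕ
    NP = ∑ vs (λ v → ∑ vs (λ u → ⟦ pr v u ⟧))

    Π⁻ Π⁺ : ℕ
    Π⁻ = ∏ vs (λ v → ∏ vs (rw⁻ v))
    Π⁺ = ∏ vs (λ v → ∏ vs (rw⁺ v))

    pairs-product : D ^ TR * (KK * RR) ^ NP * Q ^ SB ≤ KK ^ TR * (Π⁻ * Π⁺) * KK ^ SB
    pairs-product = begin
      D ^ TR * (KK * RR) ^ NP * Q ^ SB
        ≡⟨ cong₂ _*_ (cong₂ _*_ (sym (∏∏-pow D (λ v u → ⟦ ne v u ⟧))) (sym kr)) (sym (∏∏-pow Q s)) ⟩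
      ∏ vs (λ v → ∏ vs (λ u → if pr v u then D ^ ⟦ ne v u ⟧ else 1)) * ∏ vs (λ v → ∏ vs (λ u → if pr v u then KK * RR else 1)) * ∏ vs (λ v → ∏ vs (λ u → if pr v u then Q ^ s v u else 1))
        ≡⟨ sym (∏∏-*³ (λ v u → D ^ ⟦ ne v u ⟧) (λ _ _ → KK * RR) (λ v u → Q ^ s v u)) ⟩
      ∏ vs (λ v → ∏ vs (λ u → if pr v u then D ^ ⟦ ne v u ⟧ * (KK * RR) * Q ^ s v u else 1))
        ≤⟨ ∏-mono vs (λ v → ∏-mono vs (λ u → pt (pr v u) (pair v u))) ⟩
      ∏ vs (λ v → ∏ vs (λ u → if pr v u then KK ^ ⟦ ne v u ⟧ * (X⁻ v u * X⁺ v u) * KK ^ s v u else 1))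
        ≡⟨ ∏∏-*³ (λ v u → KK ^ ⟦ ne v u ⟧) (λ v u → X⁻ v u * X⁺ v u) (λ v u → KK ^ s v u) ⟩
      ∏ vs (λ v → ∏ vs (λ u → if pr v u then KK ^ ⟦ ne v u ⟧ else 1)) * ∏ vs (λ v → ∏ vs (λ u → if pr v u then X⁻ v u * X⁺ v u else 1)) * ∏ vs (λ v → ∏ vs (λ u → if pr v u then KK ^ s v u else 1))
        ≡⟨ cong₂ _*_ (cong₂ _*_ (∏∏-pow KK (λ v u → ⟦ ne v u ⟧)) xx) (∏∏-pow KK s) ⟩
      KK ^ TR * (Π⁻ * Π⁺) * KK ^ SB ∎
      where
      open ≤-Reasoning
      pt : ∀ b {x y : ℕ} → x ≤ y → (if b then x else 1) ≤ (if b then y else 1)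
      pt true  h = h
      pt false h = ≤-refl
      kr : ∏ vs (λ v → ∏ vs (λ u → if pr v u then KK * RR else 1)) ≡ (KK * RR) ^ NP
      kr = trans (∏-cong vs (λ v → ∏-if-const vs (pr v) (KK * RR))) (∏-pow vs (KK * RR) (λ v → ∑ vs (λ u → ⟦ pr v u ⟧)))
      xx : ∏ vs (λ v → ∏ vs (λ u → if pr v u then X⁻ v u * X⁺ v u else 1)) ≡ Π⁻ * Π⁺
      xx = trans (∏-cong vs (λ v → ∏-cong vs (λ u → if-* (pr v u) (X⁻ v u) (X⁺ v u)))) (∏∏-* rw⁻ rw⁺)

    private
      norm-gen : ∀ (J : V → ℕ) → ∏ vs (λ v → if odd v then P ^ δ * (K * R) ^ J v else 1) ≡ (P ^ δ) ^ N * (K * R) ^ ∑ vs (λ v → if odd v then J v else 0)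
      norm-gen J = trans (∏-cong vs (λ v → pt (odd v) (J v))) (trans (∏-* vs (λ v → if odd v then P ^ δ else 1) (λ v → (K * R) ^ (if odd v then J v else 0)))
        (cong₂ _*_ (∏-if-const vs odd (P ^ δ)) (∏-pow vs (K * R) (λ v → if odd v then J v else 0))))
        where
        pt : ∀ b j → (if b then P ^ δ * (K * R) ^ j else 1) ≡ (if b then P ^ δ else 1) * (K * R) ^ (if b then j else 0)
        pt true  j = refl
        pt false j = refl

      pull : ∀ (r : V → V → Bool) v → (if odd v then ∑ vs (λ u → ⟦ r v u ⟧) else 0) ≡ ∑ vs (λ u → ⟦ odd v ∧ r v u ⟧)
      pull r v with odd v
      ... | true  = refl
      ... | false = sym (∑-0 vs)

    norm⁻ : (Tail.norm Sys κ-1 O) ≡ (P ^ δ) ^ N * (K * R) ^ NP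
    norm⁻ = trans (norm-gen (Run.J Sys κ-1 O)) (cong (λ x → (P ^ δ) ^ N * (K * R) ^ x) (∑-cong vs (pull (Run.low Sys κ-1 O))))

    norm⁺ : (Tail.norm Sys κ-1 O′) ≡ (P ^ δ) ^ N * (K * R) ^ NP
    norm⁺ = trans (norm-gen (Run.J Sys κ-1 O′)) (cong (λ x → (P ^ δ) ^ N * (K * R) ^ x) (trans (∑-cong vs (pull (Run.low Sys κ-1 O′))) (begin
      ∑ vs (λ w → ∑ vs (λ y → ⟦ odd w ∧ (Run.low Sys κ-1 O′) w y ⟧))
        ≡⟨ sym (∑-reindex E O.π O′.π π-π′ π′-π (λ w → ∑ vs (λ y → ⟦ odd w ∧ (Run.low Sys κ-1 O′) w y ⟧))) ⟩
      ∑ vs (λ u → ∑ vs (λ y → ⟦ odd (O.π u) ∧ (Run.low Sys κ-1 O′) (O.π u) y ⟧))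
        ≡⟨ ∑-cong vs (λ u → sym (∑-reindex E O.π O′.π π-π′ π′-π (λ y → ⟦ odd (O.π u) ∧ (Run.low Sys κ-1 O′) (O.π u) y ⟧))) ⟩
      ∑ vs (λ u → ∑ vs (λ v → ⟦ odd (O.π u) ∧ (Run.low Sys κ-1 O′) (O.π u) (O.π v) ⟧))
        ≡⟨ ∑-swap vs vs (λ u v → ⟦ odd (O.π u) ∧ (Run.low Sys κ-1 O′) (O.π u) (O.π v) ⟧) ⟩
      ∑ vs (λ v → ∑ vs (λ u → ⟦ odd (O.π u) ∧ (Run.low Sys κ-1 O′) (O.π u) (O.π v) ⟧))
        ≡⟨ ∑-cong vs (λ v → ∑-cong vs (λ u → cong ⟦_⟧ (pair-cond v u))) ⟩
      NP ∎)))
      where open ≡-Reasoning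

    private
      F-gen : ∀ (b : V → Bool) → ∏ vs (λ v → if odd v then (if b v then suc P else P) ^ δ else 1) * P ^ (δ * ∑ vs (λ v → ⟦ odd v ∧ b v ⟧))
              ≡ (P ^ δ) ^ N * suc P ^ (δ * ∑ vs (λ v → ⟦ odd v ∧ b v ⟧))
      F-gen b = begin
        ∏ vs (λ v → if odd v then (if b v then suc P else P) ^ δ else 1) * P ^ (δ * β)
          ≡⟨ cong (∏ vs (λ v → if odd v then (if b v then suc P else P) ^ δ else 1) *_) (ex P) ⟩
        ∏ vs (λ v → if odd v then (if b v then suc P else P) ^ δ else 1) * ∏ vs (λ v → (P ^ δ) ^ ⟦ odd v ∧ b v ⟧)
          ≡⟨ sym (∏-* vs _ _) ⟩
        ∏ vs (λ v → (if odd v then (if b v then suc P else P) ^ δ else 1) * (P ^ δ) ^ ⟦ odd v ∧ b v ⟧)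
          ≡⟨ ∏-cong vs (λ v → pt (odd v) (b v)) ⟩
        ∏ vs (λ v → (if odd v then P ^ δ else 1) * (suc P ^ δ) ^ ⟦ odd v ∧ b v ⟧)
          ≡⟨ trans (∏-* vs _ _) (cong₂ _*_ (∏-if-const vs odd (P ^ δ)) (sym (ex (suc P)))) ⟩
        (P ^ δ) ^ N * suc P ^ (δ * β) ∎
        where
        open ≡-Reasoning
        β = ∑ vs (λ v → ⟦ odd v ∧ b v ⟧)
        ex : ∀ x → x ^ (δ * β) ≡ ∏ vs (λ v → (x ^ δ) ^ ⟦ odd v ∧ b v ⟧)
        ex x = trans (sym (^-*-assoc x δ β)) (sym (∏-pow vs (x ^ δ) (λ v → ⟦ odd v ∧ b v ⟧)))
        pt : ∀ o c → (if o then (if c then suc P else P) ^ δ else 1) * (P ^ δ) ^ ⟦ o ∧ c ⟧ ≡ (if o then P ^ δ else 1) * (suc P ^ δ) ^ ⟦ o ∧ c ⟧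
        pt true  true  = trans (cong (suc P ^ δ *_) (*-identityʳ (P ^ δ))) (trans (*-comm (suc P ^ δ) (P ^ δ)) (cong (P ^ δ *_) (sym (*-identityʳ (suc P ^ δ)))))
        pt true  false = refl
        pt false c     = refl

    β : ℕ
    β = β⁻ + β⁺

    -- In the product of the two tilts, every change between good ends and each of the `δ`
    -- allowances of a bad vertex leaves a factor `D / KK`.
    core : D ^ (TR + δ * β) * ((Tail.norm Sys κ-1 O) * (Tail.norm Sys κ-1 O′)) ≤ KK ^ (TR + δ * β) * ((Tail.tilt Sys κ-1 O) f * (Tail.tilt Sys κ-1 O′) f)
    core with m≤n⇒∃[o]m+o≡n SB≤
    -- Here `t` counts the allowances among `δ β` that no pair claims; for them `Q ≤ KK` suffices.
    ... | t , SB+t = *-cancelˡ (P ^ x * Q ^ x) (*-mono-≤ (1≤^ x (LocalBound.1≤P Sys κ-1 O)) (1≤^ x 1≤Q)) (begin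
      P ^ x * Q ^ x * (D ^ (TR + x) * ((Tail.norm Sys κ-1 O) * (Tail.norm Sys κ-1 O′)))
        ≡⟨ cong₂ (λ a b → P ^ x * a * b) (trans (cong (Q ^_) (sym SB+t)) (^-distribˡ-+-* Q SB t))
             (cong₂ _*_ (^-distribˡ-+-* D TR x) (cong₂ _*_ norm⁻ norm⁺)) ⟩
      P ^ x * (Q ^ SB * Q ^ t) * (D ^ TR * D ^ x * (p * (K * R) ^ NP * (p * (K * R) ^ NP)))
        ≡⟨ l₁ (P ^ x) (Q ^ SB) (Q ^ t) (D ^ TR) (D ^ x) p ((K * R) ^ NP) ⟩
      (D ^ TR * ((K * R) ^ NP * (K * R) ^ NP) * Q ^ SB) * Q ^ t * (D ^ x * P ^ x) * (p * p)
        ≡⟨ cong₂ (λ a b → (D ^ TR * a * Q ^ SB) * Q ^ t * b * (p * p)) (trans (sym (*-^ (K * R) (K * R) NP)) (cong (_^ NP) (l₂ K R))) (sym (*-^ D P x)) ⟩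
      (D ^ TR * (KK * RR) ^ NP * Q ^ SB) * Q ^ t * (D * P) ^ x * (p * p)
        ≤⟨ *-monoˡ-≤ (p * p) (*-mono-≤ (*-mono-≤ pairs-product (^-monoˡ-≤ t (*-mono-≤ q≤K q≤K))) (^-monoˡ-≤ x DP≤)) ⟩
      (KK ^ TR * (Π⁻ * Π⁺) * KK ^ SB) * KK ^ t * (suc P * Q) ^ x * (p * p)
        ≡⟨ cong (λ a → (KK ^ TR * (Π⁻ * Π⁺) * KK ^ SB) * KK ^ t * a * (p * p)) (trans (*-^ (suc P) Q x) (cong (_* Q ^ x) sp)) ⟩
      (KK ^ TR * (Π⁻ * Π⁺) * KK ^ SB) * KK ^ t * (suc P ^ (δ * β⁻) * suc P ^ (δ * β⁺) * Q ^ x) * (p * p)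
        ≡⟨ l₃ (KK ^ TR) Π⁻ Π⁺ (KK ^ SB) (KK ^ t) (suc P ^ (δ * β⁻)) (suc P ^ (δ * β⁺)) (Q ^ x) p ⟩
      Q ^ x * (KK ^ TR * (KK ^ SB * KK ^ t)) * ((p * suc P ^ (δ * β⁻)) * (p * suc P ^ (δ * β⁺))) * (Π⁻ * Π⁺)
        ≡⟨ cong₂ (λ a b → Q ^ x * (KK ^ TR * a) * b * (Π⁻ * Π⁺)) (trans (sym (^-distribˡ-+-* KK SB t)) (cong (KK ^_) SB+t)) (cong₂ _*_ (sym (F-gen b⁻)) (sym (F-gen b⁺))) ⟩
      Q ^ x * (KK ^ TR * KK ^ x) * ((F⁻ * P ^ (δ * β⁻)) * (F⁺ * P ^ (δ * β⁺))) * (Π⁻ * Π⁺)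
        ≡⟨ l₄ (Q ^ x) (KK ^ TR * KK ^ x) F⁻ (P ^ (δ * β⁻)) F⁺ (P ^ (δ * β⁺)) Π⁻ Π⁺ ⟩
      (P ^ (δ * β⁻) * P ^ (δ * β⁺)) * Q ^ x * (KK ^ TR * KK ^ x * (F⁻ * Π⁻ * (F⁺ * Π⁺)))
        ≡⟨ cong₂ (λ a b → a * Q ^ x * b) (sym pp) (cong₂ _*_ (sym (^-distribˡ-+-* KK TR x)) (cong₂ _*_ (sym tilt⁻) (sym tilt⁺))) ⟩
      P ^ x * Q ^ x * (KK ^ (TR + x) * ((Tail.tilt Sys κ-1 O) f * (Tail.tilt Sys κ-1 O′) f)) ∎)
      where
      open ≤-Reasoning
      x = δ * β
      p = (P ^ δ) ^ N
      1≤Q : 1 ≤ Q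
      1≤Q = *-mono-≤ 1≤q 1≤q
        where
        1≤q : 1 ≤ q
        1≤q = ≤-trans (m≤n+m 1 (3 * Λ + 6 * Λ * P)) (≤-reflexive (sym q≡))
      split : ∀ a → a ^ x ≡ a ^ (δ * β⁻) * a ^ (δ * β⁺)
      split a = trans (cong (a ^_) (*-distribˡ-+ δ β⁻ β⁺)) (^-distribˡ-+-* a (δ * β⁻) (δ * β⁺))
      sp = split (suc P)
      pp = split P
      l₁ : ∀ a b c d g p k → a * (b * c) * (d * g * (p * k * (p * k))) ≡ (d * (k * k) * b) * c * (g * a) * (p * p)
      l₁ = solve-∀
      l₂ : ∀ k r → k * r * (k * r) ≡ k * k * (r * r)
      l₂ = solve-∀
      l₃ : ∀ a x y b c g h z p → (a * (x * y) * b) * c * (g * h * z) * (p * p) ≡ z * (a * (b * c)) * ((p * g) * (p * h)) * (x * y)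
      l₃ = solve-∀
      l₄ : ∀ z a f g h k x y → z * a * ((f * g) * (h * k)) * (x * y) ≡ (g * k) * z * (a * (f * x * (h * y)))
      l₄ = solve-∀

    -- Two small tilts have a small product, but by `core` it doubles with every `KK` changes, as
    -- `(1 + 1 / KK) ^ KK ≥ 2`.
    few : ∀ c⁻ c⁺ → (2 ^ c⁻ * (Tail.norm Sys κ-1 O) ≤ᵇ (Tail.tilt Sys κ-1 O) f) ≡ false → (2 ^ c⁺ * (Tail.norm Sys κ-1 O′) ≤ᵇ (Tail.tilt Sys κ-1 O′) f) ≡ false →
          TR + δ * β ≤ (c⁻ + c⁺) * KK
    few c⁻ c⁺ h⁻ h⁺ with TR + δ * β ≤? (c⁻ + c⁺) * KK
    ... | yes h = h
    ... | no ¬h with m≤n⇒∃[o]m+o≡n (<⇒≤ (≰⇒> ¬h))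
    ...   | t , e₁ = ⊥-elim (<⇒≱ tilts< (≤-trans (*-monoˡ-≤ nn grow) core))
      where
      open ≤-Reasoning
      x = TR + δ * β
      c = c⁻ + c⁺
      nn = (Tail.norm Sys κ-1 O) * (Tail.norm Sys κ-1 O′)
      grow : KK ^ x * 2 ^ c ≤ D ^ x
      grow = begin
        KK ^ x * 2 ^ c
          ≡⟨ cong (λ y → KK ^ y * 2 ^ c) (sym e₁) ⟩
        KK ^ (c * KK + t) * 2 ^ c
          ≡⟨ cong (_* 2 ^ c) (trans (^-distribˡ-+-* KK (c * KK) t) (cong (_* KK ^ t) (ex KK))) ⟩
        (KK ^ KK) ^ c * KK ^ t * 2 ^ c
          ≡⟨ l₁ ((KK ^ KK) ^ c) (KK ^ t) (2 ^ c) ⟩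
        2 ^ c * (KK ^ KK) ^ c * KK ^ t
          ≡⟨ cong (_* KK ^ t) (sym (*-^ 2 (KK ^ KK) c)) ⟩
        (2 * KK ^ KK) ^ c * KK ^ t
          ≤⟨ *-mono-≤ (^-monoˡ-≤ c (double-≤ (K′ + K′ * K))) (^-monoˡ-≤ t (n≤1+n KK)) ⟩
        (D ^ KK) ^ c * D ^ t
          ≡⟨ cong (_* D ^ t) (sym (ex D)) ⟩
        D ^ (c * KK) * D ^ t
          ≡⟨ trans (sym (^-distribˡ-+-* D (c * KK) t)) (cong (D ^_) e₁) ⟩
        D ^ x ∎
        where
        ex : ∀ a → a ^ (c * KK) ≡ (a ^ KK) ^ c
        ex a = trans (cong (a ^_) (*-comm c KK)) (sym (^-*-assoc a KK c))
        l₁ : ∀ a b d → a * b * d ≡ d * a * b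
        l₁ = solve-∀
      lt : ∀ {a b} → (a ≤ᵇ b) ≡ false → b < a
      lt {a} {b} h = ≰⇒> (λ a≤b → true≢false (T⇒≡ (≤⇒≤ᵇ a≤b)) h)
      lt⁻ : (Tail.tilt Sys κ-1 O) f < 2 ^ c⁻ * (Tail.norm Sys κ-1 O)
      lt⁻ = lt {2 ^ c⁻ * (Tail.norm Sys κ-1 O)} {(Tail.tilt Sys κ-1 O) f} h⁻
      lt⁺ : (Tail.tilt Sys κ-1 O′) f < 2 ^ c⁺ * (Tail.norm Sys κ-1 O′)
      lt⁺ = lt {2 ^ c⁺ * (Tail.norm Sys κ-1 O′)} {(Tail.tilt Sys κ-1 O′) f} h⁺
      tilts< : KK ^ x * ((Tail.tilt Sys κ-1 O) f * (Tail.tilt Sys κ-1 O′) f) < KK ^ x * 2 ^ c * nn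
      tilts< = begin-strict
        KK ^ x * ((Tail.tilt Sys κ-1 O) f * (Tail.tilt Sys κ-1 O′) f)
          <⟨ *-monoʳ-< (KK ^ x) {{>-nonZero (1≤^ {KK} x (s≤s z≤n))}} (*-mono-< lt⁻ lt⁺) ⟩
        KK ^ x * (2 ^ c⁻ * (Tail.norm Sys κ-1 O) * (2 ^ c⁺ * (Tail.norm Sys κ-1 O′)))
          ≡⟨ l₂ (KK ^ x) (2 ^ c⁻) (Tail.norm Sys κ-1 O) (2 ^ c⁺) (Tail.norm Sys κ-1 O′) ⟩
        KK ^ x * (2 ^ c⁻ * 2 ^ c⁺) * nn
          ≡⟨ cong (λ y → KK ^ x * y * nn) (sym (^-distribˡ-+-* 2 c⁻ c⁺)) ⟩
        KK ^ x * 2 ^ c * nn ∎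
        where
        l₂ : ∀ k a n b m → k * (a * n * (b * m)) ≡ k * (a * b) * (n * m)
        l₂ = solve-∀

    changes : ℕ
    changes = ∑ vs (λ v → ∑ vs (λ u → if pr v u then ⟦ changed v u ⟧ else 0))

    -- A change has two good ends or is charged to a bad one, which takes part in at most `δ` pairs.
    changes≤ : changes ≤ TR + δ * β
    changes≤ = ≤-trans (∑-mono vs (λ v → ∑-mono vs (λ u → pt (pr v u) (b⁻ (O.π u)) (b⁺ v) (changed v u))))
      (≤-trans (≤-reflexive (trans (∑-cong vs (λ v → ∑-+ vs (λ u → if pr v u then ⟦ ne v u ⟧ else 0) (λ u → if pr v u then s v u else 0)))
        (∑-+ vs (λ v → ∑ vs (λ u → if pr v u then ⟦ ne v u ⟧ else 0)) (λ v → ∑ vs (λ u → if pr v u then s v u else 0))))) (+-monoʳ-≤ TR SB≤))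
      where
      pt : ∀ p x y c → (if p then ⟦ c ⟧ else 0) ≤ (if p then ⟦ (not x ∧ not y) ∧ c ⟧ else 0) + (if p then ⟦ x ⟧ + ⟦ y ⟧ else 0)
      pt false x     y     c = z≤n
      pt true  false false c = m≤m+n ⟦ c ⟧ 0
      pt true  false true  c = ⟦⟧≤1 c
      pt true  true  y     c = ≤-trans (⟦⟧≤1 c) (s≤s z≤n)

    β⁻≤ : β⁻ ≤ TR + δ * β
    β⁻≤ = ≤-trans (≤-trans (m≤m+n β⁻ β⁺) (m≤m+n β (deg-1 * β))) (m≤n+m (δ * β) TR)


-- The even cycle and the torus: heights, levels, matchings

module Cycle (k M : ℕ) (m≡ : suc (suc k) ≡ M + M) where

  m : ℕ
  m = suc (suc k)

  succ pred : Fin m → Fin m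
  succ a = fromℕ< (m%n<n (suc (toℕ a)) m)
  pred zero    = fromℕ (suc k)
  pred (suc i) = inject₁ i

  toℕ-succ : ∀ a → toℕ (succ a) ≡ suc (toℕ a) % m
  toℕ-succ a = Fin.toℕ-fromℕ< _

  data Step (a : Fin m) : Set where
    up   : suc (toℕ a) < m → toℕ (succ a) ≡ suc (toℕ a) → Step a
    wrap : suc (toℕ a) ≡ m → toℕ (succ a) ≡ 0 → Step a

  step : ∀ a → Step a
  step a with m≤n⇒m<n∨m≡n (Fin.toℕ<n a)
  ... | inj₁ p = up p (trans (toℕ-succ a) (m<n⇒m%n≡m p))
  ... | inj₂ p = wrap p (trans (toℕ-succ a) (trans (cong (_% m) p) (n%n≡0 m)))

  succ-pred : ∀ a → succ (pred a) ≡ a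
  succ-pred zero    = Fin.toℕ-injective (trans (toℕ-succ (fromℕ (suc k))) (trans (cong (λ x → suc x % m) (Fin.toℕ-fromℕ (suc k))) (n%n≡0 m)))
  succ-pred (suc i) = Fin.toℕ-injective (trans (toℕ-succ (inject₁ i)) (trans (cong (λ x → suc x % m) (Fin.toℕ-inject₁ i)) (m<n⇒m%n≡m (s≤s (Fin.toℕ<n i)))))

  toℕ-pred : ∀ a {j} → toℕ a ≡ suc j → toℕ (pred a) ≡ j
  toℕ-pred (suc i) e = trans (Fin.toℕ-inject₁ i) (suc-injective e)

  suc-toℕ-pred : ∀ a → 1 ≤ toℕ a → suc (toℕ (pred a)) ≡ toℕ a
  suc-toℕ-pred (suc i) _ = cong suc (Fin.toℕ-inject₁ i)

  pred-succ : ∀ a → pred (succ a) ≡ a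
  pred-succ a with step a
  ... | up p e   = Fin.toℕ-injective (toℕ-pred (succ a) e)
  ... | wrap p e = Fin.toℕ-injective (trans (cong (toℕ ∘ pred) (Fin.toℕ-injective {i = succ a} {zero} e)) (trans (Fin.toℕ-fromℕ (suc k)) (sym (suc-injective p))))

  diff1⁻ : ∀ {a b : Fin m} → diff1 a b ≡ true → b ≡ succ a ⊎ a ≡ succ b
  diff1⁻ {a} {b} h with suc (toℕ a) % m ≡ᵇ toℕ b in e
  ... | true  = inj₁ (Fin.toℕ-injective (sym (trans (toℕ-succ a) (≡ᵇ-true e))))
  ... | false = inj₂ (Fin.toℕ-injective (sym (trans (toℕ-succ b) (≡ᵇ-true h))))

  diff1-succ : ∀ (a : Fin m) → diff1 a (succ a) ≡ true
  diff1-succ a rewrite ≡⇒≡ᵇ≡ (sym (toℕ-succ a)) = refl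

  diff1-sym : ∀ (a b : Fin m) → diff1 a b ≡ diff1 b a
  diff1-sym a b = Data.Bool.Properties.∨-comm (suc (toℕ a) % m ≡ᵇ toℕ b) (suc (toℕ b) % m ≡ᵇ toℕ a)

  diff1-pred : ∀ a → diff1 a (pred a) ≡ true
  diff1-pred a = trans (diff1-sym a (pred a)) (subst (λ x → diff1 (pred a) x ≡ true) (succ-pred a) (diff1-succ (pred a)))

  succ-inj : ∀ {a b} → succ a ≡ succ b → a ≡ b
  succ-inj {a} {b} e = trans (sym (pred-succ a)) (trans (cong pred e) (pred-succ b))

  bool-ext : ∀ {a b} → (a ≡ true → b ≡ true) → (b ≡ true → a ≡ true) → a ≡ b
  bool-ext {true}  {true}  f g = refl
  bool-ext {false} {false} f g = refl
  bool-ext {true}  {false} f g = sym (f refl)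
  bool-ext {false} {true}  f g = g refl

  diff1-inv : ∀ a b → diff1 (succ a) (succ b) ≡ diff1 a b
  diff1-inv a b = bool-ext f g
    where
    f : diff1 (succ a) (succ b) ≡ true → diff1 a b ≡ true
    f h with diff1⁻ {succ a} {succ b} h
    ... | inj₁ e = subst (λ x → diff1 a x ≡ true) (sym (succ-inj e)) (diff1-succ a)
    ... | inj₂ e = trans (diff1-sym a b) (subst (λ x → diff1 b x ≡ true) (sym (succ-inj e)) (diff1-succ b))
    g : diff1 a b ≡ true → diff1 (succ a) (succ b) ≡ true
    g h with diff1⁻ {a} {b} h
    ... | inj₁ refl = diff1-succ (succ a)
    ... | inj₂ refl = trans (diff1-sym (succ (succ b)) (succ b)) (diff1-succ (succ b))

  -- The degree of the cycle, obtained by counting: 1 for `m = 2`, where both steps lead to the same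
  -- point, and 2 otherwise.
  ν : ℕ
  ν = ∑ (allFin m) (λ b → ⟦ diff1 {m} zero b ⟧)

  ∑diff1 : ∀ a → ∑ (allFin m) (λ b → ⟦ diff1 a b ⟧) ≡ ν
  ∑diff1 a = go (toℕ a) a refl
    where
    shift : ∀ a → ∑ (allFin m) (λ b → ⟦ diff1 (succ a) b ⟧) ≡ ∑ (allFin m) (λ b → ⟦ diff1 a b ⟧)
    shift a = trans (sym (∑-reindex (FinEnum m) succ pred succ-pred pred-succ (λ b → ⟦ diff1 (succ a) b ⟧)))
                (∑-cong (allFin m) (λ b → cong ⟦_⟧ (diff1-inv a b)))
    go : ∀ j a → toℕ a ≡ j → ∑ (allFin m) (λ b → ⟦ diff1 a b ⟧) ≡ ν
    go zero    a e = cong (λ a → ∑ (allFin m) (λ b → ⟦ diff1 a b ⟧)) (Fin.toℕ-injective {j = zero} e)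
    go (suc j) a e = trans (cong (λ a → ∑ (allFin m) (λ b → ⟦ diff1 a b ⟧)) (sym (succ-pred a)))
                       (trans (shift (pred a)) (go j (pred a) (toℕ-pred a e)))

  1≤ν : 1 ≤ ν
  1≤ν = ≤-trans (≤-reflexive (sym (cong ⟦_⟧ (diff1-succ zero)))) (≤∑ (FinEnum m) (λ b → ⟦ diff1 {m} zero b ⟧) (succ zero))

  ν≤m : ν ≤ m
  ν≤m = ≤-trans (∑-mono (allFin m) (λ b → ⟦⟧≤1 (diff1 {m} zero b))) (≤-reflexive (trans (∑-constF m 1) (*-identityʳ m)))

  even? : ℕ → Bool
  even? t = (t % 2) ≡ᵇ 0

  even-suc : ∀ t → even? (suc t) ≡ not (even? t)
  even-suc zero          = refl
  even-suc (suc zero)    = refl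
  even-suc (suc (suc t)) = trans (cong (λ x → x ≡ᵇ 0) (mod2 (suc t))) (trans (even-suc t) (cong (λ x → not (x ≡ᵇ 0)) (sym (mod2 t))))
    where
    mod2 : ∀ t → suc (suc t) % 2 ≡ t % 2
    mod2 t = trans (cong (_% 2) (+-comm 2 t)) ([m+n]%n≡m%n t 2)

  even-double : ∀ t → even? (t + t) ≡ true
  even-double zero    = refl
  even-double (suc t) = trans (cong even? (cong suc (+-suc t t))) (trans (even-suc (suc (t + t))) (trans (cong not (even-suc (t + t)))
    (trans (Data.Bool.Properties.not-involutive _) (even-double t))))

  even-+ : ∀ s t → even? s ≡ not (even? t) → ∀ r → even? (s + r) ≡ not (even? (t + r))
  even-+ s t h zero    = trans (cong even? (+-identityʳ s)) (trans h (cong (not ∘ even?) (sym (+-identityʳ t))))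
  even-+ s t h (suc r) = trans (cong even? (+-suc s r)) (trans (even-suc (s + r)) (cong not
    (trans (even-+ s t h r) (trans (sym (even-suc (t + r))) (cong even? (sym (+-suc t r)))))))

  even-succ : ∀ a → even? (toℕ (succ a)) ≡ not (even? (toℕ a))
  even-succ a with step a
  ... | up p e   = trans (cong even? e) (even-suc (toℕ a))
  ... | wrap p e = trans (cong even? e) (sym (trans (sym (even-suc (toℕ a))) (trans (cong even? (trans p m≡)) (even-double M))))

  diff1-parity : ∀ a b → diff1 a b ≡ true → even? (toℕ a) ≡ not (even? (toℕ b))
  diff1-parity a b h with diff1⁻ {a} {b} h
  ... | inj₁ refl = sym (trans (cong not (even-succ a)) (Data.Bool.Properties.not-involutive _))
  ... | inj₂ refl = even-succ b

  diff1-irrefl : ∀ a → diff1 a a ≡ false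
  diff1-irrefl a = ¬true (λ h → no-fix (even? (toℕ a)) (diff1-parity a a h))
    where
    no-fix : ∀ b → b ≡ not b → ⊥
    no-fix true  ()
    no-fix false ()

  -- Each step of the cycle changes the height by exactly one, and only one point has no way down;
  -- that point makes vertices with few descents rare.
  record Height : Set where
    field
      g       : Fin m → ℕ
      steps   : ∀ a b → diff1 a b ≡ true → g b ≡ suc (g a) ⊎ g a ≡ suc (g b)
      down    : ∀ a → 1 ≤ g a → ∃[ b ] (diff1 a b ≡ true × suc (g b) ≡ g a)
      bottom  : Fin m
      bottom! : ∀ a → g a ≡ 0 → a ≡ bottom

  -- The distance from 0 around the cycle.
  h : Fin m → ℕ
  h a = toℕ a ⊓ (m ∸ toℕ a)

  h-low : ∀ a → toℕ a ≤ M → h a ≡ toℕ a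
  h-low a l = m≤n⇒m⊓n≡m (≤-trans (≤-reflexive (sym (m+n∸n≡m (toℕ a) (toℕ a)))) (∸-monoˡ-≤ (toℕ a) (≤-trans (+-mono-≤ l l) (≤-reflexive (sym m≡)))))

  h-high : ∀ a → M ≤ toℕ a → h a ≡ m ∸ toℕ a
  h-high a l = m≥n⇒m⊓n≡n (≤-trans (∸-monoʳ-≤ m l) (≤-trans (≤-reflexive (trans (cong (_∸ M) m≡) (m+n∸n≡m M M))) l))

  h-succ-low : ∀ a → toℕ a < M → h (succ a) ≡ suc (h a)
  h-succ-low a l with step a
  ... | up p e   = trans (h-low (succ a) (≤-trans (≤-reflexive e) l)) (trans e (cong suc (sym (h-low a (<⇒≤ l)))))
  ... | wrap p e = ⊥-elim (<⇒≱ (m<m+n M (≤-trans (s≤s z≤n) l)) (≤-trans (≤-reflexive (trans (sym m≡) (sym p))) l))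

  h-succ-high : ∀ a → M ≤ toℕ a → suc (h (succ a)) ≡ h a
  h-succ-high a l with step a
  ... | up p e   = trans (cong suc (trans (h-high (succ a) (≤-trans l (≤-trans (n≤1+n _) (≤-reflexive (sym e))))) (cong (m ∸_) e)))
                     (trans (sym (+-∸-assoc 1 (<⇒≤ p))) (sym (h-high a l)))
  ... | wrap p e = trans (cong suc (trans (h-low (succ a) (≤-trans (≤-reflexive e) z≤n)) e))
                     (sym (trans (h-high a l) (trans (cong (_∸ toℕ a) (sym p)) (trans (+-∸-assoc 1 (≤-refl {toℕ a})) (cong suc (n∸n≡0 (toℕ a)))))))

  h-succ : ∀ a → h (succ a) ≡ suc (h a) ⊎ h a ≡ suc (h (succ a))
  h-succ a with toℕ a <? M
  ... | yes l = inj₁ (h-succ-low a l)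
  ... | no ¬l = inj₂ (sym (h-succ-high a (≮⇒≥ ¬l)))

  h-steps : ∀ a b → diff1 a b ≡ true → h b ≡ suc (h a) ⊎ h a ≡ suc (h b)
  h-steps a b d with diff1⁻ {a} {b} d
  ... | inj₁ refl = h-succ a
  ... | inj₂ refl = swap⊎ (h-succ b)

  h≤M : ∀ a → h a ≤ M
  h≤M a with ≤-total (toℕ a) M
  ... | inj₁ l = ≤-trans (≤-reflexive (h-low a l)) l
  ... | inj₂ l = ≤-trans (≤-reflexive (h-high a l)) (≤-trans (∸-monoʳ-≤ m l) (≤-reflexive (trans (cong (_∸ M) m≡) (m+n∸n≡m M M))))

  M<m : M < m
  M<m = ≤-trans (m<m+n M 1≤M) (≤-reflexive (sym m≡))
    where
    1≤M : 1 ≤ M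
    1≤M = ≮⇒≥ (λ M<1 → <⇒≱ (≤-trans (s≤s z≤n) (≤-reflexive m≡)) (+-mono-≤ (≤-pred M<1) (≤-pred M<1)))

  height : Height
  height = record { g = h ; steps = h-steps ; down = dn ; bottom = zero ; bottom! = bt }
    where
    dn : ∀ a → 1 ≤ h a → ∃[ b ] (diff1 a b ≡ true × suc (h b) ≡ h a)
    dn a l with toℕ a ≤? M
    ... | no ¬p = succ a , diff1-succ a , h-succ-high a (<⇒≤ (≰⇒> ¬p))
    ... | yes p = pred a , diff1-pred a , trans (sym (h-succ-low (pred a) lt)) (cong h (succ-pred a))
      where
      lt : toℕ (pred a) < M
      lt = ≤-trans (≤-reflexive (suc-toℕ-pred a (≤-trans l (m⊓n≤m (toℕ a) (m ∸ toℕ a))))) p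
    bt : ∀ a → h a ≡ 0 → a ≡ zero
    bt a e with ≤-total (toℕ a) M
    ... | inj₁ l = Fin.toℕ-injective (trans (sym (h-low a l)) e)
    ... | inj₂ l = ⊥-elim (<⇒≱ (Fin.toℕ<n a) (m∸n≡0⇒m≤n (trans (sym (h-high a l)) e)))

  coheight : Height
  coheight = record { g = λ a → M ∸ h a ; steps = st ; down = dn ; bottom = fromℕ< M<m ; bottom! = bt }
    where
    flip : ∀ a b → h b ≡ suc (h a) → M ∸ h a ≡ suc (M ∸ h b)
    flip a b e = trans (+-∸-assoc 1 {M} {suc (h a)} (≤-trans (≤-reflexive (sym e)) (h≤M b))) (cong (λ x → suc (M ∸ x)) (sym e))
    st : ∀ a b → diff1 a b ≡ true → M ∸ h b ≡ suc (M ∸ h a) ⊎ M ∸ h a ≡ suc (M ∸ h b)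
    st a b d with h-steps a b d
    ... | inj₁ e = inj₂ (flip a b e)
    ... | inj₂ e = inj₁ (flip b a e)
    dn : ∀ a → 1 ≤ M ∸ h a → ∃[ b ] (diff1 a b ≡ true × suc (M ∸ h b) ≡ M ∸ h a)
    dn a l with toℕ a <? M
    ... | yes p = succ a , diff1-succ a , sym (flip a (succ a) (h-succ-low a p))
    ... | no ¬p = pred a , diff1-pred a , sym (flip a (pred a) (trans (sym (h-succ-high (pred a) M≤)) (cong (suc ∘ h) (succ-pred a))))
      where
      M<a : M < toℕ a
      M<a = ≤∧≢⇒< (≮⇒≥ ¬p) (λ e → <⇒≱ l (≤-reflexive (trans (cong (M ∸_) (trans (h-low a (≤-reflexive (sym e))) (sym e))) (n∸n≡0 M))))
      M≤ : M ≤ toℕ (pred a)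
      M≤ = ≤-pred (≤-trans M<a (≤-reflexive (sym (suc-toℕ-pred a (≤-trans (s≤s z≤n) M<a)))))
    bt : ∀ a → M ∸ h a ≡ 0 → a ≡ fromℕ< M<m
    bt a e = Fin.toℕ-injective (trans (≤-antisym a≤M M≤a) (sym (Fin.toℕ-fromℕ< M<m)))
      where
      M≤h : M ≤ h a
      M≤h = m∸n≡0⇒m≤n e
      M≤a : M ≤ toℕ a
      M≤a = ≤-trans M≤h (m⊓n≤m (toℕ a) (m ∸ toℕ a))
      a≤M : toℕ a ≤ M
      a≤M = ≤-trans (≤-reflexive (sym (m∸[m∸n]≡n (<⇒≤ (Fin.toℕ<n a))))) (≤-trans (∸-monoʳ-≤ m (≤-trans M≤h (m⊓n≤n (toℕ a) (m ∸ toℕ a)))) (≤-reflexive (trans (cong (_∸ M) m≡) (m+n∸n≡m M M))))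

  abstract
    -- With `κ = 8 m`, a vertex at which a quarter of the `e` tail coordinates can be lowered
    -- satisfies `κ J ≥ 2 m e ≥ δ`.
    κ-1 : ℕ
    κ-1 = 8 * m ∸ 1

    κ≡ : suc κ-1 ≡ 8 * m
    κ≡ = refl


module Torus (k M : ℕ) (m≡ : suc (suc k) ≡ M + M) where
  open Cycle k M m≡

  eqFin≡ : ∀ (a b : Fin m) → eqFin a b ≡ does (a Fin.≟ b)
  eqFin≡ a b = bool-ext (λ e → dec-true (a Fin.≟ b) (Fin.toℕ-injective (≡ᵇ-true e))) (g (a Fin.≟ b))
    where
    g : ∀ (d : Dec (a ≡ b)) → does d ≡ true → eqFin a b ≡ true
    g (yes e) _ = ≡⇒≡ᵇ≡ (cong toℕ e)

  _≟ᵛ_ : ∀ {d} → DecidableEquality (Vertex m d)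
  _≟ᵛ_ = Vec.≡-dec Fin._≟_

  -- Adjacency in a form suited to induction on the dimension. The relation `r` on one coordinate
  -- stays open, so that steps downwards can be counted in the same way.
  nbr : (Fin m → Fin m → Bool) → ∀ {d} → Vertex m d → Vertex m d → Bool
  nbr r []       []       = false
  nbr r (x ∷ xs) (y ∷ ys) = (does (x Fin.≟ y) ∧ nbr r xs ys) ∨ (r x y ∧ does (xs ≟ᵛ ys))

  does-true : ∀ {A : Set} (d : Dec A) → does d ≡ true → A
  does-true (yes a) _ = a

  numDiff-self : ∀ {d} (xs : Vertex m d) → numDiff xs xs ≡ 0
  numDiff-self []       = refl
  numDiff-self (x ∷ xs) rewrite ≡⇒≡ᵇ≡ {toℕ x} refl = numDiff-self xs

  numDiff-0 : ∀ {d} (xs ys : Vertex m d) → numDiff xs ys ≡ 0 → xs ≡ ys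
  numDiff-0 []       []       _ = refl
  numDiff-0 (x ∷ xs) (y ∷ ys) e with toℕ x ≡ᵇ toℕ y in eq
  ... | true  = cong₂ _∷_ (Fin.toℕ-injective (≡ᵇ-true eq)) (numDiff-0 xs ys e)

  allEq-self : ∀ {d} (xs : Vertex m d) → allEqOrDiff1 xs xs ≡ true
  allEq-self []       = refl
  allEq-self (x ∷ xs) rewrite ≡⇒≡ᵇ≡ {toℕ x} refl = allEq-self xs

  eq-numDiff : ∀ {d} (xs ys : Vertex m d) → allEqOrDiff1 xs ys ∧ (numDiff xs ys ≡ᵇ 0) ≡ does (xs ≟ᵛ ys)
  eq-numDiff xs ys = bool-ext
    (λ e → dec-true (xs ≟ᵛ ys) (numDiff-0 xs ys (≡ᵇ-true (proj₂ (∧-true {allEqOrDiff1 xs ys} e)))))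
    (λ e → f (does-true (xs ≟ᵛ ys) e))
    where
    f : xs ≡ ys → allEqOrDiff1 xs ys ∧ (numDiff xs ys ≡ᵇ 0) ≡ true
    f refl = cong₂ _∧_ (allEq-self xs) (≡⇒≡ᵇ≡ (numDiff-self xs))

  adj-nbr : ∀ {d} (u v : Vertex m d) → torusAdj u v ≡ nbr diff1 u v
  adj-nbr []       []       = refl
  adj-nbr (x ∷ xs) (y ∷ ys) rewrite sym (eqFin≡ x y) with eqFin x y in eq
  ... | true rewrite Fin.toℕ-injective {i = x} {y} (≡ᵇ-true eq) | diff1-irrefl y = trans (adj-nbr xs ys) (sym (Data.Bool.Properties.∨-identityʳ _))
  ... | false with diff1 x y
  ...   | true  = eq-numDiff xs ys
  ...   | false = refl

  nbr-sym : ∀ r → (∀ a b → r a b ≡ r b a) → ∀ {d} (u v : Vertex m d) → nbr r u v ≡ nbr r v u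
  nbr-sym r rs []       []       = refl
  nbr-sym r rs (x ∷ xs) (y ∷ ys) = cong₂ _∨_ (cong₂ _∧_ (does-sym (x Fin.≟ y) (y Fin.≟ x)) (nbr-sym r rs xs ys))
                                             (cong₂ _∧_ (rs x y) (does-sym (xs ≟ᵛ ys) (ys ≟ᵛ xs)))
    where
    does-sym : ∀ {A : Set} {a b : A} (p : Dec (a ≡ b)) (q : Dec (b ≡ a)) → does p ≡ does q
    does-sym p q = bool-ext (λ e → dec-true q (sym (does-true p e))) (λ e → dec-true p (sym (does-true q e)))

  data Nbr (r : Fin m → Fin m → Bool) {d} (x y : Fin m) (xs ys : Vertex m d) : Set where
    tail : x ≡ y → nbr r xs ys ≡ true → Nbr r x y xs ys
    head : r x y ≡ true → xs ≡ ys → Nbr r x y xs ys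

  nbr⁻ : ∀ r {d} x y (xs ys : Vertex m d) → nbr r (x ∷ xs) (y ∷ ys) ≡ true → Nbr r x y xs ys
  nbr⁻ r x y xs ys h with does (x Fin.≟ y) ∧ nbr r xs ys in e
  ... | true  = tail (does-true (x Fin.≟ y) (proj₁ (∧-true {does (x Fin.≟ y)} e))) (proj₂ (∧-true {does (x Fin.≟ y)} e))
  ... | false = head (proj₁ (∧-true {r x y} h)) (does-true (xs ≟ᵛ ys) (proj₂ (∧-true {r x y} h)))

  nbr-tail : ∀ r {d} x (xs ys : Vertex m d) → nbr r xs ys ≡ true → nbr r (x ∷ xs) (x ∷ ys) ≡ true
  nbr-tail r x xs ys h rewrite dec-true (x Fin.≟ x) refl | h = refl

  nbr-head : ∀ r {d} x y (xs : Vertex m d) → r x y ≡ true → nbr r (x ∷ xs) (y ∷ xs) ≡ true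
  nbr-head r x y xs h rewrite h | dec-true (xs ≟ᵛ xs) refl = Data.Bool.Properties.∨-zeroʳ _

  deg-at : (Fin m → Fin m → Bool) → Fin m → ℕ
  deg-at r x = ∑ (allFin m) (λ b → ⟦ r x b ⟧)

  ∑v : ∀ {d} → (Fin m → ℕ) → Vertex m d → ℕ
  ∑v c []       = 0
  ∑v c (x ∷ xs) = c x + ∑v c xs

  count-nbr : ∀ r → (∀ a → r a a ≡ false) → ∀ {d} (xs : Vertex m d) →
              ∑ (allVerts m d) (λ ys → ⟦ nbr r xs ys ⟧) ≡ ∑v (deg-at r) xs
  count-nbr r irr []       = refl
  count-nbr r irr {suc d} (x ∷ xs) = begin
    ∑ (allVerts m (suc d)) (λ ys → ⟦ nbr r (x ∷ xs) ys ⟧)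
      ≡⟨ ∑-concatMap (λ y → map (y ∷_) (allVerts m d)) (allFin m) _ ⟩
    ∑ (allFin m) (λ y → ∑ (map (y ∷_) (allVerts m d)) (λ ys → ⟦ nbr r (x ∷ xs) ys ⟧))
      ≡⟨ ∑-cong (allFin m) (λ y → trans (∑-map (y ∷_) (allVerts m d) _) (trans (∑-cong (allVerts m d) (λ ys → pt y ys)) (trans (∑-+ (allVerts m d) _ _) (cong₂ _+_ (p₁ y) (p₂ y))))) ⟩
    ∑ (allFin m) (λ y → ⟦ does (y Fin.≟ x) ⟧ * c + ⟦ r x y ⟧)
      ≡⟨ trans (∑-+ (allFin m) (λ y → ⟦ does (y Fin.≟ x) ⟧ * c) (λ y → ⟦ r x y ⟧)) (cong (_+ deg-at r x) (∑-δ (FinEnum m) (λ _ → c) x)) ⟩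
    c + deg-at r x
      ≡⟨ trans (+-comm c (deg-at r x)) (cong (deg-at r x +_) (count-nbr r irr xs)) ⟩
    deg-at r x + ∑v (deg-at r) xs ∎
    where
    open ≡-Reasoning
    c = ∑ (allVerts m d) (λ ys → ⟦ nbr r xs ys ⟧)
    pt : ∀ y ys → ⟦ nbr r (x ∷ xs) (y ∷ ys) ⟧ ≡ ⟦ does (y Fin.≟ x) ⟧ * ⟦ nbr r xs ys ⟧ + ⟦ r x y ⟧ * ⟦ does (ys ≟ᵛ xs) ⟧
    pt y ys with x Fin.≟ y | y Fin.≟ x | xs ≟ᵛ ys | ys ≟ᵛ xs
    ... | yes p | no q | _ | _ = ⊥-elim (q (sym p))
    ... | no p | yes q | _ | _ = ⊥-elim (p (sym q))
    ... | _ | _ | yes p | no q = ⊥-elim (q (sym p))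
    ... | _ | _ | no p | yes q = ⊥-elim (p (sym q))
    ... | yes refl | yes _ | a | b rewrite irr x = trans (cong ⟦_⟧ (Data.Bool.Properties.∨-identityʳ (nbr r xs ys))) (lem ⟦ nbr r xs ys ⟧)
      where
      lem : ∀ z → z ≡ 1 * z + 0
      lem = solve-∀
    ... | no _ | no _ | yes _ | yes _ = trans (⟦∧⟧ (r x y) true) refl
    ... | no _ | no _ | no _ | no _ = ⟦∧⟧ (r x y) false
    p₁ : ∀ y → ∑ (allVerts m d) (λ ys → ⟦ does (y Fin.≟ x) ⟧ * ⟦ nbr r xs ys ⟧) ≡ ⟦ does (y Fin.≟ x) ⟧ * c
    p₁ y = ∑-*ˡ (allVerts m d) ⟦ does (y Fin.≟ x) ⟧ (λ ys → ⟦ nbr r xs ys ⟧)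
    p₂ : ∀ y → ∑ (allVerts m d) (λ ys → ⟦ r x y ⟧ * ⟦ does (ys ≟ᵛ xs) ⟧) ≡ ⟦ r x y ⟧
    p₂ y = trans (∑-*ˡ (allVerts m d) ⟦ r x y ⟧ (λ ys → ⟦ does (ys ≟ᵛ xs) ⟧)) (trans (cong (⟦ r x y ⟧ *_) (Enum.once (VertexEnum m d) xs)) (*-identityʳ _))

  ∑v-const : ∀ {d} (c : Fin m → ℕ) z → (∀ a → c a ≡ z) → ∀ (xs : Vertex m d) → ∑v c xs ≡ d * z
  ∑v-const c z h []       = refl
  ∑v-const c z h (x ∷ xs) = cong₂ _+_ (h x) (∑v-const c z h xs)

  ∑v-mono : ∀ {d} (c c′ : Fin m → ℕ) → (∀ a → c a ≤ c′ a) → ∀ (xs : Vertex m d) → ∑v c xs ≤ ∑v c′ xs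
  ∑v-mono c c′ h []       = z≤n
  ∑v-mono c c′ h (x ∷ xs) = +-mono-≤ (h x) (∑v-mono c c′ h xs)

  parity-nbr : ∀ {d} (u v : Vertex m d) → nbr diff1 u v ≡ true → even? (coordSum u) ≡ not (even? (coordSum v))
  parity-nbr [] [] ()
  parity-nbr (x ∷ xs) (y ∷ ys) h with nbr⁻ diff1 x y xs ys h
  ... | tail refl t = trans (cong even? (+-comm (toℕ x) (coordSum xs)))
        (trans (even-+ (coordSum xs) (coordSum ys) (parity-nbr xs ys t) (toℕ x)) (cong (not ∘ even?) (+-comm (coordSum ys) (toℕ x))))
  ... | head t refl = even-+ (toℕ x) (toℕ y) (diff1-parity x y t) (coordSum xs)

  module Sys (n : ℕ) (H : Adj n) (H-sym : ∀ i j → H i j ≡ H j i)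
             (wgt : Fin n → ℕ) (1≤wgt : ∀ c → 1 ≤ wgt c) (e : ℕ) where

    V : Set
    V = Vertex m (suc e)

    abstract
      deg-1 : ℕ
      deg-1 = suc e * ν ∸ 1

      δ≡ : suc deg-1 ≡ suc e * ν
      δ≡ = m+[n∸m]≡n (≤-trans 1≤ν (m≤m+n ν (e * ν)))

    sys : System
    sys = record
      { V = V ; E = VertexEnum m (suc e) ; n = n ; H = H ; H-sym = H-sym ; wgt = wgt ; 1≤wgt = 1≤wgt
      ; adj = torusAdj
      ; adj-sym = λ u v → trans (adj-nbr u v) (trans (nbr-sym diff1 diff1-sym u v) (sym (adj-nbr v u)))
      ; odd = isOdd
      ; adj-odd = λ {u} {v} a → cong not (parity-nbr u v (trans (sym (adj-nbr u v)) a))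
      ; deg-1 = deg-1
      ; deg = λ v → trans (∑-cong (allVerts m (suc e)) (λ u → cong ⟦_⟧ (adj-nbr v u)))
                (trans (count-nbr diff1 diff1-irrefl v) (trans (∑v-const (deg-at diff1) ν ∑diff1 v) (sym δ≡)))
      }

    -- Levels ignore the head coordinate, in which the matched neighbour lies.
    level : (Fin m → ℕ) → V → ℕ
    level g (x ∷ xs) = ∑v g xs

    nbr-level : ∀ (Ht : Height) {d} (xs ys : Vertex m d) → nbr diff1 xs ys ≡ true →
                ∑v (Height.g Ht) ys ≡ suc (∑v (Height.g Ht) xs) ⊎ ∑v (Height.g Ht) xs ≡ suc (∑v (Height.g Ht) ys)
    nbr-level Ht [] [] ()
    nbr-level Ht (x ∷ xs) (y ∷ ys) h with nbr⁻ diff1 x y xs ys h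
    ... | tail refl t with nbr-level Ht xs ys t
    ...   | inj₁ p = inj₁ (trans (cong (Height.g Ht x +_) p) (+-suc _ _))
    ...   | inj₂ p = inj₂ (trans (cong (Height.g Ht x +_) p) (+-suc _ _))
    nbr-level Ht (x ∷ xs) (y ∷ ys) h | head t refl with Height.steps Ht x y t
    ...   | inj₁ p = inj₁ (cong (_+ ∑v (Height.g Ht) xs) p)
    ...   | inj₂ p = inj₂ (cong (_+ ∑v (Height.g Ht) xs) p)

    adj-level : ∀ Ht v u → torusAdj v u ≡ true → level (Height.g Ht) v ≤ suc (level (Height.g Ht) u)
    adj-level Ht (x ∷ xs) (y ∷ ys) a with nbr⁻ diff1 x y xs ys (trans (sym (adj-nbr (x ∷ xs) (y ∷ ys))) a)
    ... | head _ refl = n≤1+n _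
    ... | tail _ t with nbr-level Ht xs ys t
    ...   | inj₁ p = ≤-trans (n≤1+n _) (≤-trans (≤-reflexive (sym p)) (n≤1+n _))
    ...   | inj₂ p = ≤-reflexive p

    hmap : (Fin m → Fin m) → V → V
    hmap s (x ∷ xs) = s x ∷ xs

    ordering : Height → (s : Fin m → Fin m) → (∀ a → diff1 a (s a) ≡ true) → Ordering sys
    ordering Ht s ds = record
      { lev = level (Height.g Ht) ; lev-adj = λ {v} {u} → adj-level Ht v u ; π = hmap s
      ; lev-π = λ { (x ∷ xs) → refl }
      ; adj-π = λ { (x ∷ xs) → trans (adj-nbr (x ∷ xs) (s x ∷ xs)) (nbr-head diff1 x (s x) xs (ds x)) } }

    -- With `u` one level below an odd `v`, the first two orders compare the palette of `v` with
    -- that at `u` shifted by `succ` in the head coordinate, the primed ones with that at `u`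
    -- shifted by `pred`.
    O↑ O↓ O↑′ O↓′ : Ordering sys
    O↑  = ordering height succ diff1-succ
    O↓  = ordering coheight pred diff1-pred
    O↑′ = ordering height pred diff1-pred
    O↓′ = ordering coheight succ diff1-succ

    -- The levels for `h` and `M - h` add up to the constant `e M`, so going down becomes going up;
    -- the shift of the head is an automorphism that preserves levels.
    reversal : ∀ s p ds dp → (∀ a → s (p a) ≡ a) → (∀ a → p (s a) ≡ a) → (∀ a b → diff1 (s a) (s b) ≡ diff1 a b) →
               Reversal (ordering height s ds) (ordering coheight p dp)
    reversal s p ds dp sp ps inv = record
      { π-π′ = λ { (x ∷ xs) → cong (_∷ xs) (sp x) } ; π′-π = λ { (x ∷ xs) → cong (_∷ xs) (ps x) } ; rev = rv }
      where
      adj-inv : ∀ v u → torusAdj (hmap s u) (hmap s v) ≡ torusAdj v u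
      adj-inv (x ∷ xs) (y ∷ ys) = trans (adj-nbr (s y ∷ ys) (s x ∷ xs)) (trans (cong₂ _∨_ (cong (_∧ nbr diff1 ys xs) eqs) (cong (_∧ does (ys ≟ᵛ xs)) (inv y x)))
         (trans (nbr-sym diff1 diff1-sym (y ∷ ys) (x ∷ xs)) (sym (adj-nbr (x ∷ xs) (y ∷ ys)))))
        where
        eqs : does (s y Fin.≟ s x) ≡ does (y Fin.≟ x)
        eqs = bool-ext (λ e → dec-true (y Fin.≟ x) (trans (sym (ps y)) (trans (cong p (does-true (s y Fin.≟ s x) e)) (ps x))))
                       (λ e → dec-true (s y Fin.≟ s x) (cong s (does-true (y Fin.≟ x) e)))
      total : ∀ {d} (xs : Vertex m d) → ∑v (λ a → M ∸ h a) xs + ∑v h xs ≡ d * M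
      total []       = refl
      total (x ∷ xs) = trans (lem (M ∸ h x) (∑v (λ a → M ∸ h a) xs) (h x) (∑v h xs)) (cong₂ _+_ (m∸n+n≡m (h≤M x)) (total xs))
        where
        lem : ∀ a b c d → a + b + (c + d) ≡ (a + c) + (b + d)
        lem = solve-∀
      tot : ∀ v → level (λ a → M ∸ h a) v + level h v ≡ e * M
      tot (x ∷ xs) = total xs
      co : ∀ v → level (λ a → M ∸ h a) (hmap s v) ≡ level (λ a → M ∸ h a) v
      co (x ∷ xs) = refl
      lev-flip : ∀ v u → (suc (level (λ a → M ∸ h a) v) ≡ᵇ level (λ a → M ∸ h a) u) ≡ (suc (level h u) ≡ᵇ level h v)
      lev-flip v u = bool-ext
          (λ q → ≡⇒≡ᵇ≡ (+-cancelˡ-≡ a′ (suc (level h u)) (level h v) (trans (+-suc a′ (level h u)) (trans (cong (_+ level h u) (≡ᵇ-true {suc a′} q)) (trans (tot u) (sym (tot v)))))))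
          (λ q → ≡⇒≡ᵇ≡ (+-cancelʳ-≡ (level h u) (suc a′) b′ (trans (sym (+-suc a′ (level h u))) (trans (cong (a′ +_) (≡ᵇ-true {suc (level h u)} q)) (trans (tot v) (sym (tot u)))))))
        where
        a′ = level (λ a → M ∸ h a) v
        b′ = level (λ a → M ∸ h a) u
      rv : ∀ v u → System.lower sys (level (λ a → M ∸ h a)) (hmap s u) (hmap s v) ≡ System.lower sys (level h) v u
      rv v u = cong₂ _∧_ (adj-inv v u) (trans (cong₂ (λ a b → suc a ≡ᵇ b) (co v) (co u)) (lev-flip v u))

    pred-inv : ∀ a b → diff1 (pred a) (pred b) ≡ diff1 a b
    pred-inv a b = trans (sym (diff1-inv (pred a) (pred b))) (cong₂ diff1 (succ-pred a) (succ-pred b))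

    ρ : Reversal O↑ O↓
    ρ = reversal succ pred diff1-succ diff1-pred succ-pred pred-succ diff1-inv

    ρ′ : Reversal O↑′ O↓′
    ρ′ = reversal pred succ diff1-pred diff1-succ pred-succ succ-pred pred-inv

    slack : Height → V → ℕ
    slack Ht (x ∷ xs) = ∑v (λ a → ⟦ 1 ≤ᵇ Height.g Ht a ⟧) xs

    -- Every tail coordinate off the bottom can be lowered, and each choice gives another lower
    -- neighbour.
    slack≤J : ∀ Ht v → slack Ht v ≤ ∑ (allVerts m (suc e)) (λ u → ⟦ System.lower sys (level (Height.g Ht)) v u ⟧)
    slack≤J Ht (x ∷ xs) = begin
      ∑v (λ a → ⟦ 1 ≤ᵇ g a ⟧) xs
        ≤⟨ ∑v-mono (λ a → ⟦ 1 ≤ᵇ g a ⟧) (deg-at r) pt xs ⟩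
      ∑v (deg-at r) xs
        ≡⟨ sym (count-nbr r irr xs) ⟩
      ∑ (allVerts m e) (λ ys → ⟦ nbr r xs ys ⟧)
        ≤⟨ ∑-mono (allVerts m e) (λ ys → imp (nbr r xs ys) (System.lower sys (level g) (x ∷ xs) (x ∷ ys)) (down-lower ys)) ⟩
      ∑ (allVerts m e) (λ ys → ⟦ System.lower sys (level g) (x ∷ xs) (x ∷ ys) ⟧)
        ≡⟨ sym (∑-map (x ∷_) (allVerts m e) _) ⟩
      ∑ (map (x ∷_) (allVerts m e)) (λ u → ⟦ System.lower sys (level g) (x ∷ xs) u ⟧)
        ≤⟨ ≤∑ (FinEnum m) (λ y → ∑ (map (y ∷_) (allVerts m e)) (λ u → ⟦ System.lower sys (level g) (x ∷ xs) u ⟧)) x ⟩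
      ∑ (allFin m) (λ y → ∑ (map (y ∷_) (allVerts m e)) (λ u → ⟦ System.lower sys (level g) (x ∷ xs) u ⟧))
        ≡⟨ sym (∑-concatMap (λ y → map (y ∷_) (allVerts m e)) (allFin m) _) ⟩
      ∑ (allVerts m (suc e)) (λ u → ⟦ System.lower sys (level g) (x ∷ xs) u ⟧) ∎
      where
      open ≤-Reasoning
      open Height Ht
      r : Fin m → Fin m → Bool
      r a b = diff1 a b ∧ (suc (g b) ≡ᵇ g a)
      irr : ∀ a → r a a ≡ false
      irr a rewrite diff1-irrefl a = refl
      imp : ∀ a b → (a ≡ true → b ≡ true) → ⟦ a ⟧ ≤ ⟦ b ⟧
      imp false b f = z≤n
      imp true  b f rewrite f refl = ≤-refl
      pt : ∀ a → ⟦ 1 ≤ᵇ g a ⟧ ≤ deg-at r a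
      pt a with 1 ≤ᵇ g a in p
      ... | false = z≤n
      ... | true with down a (≤ᵇ⇒≤ 1 (g a) (≡⇒T p))
      ...   | b , d , q = ≤-trans (≤-reflexive (cong ⟦_⟧ (sym (cong₂ _∧_ d (≡⇒≡ᵇ≡ q))))) (≤∑ (FinEnum m) (λ b → ⟦ r a b ⟧) b)
      r-step : ∀ {d} (xs ys : Vertex m d) → nbr r xs ys ≡ true → nbr diff1 xs ys ≡ true × suc (∑v g ys) ≡ ∑v g xs
      r-step [] [] ()
      r-step (x ∷ xs) (y ∷ ys) h with nbr⁻ r x y xs ys h
      ... | tail refl t = nbr-tail diff1 x xs ys (proj₁ (r-step xs ys t)) , trans (sym (+-suc (g x) _)) (cong (g x +_) (proj₂ (r-step xs ys t)))
      ... | head t refl = nbr-head diff1 x y xs (proj₁ (∧-true {diff1 x y} t)) , cong (_+ ∑v g xs) (≡ᵇ-true {suc (g y)} (proj₂ (∧-true {diff1 x y} t)))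
      down-lower : ∀ ys → nbr r xs ys ≡ true → System.lower sys (level g) (x ∷ xs) (x ∷ ys) ≡ true
      down-lower ys h with r-step xs ys h
      ... | a , l = cong₂ _∧_ (trans (adj-nbr (x ∷ xs) (x ∷ ys)) (nbr-tail diff1 x xs ys a)) (≡⇒≡ᵇ≡ l)

    few-slack : Height → V → Bool
    few-slack Ht v = 4 * slack Ht v <ᵇ e


-- From few changes to a dominant palette

∑-const-1 : ∀ (l : List X) → ∑ l (λ _ → 1) ≡ length l
∑-const-1 l = trans (∑-const l 1) (*-identityʳ _)

pigeonhole : ∀ (l : List X) (f : X → ℕ) B → 1 ≤ length l → ∑ l f ≤ length l * B → ∃[ x ] f x ≤ B
pigeonhole (x ∷ l) f B _ = go x l
  where
  go : ∀ x l → ∑ (x ∷ l) f ≤ length (x ∷ l) * B → ∃[ x ] f x ≤ B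
  go x []      h = x , ≤-trans (m≤m+n (f x) 0) (≤-trans h (≤-reflexive (+-identityʳ B)))
  go x (y ∷ l) h with f x ≤? B
  ... | yes p = x , p
  ... | no ¬p = go y l (+-cancelˡ-≤ B _ _ (≤-trans (+-monoˡ-≤ (∑ (y ∷ l) f) (<⇒≤ (≰⇒> ¬p))) h))

length-allVerts : ∀ m d → length (allVerts m d) ≡ m ^ d
length-allVerts m zero    = refl
length-allVerts m (suc d) = trans (sym (∑-const-1 (allVerts m (suc d)))) (trans (∑-concatMap (λ x → map (x ∷_) (allVerts m d)) (allFin m) (λ _ → 1))
  (trans (∑-cong (allFin m) (λ x → trans (∑-map (x ∷_) (allVerts m d) (λ _ → 1)) (trans (∑-const-1 (allVerts m d)) (length-allVerts m d)))) (∑-constF m (m ^ d))))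

∑-verts : ∀ m d (f : Vertex m (suc d) → ℕ) → ∑ (allVerts m (suc d)) f ≡ ∑ (allFin m) (λ x → ∑ (allVerts m d) (λ xs → f (x ∷ xs)))
∑-verts m d f = trans (∑-concatMap (λ x → map (x ∷_) (allVerts m d)) (allFin m) f) (∑-cong (allFin m) (λ x → ∑-map (x ∷_) (allVerts m d) f))

module Majority (k M : ℕ) (m≡ : suc (suc k) ≡ M + M) {X : Set} (_≟_ : DecidableEquality X) where
  open Cycle k M m≡
  open Torus k M m≡

  ne : X → X → ℕ
  ne a b = ⟦ not (does (a ≟ b)) ⟧

  ne-tri : ∀ a b c → ne a c ≤ ne a b + ne b c
  ne-tri a b c with a ≟ b | b ≟ c | a ≟ c
  ... | _        | _        | yes _ = z≤n
  ... | no _     | _        | no _  = s≤s z≤n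
  ... | yes _    | no _     | no _  = ≤-refl
  ... | yes refl | yes refl | no q  = ⊥-elim (q refl)

  ne-sym : ∀ a b → ne a b ≡ ne b a
  ne-sym a b with a ≟ b | b ≟ a
  ... | yes _ | yes _ = refl
  ... | no _  | no _  = refl
  ... | yes p | no q  = ⊥-elim (q (sym p))
  ... | no p  | yes q = ⊥-elim (p (sym q))

  ne-self : ∀ a → ne a a ≡ 0
  ne-self a = cong (λ b → ⟦ not b ⟧) (dec-true (a ≟ a) refl)

  -- Either the line contains a change, and the right side is at least 1, or `ψ` is constant on it.
  line : ∀ (ψ : Fin m → X) x y → ne (ψ x) (ψ y) ≤ ∑ (allFin m) (λ z → ne (ψ z) (ψ (succ z)))
  line ψ x y with ∑ (allFin m) (λ z → ne (ψ z) (ψ (succ z))) in eq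
  ... | suc _ = ≤-trans (⟦⟧≤1 (not (does (ψ x ≟ ψ y)))) (s≤s z≤n)
  ... | zero  = ≤-reflexive (trans (cong₂ ne (const (toℕ x) x refl) (const (toℕ y) y refl)) (ne-self (ψ zero)))
    where
    same : ∀ z → ψ z ≡ ψ (succ z)
    same z with ψ z ≟ ψ (succ z) in d
    ... | yes p = p
    ... | no _  = ⊥-elim (<⇒≱ (≤-trans (≤-reflexive (sym (cong (λ b → ⟦ not (does b) ⟧) d))) (≤∑ (FinEnum m) (λ z → ne (ψ z) (ψ (succ z))) z)) (≤-reflexive eq))
    const : ∀ j x → toℕ x ≡ j → ψ x ≡ ψ zero
    const zero    x e = cong ψ (Fin.toℕ-injective {j = zero} e)
    const (suc j) x e = trans (cong ψ (sym (succ-pred x))) (trans (sym (same (pred x))) (const j (pred x) (toℕ-pred x e)))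

  -- Changes along all coordinate lines, each step taken in the positive direction.
  chg : ∀ d → (Vertex m d → X) → ℕ
  chg zero    Ψ = 0
  chg (suc d) Ψ = ∑ (allVerts m d) (λ xs → ∑ (allFin m) (λ x → ne (Ψ (x ∷ xs)) (Ψ (succ x ∷ xs))))
                  + ∑ (allFin m) (λ x → chg d (Ψ ∘ (x ∷_)))

  -- A canonical-path argument: one vertex is moved to the other coordinate by coordinate, and a
  -- move can alter the value only if its line contains a change.
  pairs : ∀ d (Ψ : Vertex m d → X) → ∑ (allVerts m d) (λ v → ∑ (allVerts m d) (λ w → ne (Ψ v) (Ψ w))) ≤ m ^ d * (m * chg d Ψ)
  pairs zero    Ψ rewrite ne-self (Ψ []) = z≤n
  pairs (suc d) Ψ = begin
    ∑ (allVerts m (suc d)) (λ v → ∑ (allVerts m (suc d)) (λ w → ne (Ψ v) (Ψ w)))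
      ≡⟨ trans (∑-verts m d (λ v → ∑ (allVerts m (suc d)) (λ w → ne (Ψ v) (Ψ w)))) (∑-cong F (λ x → ∑-cong W (λ xs → ∑-verts m d (λ w → ne (Ψ (x ∷ xs)) (Ψ w))))) ⟩
    ∑ F (λ x → ∑ W (λ xs → ∑ F (λ y → ∑ W (λ ys → ne (Ψ (x ∷ xs)) (Ψ (y ∷ ys))))))
      ≤⟨ ∑-mono F (λ x → ∑-mono W (λ xs → ∑-mono F (λ y → ∑-mono W (λ ys →
           ≤-trans (ne-tri (Ψ (x ∷ xs)) (Ψ (y ∷ xs)) (Ψ (y ∷ ys))) (+-monoˡ-≤ (ne (Ψ (y ∷ xs)) (Ψ (y ∷ ys))) (line (λ z → Ψ (z ∷ xs)) x y)))))) ⟩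
    ∑ F (λ x → ∑ W (λ xs → ∑ F (λ y → ∑ W (λ ys → l xs + ne (Ψ (y ∷ xs)) (Ψ (y ∷ ys))))))
      ≡⟨ ∑-cong F (λ _ → ∑-cong W (λ xs → trans (∑-cong F (λ y → trans (∑-+ W (λ _ → l xs) (λ ys → ne (Ψ (y ∷ xs)) (Ψ (y ∷ ys)))) (cong (_+ ∑ W (λ ys → ne (Ψ (y ∷ xs)) (Ψ (y ∷ ys)))) (cW (l xs)))))
           (trans (∑-+ F (λ _ → m ^ d * l xs) (λ y → ∑ W (λ ys → ne (Ψ (y ∷ xs)) (Ψ (y ∷ ys))))) (cong (_+ ∑ F (λ y → ∑ W (λ ys → ne (Ψ (y ∷ xs)) (Ψ (y ∷ ys))))) (∑-constF m (m ^ d * l xs)))))) ⟩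
    ∑ F (λ _ → ∑ W (λ xs → m * (m ^ d * l xs) + ∑ F (λ y → ∑ W (λ ys → ne (Ψ (y ∷ xs)) (Ψ (y ∷ ys))))))
      ≡⟨ trans (∑-constF m (∑ W (λ xs → m * (m ^ d * l xs) + ∑ F (λ y → ∑ W (λ ys → ne (Ψ (y ∷ xs)) (Ψ (y ∷ ys))))))) (cong (m *_) (∑-+ W (λ xs → m * (m ^ d * l xs)) (λ xs → ∑ F (λ y → ∑ W (λ ys → ne (Ψ (y ∷ xs)) (Ψ (y ∷ ys))))))) ⟩
    m * (∑ W (λ xs → m * (m ^ d * l xs)) + ∑ W (λ xs → ∑ F (λ y → ∑ W (λ ys → ne (Ψ (y ∷ xs)) (Ψ (y ∷ ys))))))
      ≡⟨ cong₂ (λ a b → m * (a + b)) (trans (∑-*ˡ W m (λ xs → m ^ d * l xs)) (cong (m *_) (∑-*ˡ W (m ^ d) l))) (∑-swap W F (λ xs y → ∑ W (λ ys → ne (Ψ (y ∷ xs)) (Ψ (y ∷ ys))))) ⟩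
    m * (m * (m ^ d * ∑ W l) + ∑ F (λ y → ∑ W (λ xs → ∑ W (λ ys → ne (Ψ (y ∷ xs)) (Ψ (y ∷ ys))))))
      ≤⟨ *-monoʳ-≤ m (+-monoʳ-≤ (m * (m ^ d * ∑ W l)) (≤-trans (∑-mono F (λ y → pairs d (Ψ ∘ (y ∷_))))
           (≤-reflexive (trans (∑-*ˡ F (m ^ d) (λ y → m * chg d (Ψ ∘ (y ∷_)))) (cong (m ^ d *_) (∑-*ˡ F m (λ y → chg d (Ψ ∘ (y ∷_))))))))) ⟩
    m * (m * (m ^ d * ∑ W l) + m ^ d * (m * ∑ F (λ y → chg d (Ψ ∘ (y ∷_)))))
      ≡⟨ lem m (m ^ d) (∑ W l) (∑ F (λ y → chg d (Ψ ∘ (y ∷_)))) ⟩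
    m ^ suc d * (m * chg (suc d) Ψ) ∎
    where
    open ≤-Reasoning
    F = allFin m
    W = allVerts m d
    l : Vertex m d → ℕ
    l xs = ∑ F (λ z → ne (Ψ (z ∷ xs)) (Ψ (succ z ∷ xs)))
    cW : ∀ c → ∑ W (λ _ → c) ≡ m ^ d * c
    cW c = trans (∑-const W c) (cong (_* c) (length-allVerts m d))
    lem : ∀ m p a b → m * (m * (p * a) + p * (m * b)) ≡ m * p * (m * (a + b))
    lem = solve-∀

  -- The average over `w` of the number of disagreements is at most `m` times the number of changes.
  majority : ∀ d (Ψ : Vertex m d → X) → ∃[ w ] ∑ (allVerts m d) (λ v → ne (Ψ v) (Ψ w)) ≤ m * chg d Ψ
  majority d Ψ = pigeonhole (allVerts m d) (λ w → ∑ (allVerts m d) (λ v → ne (Ψ v) (Ψ w))) (m * chg d Ψ)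
    (≤-trans (1≤^ {m} d (s≤s z≤n)) (≤-reflexive (sym (length-allVerts m d))))
    (≤-trans (≤-reflexive (∑-swap (allVerts m d) (allVerts m d) (λ w v → ne (Ψ v) (Ψ w))))
      (≤-trans (pairs d Ψ) (≤-reflexive (cong (_* (m * chg d Ψ)) (sym (length-allVerts m d))))))

  chg≤ : ∀ d (Ψ : Vertex m d → X) → chg d Ψ ≤ ∑ (allVerts m d) (λ v → ∑ (allVerts m d) (λ w → ⟦ nbr diff1 v w ⟧ * ne (Ψ v) (Ψ w)))
  chg≤ zero    Ψ = z≤n
  chg≤ (suc d) Ψ = begin
    ∑ W (λ xs → ∑ F (λ x → ne (Ψ (x ∷ xs)) (Ψ (succ x ∷ xs)))) + ∑ F (λ x → chg d (Ψ ∘ (x ∷_)))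
      ≤⟨ +-mono-≤ (≤-reflexive (∑-swap W F (λ xs x → a x xs))) (∑-mono F (λ x → chg≤ d (Ψ ∘ (x ∷_)))) ⟩
    ∑ F (λ x → ∑ W (λ xs → ne (Ψ (x ∷ xs)) (Ψ (succ x ∷ xs)))) + ∑ F (λ x → ∑ W (λ xs → ∑ W (λ ys → ⟦ nbr diff1 xs ys ⟧ * ne (Ψ (x ∷ xs)) (Ψ (x ∷ ys)))))
      ≡⟨ sym (trans (∑-cong F (λ x → ∑-+ W (a x) (b x))) (∑-+ F (λ x → ∑ W (a x)) (λ x → ∑ W (b x)))) ⟩
    ∑ F (λ x → ∑ W (λ xs → ne (Ψ (x ∷ xs)) (Ψ (succ x ∷ xs)) + ∑ W (λ ys → ⟦ nbr diff1 xs ys ⟧ * ne (Ψ (x ∷ xs)) (Ψ (x ∷ ys)))))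
      ≤⟨ ∑-mono F (λ x → ∑-mono W (λ xs → one x xs)) ⟩
    ∑ F (λ x → ∑ W (λ xs → ∑ F (λ y → ∑ W (λ ys → ⟦ nbr diff1 (x ∷ xs) (y ∷ ys) ⟧ * ne (Ψ (x ∷ xs)) (Ψ (y ∷ ys))))))
      ≡⟨ sym (trans (∑-verts m d (λ v → ∑ (allVerts m (suc d)) (λ w → ⟦ nbr diff1 v w ⟧ * ne (Ψ v) (Ψ w)))) (∑-cong F (λ x → ∑-cong W (λ xs → ∑-verts m d (λ w → ⟦ nbr diff1 (x ∷ xs) w ⟧ * ne (Ψ (x ∷ xs)) (Ψ w)))))) ⟩
    ∑ (allVerts m (suc d)) (λ v → ∑ (allVerts m (suc d)) (λ w → ⟦ nbr diff1 v w ⟧ * ne (Ψ v) (Ψ w))) ∎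
    where
    open ≤-Reasoning
    F = allFin m
    W = allVerts m d
    a b : Fin m → Vertex m d → ℕ
    a x xs = ne (Ψ (x ∷ xs)) (Ψ (succ x ∷ xs))
    b x xs = ∑ W (λ ys → ⟦ nbr diff1 xs ys ⟧ * ne (Ψ (x ∷ xs)) (Ψ (x ∷ ys)))
    one : ∀ x xs → ne (Ψ (x ∷ xs)) (Ψ (succ x ∷ xs)) + ∑ W (λ ys → ⟦ nbr diff1 xs ys ⟧ * ne (Ψ (x ∷ xs)) (Ψ (x ∷ ys)))
                 ≤ ∑ F (λ y → ∑ W (λ ys → ⟦ nbr diff1 (x ∷ xs) (y ∷ ys) ⟧ * ne (Ψ (x ∷ xs)) (Ψ (y ∷ ys))))
    one x xs = begin
      ne (Ψ (x ∷ xs)) (Ψ (succ x ∷ xs)) + R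
        ≤⟨ +-monoˡ-≤ R (≤∑ (FinEnum m) (λ y → ⟦ diff1 x y ⟧ * n′ y) (succ x) ≪ ≤-reflexive (sym (trans (cong (λ b → ⟦ b ⟧ * n′ (succ x)) (diff1-succ x)) (+-identityʳ _)))) ⟩
      ∑ F (λ y → ⟦ diff1 x y ⟧ * n′ y) + R
        ≡⟨ cong (∑ F (λ y → ⟦ diff1 x y ⟧ * n′ y) +_) (sym (∑-δ (FinEnum m) (λ y → ∑ W (λ ys → ⟦ nbr diff1 xs ys ⟧ * ne (Ψ (x ∷ xs)) (Ψ (y ∷ ys)))) x)) ⟩
      ∑ F (λ y → ⟦ diff1 x y ⟧ * n′ y) + ∑ F (λ y → ⟦ does (y Fin.≟ x) ⟧ * ∑ W (λ ys → ⟦ nbr diff1 xs ys ⟧ * ne (Ψ (x ∷ xs)) (Ψ (y ∷ ys))))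
        ≡⟨ sym (∑-+ F (λ y → ⟦ diff1 x y ⟧ * n′ y) (λ y → ⟦ does (y Fin.≟ x) ⟧ * ∑ W (λ ys → ⟦ nbr diff1 xs ys ⟧ * ne (Ψ (x ∷ xs)) (Ψ (y ∷ ys))))) ⟩
      ∑ F (λ y → ⟦ diff1 x y ⟧ * n′ y + ⟦ does (y Fin.≟ x) ⟧ * ∑ W (λ ys → ⟦ nbr diff1 xs ys ⟧ * ne (Ψ (x ∷ xs)) (Ψ (y ∷ ys))))
        ≤⟨ ∑-mono F pt ⟩
      ∑ F (λ y → ∑ W (λ ys → ⟦ nbr diff1 (x ∷ xs) (y ∷ ys) ⟧ * ne (Ψ (x ∷ xs)) (Ψ (y ∷ ys)))) ∎
      where
      R = ∑ W (λ ys → ⟦ nbr diff1 xs ys ⟧ * ne (Ψ (x ∷ xs)) (Ψ (x ∷ ys)))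
      n′ : Fin m → ℕ
      n′ y = ne (Ψ (x ∷ xs)) (Ψ (y ∷ xs))
      _≪_ : ∀ {a b c : ℕ} → b ≤ c → a ≤ b → a ≤ c
      p ≪ q = ≤-trans q p
      pt : ∀ y → ⟦ diff1 x y ⟧ * n′ y + ⟦ does (y Fin.≟ x) ⟧ * ∑ W (λ ys → ⟦ nbr diff1 xs ys ⟧ * ne (Ψ (x ∷ xs)) (Ψ (y ∷ ys)))
             ≤ ∑ W (λ ys → ⟦ nbr diff1 (x ∷ xs) (y ∷ ys) ⟧ * ne (Ψ (x ∷ xs)) (Ψ (y ∷ ys)))
      pt y with y Fin.≟ x
      ... | yes refl rewrite diff1-irrefl y = ≤-trans (≤-reflexive (+-identityʳ _)) (∑-mono W (λ ys → *-monoˡ-≤ (ne (Ψ (x ∷ xs)) (Ψ (y ∷ ys))) (nb ys)))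
        where
        nb : ∀ ys → ⟦ nbr diff1 xs ys ⟧ ≤ ⟦ (does (y Fin.≟ y) ∧ nbr diff1 xs ys) ∨ false ⟧
        nb ys rewrite dec-true (y Fin.≟ y) refl = ≤-reflexive (cong ⟦_⟧ (sym (Data.Bool.Properties.∨-identityʳ (nbr diff1 xs ys))))
      ... | no _ with diff1 x y in dxy
      ...   | false = z≤n
      ...   | true  = ≤-trans (≤-reflexive (trans (+-identityʳ _) (+-identityʳ _))) (≤-trans (≤-reflexive hd′) (≤∑ (VertexEnum m d) (λ ys → ⟦ (does (x Fin.≟ y) ∧ nbr diff1 xs ys) ∨ does (xs ≟ᵛ ys) ⟧ * ne (Ψ (x ∷ xs)) (Ψ (y ∷ ys))) xs))
        where
        hd′ : n′ y ≡ ⟦ (does (x Fin.≟ y) ∧ nbr diff1 xs xs) ∨ does (xs ≟ᵛ xs) ⟧ * n′ y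
        hd′ rewrite dec-true (xs ≟ᵛ xs) refl | Data.Bool.Properties.∨-zeroʳ (does (x Fin.≟ y) ∧ nbr diff1 xs xs) = sym (+-identityʳ _)

module Phases (k M : ℕ) (m≡ : suc (suc k) ≡ M + M) (n : ℕ) (H : Adj n) (H-sym : ∀ i j → H i j ≡ H j i)
              (wgt : Fin n → ℕ) (1≤wgt : ∀ c → 1 ≤ wgt c) (e′ : ℕ) where
  open Cycle k M m≡
  open Torus k M m≡
  open Sys n H H-sym wgt 1≤wgt (suc e′)
  open System sys using (Col; vs; E)
  open Majority k M m≡ (Enum._≟_ (SubsetEnum n))

  e d : ℕ
  e = suc e′
  d = suc e

  hs hp : V → V
  hs = hmap succ
  hp = hmap pred

  hs-hp : ∀ v → hs (hp v) ≡ v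
  hs-hp (x ∷ xs) = cong (_∷ xs) (succ-pred x)

  hp-hs : ∀ v → hp (hs v) ≡ v
  hp-hs (x ∷ xs) = cong (_∷ xs) (pred-succ x)

  low : V → V → Bool
  low = System.lower sys (level h)

  odd-hs : ∀ v → isOdd (hs v) ≡ not (isOdd v)
  odd-hs v = System.adj-odd sys {hs v} {v} (trans (System.adj-sym sys (hs v) v) (Ordering.adj-π O↑ v))

  adj-tail : ∀ x (xs ys : Vertex m e) → nbr diff1 xs ys ≡ true → torusAdj (x ∷ xs) (x ∷ ys) ≡ true
  adj-tail x xs ys t = trans (adj-nbr (x ∷ xs) (x ∷ ys)) (nbr-tail diff1 x xs ys t)

  module _ (f : Col) where

    -- Only palettes of odd vertices are compared, so an even vertex borrows the palette of its
    -- successor in the head direction. This gives a phase to every vertex, and changes can be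
    -- counted along edges.
    A Φ : V → Subset n
    A = Weights.nbrs sys (suc κ-1) f
    Φ v = if isOdd v then A v else A (hs v)

    c₁ c₂ : V → V → ℕ
    c₁ v u = if isOdd v ∧ low v u then ne (A v) (A (hs u)) else 0
    c₂ v u = if isOdd v ∧ low v u then ne (A v) (A (hp u)) else 0

    -- If `u` is the lower end, the edge is a pair of the first two orders. If `v` is, shifting both
    -- ends by `hs` gives a pair of the primed orders, since `hp` brings `hs v` back to `v`.
    edge-odd : ∀ x xs ys → isOdd (x ∷ xs) ≡ true → nbr diff1 xs ys ≡ true →
               ne (Φ (x ∷ xs)) (Φ (x ∷ ys)) ≤ c₁ (x ∷ xs) (x ∷ ys) + c₂ (hs (x ∷ ys)) (hs (x ∷ xs))
    edge-odd x xs ys o t = ≤-trans (≤-reflexive (cong₂ ne (if-true {b = isOdd v} o) (if-false {b = isOdd u} ou))) (go (nbr-level height xs ys t))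
      where
      v = x ∷ xs
      u = x ∷ ys
      ou : isOdd u ≡ false
      ou = not-true (trans (sym (System.adj-odd sys {v} {u} (adj-tail x xs ys t))) o)
      go : ∑v h ys ≡ suc (∑v h xs) ⊎ ∑v h xs ≡ suc (∑v h ys) → ne (A v) (A (hs u)) ≤ c₁ v u + c₂ (hs u) (hs v)
      go (inj₂ p) = ≤-trans (≤-reflexive (sym (if-true {b = isOdd v ∧ low v u} (cong₂ _∧_ o (cong₂ _∧_ (adj-tail x xs ys t) (≡⇒≡ᵇ≡ (sym p))))))) (m≤m+n _ _)
      go (inj₁ p) = ≤-trans (≤-reflexive (trans (ne-sym (A v) (A (hs u))) (trans (cong (λ z → ne (A (hs u)) (A z)) (sym (hp-hs v)))
          (sym (if-true {b = isOdd (hs u) ∧ low (hs u) (hs v)} (cong₂ _∧_ (trans (odd-hs u) (cong not ou))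
            (cong₂ _∧_ (adj-tail (succ x) ys xs (trans (nbr-sym diff1 diff1-sym ys xs) t)) (≡⇒≡ᵇ≡ (sym p)))))))))
          (m≤n+m _ _)

    q : V → V → ℕ
    q v u = (c₁ v u + c₂ (hs u) (hs v)) + (c₁ u v + c₂ (hs v) (hs u))

    edge : ∀ x xs ys → nbr diff1 xs ys ≡ true → ne (Φ (x ∷ xs)) (Φ (x ∷ ys)) ≤ q (x ∷ xs) (x ∷ ys)
    edge x xs ys t = go (isOdd (x ∷ xs)) refl
      where
      go : ∀ b → isOdd (x ∷ xs) ≡ b → ne (Φ (x ∷ xs)) (Φ (x ∷ ys)) ≤ q (x ∷ xs) (x ∷ ys)
      go true  o = ≤-trans (edge-odd x xs ys o t) (m≤m+n _ _)
      go false o = ≤-trans (≤-reflexive (ne-sym (Φ (x ∷ xs)) (Φ (x ∷ ys)))) (≤-trans (edge-odd x ys xs o′ (trans (nbr-sym diff1 diff1-sym ys xs) t)) (m≤n+m _ (c₁ (x ∷ xs) (x ∷ ys) + c₂ (hs (x ∷ ys)) (hs (x ∷ xs)))))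
        where
        o′ : isOdd (x ∷ ys) ≡ true
        o′ = trans (System.adj-odd sys {x ∷ ys} {x ∷ xs} (trans (System.adj-sym sys (x ∷ ys) (x ∷ xs)) (adj-tail x xs ys t))) (cong not o)

    T₁ T₂ TT : ℕ
    T₁ = Pairing.changes sys κ-1 O↑ O↓ ρ f
    T₂ = Pairing.changes sys κ-1 O↑′ O↓′ ρ′ f
    TT = ∑ (allFin m) (λ x → ∑ (allVerts m e) (λ xs → ∑ (allVerts m e) (λ ys → ⟦ nbr diff1 xs ys ⟧ * ne (Φ (x ∷ xs)) (Φ (x ∷ ys)))))

    private
      V₂ : (V → V → ℕ) → ℕ
      V₂ g = ∑ vs (λ v → ∑ vs (λ u → g v u))

      V₂-+ : ∀ g g′ → V₂ (λ v u → g v u + g′ v u) ≡ V₂ g + V₂ g′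
      V₂-+ g g′ = trans (∑-cong vs (λ v → ∑-+ vs (g v) (g′ v))) (∑-+ vs (λ v → ∑ vs (g v)) (λ v → ∑ vs (g′ v)))

      V₂-swap : ∀ g → V₂ (λ v u → g u v) ≡ V₂ g
      V₂-swap g = ∑-swap vs vs (λ v u → g u v)

      V₂-hs : ∀ g → V₂ (λ v u → g (hs v) (hs u)) ≡ V₂ g
      V₂-hs g = trans (∑-cong vs (λ v → ∑-reindex E hs hp hs-hp hp-hs (g (hs v)))) (∑-reindex E hs hp hs-hp hp-hs (λ v → ∑ vs (g v)))

    V₂q : V₂ q ≡ 2 * (T₁ + T₂)
    V₂q = trans (V₂-+ (λ v u → c₁ v u + c₂ (hs u) (hs v)) (λ v u → c₁ u v + c₂ (hs v) (hs u)))
      (trans (cong₂ _+_ (trans (V₂-+ c₁ (λ v u → c₂ (hs u) (hs v))) (cong (V₂ c₁ +_) (trans (V₂-swap (λ v u → c₂ (hs v) (hs u))) (V₂-hs c₂))))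
                        (trans (V₂-+ (λ v u → c₁ u v) (λ v u → c₂ (hs v) (hs u))) (cong₂ _+_ (V₂-swap c₁) (V₂-hs c₂))))
        (lem T₁ T₂))
      where
      lem : ∀ a b → a + b + (a + b) ≡ 2 * (a + b)
      lem = solve-∀

    TT≤ : TT ≤ 2 * (T₁ + T₂)
    TT≤ = begin
      TT
        ≤⟨ ∑-mono (allFin m) (λ x → ∑-mono (allVerts m e) (λ xs → ∑-mono (allVerts m e) (λ ys → pt x xs ys (nbr diff1 xs ys) refl))) ⟩
      ∑ (allFin m) (λ x → ∑ (allVerts m e) (λ xs → ∑ (allVerts m e) (λ ys → q (x ∷ xs) (x ∷ ys))))
        ≤⟨ ∑-mono (allFin m) (λ x → ∑-mono (allVerts m e) (λ xs → ≤∑ (FinEnum m) (λ y → ∑ (allVerts m e) (λ ys → q (x ∷ xs) (y ∷ ys))) x)) ⟩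
      ∑ (allFin m) (λ x → ∑ (allVerts m e) (λ xs → ∑ (allFin m) (λ y → ∑ (allVerts m e) (λ ys → q (x ∷ xs) (y ∷ ys)))))
        ≡⟨ sym (trans (∑-verts m e (λ v → ∑ vs (q v))) (∑-cong (allFin m) (λ x → ∑-cong (allVerts m e) (λ xs → ∑-verts m e (q (x ∷ xs)))))) ⟩
      V₂ q
        ≡⟨ V₂q ⟩
      2 * (T₁ + T₂) ∎
      where
      open ≤-Reasoning
      pt : ∀ x xs ys b → nbr diff1 xs ys ≡ b → ⟦ b ⟧ * ne (Φ (x ∷ xs)) (Φ (x ∷ ys)) ≤ q (x ∷ xs) (x ∷ ys)
      pt x xs ys true  t = ≤-trans (≤-reflexive (+-identityʳ _)) (edge x xs ys t)
      pt x xs ys false t = z≤n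

    -- A step in the first tail coordinate, available since the dimension is at least 2.
    shift : V → V
    shift (x ∷ z ∷ zs) = x ∷ succ z ∷ zs

    shift≤ : ∑ vs (λ v → ne (Φ v) (Φ (shift v))) ≤ TT
    shift≤ = ≤-trans (≤-reflexive (∑-verts m e (λ v → ne (Φ v) (Φ (shift v))))) (∑-mono (allFin m) (λ x → ∑-mono (allVerts m e) (λ xs → pt x xs)))
      where
      pt : ∀ x xs → ne (Φ (x ∷ xs)) (Φ (shift (x ∷ xs))) ≤ ∑ (allVerts m e) (λ ys → ⟦ nbr diff1 xs ys ⟧ * ne (Φ (x ∷ xs)) (Φ (x ∷ ys)))
      pt x xs@(z ∷ zs) = ≤-trans (≤-reflexive (sym (trans (cong (λ b → ⟦ b ⟧ * ne (Φ (x ∷ xs)) (Φ (x ∷ succ z ∷ zs))) (nbr-head diff1 z (succ z) zs (diff1-succ z))) (+-identityʳ _))))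
                          (≤∑ (VertexEnum m e) (λ ys → ⟦ nbr diff1 xs ys ⟧ * ne (Φ (x ∷ xs)) (Φ (x ∷ ys))) (succ z ∷ zs))

    -- A head step from an odd vertex is replaced by two tail steps, as the even vertex in between takes its
    -- phase from the other side.
    head-step : ∀ v → ne (Φ v) (Φ (hs v)) ≤ ne (Φ v) (Φ (shift v)) + ne (Φ (shift (hs v))) (Φ (hs v))
    head-step v@(x ∷ z ∷ zs) = go (isOdd v) refl
      where
      y = shift v
      go : ∀ b → isOdd v ≡ b → ne (Φ v) (Φ (hs v)) ≤ ne (Φ v) (Φ y) + ne (Φ (hs y)) (Φ (hs v))
      go false o = ≤-trans (≤-reflexive (trans (cong₂ ne (if-false {b = isOdd v} o) (if-true {b = isOdd (hs v)} (trans (odd-hs v) (cong not o)))) (ne-self (A (hs v))))) z≤n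
      go true  o = ≤-trans (ne-tri (Φ v) (Φ y) (Φ (hs v))) (+-monoʳ-≤ (ne (Φ v) (Φ y)) (≤-reflexive (cong (λ a → ne a (Φ (hs v)))
                     (trans (if-false {b = isOdd y} oy) (sym (if-true {b = isOdd (hs y)} (trans (odd-hs y) (cong not oy))))))))
        where
        oy : isOdd y ≡ false
        oy = not-true (trans (sym (System.adj-odd sys {v} {y} (adj-tail x (z ∷ zs) (succ z ∷ zs) (nbr-head diff1 z (succ z) zs (diff1-succ z))))) o)

    chgΦ : chg d Φ ≤ 3 * TT
    chgΦ = ≤-trans (+-mono-≤ heads (∑-mono (allFin m) (λ x → chg≤ e (Φ ∘ (x ∷_))))) (≤-reflexive (lem TT))
      where
      open ≤-Reasoning
      lem : ∀ t → t + t + t ≡ 3 * t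
      lem = solve-∀
      heads : ∑ (allVerts m e) (λ xs → ∑ (allFin m) (λ x → ne (Φ (x ∷ xs)) (Φ (succ x ∷ xs)))) ≤ TT + TT
      heads = begin
        ∑ (allVerts m e) (λ xs → ∑ (allFin m) (λ x → ne (Φ (x ∷ xs)) (Φ (succ x ∷ xs))))
          ≡⟨ trans (∑-swap (allVerts m e) (allFin m) (λ xs x → ne (Φ (x ∷ xs)) (Φ (succ x ∷ xs)))) (sym (∑-verts m e (λ v → ne (Φ v) (Φ (hs v))))) ⟩
        ∑ vs (λ v → ne (Φ v) (Φ (hs v)))
          ≤⟨ ∑-mono vs head-step ⟩
        ∑ vs (λ v → ne (Φ v) (Φ (shift v)) + ne (Φ (shift (hs v))) (Φ (hs v)))
          ≡⟨ ∑-+ vs (λ v → ne (Φ v) (Φ (shift v))) (λ v → ne (Φ (shift (hs v))) (Φ (hs v))) ⟩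
        ∑ vs (λ v → ne (Φ v) (Φ (shift v))) + ∑ vs (λ v → ne (Φ (shift (hs v))) (Φ (hs v)))
          ≡⟨ cong (∑ vs (λ v → ne (Φ v) (Φ (shift v))) +_) (trans (∑-reindex E hs hp hs-hp hp-hs (λ v → ne (Φ (shift v)) (Φ v))) (∑-cong vs (λ v → ne-sym (Φ (shift v)) (Φ v)))) ⟩
        ∑ vs (λ v → ne (Φ v) (Φ (shift v))) + ∑ vs (λ v → ne (Φ v) (Φ (shift v)))
          ≤⟨ +-mono-≤ shift≤ shift≤ ⟩
        TT + TT ∎

    center : V
    center = proj₁ (majority d Φ)

    dominant : ∀ B → T₁ ≤ B → T₂ ≤ B → ∑ vs (λ v → ne (Φ v) (Φ center)) ≤ m * (6 * (B + B))
    dominant B T₁≤ T₂≤ = ≤-trans (proj₂ (majority d Φ)) (scale m (chg d Φ) TT T₁ T₂ B chgΦ TT≤ T₁≤ T₂≤)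
      where
      scale : ∀ m c t s s′ B → c ≤ 3 * t → t ≤ 2 * (s + s′) → s ≤ B → s′ ≤ B → m * c ≤ m * (6 * (B + B))
      scale m c t s s′ B c≤ t≤ s≤ s′≤ = *-monoʳ-≤ m (≤-trans c≤ (≤-trans (*-monoʳ-≤ 3 (≤-trans t≤ (*-monoʳ-≤ 2 (+-mono-≤ s≤ s′≤)))) (≤-reflexive (lem (B + B)))))
        where
        lem : ∀ t → 3 * (2 * t) ≡ 6 * t
        lem = solve-∀

  -- Vertices with few descents: 8 ^ e ≤ 5 ^ e 2 ^ zeros if fewer than a quarter of the coordinates are non-zero.
  zeros : Height → ∀ {e} → Vertex m e → ℕ
  zeros Ht = ∑v (λ a → ⟦ not (1 ≤ᵇ Height.g Ht a) ⟧)

  ups : Height → ∀ {e} → Vertex m e → ℕ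
  ups Ht = ∑v (λ a → ⟦ 1 ≤ᵇ Height.g Ht a ⟧)

  ups+zeros : ∀ Ht {e} (xs : Vertex m e) → ups Ht xs + zeros Ht xs ≡ e
  ups+zeros Ht []       = refl
  ups+zeros Ht (x ∷ xs) = trans (pt (1 ≤ᵇ Height.g Ht x)) (cong suc (ups+zeros Ht xs))
    where
    pt : ∀ b → (⟦ b ⟧ + ups Ht xs) + (⟦ not b ⟧ + zeros Ht xs) ≡ suc (ups Ht xs + zeros Ht xs)
    pt true  = refl
    pt false = +-suc (ups Ht xs) (zeros Ht xs)

  -- Each coordinate contributes at most `m + 1`: the bottom counts 2 and every other point 1.
  ∑2^zeros : ∀ Ht e → ∑ (allVerts m e) (λ xs → 2 ^ zeros Ht xs) ≤ suc m ^ e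
  ∑2^zeros Ht zero    = ≤-refl
  ∑2^zeros Ht (suc e) = begin
    ∑ (allVerts m (suc e)) (λ xs → 2 ^ zeros Ht xs)
      ≡⟨ ∑-verts m e (λ xs → 2 ^ zeros Ht xs) ⟩
    ∑ (allFin m) (λ x → ∑ (allVerts m e) (λ xs → 2 ^ (z x + zeros Ht xs)))
      ≡⟨ ∑-cong (allFin m) (λ x → trans (∑-cong (allVerts m e) (λ xs → ^-distribˡ-+-* 2 (z x) (zeros Ht xs))) (∑-*ˡ (allVerts m e) (2 ^ z x) (λ xs → 2 ^ zeros Ht xs))) ⟩
    ∑ (allFin m) (λ x → 2 ^ z x * ∑ (allVerts m e) (λ xs → 2 ^ zeros Ht xs))
      ≡⟨ ∑-*ʳ (allFin m) (∑ (allVerts m e) (λ xs → 2 ^ zeros Ht xs)) (λ x → 2 ^ z x) ⟩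
    ∑ (allFin m) (λ x → 2 ^ z x) * ∑ (allVerts m e) (λ xs → 2 ^ zeros Ht xs)
      ≤⟨ *-mono-≤ (≤-trans (∑-mono (allFin m) pt) (≤-reflexive (trans (∑-+ (allFin m) (λ x → ⟦ does (x Fin.≟ bottom) ⟧) (λ _ → 1)) (cong₂ _+_ (once-allFin m bottom) (trans (∑-constF m 1) (*-identityʳ m)))))) (∑2^zeros Ht e) ⟩
    suc m * suc m ^ e ∎
    where
    open ≤-Reasoning
    open Height Ht
    z : Fin m → ℕ
    z a = ⟦ not (1 ≤ᵇ g a) ⟧
    pt : ∀ x → 2 ^ z x ≤ ⟦ does (x Fin.≟ bottom) ⟧ + 1
    pt x = go (1 ≤ᵇ g x) refl
      where
      go : ∀ b → (1 ≤ᵇ g x) ≡ b → 2 ^ ⟦ not b ⟧ ≤ ⟦ does (x Fin.≟ bottom) ⟧ + 1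
      go true  _ = m≤n+m 1 ⟦ does (x Fin.≟ bottom) ⟧
      go false p rewrite dec-true (x Fin.≟ bottom) (bottom! x (n<1⇒n≡0 (≰⇒> (λ q → true≢false (T⇒≡ (≤⇒≤ᵇ q)) p)))) = ≤-refl

  -- A Chernoff bound with base 2, whose rate `5 (m + 1) / 8` is below `m` as soon as `m ≥ 2`.
  scarce : ∀ Ht → ∑ vs (λ v → ⟦ few-slack Ht v ⟧) * 8 ^ e ≤ m * (5 * suc m) ^ e
  scarce Ht = begin
    ∑ vs (λ v → ⟦ few-slack Ht v ⟧) * 8 ^ e
      ≡⟨ cong (_* 8 ^ e) (trans (∑-verts m e (λ v → ⟦ few-slack Ht v ⟧)) (∑-constF m (∑ W (λ xs → ⟦ 4 * ups Ht xs <ᵇ e ⟧)))) ⟩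
    m * ∑ W (λ xs → ⟦ 4 * ups Ht xs <ᵇ e ⟧) * 8 ^ e
      ≡⟨ trans (*-assoc m (∑ W (λ xs → ⟦ 4 * ups Ht xs <ᵇ e ⟧)) (8 ^ e)) (cong (m *_) (sym (∑-*ʳ W (8 ^ e) (λ xs → ⟦ 4 * ups Ht xs <ᵇ e ⟧)))) ⟩
    m * ∑ W (λ xs → ⟦ 4 * ups Ht xs <ᵇ e ⟧ * 8 ^ e)
      ≤⟨ *-monoʳ-≤ m (∑-mono W (λ xs → pt xs (4 * ups Ht xs <ᵇ e) refl)) ⟩
    m * ∑ W (λ xs → 5 ^ e * 2 ^ zeros Ht xs)
      ≤⟨ *-monoʳ-≤ m (≤-trans (≤-reflexive (∑-*ˡ W (5 ^ e) (λ xs → 2 ^ zeros Ht xs))) (*-monoʳ-≤ (5 ^ e) (∑2^zeros Ht e))) ⟩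
    m * (5 ^ e * suc m ^ e)
      ≡⟨ cong (m *_) (sym (*-^ 5 (suc m) e)) ⟩
    m * (5 * suc m) ^ e ∎
    where
    open ≤-Reasoning
    W = allVerts m e
    key : ∀ u z e → u + z ≡ e → 4 * u ≤ e → 8 ^ e ≤ 5 ^ e * 2 ^ z
    key u z e refl le with m≤n⇒∃[o]m+o≡n le
    ... | t , eq = begin
      8 ^ (u + z)                          ≡⟨ trans (*-^ 2 4 (u + z)) (cong (_* 4 ^ (u + z)) (^-distribˡ-+-* 2 u z)) ⟩
      2 ^ u * 2 ^ z * 4 ^ (u + z)          ≡⟨ cong (λ x → 2 ^ u * 2 ^ z * x) (trans (cong (4 ^_) (sym eq)) (trans (^-distribˡ-+-* 4 (4 * u) t) (cong (_* 4 ^ t) (sym (^-*-assoc 4 4 u))))) ⟩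
      2 ^ u * 2 ^ z * (256 ^ u * 4 ^ t)    ≡⟨ lem (2 ^ u) (2 ^ z) (256 ^ u) (4 ^ t) ⟩
      (2 ^ u * 256 ^ u) * 4 ^ t * 2 ^ z    ≡⟨ cong (λ x → x * 4 ^ t * 2 ^ z) (sym (*-^ 2 256 u)) ⟩
      -- `2 ^ 9 ≤ 5 ^ 4` says that `8 / 5 ≤ 2 ^ (3 / 4)`, the case of exactly three quarters of
      -- zeros.
      512 ^ u * 4 ^ t * 2 ^ z              ≤⟨ *-monoˡ-≤ (2 ^ z) (*-mono-≤ (^-monoˡ-≤ u (≤ᵇ⇒≤ 512 625 tt)) (^-monoˡ-≤ t (n≤1+n 4))) ⟩
      625 ^ u * 5 ^ t * 2 ^ z              ≡⟨ cong (_* 2 ^ z) (trans (cong (_* 5 ^ t) (^-*-assoc 5 4 u)) (trans (sym (^-distribˡ-+-* 5 (4 * u) t)) (cong (5 ^_) eq))) ⟩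
      5 ^ (u + z) * 2 ^ z ∎
      where
      lem : ∀ a b c d → a * b * (c * d) ≡ (a * c) * d * b
      lem = solve-∀
    pt : ∀ xs b → (4 * ups Ht xs <ᵇ e) ≡ b → ⟦ b ⟧ * 8 ^ e ≤ 5 ^ e * 2 ^ zeros Ht xs
    pt xs false _ = z≤n
    pt xs true  p = ≤-trans (≤-reflexive (+-identityʳ _)) (key (ups Ht xs) (zeros Ht xs) e (ups+zeros Ht xs) (<⇒≤ (<ᵇ-true {4 * ups Ht xs} {e} p)))

  δ≤ : suc deg-1 ≤ 2 * m * e
  δ≤ = ≤-trans (≤-reflexive δ≡) (≤-trans (*-mono-≤ (≤-trans (m≤m+n (suc e) e′) (≤-reflexive (lem e′))) ν≤m) (≤-reflexive (lem′ e m)))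
    where
    lem : ∀ x → suc (suc x) + x ≡ 2 * suc x
    lem = solve-∀
    lem′ : ∀ e m → 2 * e * m ≡ 2 * m * e
    lem′ = solve-∀

  init⇒few : ∀ Ht s ds v → Tail.init sys κ-1 (ordering Ht s ds) v ≡ true → few-slack Ht v ≡ true
  init⇒few Ht s ds v i = go (few-slack Ht v) refl
    where
    O = ordering Ht s ds
    J = Run.J sys κ-1 O v
    go : ∀ b → few-slack Ht v ≡ b → few-slack Ht v ≡ true
    go true  q = q
    go false q = ⊥-elim (true≢false (T⇒≡ (≤⇒≤ᵇ {suc deg-1} {suc κ-1 * J} le)) (not-true {suc deg-1 ≤ᵇ suc κ-1 * J} i))
      where
      open ≤-Reasoning
      le : suc deg-1 ≤ suc κ-1 * J
      le = begin
        suc deg-1              ≤⟨ δ≤ ⟩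
        2 * m * e              ≤⟨ *-monoʳ-≤ (2 * m) (≮⇒≥ (λ p → true≢false (<⇒<ᵇ≡ {4 * slack Ht v} {e} p) q)) ⟩
        2 * m * (4 * slack Ht v) ≡⟨ lem m (slack Ht v) ⟩
        8 * m * slack Ht v     ≤⟨ *-monoʳ-≤ (8 * m) (slack≤J Ht v) ⟩
        8 * m * J             ≡⟨ cong (_* J) (sym κ≡) ⟩
        suc κ-1 * J ∎
        where
        lem : ∀ m s → 2 * m * (4 * s) ≡ 8 * m * s
        lem = solve-∀

  ι≤ : ∀ Ht s ds → Tail.ι sys κ-1 (ordering Ht s ds) * 8 ^ e ≤ m * (5 * suc m) ^ e
  ι≤ Ht s ds = ≤-trans (*-monoˡ-≤ (8 ^ e) (∑-mono vs pt)) (scarce Ht)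
    where
    pt : ∀ v → ⟦ isOdd v ∧ Tail.init sys κ-1 (ordering Ht s ds) v ⟧ ≤ ⟦ few-slack Ht v ⟧
    pt v = go (isOdd v) (Tail.init sys κ-1 (ordering Ht s ds) v) refl
      where
      go : ∀ a b → Tail.init sys κ-1 (ordering Ht s ds) v ≡ b → ⟦ a ∧ b ⟧ ≤ ⟦ few-slack Ht v ⟧
      go false b     _ = z≤n
      go true  false _ = z≤n
      go true  true  i = ≤-reflexive (cong ⟦_⟧ (sym (init⇒few Ht s ds v i)))


-- The lower bound for the partition function, missed colours

∏-zero : ∀ (E : Enum X) (f : X → ℕ) x → f x ≡ 0 → ∏ (Enum.elts E) f ≡ 0
∏-zero E f x e with ∏-isolate E x
... | R , eq , _ = trans (eq f) (cong (_* ∏ R f) e)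

module Partition (Sys : System) (κ-1 : ℕ) (fs : List (System.Col Sys)) (f₀ : System.Col Sys)
                 (full : ∀ h → ∑ fs (λ f → System.agree Sys f h) ≡ 1) where
  open System Sys
  open Core Sys (suc κ-1)
  open Weights Sys (suc κ-1)

  Zn : ℕ
  Zn = ∑ fs weight

  weight-ext : Ext weight
  weight-ext f g h = ∏-cong vs pt
    where
    pt : ∀ v → (if odd v then (if lookup (comm (nbrs f v)) (f v) then wgt (f v) else 0) else wgt (f v))
             ≡ (if odd v then (if lookup (comm (nbrs g v)) (g v) then wgt (g v) else 0) else wgt (g v))
    pt v rewrite pal-cong adj f g v (λ u _ → h u) | h v = refl

  all-unique : Unique (evens ++ odds)
  all-unique = Unique.++⁺ (Unique.filter⁺ _ (unique-elts E)) (Unique.filter⁺ _ (unique-elts E))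
    (λ { (m , m′) → true≢false (odds-odd m′) (evens-even m) })

  all-∏ : ∀ φ → ∏ (evens ++ odds) φ ≡ ∏ vs φ
  all-∏ g = trans (∏-++ evens odds g) (sym (trans (∏-cong vs (λ v → sym (if-same (odd v)))) (∏-parity g g)))
    where
    if-same : ∀ b {x : ℕ} → (if b then x else x) ≡ x
    if-same true  = refl
    if-same false = refl

  ∑≡S : ∀ F → Ext F → ∑ fs F ≡ S (evens ++ odds) F f₀
  ∑≡S F ext = transfer fs (evens ++ odds) all-unique all-∏ full F ext f₀

  -- The colourings with colours of an optimal `a` on the even vertices and of `comm a` on the odd
  -- ones already have this weight, as both classes have `N` vertices.
  η^N≤Z : ∑ vs (λ v → ⟦ not (odd v) ⟧) ≡ N → η ^ N ≤ Zn
  η^N≤Z balanced with η-attained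
  ... | a , ηa = begin
    η ^ N
      ≡⟨ trans (cong (_^ N) ηa) (*-^ (σ a) (σ (comm a)) N) ⟩
    σ a ^ N * σ (comm a) ^ N
      ≡⟨ cong₂ _*_ (trans (cong (σ a ^_) (sym balanced)) (sym (trans (∏-filter (not ∘ odd) vs (λ _ → σ a)) (∏-if-const vs (not ∘ odd) (σ a)))))
                   (sym (trans (∏-filter odd vs (λ _ → σ (comm a))) (∏-if-const vs odd (σ (comm a))))) ⟩
    ∏ evens (λ _ → σ a) * ∏ odds (λ _ → σ (comm a))
      ≡⟨ sym (trans (∏-cong vs pt₂) (∏-parity (λ _ → σ (comm a)) (λ _ → σ a))) ⟩
    ∏ vs (λ v → ∑ (allFin n) (φ v))
      ≡⟨ sym (all-∏ (λ v → ∑ (allFin n) (φ v))) ⟩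
    ∏ (evens ++ odds) (λ v → ∑ (allFin n) (φ v))
      ≡⟨ sym (trans (S-factor (evens ++ odds) all-unique (λ _ → 1) (λ v _ → φ v) (λ _ _ _ _ → refl) (λ _ _ _ _ _ _ → refl) f₀) (+-identityʳ _)) ⟩
    S (evens ++ odds) (λ h → 1 * ∏ (evens ++ odds) (λ v → φ v (h v))) f₀
      ≤⟨ S-mono (evens ++ odds) pointwise f₀ ⟩
    S (evens ++ odds) weight f₀
      ≡⟨ sym (∑≡S weight weight-ext) ⟩
    Zn ∎
    where
    open ≤-Reasoning
    φ : V → Fin n → ℕ
    φ v c = if (if odd v then lookup (comm a) c else lookup a c) then wgt c else 0
    pt₂ : ∀ v → ∑ (allFin n) (φ v) ≡ (if odd v then σ (comm a) else σ a)
    pt₂ v with odd v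
    ... | true  = refl
    ... | false = refl
    pointwise : ∀ h → 1 * ∏ (evens ++ odds) (λ v → φ v (h v)) ≤ weight h
    pointwise h = ≤-trans (≤-reflexive (trans (+-identityʳ _) (all-∏ (λ v → φ v (h v))))) (go (all (λ v → odd v ∨ lookup a (h v)) vs) refl)
      where
      go : ∀ b → all (λ v → odd v ∨ lookup a (h v)) vs ≡ b → ∏ vs (λ v → φ v (h v)) ≤ weight h
      go false e with all-false⁻ _ vs e
      ... | v , _ , p = ≤-trans (≤-reflexive (∏-zero E (λ v → φ v (h v)) v (z p))) z≤n
        where
        z : odd v ∨ lookup a (h v) ≡ false → φ v (h v) ≡ 0
        z q with odd v
        ... | false rewrite q = refl
      go true e = ∏-mono vs pt
        where
        ∈a : ∀ v → odd v ≡ false → lookup a (h v) ≡ true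
        ∈a v o with all-true⁻ _ e (∈-elts E v)
        ... | q rewrite o = q
        inc : ∀ v → odd v ≡ true → ∀ c → lookup (comm a) c ≡ true → lookup (comm (nbrs h v)) c ≡ true
        inc v o c q = comm-complete (nbrs h v) c (λ i p → let (u , au , hu) = pal-∋ adj h v i p in
          comm-adj a (subst (λ i → lookup a i ≡ true) hu (∈a u (not-true (trans (sym (adj-odd au)) o)))) q)
        pt : ∀ v → φ v (h v) ≤ (if odd v then (if lookup (comm (nbrs h v)) (h v) then wgt (h v) else 0) else wgt (h v))
        pt v = f (odd v) refl
          where
          f : ∀ b → odd v ≡ b → (if (if b then lookup (comm a) (h v) else lookup a (h v)) then wgt (h v) else 0)
                              ≤ (if b then (if lookup (comm (nbrs h v)) (h v) then wgt (h v) else 0) else wgt (h v))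
          f false o with lookup a (h v)
          ... | true  = ≤-refl
          ... | false = z≤n
          f true o with lookup (comm a) (h v) in q
          ... | false = z≤n
          ... | true rewrite inc v o (h v) q = ≤-refl

  module _ (O : Ordering Sys) where
    open Ordering O
    open Run Sys κ-1 O using (hd; rw; low; low⇒adj)
    open LocalBound Sys κ-1 O using (pfac)
    open Tail Sys κ-1 O

    -- Palettes and predictions of odd vertices read even colours only, so the odd colours can be
    -- summed out before the heavy colourings are estimated.
    tilt-local : ∀ f g → (∀ v → odd v ≡ false → f v ≡ g v) → tilt f ≡ tilt g
    tilt-local f g h = ∏-cong vs pt
      where
      nb : ∀ v → odd v ≡ true → ∀ {u} → adj v u ≡ true → f u ≡ g u
      nb v o a = h _ (not-true (trans (sym (adj-odd a)) o))
      nbrs≡ : ∀ v → odd v ≡ true → nbrs f v ≡ nbrs g v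
      nbrs≡ v o = pal-cong adj f g v (λ u a → nb v o a)
      hd≡ : ∀ v → odd v ≡ true → hd v f ≡ hd v g
      hd≡ v o = pal-cong low f g v (λ u a → nb v o (low⇒adj a))
      pf≡ : ∀ v → odd v ≡ true → pfac f v ≡ pfac g v
      pf≡ v o = cong₂ (λ a b → if not (optimal a ∧ does (a ≟ˢ b)) then suc P else P) (nbrs≡ v o) (hd≡ v o)
      rw≡ : ∀ v → odd v ≡ true → ∀ y → rw (nbrs f v) v y f (f y) ≡ rw (nbrs g v) v y g (g y)
      rw≡ v o y = go (low v y) refl
        where
        go : ∀ b → low v y ≡ b → rw (nbrs f v) v y f (f y) ≡ rw (nbrs g v) v y g (g y)
        go false l = trans (if-false {b = low v y} l) (sym (if-false {b = low v y} l))
        go true  l = trans (if-true {b = low v y} l) (trans (cong (R *_) t≡) (sym (if-true {b = low v y} l)))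
          where
          oy : odd (π y) ≡ true
          oy = trans (adj-odd (trans (adj-sym (π y) y) (adj-π y))) (trans (sym (adj-odd (low⇒adj l))) o)
          t≡ : τ (nbrs f v) (hd (π y) f) (f y) ≡ τ (nbrs g v) (hd (π y) g) (g y)
          t≡ = trans (cong₂ (λ a b → τ a b (f y)) (nbrs≡ v o) (hd≡ (π y) oy)) (cong (τ (nbrs g v) (hd (π y) g)) (nb v o (low⇒adj l)))
      pt : ∀ v → (if odd v then pfac f v ^ δ * ∏ vs (λ y → rw (nbrs f v) v y f (f y)) else 1)
               ≡ (if odd v then pfac g v ^ δ * ∏ vs (λ y → rw (nbrs g v) v y g (g y)) else 1)
      pt v = go (odd v) refl
        where
        go : ∀ b → odd v ≡ b → (if b then pfac f v ^ δ * ∏ vs (λ y → rw (nbrs f v) v y f (f y)) else 1)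
                             ≡ (if b then pfac g v ^ δ * ∏ vs (λ y → rw (nbrs g v) v y g (g y)) else 1)
        go false _ = refl
        go true  o = cong₂ (λ a b → a ^ δ * b) (pf≡ v o) (∏-cong vs (rw≡ v o))

    heavy-∑ : ∀ Θ → ∑ fs (λ f → heavy Θ f * weight f) ≡ S order (λ f → heavy Θ f * marginal f) f₀
    heavy-∑ Θ = trans (transfer fs (order ++ odds) order-unique order-∏ full (λ f → heavy Θ f * weight f) ext f₀)
      (trans (S-++ order odds (λ f → heavy Θ f * weight f) f₀) (S-cong order (S-odds (heavy Θ) eo) f₀))
      where
      ext : Ext (λ f → heavy Θ f * weight f)
      ext f g h = cong₂ (λ a b → ⟦ Θ * norm ≤ᵇ a ⟧ * b) (tilt-local f g (λ v _ → h v)) (weight-ext f g h)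
      eo : EvenOnly (heavy Θ)
      eo u ou f c = cong (λ a → ⟦ Θ * norm ≤ᵇ a ⟧) (tilt-local (upd f u c) f (λ v ov → upd-other f u c (λ { refl → true≢false ou ov })))

  -- Every neighbour of `u` was free to take the colour `b`, and none did.
  missed : V → Fin n → Col → Bool
  missed u b h = all (λ v → not (adj u v) ∨ (lookup (comm (nbrs h v)) b ∧ not (eqFin (h v) b))) vs

  gibbs : ∀ u b → odd u ≡ false → ∑ fs (λ f → ⟦ missed u b f ⟧ * weight f) * Λ ^ δ ≤ L ^ δ * Zn
  gibbs u b ou = begin
    ∑ fs (λ f → ⟦ missed u b f ⟧ * weight f) * Λ ^ δ
      ≡⟨ cong (_* Λ ^ δ) (trans (∑≡S _ ext) (S-++ evens odds (λ f → ⟦ missed u b f ⟧ * weight f) f₀)) ⟩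
    S evens (S odds (λ f → ⟦ missed u b f ⟧ * weight f)) f₀ * Λ ^ δ
      ≤⟨ *-monoˡ-≤ (Λ ^ δ) (S-mono evens (λ f → ≤-trans (S-mono odds cut f) (≤-reflexive (trans (S-odds-gen (λ _ → 1) ok (λ _ _ _ _ → refl) ok-inv f) (+-identityʳ _)))) f₀) ⟩
    S evens (λ f → ∏ vs (λ v → if odd v then sel (ok v f) wgt else wgt (f v))) f₀ * Λ ^ δ
      ≡⟨ trans (*-comm _ (Λ ^ δ)) (sym (S-*ˡ evens (Λ ^ δ) _ f₀)) ⟩
    S evens (λ f → Λ ^ δ * ∏ vs (λ v → if odd v then sel (ok v f) wgt else wgt (f v))) f₀
      ≤⟨ S-mono evens local f₀ ⟩
    S evens (λ f → L ^ δ * (1 * marginal f)) f₀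
      ≡⟨ trans (S-*ˡ evens (L ^ δ) _ f₀) (cong (L ^ δ *_) (sym (trans (∑≡S weight weight-ext) (trans (S-++ evens odds weight f₀)
           (S-cong evens (λ f → trans (S-cong odds (λ h → sym (+-identityʳ (weight h))) f) (S-odds (λ _ → 1) (λ _ _ _ _ → refl) f)) f₀))))) ⟩
    L ^ δ * Zn ∎
    where
    open ≤-Reasoning
    ext : Ext (λ f → ⟦ missed u b f ⟧ * weight f)
    ext f g h = cong₂ (λ a b → ⟦ a ⟧ * b) (all-cong vs (λ v → cong₂ (λ a c → not (adj u v) ∨ (lookup (comm a) b ∧ not (eqFin c b))) (pal-cong adj f g v (λ u _ → h u)) (h v))) (weight-ext f g h)
      where
      all-cong : ∀ {p q : V → Bool} xs → (∀ x → p x ≡ q x) → all p xs ≡ all q xs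
      all-cong []       e = refl
      all-cong (x ∷ xs) e = cong₂ _∧_ (e x) (all-cong xs e)
    ok : V → Col → Fin n → Bool
    ok v h c = lookup (comm (nbrs h v)) c ∧ (not (adj u v) ∨ (lookup (comm (nbrs h v)) b ∧ not (eqFin c b)))
    ok-inv : ∀ v w f c e → odd w ≡ true → odd v ≡ true → ok v (upd f w c) e ≡ ok v f e
    ok-inv v w f c e ow ov = cong (λ a → lookup (comm a) e ∧ (not (adj u v) ∨ (lookup (comm a) b ∧ not (eqFin e b)))) (odd-upd f c ow ov)
    cut : ∀ h → ⟦ missed u b h ⟧ * weight h ≤ 1 * ∏ vs (λ v → if odd v then (if ok v h (h v) then wgt (h v) else 0) else wgt (h v))
    cut h = go (missed u b h) refl
      where
      go : ∀ x → missed u b h ≡ x → ⟦ x ⟧ * weight h ≤ 1 * ∏ vs (λ v → if odd v then (if ok v h (h v) then wgt (h v) else 0) else wgt (h v))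
      go false _ = z≤n
      go true  e = *-monoʳ-≤ 1 (≤-reflexive (∏-cong vs (λ v → cong (λ x → if odd v then (if x then wgt (h v) else 0) else wgt (h v))
        (sym (trans (cong (lookup (comm (nbrs h v)) (h v) ∧_) (all-true⁻ _ e (∈-elts E v))) (Data.Bool.Properties.∧-identityʳ _))))))
    local : ∀ f → Λ ^ δ * ∏ vs (λ v → if odd v then sel (ok v f) wgt else wgt (f v)) ≤ L ^ δ * (1 * marginal f)
    local f = begin
      Λ ^ δ * ∏ vs (λ v → if odd v then sel (ok v f) wgt else wgt (f v))
        ≡⟨ cong (_* ∏ vs (λ v → if odd v then sel (ok v f) wgt else wgt (f v))) (sym (trans (∏-if-const vs (adj u) Λ) (cong (Λ ^_) (deg u)))) ⟩
      ∏ vs (λ v → if adj u v then Λ else 1) * ∏ vs (λ v → if odd v then sel (ok v f) wgt else wgt (f v))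
        ≡⟨ sym (∏-* vs _ _) ⟩
      ∏ vs (λ v → (if adj u v then Λ else 1) * (if odd v then sel (ok v f) wgt else wgt (f v)))
        ≤⟨ ∏-mono vs (λ v → pt v (adj u v) refl (odd v) refl) ⟩
      ∏ vs (λ v → (if adj u v then L else 1) * (if odd v then σ (comm (nbrs f v)) else wgt (f v)))
        ≡⟨ trans (∏-* vs _ _) (cong₂ _*_ (trans (∏-if-const vs (adj u) L) (cong (L ^_) (deg u))) (sym (+-identityʳ (marginal f)))) ⟩
      L ^ δ * (1 * marginal f) ∎
      where
      pt : ∀ v x → adj u v ≡ x → ∀ y → odd v ≡ y → (if x then Λ else 1) * (if y then sel (ok v f) wgt else wgt (f v))
           ≤ (if x then L else 1) * (if y then σ (comm (nbrs f v)) else wgt (f v))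
      pt v false a false o = ≤-refl
      pt v true  a false o = ⊥-elim (true≢false (trans (sym (Data.Bool.Properties.not-involutive (odd v))) (trans (cong not (sym (adj-odd a))) (cong not ou))) o)
      pt v false a true  o = *-monoʳ-≤ 1 (∑-mono (allFin n) q₁)
        where
        q₁ : ∀ c → (if ok v f c then wgt c else 0) ≤ (if lookup (comm (nbrs f v)) c then wgt c else 0)
        q₁ c with lookup (comm (nbrs f v)) c
        ... | false = z≤n
        ... | true with not (adj u v) ∨ (lookup (comm (nbrs f v)) b ∧ not (eqFin c b))
        ...   | true  = ≤-refl
        ...   | false = z≤n
      pt v true  a true  o = go (lookup B b) refl
        where
        B = comm (nbrs f v)
        s = sel (ok v f) wgt
        ok≡ : ∀ c → ok v f c ≡ lookup B c ∧ (lookup B b ∧ not (eqFin c b))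
        ok≡ c = cong (λ x → lookup B c ∧ (not x ∨ (lookup B b ∧ not (eqFin c b)))) a
        go : ∀ x → lookup B b ≡ x → Λ * s ≤ L * σ B
        go false x = ≤-trans (≤-reflexive (trans (cong (Λ *_) (trans (∑-cong (allFin n) (λ c → if-false {b = ok v f c} (trans (ok≡ c) (trans (cong (λ y → lookup B c ∧ (y ∧ not (eqFin c b))) x) (Data.Bool.Properties.∧-zeroʳ (lookup B c)))))) (∑-0 (allFin n)))) (*-zeroʳ Λ))) z≤n
        go true x = begin
          Λ * s          ≤⟨ +-monoˡ-≤ (L * s) (≤-pred (≤-trans s+1 (σ≤Λ B))) ⟩
          L + L * s      ≡⟨ sym (*-suc L s) ⟩
          L * suc s      ≤⟨ *-monoʳ-≤ L s+1 ⟩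
          L * σ B ∎
          where
          okb : ok v f b ≡ false
          okb = trans (ok≡ b) (trans (cong (λ y → lookup B b ∧ (lookup B b ∧ not y)) (≡⇒≡ᵇ≡ {toℕ b} refl))
                  (trans (cong (lookup B b ∧_) (Data.Bool.Properties.∧-zeroʳ (lookup B b))) (Data.Bool.Properties.∧-zeroʳ (lookup B b))))
          s+1 : suc s ≤ σ B
          s+1 = ≤-trans (≤-reflexive (+-comm 1 s)) (≤-trans (sel-drop B (ok v f) wgt 1 b 1 x (λ c p → proj₁ (∧-true {lookup B c} p)) (λ c → ≤-reflexive (sym (*-identityʳ (wgt c))))
                  (≤-trans (≤-reflexive (cong (λ y → (if y then wgt b else 0) + 1) okb)) (≤-trans (1≤wgt b) (≤-reflexive (sym (*-identityʳ (wgt b)))))))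
                  (≤-reflexive (*-identityʳ (σ B))))

  misses : Col → ℕ
  misses f = ∑ vs (λ u → ∑ (allFin n) (λ b → ⟦ not (odd u) ∧ missed u b f ⟧))

  ∑misses : ∑ fs (λ f → misses f * weight f) * Λ ^ δ ≤ length vs * (n * (L ^ δ * Zn))
  ∑misses = begin
    ∑ fs (λ f → misses f * weight f) * Λ ^ δ
      ≡⟨ cong (_* Λ ^ δ) (trans (∑-cong fs (λ f → trans (sym (∑-*ʳ vs (weight f) _)) (∑-cong vs (λ u → sym (∑-*ʳ (allFin n) (weight f) _)))))
           (trans (∑-swap fs vs _) (∑-cong vs (λ u → ∑-swap fs (allFin n) (λ f b → ⟦ not (odd u) ∧ missed u b f ⟧ * weight f))))) ⟩
    ∑ vs (λ u → ∑ (allFin n) (λ b → ∑ fs (λ f → ⟦ not (odd u) ∧ missed u b f ⟧ * weight f))) * Λ ^ δ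
      ≡⟨ sym (trans (∑-cong vs (λ u → ∑-*ʳ (allFin n) (Λ ^ δ) _)) (∑-*ʳ vs (Λ ^ δ) _)) ⟩
    ∑ vs (λ u → ∑ (allFin n) (λ b → ∑ fs (λ f → ⟦ not (odd u) ∧ missed u b f ⟧ * weight f) * Λ ^ δ))
      ≤⟨ ∑-mono vs (λ u → ∑-mono (allFin n) (λ b → pt u b (odd u) refl)) ⟩
    ∑ vs (λ u → ∑ (allFin n) (λ b → L ^ δ * Zn))
      ≡⟨ trans (∑-const vs (∑ (allFin n) (λ b → L ^ δ * Zn))) (cong (length vs *_) (∑-constF n (L ^ δ * Zn))) ⟩
    length vs * (n * (L ^ δ * Zn)) ∎
    where
    open ≤-Reasoning
    pt : ∀ u b x → odd u ≡ x → ∑ fs (λ f → ⟦ not x ∧ missed u b f ⟧ * weight f) * Λ ^ δ ≤ L ^ δ * Zn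
    pt u b true  _ = ≤-trans (≤-reflexive (cong (_* Λ ^ δ) (∑-0 fs))) z≤n
    pt u b false o = gibbs u b o

-- Calculus of quantities bounded by `(m - Ω(1)) ^ d`

-- The rate `m - 1 / q` increases with `q`.
rate-mono : ∀ m q q′ d T Y → 1 ≤ m → 1 ≤ q → q ≤ q′ → Y * q ^ d ≤ T * (m * q ∸ 1) ^ d → Y * q′ ^ d ≤ T * (m * q′ ∸ 1) ^ d
rate-mono m q q′ d T Y 1≤m 1≤q q≤q′ h = *-cancelˡ (q ^ d) (1≤^ d 1≤q) (begin
  q ^ d * (Y * q′ ^ d)           ≡⟨ l₁ (q ^ d) Y (q′ ^ d) ⟩
  Y * q ^ d * q′ ^ d             ≤⟨ *-monoˡ-≤ (q′ ^ d) h ⟩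
  T * (m * q ∸ 1) ^ d * q′ ^ d   ≡⟨ trans (*-assoc T _ _) (cong (T *_) (sym (*-^ (m * q ∸ 1) q′ d))) ⟩
  T * ((m * q ∸ 1) * q′) ^ d     ≤⟨ *-monoʳ-≤ T (^-monoˡ-≤ d base) ⟩
  T * ((m * q′ ∸ 1) * q) ^ d     ≡⟨ trans (cong (T *_) (*-^ (m * q′ ∸ 1) q d)) (l₂ T ((m * q′ ∸ 1) ^ d) (q ^ d)) ⟩
  q ^ d * (T * (m * q′ ∸ 1) ^ d) ∎)
  where
  open ≤-Reasoning
  l₁ : ∀ a y b → a * (y * b) ≡ y * a * b
  l₁ = solve-∀
  l₂ : ∀ t a b → t * (a * b) ≡ b * (t * a)
  l₂ = solve-∀
  l₃ : ∀ m q r → m * q * r ≡ m * r * q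
  l₃ = solve-∀
  base : (m * q ∸ 1) * q′ ≤ (m * q′ ∸ 1) * q
  base = ≤-trans (≤-reflexive (*-distribʳ-∸ q′ (m * q) 1)) (≤-trans (≤-reflexive (cong₂ _∸_ (l₃ m q q′) (+-identityʳ q′)))
    (≤-trans (∸-monoʳ-≤ (m * q′ * q) q≤q′) (≤-reflexive (trans (cong (m * q′ * q ∸_) (sym (+-identityʳ q))) (sym (*-distribʳ-∸ q (m * q′) 1))))))

-- A polynomial is absorbed by (1 + 1 / s)^d ≥ (1 + 1 / (2s + 1))^(2d), one factor at a time.
poly≤exp : ∀ r c s → 1 ≤ s → ∃[ d₀ ] ∀ d → d₀ ≤ d → c * suc d ^ r * s ^ d ≤ suc s ^ d
poly≤exp zero c s 1≤s = c * s , λ d h → *-cancelˡ s 1≤s (begin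
  s * (c * 1 * s ^ d)     ≡⟨ l₁ s c (s ^ d) ⟩
  s ^ d * (c * s)         ≤⟨ *-monoʳ-≤ (s ^ d) (≤-trans h (m≤n+m d s)) ⟩
  s ^ d * (s + d)         ≤⟨ bernoulli s d ⟩
  s * suc s ^ d ∎)
  where
  open ≤-Reasoning
  l₁ : ∀ s c x → s * (c * 1 * x) ≡ x * (c * s)
  l₁ = solve-∀
poly≤exp (suc r) c s 1≤s with poly≤exp r (c * suc (2 * s)) (suc (2 * s)) (s≤s z≤n)
... | d₀ , IH = d₀ , λ d h → *-cancelˡ (t ^ d * t ^ d) (*-mono-≤ (1≤^ d (s≤s z≤n)) (1≤^ d (s≤s z≤n))) (begin
  t ^ d * t ^ d * (c * (suc d * suc d ^ r) * s ^ d)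
    ≡⟨ l₁ (t ^ d) c (suc d) (suc d ^ r) (s ^ d) ⟩
  c * suc d ^ r * t ^ d * (t ^ d * suc d) * s ^ d
    ≤⟨ *-monoˡ-≤ (s ^ d) (*-monoʳ-≤ (c * suc d ^ r * t ^ d) (≤-trans (*-monoʳ-≤ (t ^ d) (s≤s (m≤n+m d (2 * s)))) (bernoulli t d))) ⟩
  c * suc d ^ r * t ^ d * (t * suc t ^ d) * s ^ d
    ≡⟨ l₂ c (suc d ^ r) (t ^ d) t (suc t ^ d) (s ^ d) ⟩
  c * t * suc d ^ r * t ^ d * suc t ^ d * s ^ d
    ≤⟨ *-monoˡ-≤ (s ^ d) (*-monoˡ-≤ (suc t ^ d) (IH d h)) ⟩
  suc t ^ d * suc t ^ d * s ^ d
    ≡⟨ trans (cong (_* s ^ d) (sym (*-^ (suc t) (suc t) d))) (sym (*-^ (suc t * suc t) s d)) ⟩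
  (suc t * suc t * s) ^ d
    ≤⟨ ^-monoˡ-≤ d (≤-trans (m≤m+n (suc t * suc t * s) (suc s)) (≤-reflexive (l₃ s))) ⟩
  (t * t * suc s) ^ d
    ≡⟨ trans (*-^ (t * t) (suc s) d) (cong (_* suc s ^ d) (*-^ t t d)) ⟩
  t ^ d * t ^ d * suc s ^ d ∎)
  where
  open ≤-Reasoning
  t = suc (2 * s)
  l₁ : ∀ t c d e s → t * t * (c * (d * e) * s) ≡ c * e * t * (t * d) * s
  l₁ = solve-∀
  l₂ : ∀ c e x t y s → c * e * x * (t * y) * s ≡ c * t * e * x * y * s
  l₂ = solve-∀
  l₃ : ∀ s → suc (suc (2 * s)) * suc (suc (2 * s)) * s + suc s ≡ suc (2 * s) * suc (2 * s) * suc s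
  l₃ = solve-∀

module Growth (m-2 : ℕ) where

  m : ℕ
  m = suc (suc m-2)

  -- The argument of Y is the dimension minus 2.
  record Exp (Y : ℕ → ℕ) : Set where
    constructor exp
    field
      q c r : ℕ
      1≤q   : 1 ≤ q
      bound : ∀ e → Y e * q ^ (2 + e) ≤ c * (3 + e) ^ r * (m * q ∸ 1) ^ (2 + e)

  exp-≤ : ∀ {Y Y′} → (∀ e → Y′ e ≤ Y e) → Exp Y → Exp Y′
  exp-≤ h (exp q c r 1≤q b) = exp q c r 1≤q (λ e → ≤-trans (*-monoˡ-≤ (q ^ (2 + e)) (h e)) (b e))

  exp-1 : Exp (λ _ → 1)
  exp-1 = exp 1 1 0 ≤-refl (λ e → ≤-trans (≤-reflexive (trans (+-identityʳ _) (^-zeroˡ (2 + e))))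
            (≤-trans (1≤^ (2 + e) (≤-trans (s≤s z≤n) (≤-reflexive (sym (cong (_∸ 1) (*-identityʳ m)))))) (≤-reflexive (sym (+-identityʳ _)))))

  exp-+ : ∀ {Y Y′} → Exp Y → Exp Y′ → Exp (λ e → Y e + Y′ e)
  exp-+ {Y} {Y′} (exp q c r 1≤q b) (exp q′ c′ r′ 1≤q′ b′) = exp (q + q′) (c + c′) (r + r′) (≤-trans 1≤q (m≤m+n q q′)) (λ e → let
      x = 3 + e ; ρ = (m * (q + q′) ∸ 1) ^ (2 + e) in begin
      (Y e + Y′ e) * (q + q′) ^ (2 + e)
        ≡⟨ *-distribʳ-+ ((q + q′) ^ (2 + e)) (Y e) (Y′ e) ⟩
      Y e * (q + q′) ^ (2 + e) + Y′ e * (q + q′) ^ (2 + e)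
        ≤⟨ +-mono-≤ (rate-mono m q (q + q′) (2 + e) (c * x ^ r) (Y e) (s≤s z≤n) 1≤q (m≤m+n q q′) (b e))
                    (rate-mono m q′ (q + q′) (2 + e) (c′ * x ^ r′) (Y′ e) (s≤s z≤n) 1≤q′ (m≤n+m q′ q) (b′ e)) ⟩
      c * x ^ r * ρ + c′ * x ^ r′ * ρ
        ≤⟨ +-mono-≤ (*-monoˡ-≤ ρ (*-monoʳ-≤ c (^-monoʳ-≤ x (m≤m+n r r′)))) (*-monoˡ-≤ ρ (*-monoʳ-≤ c′ (^-monoʳ-≤ x (m≤n+m r′ r)))) ⟩
      c * x ^ (r + r′) * ρ + c′ * x ^ (r + r′) * ρ
        ≡⟨ lem c c′ (x ^ (r + r′)) ρ ⟩
      (c + c′) * x ^ (r + r′) * ρ ∎)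
    where
    open ≤-Reasoning
    lem : ∀ c d x ρ → c * x * ρ + d * x * ρ ≡ (c + d) * x * ρ
    lem = solve-∀

  exp-*c : ∀ {Y} a → Exp Y → Exp (λ e → a * Y e)
  exp-*c {Y} a (exp q c r 1≤q b) = exp q (a * c) r 1≤q (λ e → ≤-trans (≤-reflexive (*-assoc a (Y e) _))
    (≤-trans (*-monoʳ-≤ a (b e)) (≤-reflexive (lem a c ((3 + e) ^ r) ((m * q ∸ 1) ^ (2 + e))))))
    where
    lem : ∀ a c x ρ → a * (c * x * ρ) ≡ a * c * x * ρ
    lem = solve-∀

  exp-*d : ∀ {Y} → Exp Y → Exp (λ e → (2 + e) * Y e)
  exp-*d {Y} (exp q c r 1≤q b) = exp q c (suc r) 1≤q (λ e → ≤-trans (≤-reflexive (*-assoc (2 + e) (Y e) _))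
    (≤-trans (*-mono-≤ (n≤1+n (2 + e)) (b e)) (≤-reflexive (lem (3 + e) c ((3 + e) ^ r) ((m * q ∸ 1) ^ (2 + e))))))
    where
    lem : ∀ a c x ρ → a * (c * x * ρ) ≡ c * (a * x) * ρ
    lem = solve-∀

  Small : (ℕ → ℕ) → ℕ → ℕ → Set
  Small Y k d₀ = ∀ e → d₀ ≤ 2 + e → Y e * k ^ (2 + e) ≤ (m * k ∸ 1) ^ (2 + e)

  -- Doubling `q` enlarges the base slightly, and the exponential ratio of the two powers absorbs
  -- the polynomial.
  small : ∀ {Y} → Exp Y → ∃[ k ] ∃[ d₀ ] (1 ≤ k × Small Y k d₀)
  small {Y} (exp q c r 1≤q b) = 2 * q , proj₁ pe , ≤-trans 1≤q (m≤m+n q (q + 0)) , λ e h → begin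
      Y e * (2 * q) ^ (2 + e)
        ≡⟨ trans (cong (Y e *_) (*-^ 2 q (2 + e))) (l₁ (Y e) (2 ^ (2 + e)) (q ^ (2 + e))) ⟩
      Y e * q ^ (2 + e) * 2 ^ (2 + e)
        ≤⟨ *-monoˡ-≤ (2 ^ (2 + e)) (b e) ⟩
      c * (3 + e) ^ r * (m * q ∸ 1) ^ (2 + e) * 2 ^ (2 + e)
        ≡⟨ trans (*-assoc (c * (3 + e) ^ r) _ _) (cong (c * (3 + e) ^ r *_) (sym (*-^ (m * q ∸ 1) 2 (2 + e)))) ⟩
      c * (3 + e) ^ r * s ^ (2 + e)
        ≤⟨ proj₂ pe (2 + e) h ⟩
      suc s ^ (2 + e)
        ≤⟨ ^-monoˡ-≤ (2 + e) s< ⟩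
      (m * (2 * q) ∸ 1) ^ (2 + e) ∎
    where
    open ≤-Reasoning
    s = (m * q ∸ 1) * 2
    2≤mq : 2 ≤ m * q
    2≤mq = ≤-trans (s≤s (s≤s z≤n)) (m≤m*n m q {{>-nonZero 1≤q}})
    1≤s : 1 ≤ s
    1≤s = ≤-trans (∸-monoˡ-≤ 1 2≤mq) (m≤m*n (m * q ∸ 1) 2)
    pe = poly≤exp r c s 1≤s
    s< : suc s ≤ m * (2 * q) ∸ 1
    s< = ≤-reflexive (trans (cong suc (*-distribʳ-∸ 2 (m * q) 1)) (trans (sym (+-∸-assoc 1 {m * q * 2} {2} (≤-trans (≤-trans 2≤mq (m≤m*n (m * q) 2)) ≤-refl))) (cong (_∸ 1) (l₂ m q))))
      where
      l₂ : ∀ m q → m * q * 2 ≡ m * (2 * q)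
      l₂ = solve-∀
    l₁ : ∀ y a b → y * (a * b) ≡ y * b * a
    l₁ = solve-∀

  small-mono : ∀ {Y k d₀} k′ → 1 ≤ k → k ≤ k′ → Small Y k d₀ → Small Y k′ d₀
  small-mono {Y} {k} k′ 1≤k k≤ h e d≤ = ≤-trans (rate-mono m k k′ (2 + e) 1 (Y e) (s≤s z≤n) 1≤k k≤ (≤-trans (h e d≤) (≤-reflexive (sym (+-identityʳ _))))) (≤-reflexive (+-identityʳ _))

  m*pred≤ : ∀ q → m * (q ∸ 1) ≤ m * q ∸ 1
  m*pred≤ q = ≤-trans (≤-reflexive (trans (*-distribˡ-∸ m q 1) (cong (m * q ∸_) (*-identityʳ m)))) (∸-monoʳ-≤ (m * q) (s≤s z≤n))

  -- The left side compares (R′ / R) ^ j, where j = ⌊u / κ⌋ or so, with an exponential in u.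
  decay : ∀ κ-1 R′ j u → 1 ≤ R′ → suc κ-1 * j ≤ u → u ≤ suc κ-1 * suc j →
          R′ ^ j * (suc κ-1 * suc R′) ^ u ≤ (suc κ-1 * suc R′) ^ suc κ-1 * (suc R′ ^ j * (suc κ-1 * suc R′ ∸ 1) ^ u)
  decay κ-1 R′ j u 1≤R′ lo hi with m≤n⇒∃[o]m+o≡n lo
  ... | t , refl = begin
    R′ ^ j * Q ^ (κ * j + t)
      ≡⟨ trans (cong (R′ ^ j *_) (trans (^-distribˡ-+-* Q (κ * j) t) (cong (_* Q ^ t) (sym (^-*-assoc Q κ j))))) (sym (*-assoc (R′ ^ j) _ _)) ⟩
    R′ ^ j * (Q ^ κ) ^ j * Q ^ t
      ≡⟨ cong (_* Q ^ t) (sym (*-^ R′ (Q ^ κ) j)) ⟩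
    (R′ * Q ^ κ) ^ j * Q ^ t
      ≤⟨ *-mono-≤ (^-monoˡ-≤ j base) (≤-trans (^-monoʳ-≤ Q t≤κ) (m≤m*n (Q ^ κ) (p ^ t) {{>-nonZero (1≤^ t 1≤p)}})) ⟩
    (suc R′ * p ^ κ) ^ j * (Q ^ κ * p ^ t)
      ≡⟨ cong (_* (Q ^ κ * p ^ t)) (trans (*-^ (suc R′) (p ^ κ) j) (cong (suc R′ ^ j *_) (^-*-assoc p κ j))) ⟩
    suc R′ ^ j * p ^ (κ * j) * (Q ^ κ * p ^ t)
      ≡⟨ lem (suc R′ ^ j) (p ^ (κ * j)) (Q ^ κ) (p ^ t) ⟩
    Q ^ κ * (suc R′ ^ j * (p ^ (κ * j) * p ^ t))
      ≡⟨ cong (λ x → Q ^ κ * (suc R′ ^ j * x)) (sym (^-distribˡ-+-* p (κ * j) t)) ⟩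
    Q ^ κ * (suc R′ ^ j * p ^ (κ * j + t)) ∎
    where
    open ≤-Reasoning
    κ = suc κ-1
    Q = κ * suc R′
    p = Q ∸ 1
    1≤p : 1 ≤ p
    1≤p = ≤-trans 1≤R′ (m≤m+n R′ (κ-1 * suc R′))
    t≤κ : t ≤ κ
    t≤κ = +-cancelˡ-≤ (κ * j) t κ (≤-trans hi (≤-reflexive (trans (*-suc κ j) (+-comm κ (κ * j)))))
    lem : ∀ a b c d → a * b * (c * d) ≡ c * (a * (b * d))
    lem = solve-∀
    -- Bernoulli's inequality in the form `1 - 1 / R ≤ (1 - 1 / (κ R)) ^ κ`.
    base : R′ * Q ^ κ ≤ suc R′ * p ^ κ
    base = *-cancelˡ κ (s≤s z≤n) (≤-trans (≤-reflexive (l₁ κ R′ (Q ^ κ))) (≤-trans (bernoulli-down κ-1 p (κ * R′) (*-suc κ R′)) (≤-reflexive (*-assoc κ (suc R′) (p ^ κ)))))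
      where
      l₁ : ∀ k r q → k * (r * q) ≡ q * (k * r)
      l₁ = solve-∀

-- Rational weights as natural numbers over a common denominator

toℚ : ℕ → ℚ
toℚ x = ℚ._/_ (ℤ.+ x) 1

private
  num : ℕ → ℚᵘ.ℚᵘ
  num x = ℚᵘ.mkℚᵘ (ℤ.+ x) 0

  toℚᵘ-toℚ : ∀ x → ℚ.toℚᵘ (toℚ x) ℚᵘ.≃ num x
  toℚᵘ-toℚ x = ℚ.toℚᵘ-fromℚᵘ (num x)

toℚ-* : ∀ x y → toℚ (x * y) ≡ toℚ x ℚ.* toℚ y
toℚ-* x y = ℚ.toℚᵘ-injective (ℚᵘ.≃-trans (toℚᵘ-toℚ (x * y)) (ℚᵘ.≃-trans (ℚᵘ.≃-reflexive (cong (λ z → ℚᵘ.mkℚᵘ z 0) (ℤ.pos-* x y)))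
  (ℚᵘ.≃-sym (ℚᵘ.≃-trans (ℚ.toℚᵘ-homo-* (toℚ x) (toℚ y)) (ℚᵘ.*-cong (toℚᵘ-toℚ x) (toℚᵘ-toℚ y))))))

toℚ-+ : ∀ x y → toℚ (x + y) ≡ toℚ x ℚ.+ toℚ y
toℚ-+ x y = ℚ.toℚᵘ-injective (ℚᵘ.≃-trans (toℚᵘ-toℚ (x + y)) (ℚᵘ.≃-trans
  (ℚᵘ.≃-reflexive (cong (λ z → ℚᵘ.mkℚᵘ z 0) (trans (ℤ.pos-+ x y) (cong₂ ℤ._+_ (sym (ℤ.*-identityʳ (ℤ.+ x))) (sym (ℤ.*-identityʳ (ℤ.+ y)))))))
  (ℚᵘ.≃-sym (ℚᵘ.≃-trans (ℚ.toℚᵘ-homo-+ (toℚ x) (toℚ y)) (ℚᵘ.+-cong (toℚᵘ-toℚ x) (toℚᵘ-toℚ y))))))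

toℚ-≤ : ∀ {x y} → x ≤ y → toℚ x ℚ.≤ toℚ y
toℚ-≤ {x} {y} x≤y = ℚ.toℚᵘ-cancel-≤ (ℚᵘ.≤-trans (ℚᵘ.≤-reflexive (toℚᵘ-toℚ x)) (ℚᵘ.≤-trans
  (ℚᵘ.*≤* (ℤ.*-monoʳ-≤-nonNeg (ℤ.+ 1) (ℤ.+≤+ x≤y))) (ℚᵘ.≤-reflexive (ℚᵘ.≃-sym (toℚᵘ-toℚ y)))))

toℚ-pos : ∀ x → 1 ≤ x → ℚ.Positive (toℚ x)
toℚ-pos (suc x) _ = ℚ.normalize-pos (suc x) 1

powℚ-toℚ : ∀ x k → powℚ (toℚ x) k ≡ toℚ (x ^ k)
powℚ-toℚ x zero    = refl
powℚ-toℚ x (suc k) = trans (cong (toℚ x ℚ.*_) (powℚ-toℚ x k)) (sym (toℚ-* x (x ^ k)))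

swapℚ : ∀ a b c d → (a ℚ.* b) ℚ.* (c ℚ.* d) ≡ (a ℚ.* c) ℚ.* (b ℚ.* d)
swapℚ a b c d = trans (ℚ.*-assoc a b (c ℚ.* d)) (trans (cong (a ℚ.*_) (trans (sym (ℚ.*-assoc b c d)) (trans (cong (ℚ._* d) (ℚ.*-comm b c)) (ℚ.*-assoc c b d))))
  (sym (ℚ.*-assoc a c (b ℚ.* d))))

powℚ-* : ∀ a b k → powℚ (a ℚ.* b) k ≡ powℚ a k ℚ.* powℚ b k
powℚ-* a b zero    = refl
powℚ-* a b (suc k) = trans (cong ((a ℚ.* b) ℚ.*_) (powℚ-* a b k)) (swapℚ a b (powℚ a k) (powℚ b k))

-- The equation `q = x / D` without division. The fraction need not be reduced, so one denominator
-- can be carried through a whole sum.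
record _over_is_ (x D : ℕ) (q : ℚ) : Set where
  constructor over
  field cleared-denominator : q ℚ.* toℚ D ≡ toℚ x

over-* : ∀ {x y D D′ q r} → x over D is q → y over D′ is r → (x * y) over (D * D′) is (q ℚ.* r)
over-* {x} {y} {D} {D′} {q} {r} (over h) (over h′) = over (trans (cong ((q ℚ.* r) ℚ.*_) (toℚ-* D D′)) (trans (swapℚ q r (toℚ D) (toℚ D′)) (trans (cong₂ ℚ._*_ h h′) (sym (toℚ-* x y)))))

over-+ : ∀ {x y D q r} → x over D is q → y over D is r → (x + y) over D is (q ℚ.+ r)
over-+ {x} {y} {D} {q} {r} (over h) (over h′) = over (trans (ℚ.*-distribʳ-+ (toℚ D) q r) (trans (cong₂ ℚ._+_ h h′) (sym (toℚ-+ x y))))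

over-≤ : ∀ {x y D q r} → 1 ≤ D → x over D is q → y over D is r → x ≤ y → q ℚ.≤ r
over-≤ {x} {y} {D} {q} {r} 1≤D (over h) (over h′) x≤y = ℚ.*-cancelʳ-≤-pos (toℚ D) {{toℚ-pos D 1≤D}}
  (ℚ.≤-trans (ℚ.≤-reflexive h) (ℚ.≤-trans (toℚ-≤ x≤y) (ℚ.≤-reflexive (sym h′))))

over-pow : ∀ {x D q} k → x over D is q → (x ^ k) over (D ^ k) is powℚ q k
over-pow {x} {D} {q} k (over h) = over (trans (cong (powℚ q k ℚ.*_) (sym (powℚ-toℚ D k))) (trans (sym (powℚ-* q (toℚ D) k)) (trans (cong (λ z → powℚ z k) h) (powℚ-toℚ x k))))

over-scale : ∀ {x D q} D′ → x over D is q → (D′ * x) over (D′ * D) is q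
over-scale {x} {D} {q} D′ (over h) = over (trans (cong (q ℚ.*_) (toℚ-* D′ D)) (trans (trans (sym (ℚ.*-assoc q (toℚ D′) (toℚ D))) (trans (cong (ℚ._* toℚ D) (ℚ.*-comm q (toℚ D′))) (ℚ.*-assoc (toℚ D′) q (toℚ D))))
  (trans (cong (toℚ D′ ℚ.*_) h) (sym (toℚ-* D′ x)))))

over-1 : ∀ x → x over 1 is toℚ x
over-1 x = over (ℚ.*-identityʳ (toℚ x))

single : ∀ q → 0ℚ ℚ.< q → ∃[ x ] ∃[ D ] (1 ≤ x × 1 ≤ D × x over D is q)
single q@(ℚ.mkℚ (ℤ.+ zero)  d c) (ℚ.*<* (ℤ.+<+ ()))
single q@(ℚ.mkℚ (ℤ.+ suc x) d c) _ = suc x , suc d , s≤s z≤n , s≤s z≤n , over (ℚ.toℚᵘ-injective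
  (ℚᵘ.≃-trans (ℚ.toℚᵘ-homo-* q (toℚ (suc d))) (ℚᵘ.≃-trans (ℚᵘ.*-congˡ {ℚ.toℚᵘ q} (toℚᵘ-toℚ (suc d))) (ℚᵘ.≃-trans (ℚᵘ.*≡* eq) (ℚᵘ.≃-sym (toℚᵘ-toℚ (suc x)))))))
  where
  eq : (ℤ.+ suc x ℤ.* ℤ.+ suc d) ℤ.* ℤ.+ 1 ≡ ℤ.+ suc x ℤ.* (ℤ.+ suc (d * 1))
  eq = trans (ℤ.*-identityʳ _) (cong (λ z → ℤ.+ suc x ℤ.* ℤ.+ suc z) (sym (*-identityʳ d)))
single (ℚ.mkℚ (ℤ.-[1+ x ]) d c) (ℚ.*<* ())

common : ∀ n (lam : Fin n → ℚ) → (∀ i → 0ℚ ℚ.< lam i) →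
         ∃[ D ] Σ (Fin n → ℕ) λ a → 1 ≤ D × (∀ i → 1 ≤ a i) × (∀ i → a i over D is lam i)
common zero    lam pos = 1 , (λ ()) , s≤s z≤n , (λ ()) , (λ ())
common (suc n) lam pos = hlp (single (lam zero) (pos zero)) (common n (lam ∘ suc) (pos ∘ suc))
  where
  hlp : ∃[ x ] ∃[ D ] (1 ≤ x × 1 ≤ D × x over D is lam zero) →
        ∃[ D ] Σ (Fin n → ℕ) (λ a → 1 ≤ D × (∀ i → 1 ≤ a i) × (∀ i → a i over D is lam (suc i))) →
        ∃[ D ] Σ (Fin (suc n) → ℕ) λ a → 1 ≤ D × (∀ i → 1 ≤ a i) × (∀ i → a i over D is lam i)
  hlp (x , D , 1≤x , 1≤D , h) (D′ , a , 1≤D′ , 1≤a , h′) = D′ * D , a′ , *-mono-≤ 1≤D′ 1≤D , 1≤a′ , ha′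
    where
    a′ : Fin (suc n) → ℕ
    a′ zero    = D′ * x
    a′ (suc i) = D * a i
    1≤a′ : ∀ i → 1 ≤ a′ i
    1≤a′ zero    = *-mono-≤ 1≤D′ 1≤x
    1≤a′ (suc i) = *-mono-≤ 1≤D (1≤a i)
    ha′ : ∀ i → a′ i over (D′ * D) is lam i
    ha′ zero    = over-scale D′ h
    ha′ (suc i) = subst (λ z → (D * a i) over z is lam (suc i)) (*-comm D D′) (over-scale D (h′ i))

module Scaled {n} (lam : Fin n → ℚ) (D : ℕ) (1≤D : 1 ≤ D) (a : Fin n → ℕ) (rep : ∀ i → a i over D is lam i) where

  over-sum : ∀ {X : Set} D (b : X → Bool) (g : X → ℚ) (g′ : X → ℕ) → (∀ x → g′ x over D is g x) → ∀ l →
             ∑ l (λ x → if b x then g′ x else 0) over D is sumℚ (map g (filter (λ x → T? (b x)) l))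
  over-sum D b g g′ h []      = over (ℚ.*-zeroˡ (toℚ D))
  over-sum D b g g′ h (x ∷ l) with b x
  ... | true  = over-+ (h x) (over-sum D b g g′ h l)
  ... | false = over-sum D b g g′ h l

  over-prod : ∀ {X : Set} (f : X → Fin n) l → ∏ l (λ x → a (f x)) over (D ^ length l) is prodℚ (map (λ x → lam (f x)) l)
  over-prod f []      = over-1 1
  over-prod f (x ∷ l) = over-* (rep (f x)) (over-prod f l)

  over-lamS : ∀ A → ∑ (allFin n) (λ c → if lookup A c then a c else 0) over D is lamS lam A
  over-lamS A = over-sum D (lookup A) lam a rep (allFin n)

  over-wtHom : ∀ (H : Adj n) m d (Q : Coloring n m d → Bool) →
               ∑ (allColorings n m d) (λ f → if isHom H m d f ∧ Q f then ∏ (allVerts m d) (λ v → a (f v)) else 0)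
               over (D ^ length (allVerts m d)) is wtHom H lam m d Q
  over-wtHom H m d Q = over-sum (D ^ length (allVerts m d)) (λ f → isHom H m d f ∧ Q f) (wt lam m d) (λ f → ∏ (allVerts m d) (λ v → a (f v)))
    (λ f → over-prod f (allVerts m d)) (allColorings n m d)

  inM : ∀ (H : Adj n) A B → A ∼[ H ] B →
        (∀ A′ B′ → A′ ∼[ H ] B′ → ∑ (allFin n) (λ c → if lookup A′ c then a c else 0) * ∑ (allFin n) (λ c → if lookup B′ c then a c else 0)
                                ≤ ∑ (allFin n) (λ c → if lookup A c then a c else 0) * ∑ (allFin n) (λ c → if lookup B c then a c else 0)) →
        InM H lam (A , B)
  inM H A B AB mx = AB , λ A′ B′ AB′ → over-≤ (*-mono-≤ 1≤D 1≤D) (over-* (over-lamS A′) (over-lamS B′))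
    (over-* (over-lamS A) (over-lamS B)) (mx A′ B′ AB′)

  over-power : ∀ {w z D′} W W′ k d → 1 ≤ D′ → W over D′ is w → W′ over D′ is z → W ^ k * 2 ^ d ≤ W′ ^ k →
               powℚ w k ℚ.* toℚ (2 ^ d) ℚ.≤ powℚ z k
  over-power {w} {z} {D′} W W′ k d 1≤D′ h h′ le = over-≤ (*-mono-≤ (1≤^ k 1≤D′) (≤-refl {1}))
    (over-* (over-pow k h) (over-1 (2 ^ d)))
    (subst (λ t → (W′ ^ k) over t is powℚ z k) (sym (*-identityʳ (D′ ^ k))) (over-pow k h′)) le

-- The rate splits as `p / (p + 1) = (2 p) / (2 p + 1)` times `(2 p + 1) / (2 p + 2)`. By Bernoulli
-- the first part absorbs the factor 5 once `d ≥ 8 p`; the inverse of the second, raised to the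
-- power `k`, is at least 2.
final-power : ∀ p k d W Z → 1 ≤ p → 8 * p ≤ d → 2 * suc p ≤ k → W * suc p ^ d ≤ 5 * (p ^ d * Z) → W ^ k * 2 ^ d ≤ Z ^ k
final-power p k d W Z 1≤p 8p≤d 2p≤k h = *-cancelˡ ((q ^ k) ^ d) (1≤^ d (1≤^ k (s≤s z≤n))) (begin
  (q ^ k) ^ d * (W ^ k * 2 ^ d)         ≡⟨ l₁ ((q ^ k) ^ d) (W ^ k) (2 ^ d) ⟩
  W ^ k * (2 ^ d * (q ^ k) ^ d)         ≡⟨ cong (W ^ k *_) (sym (*-^ 2 (q ^ k) d)) ⟩
  W ^ k * (2 * q ^ k) ^ d               ≤⟨ *-monoʳ-≤ (W ^ k) (^-monoˡ-≤ d twice) ⟩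
  W ^ k * (suc q ^ k) ^ d               ≡⟨ cong (W ^ k *_) (flip (suc q)) ⟩
  W ^ k * (suc q ^ d) ^ k               ≡⟨ sym (*-^ W (suc q ^ d) k) ⟩
  (W * suc q ^ d) ^ k                   ≤⟨ ^-monoˡ-≤ k step ⟩
  (q ^ d * Z) ^ k                       ≡⟨ trans (*-^ (q ^ d) Z k) (cong (_* Z ^ k) (sym (flip q))) ⟩
  (q ^ k) ^ d * Z ^ k ∎)
  where
  open ≤-Reasoning
  q = suc (2 * p)
  l₁ : ∀ a b c → a * (b * c) ≡ b * (c * a)
  l₁ = solve-∀
  flip : ∀ z → (z ^ k) ^ d ≡ (z ^ d) ^ k
  flip z = trans (^-*-assoc z k d) (trans (cong (z ^_) (*-comm k d)) (sym (^-*-assoc z d k)))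
  q≤k : q ≤ k
  q≤k = ≤-trans (≤-trans (n≤1+n q) (≤-reflexive (l₂ p))) 2p≤k
    where
    l₂ : ∀ p → suc (suc (2 * p)) ≡ 2 * suc p
    l₂ = solve-∀
  twice : 2 * q ^ k ≤ suc q ^ k
  twice with m≤n⇒∃[o]m+o≡n q≤k
  ... | t , e = begin
    2 * q ^ k              ≡⟨ cong (λ z → 2 * q ^ z) (sym e) ⟩
    2 * q ^ (q + t)        ≡⟨ trans (cong (2 *_) (^-distribˡ-+-* q q t)) (sym (*-assoc 2 (q ^ q) (q ^ t))) ⟩
    2 * q ^ q * q ^ t      ≤⟨ *-mono-≤ (double-≤ (2 * p)) (^-monoˡ-≤ t (n≤1+n q)) ⟩
    suc q ^ q * suc q ^ t  ≡⟨ sym (^-distribˡ-+-* (suc q) q t) ⟩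
    suc q ^ (q + t)        ≡⟨ cong (suc q ^_) e ⟩
    suc q ^ k ∎
  five : 5 * (2 * p) ^ d ≤ q ^ d
  five = *-cancelˡ (2 * p) (≤-trans 1≤p (m≤m+n p (p + 0))) (begin
    2 * p * (5 * (2 * p) ^ d)   ≡⟨ l₃ p ((2 * p) ^ d) ⟩
    (2 * p) ^ d * (2 * p + 8 * p) ≤⟨ *-monoʳ-≤ ((2 * p) ^ d) (+-monoʳ-≤ (2 * p) 8p≤d) ⟩
    (2 * p) ^ d * (2 * p + d)   ≤⟨ bernoulli (2 * p) d ⟩
    2 * p * q ^ d ∎)
    where
    l₃ : ∀ p x → 2 * p * (5 * x) ≡ x * (2 * p + 8 * p)
    l₃ = solve-∀
  step : W * suc q ^ d ≤ q ^ d * Z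
  step = begin
    W * suc q ^ d                ≡⟨ cong (λ z → W * z ^ d) (l₂ p) ⟩
    W * (2 * suc p) ^ d          ≡⟨ trans (cong (W *_) (*-^ 2 (suc p) d)) (l₁ W (2 ^ d) (suc p ^ d)) ⟩
    2 ^ d * (suc p ^ d * W)      ≡⟨ cong (2 ^ d *_) (*-comm (suc p ^ d) W) ⟩
    2 ^ d * (W * suc p ^ d)      ≤⟨ *-monoʳ-≤ (2 ^ d) h ⟩
    2 ^ d * (5 * (p ^ d * Z))    ≡⟨ l₄ (2 ^ d) (p ^ d) Z ⟩
    5 * (2 ^ d * p ^ d) * Z      ≡⟨ cong (λ x → 5 * x * Z) (sym (*-^ 2 p d)) ⟩
    5 * (2 * p) ^ d * Z          ≤⟨ *-monoˡ-≤ Z five ⟩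
    q ^ d * Z ∎
    where
    l₂ : ∀ p → suc (suc (2 * p)) ≡ 2 * suc p
    l₂ = solve-∀
    l₄ : ∀ a b z → a * (5 * (b * z)) ≡ 5 * (a * b) * z
    l₄ = solve-∀

-- Explicit bounds, and their use in one fixed dimension

floor : ∀ x y → 1 ≤ y → ℕ
floor x y 1≤y = _/_ x y {{>-nonZero 1≤y}}

floor* : ∀ x y (p : 1 ≤ y) → floor x y p * y ≤ x
floor* x y p = m/n*n≤m x y {{>-nonZero p}}

≤floor : ∀ x y (p : 1 ≤ y) → x ≤ suc (floor x y p) * y
≤floor x y p = ≤-trans (≤-reflexive (m≡m%n+[m/n]*n x y {{>-nonZero p}})) (+-monoˡ-≤ (floor x y p * y) (<⇒≤ (m%n<n x y {{>-nonZero p}})))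

≤-floor : ∀ a x y (p : 1 ≤ y) → a * y ≤ x → a ≤ floor x y p
≤-floor a x y p h = ≤-trans (≤-reflexive (sym (m*n/n≡m a y {{>-nonZero p}}))) (/-monoˡ-≤ y {{>-nonZero p}} h)

-- The argument e of the bounds stands for dimension e + 2.
module Numbers (k M : ℕ) (m≡ : suc (suc k) ≡ M + M) (n : ℕ) (H : Adj n) (wgt : Fin n → ℕ) (1≤wgt : ∀ c → 1 ≤ wgt c) where
  open Cycle k M m≡ using (m; κ-1)
  open Colours n H wgt 1≤wgt (suc κ-1) using (L; P; K; K′; R; R′; η; K′≡; R′≡; subsets)
  open Growth k hiding (m)

  κ C KK p : ℕ
  κ  = suc κ-1
  C  = length subsets * (n + 2)
  KK = K * K
  p  = suc (2 * L)

  1≤R′ : 1 ≤ R′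
  1≤R′ = ≤-trans (≤-trans (s≤s z≤n) (≤-reflexive (sym K′≡))) (≤-trans (m≤m+n K′ (η * P)) (≤-reflexive (sym R′≡)))

  opaque
    -- The floor of `(d - 1) / κ`. Starting from `d - 1` turns the strict bound on the remainder
    -- into `d ≤ κ (j₀ + 1)`, as `decay` requires.
    j₀ : ℕ → ℕ
    j₀ e = floor (suc e) κ (s≤s z≤n)

    κj₀≤ : ∀ e → κ * j₀ e ≤ suc e
    κj₀≤ e = ≤-trans (≤-reflexive (*-comm κ (j₀ e))) (floor* (suc e) κ (s≤s z≤n))

    <j₀ : ∀ e → 2 + e ≤ κ * suc (j₀ e)
    <j₀ e = ≤-trans (≤-trans (≤-reflexive (cong suc (m≡m%n+[m/n]*n (suc e) κ))) (+-monoˡ-≤ (j₀ e * κ) (m%n<n (suc e) κ))) (≤-reflexive (*-comm (suc (j₀ e)) κ))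

  opaque
    B₀ : ℕ → ℕ
    B₀ e = floor (m ^ (2 + e) * (C * R′ ^ j₀ e)) (R ^ j₀ e) (1≤^ (j₀ e) (s≤s z≤n))

    B₀≤ : ∀ e → B₀ e * R ^ j₀ e ≤ m ^ (2 + e) * (C * R′ ^ j₀ e)
    B₀≤ e = floor* (m ^ (2 + e) * (C * R′ ^ j₀ e)) (R ^ j₀ e) (1≤^ (j₀ e) (s≤s z≤n))

    ≤B : ∀ e → m ^ (2 + e) * (C * R′ ^ j₀ e) ≤ suc (B₀ e) * R ^ j₀ e
    ≤B e = ≤floor (m ^ (2 + e) * (C * R′ ^ j₀ e)) (R ^ j₀ e) (1≤^ (j₀ e) (s≤s z≤n))

  -- An upper bound for the total damping `N C (R′ / R) ^ j₀`, hence the successor of a floor.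
  B : ℕ → ℕ
  B e = suc (B₀ e)

  exp-B : Exp B
  exp-B = exp-+ exp-1 (exp Q (C * Q ^ κ) 0 (s≤s z≤n) bd)
    where
    Q = κ * R
    lemma : ∀ F r q md c r′ x mq y → F * r ≤ md * (c * r′) → r′ * q ≤ x * (r * y) → md * y ≤ mq → 1 ≤ r →
            F * q ≤ c * x * 1 * mq
    lemma F r q md c r′ x mq y h₁ h₂ h₃ 1≤r = *-cancelˡ r 1≤r (begin
      r * (F * q)                ≡⟨ l₁ r F q ⟩
      F * r * q                  ≤⟨ *-monoˡ-≤ q h₁ ⟩
      md * (c * r′) * q          ≡⟨ l₂ md c r′ q ⟩
      md * c * (r′ * q)          ≤⟨ *-monoʳ-≤ (md * c) h₂ ⟩
      md * c * (x * (r * y))     ≡⟨ l₃ md c x r y ⟩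
      r * (c * x * 1 * (md * y)) ≤⟨ *-monoʳ-≤ r (*-monoʳ-≤ (c * x * 1) h₃) ⟩
      r * (c * x * 1 * mq) ∎)
      where
      open ≤-Reasoning
      l₁ : ∀ r f q → r * (f * q) ≡ f * r * q
      l₁ = solve-∀
      l₂ : ∀ m c r q → m * (c * r) * q ≡ m * c * (r * q)
      l₂ = solve-∀
      l₃ : ∀ m c q r x → m * c * (q * (r * x)) ≡ r * (c * q * 1 * (m * x))
      l₃ = solve-∀
    bd : ∀ e → B₀ e * Q ^ (2 + e) ≤ C * Q ^ κ * 1 * (m * Q ∸ 1) ^ (2 + e)
    bd e = lemma (B₀ e) (R ^ j₀ e) (Q ^ (2 + e)) (m ^ (2 + e)) C (R′ ^ j₀ e) (Q ^ κ) ((m * Q ∸ 1) ^ (2 + e)) ((Q ∸ 1) ^ (2 + e))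
      (B₀≤ e) (decay κ-1 R′ (j₀ e) (2 + e) 1≤R′ (≤-trans (κj₀≤ e) (n≤1+n (suc e))) (<j₀ e))
      (≤-trans (≤-reflexive (sym (*-^ m (Q ∸ 1) (2 + e)))) (^-monoˡ-≤ (2 + e) (m*pred≤ Q)))
      (1≤^ (j₀ e) (s≤s z≤n))

  opaque
    -- Bounds the number `ι` of vertices with few lower neighbours; being an integer, `ι` stays
    -- below the floor.
    I : ℕ → ℕ
    I e = floor (m * (5 * suc m) ^ suc e) (8 ^ suc e) (1≤^ (suc e) (s≤s z≤n))

    I≤ : ∀ e → I e * 8 ^ suc e ≤ m * (5 * suc m) ^ suc e
    I≤ e = floor* (m * (5 * suc m) ^ suc e) (8 ^ suc e) (1≤^ (suc e) (s≤s z≤n))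

    ≤I : ∀ a e → a * 8 ^ suc e ≤ m * (5 * suc m) ^ suc e → a ≤ I e
    ≤I a e = ≤-floor a (m * (5 * suc m) ^ suc e) (8 ^ suc e) (1≤^ (suc e) (s≤s z≤n))

  exp-I : Exp I
  exp-I = exp 8 (8 * m) 0 (s≤s z≤n) (λ e → lemma (I e) (8 ^ suc e) m ((5 * suc m) ^ suc e) ((m * 8 ∸ 1) ^ (2 + e)) (I≤ e)
      (≤-trans (^-monoˡ-≤ (suc e) base) (^-monoʳ-≤ (m * 8 ∸ 1) (n≤1+n (suc e)))))
    where
    lemma : ∀ i x m y z → i * x ≤ m * y → y ≤ z → i * (8 * x) ≤ 8 * m * 1 * z
    lemma i x m y z h₁ h₂ = ≤-trans (≤-reflexive (l₁ i x)) (≤-trans (*-monoʳ-≤ 8 (≤-trans h₁ (*-monoʳ-≤ m h₂))) (≤-reflexive (l₂ m z)))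
      where
      l₁ : ∀ i x → i * (8 * x) ≡ 8 * (i * x)
      l₁ = solve-∀
      l₂ : ∀ m x → 8 * (m * x) ≡ 8 * m * 1 * x
      l₂ = solve-∀
    base : 5 * suc m ≤ m * 8 ∸ 1
    base = ≤-trans (m≤m+n (5 * suc m) (3 * k)) (≤-reflexive (l₃ k))
      where
      l₃ : ∀ k → 5 * suc (suc (suc k)) + 3 * k ≡ 15 + k * 8
      l₃ = solve-∀

  opaque
    Ξ₀ : ℕ → ℕ
    Ξ₀ e = floor (n * (m * p) ^ (2 + e)) (suc p ^ (2 + e)) (1≤^ (2 + e) (s≤s z≤n))

    Ξ₀≤ : ∀ e → Ξ₀ e * suc p ^ (2 + e) ≤ n * (m * p) ^ (2 + e)
    Ξ₀≤ e = floor* (n * (m * p) ^ (2 + e)) (suc p ^ (2 + e)) (1≤^ (2 + e) (s≤s z≤n))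

    ≤Ξ : ∀ e → n * (m * p) ^ (2 + e) ≤ suc (Ξ₀ e) * suc p ^ (2 + e)
    ≤Ξ e = ≤floor (n * (m * p) ^ (2 + e)) (suc p ^ (2 + e)) (1≤^ (2 + e) (s≤s z≤n))

  -- A threshold for `misses` with the rate `p / (p + 1)`, whose square is still at least `L / Λ`;
  -- Markov's inequality then leaves the same rate for the exceptional weight.
  Ξ : ℕ → ℕ
  Ξ e = suc (Ξ₀ e)

  exp-Ξ : Exp Ξ
  exp-Ξ = exp-+ exp-1 (exp (suc p) n 0 (s≤s z≤n) bd)
    where
    bd : ∀ e → Ξ₀ e * suc p ^ (2 + e) ≤ n * 1 * (m * suc p ∸ 1) ^ (2 + e)
    bd e = ≤-trans (Ξ₀≤ e) (≤-trans (*-monoʳ-≤ n (^-monoˡ-≤ (2 + e) (m*pred≤ (suc p)))) (≤-reflexive (cong (_* (m * suc p ∸ 1) ^ (2 + e)) (sym (*-identityʳ n)))))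

  opaque
    -- The value of `excess` for `s = d`, with `δ` replaced by `d m` and `ι` by `I`.
    c : ℕ → ℕ
    c e = (2 + e) * ((2 + e) * m) + (2 * B e + ((2 + e) * m + C) * I e)

    c≡ : ∀ e → c e ≡ (2 + e) * ((2 + e) * m) + (2 * B e + ((2 + e) * m + C) * I e)
    c≡ e = refl

  opaque
    b : ℕ → ℕ
    b e = (c e + c e) * KK

    b≡ : ∀ e → b e ≡ (c e + c e) * KK
    b≡ e = refl

  opaque
    D₁ : ℕ → ℕ
    D₁ e = m * (6 * (b e + b e))

    D₁≡ : ∀ e → D₁ e ≡ m * (6 * (b e + b e))
    D₁≡ e = refl

  opaque
    -- One bound for all exceptional counts together. The leading successor turns `Ψ ≤ m ^ d` into
    -- the strict inequality that `optimal-A` asks for.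
    Ψ : ℕ → ℕ
    Ψ e = suc (2 * (D₁ e + b e)) + ((2 + e) * (m * D₁ e) + Ξ e)

    Ψ≡ : ∀ e → Ψ e ≡ suc (2 * (D₁ e + b e)) + ((2 + e) * (m * D₁ e) + Ξ e)
    Ψ≡ e = refl

  exp-c : Exp c
  exp-c = exp-≤ (λ e → ≤-reflexive (trans (c≡ e) (l₁ e m (B e) C (I e))))
    (exp-+ (exp-*d (exp-*d (exp-*c m exp-1))) (exp-+ (exp-*c 2 exp-B) (exp-+ (exp-*d (exp-*c m exp-I)) (exp-*c C exp-I))))
    where
    l₁ : ∀ e m b c i → (2 + e) * ((2 + e) * m) + (2 * b + ((2 + e) * m + c) * i)
                     ≡ (2 + e) * ((2 + e) * (m * 1)) + (2 * b + ((2 + e) * (m * i) + c * i))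
    l₁ = solve-∀

  exp-b : Exp b
  exp-b = exp-≤ (λ e → ≤-reflexive (trans (b≡ e) (*-comm (c e + c e) KK))) (exp-*c KK (exp-+ exp-c exp-c))

  exp-D₁ : Exp D₁
  exp-D₁ = exp-≤ (λ e → ≤-reflexive (D₁≡ e)) (exp-*c m (exp-*c 6 (exp-+ exp-b exp-b)))

  exp-Ψ : Exp Ψ
  exp-Ψ = exp-≤ (λ e → ≤-reflexive (Ψ≡ e)) (exp-+ (exp-+ exp-1 (exp-*c 2 (exp-+ exp-D₁ exp-b))) (exp-+ (exp-*d (exp-*c m exp-D₁)) exp-Ξ))

module Dimension (k M : ℕ) (m≡ : suc (suc k) ≡ M + M) (n : ℕ) (H : Adj n) (H-sym : ∀ i j → H i j ≡ H j i)
                 (wgt : Fin n → ℕ) (1≤wgt : ∀ c → 1 ≤ wgt c) (e′ : ℕ) (f₀ : Coloring n (suc (suc k)) (2 + e′)) where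
  open Cycle k M m≡ using (m; κ-1; ν; ν≤m; 1≤ν; Height; height; coheight; succ; pred; diff1-succ; diff1-pred)
  open Torus.Sys k M m≡ n H H-sym wgt 1≤wgt (suc e′) using (sys; δ≡; ordering; O↑; O↓; O↑′; O↓′; ρ; ρ′)
  open Phases k M m≡ n H H-sym wgt 1≤wgt e′ using (Φ; center; dominant; ι≤; hs; hp; hs-hp; hp-hs; odd-hs)
  open System sys using (vs; Col; δ; adj-sym; adj-odd; deg)
  open Core sys (suc κ-1) using (comm; optimal; comm-complete; pal-∈; pal-∋)
  open Weights sys (suc κ-1) using (weight; nbrs; N)
  open Numbers k M m≡ n H wgt 1≤wgt using (j₀; B; c; b; D₁; Ξ; C; KK; κj₀≤; ≤B; ≤I; c≡; b≡; D₁≡)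

  d : ℕ
  d = 2 + e′

  fs : List (Coloring n m d)
  fs = allColorings n m d

  module Par = Partition sys κ-1 fs f₀ (allColorings-once n m d)
  open Par using (Zn; misses; missed)

  balanced : ∑ vs (λ v → ⟦ not (isOdd v) ⟧) ≡ N
  balanced = trans (∑-cong vs (λ v → cong ⟦_⟧ (sym (odd-hs v)))) (∑-reindex (System.E sys) hs hp hs-hp hp-hs (λ v → ⟦ isOdd v ⟧))

  N+N : N + N ≡ m ^ d
  N+N = trans (cong (_+ N) (sym balanced)) (trans (sym (∑-+ vs (λ v → ⟦ not (isOdd v) ⟧) (λ v → ⟦ isOdd v ⟧)))
    (trans (∑-cong vs (λ v → pt (isOdd v))) (trans (∑-const-1 vs) (length-allVerts m d))))
    where
    pt : ∀ b → ⟦ not b ⟧ + ⟦ b ⟧ ≡ 1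
    pt true  = refl
    pt false = refl

  δ≤dm : δ ≤ d * m
  δ≤dm = ≤-trans (≤-reflexive δ≡) (*-monoʳ-≤ d ν≤m)

  d≤δ : d ≤ δ
  d≤δ = ≤-trans (m≤m*n d ν {{>-nonZero 1≤ν}}) (≤-reflexive (sym δ≡))

  module Extremal (Ht : Height) (s : Fin m → Fin m) (ds : ∀ a → diff1 a (s a) ≡ true) where

    O : Ordering sys
    O = ordering Ht s ds

    ex : ℕ
    ex = Tail.excess sys κ-1 O d (B e′)

    ex≤c : ex ≤ c e′
    ex≤c = ≤-trans (+-mono-≤ (*-monoʳ-≤ d δ≤dm) (+-monoʳ-≤ (2 * B e′) (*-mono-≤ (+-monoˡ-≤ C δ≤dm)
      (≤I (Tail.ι sys κ-1 O) e′ (ι≤ Ht s ds))))) (≤-reflexive (sym (c≡ e′)))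

    heavy : Col → ℕ
    heavy = Tail.heavy sys κ-1 O (2 ^ ex)

    heavy-sum : 2 ^ d * ∑ fs (λ f → heavy f * weight f) ≤ Zn
    heavy-sum = ≤-trans (*-monoʳ-≤ (2 ^ d) (≤-reflexive (Par.heavy-∑ O (2 ^ ex))))
      (≤-trans (Tail.tail sys κ-1 O d (j₀ e′) (B e′) (≤-trans (κj₀≤ e′) (≤-trans (n≤1+n (suc e′)) d≤δ))
                  (≤-trans (*-monoˡ-≤ _ (≤-trans (m≤m+n N N) (≤-reflexive N+N))) (≤B e′)) f₀)
        (Par.η^N≤Z balanced))

  module E↑  = Extremal height succ diff1-succ
  module E↓  = Extremal coheight pred diff1-pred
  module E↑′ = Extremal height pred diff1-pred
  module E↓′ = Extremal coheight succ diff1-succ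

  record Light (f : Col) : Set where
    field
      l↑  : E↑.heavy f ≡ 0
      l↓  : E↓.heavy f ≡ 0
      l↑′ : E↑′.heavy f ≡ 0
      l↓′ : E↓′.heavy f ≡ 0

  ⟦⟧≡0 : ∀ {x} → ⟦ x ⟧ ≡ 0 → x ≡ false
  ⟦⟧≡0 {false} _ = refl

  own : ∀ f → (∀ u v → torusAdj u v ≡ true → H (f u) (f v) ≡ true) → ∀ v → lookup (comm (nbrs f v)) (f v) ≡ true
  own f hom v = comm-complete (nbrs f v) (f v) (λ i q → let (u , a , fu) = pal-∋ torusAdj f v i q in
    subst (λ i → H i (f v) ≡ true) fu (hom u v (trans (adj-sym u v) a)))

  module _ (f : Col) (light : Light f) where
    open Light light

    T₁ T₂ β⁻ : ℕ
    T₁ = Pairing.changes sys κ-1 O↑ O↓ ρ f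
    T₂ = Pairing.changes sys κ-1 O↑′ O↓′ ρ′ f
    β⁻ = Pairing.β⁻ sys κ-1 O↑ O↓ ρ f

    private
      few₁ : Pairing.TR sys κ-1 O↑ O↓ ρ f + δ * Pairing.β sys κ-1 O↑ O↓ ρ f ≤ b e′
      few₁ = ≤-trans (Pairing.few sys κ-1 O↑ O↓ ρ f E↑.ex E↓.ex (⟦⟧≡0 l↑) (⟦⟧≡0 l↓)) (≤-trans (*-monoˡ-≤ KK (+-mono-≤ E↑.ex≤c E↓.ex≤c)) (≤-reflexive (sym (b≡ e′))))
      few₂ : Pairing.TR sys κ-1 O↑′ O↓′ ρ′ f + δ * Pairing.β sys κ-1 O↑′ O↓′ ρ′ f ≤ b e′
      few₂ = ≤-trans (Pairing.few sys κ-1 O↑′ O↓′ ρ′ f E↑′.ex E↓′.ex (⟦⟧≡0 l↑′) (⟦⟧≡0 l↓′)) (≤-trans (*-monoˡ-≤ KK (+-mono-≤ E↑′.ex≤c E↓′.ex≤c)) (≤-reflexive (sym (b≡ e′))))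

    T₁≤ : T₁ ≤ b e′
    T₁≤ = ≤-trans (Pairing.changes≤ sys κ-1 O↑ O↓ ρ f) few₁

    T₂≤ : T₂ ≤ b e′
    T₂≤ = ≤-trans (Pairing.changes≤ sys κ-1 O↑′ O↓′ ρ′ f) few₂

    β⁻≤b : β⁻ ≤ b e′
    β⁻≤b = ≤-trans (Pairing.β⁻≤ sys κ-1 O↑ O↓ ρ f) few₁

    A : Subset n
    A = Φ f (center f)

    _≟s_ : DecidableEquality (Subset n)
    _≟s_ = Enum._≟_ (SubsetEnum n)

    off : Vertex m d → ℕ
    off v = ⟦ not (does (Φ f v ≟s A)) ⟧

    ∑off≤ : ∑ vs off ≤ D₁ e′
    ∑off≤ = ≤-trans (dominant f (b e′) T₁≤ T₂≤) (≤-reflexive (sym (D₁≡ e′)))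

    off-cases : ∀ v → Φ f v ≡ A ⊎ off v ≡ 1
    off-cases v = cases (Φ f v ≟s A)
      where
      cases : ∀ (x : Dec (Φ f v ≡ A)) → Φ f v ≡ A ⊎ ⟦ not (does x) ⟧ ≡ 1
      cases (yes q) = inj₁ q
      cases (no _)  = inj₂ refl

    Φ-odd : ∀ v → isOdd v ≡ true → Φ f v ≡ nbrs f v
    Φ-odd v o = if-true {b = isOdd v} o

    Φ-even : ∀ v → isOdd v ≡ false → Φ f v ≡ nbrs f (hs v)
    Φ-even v o = if-false {b = isOdd v} o

    bounded : ∀ v {x} → (x ≡ true → Φ f v ≡ A → ⊥) → ⟦ x ⟧ ≤ off v
    bounded v {false} _ = z≤n
    bounded v {true}  h = go (off-cases v)
      where
      go : Φ f v ≡ A ⊎ off v ≡ 1 → 1 ≤ off v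
      go (inj₁ q) = ⊥-elim (h refl q)
      go (inj₂ q) = ≤-reflexive (sym q)

    -- Otherwise every odd vertex would be bad or have another phase than `A`, and there are too few
    -- of those to fill half of the torus.
    optimal-A : 2 * (D₁ e′ + b e′) < m ^ d → optimal A ≡ true
    optimal-A small = go (all g vs) refl
      where
      bad : Vertex m d → Bool
      bad = LocalBound.bad sys κ-1 O↑ f
      g : Vertex m d → Bool
      g v = not (isOdd v) ∨ (bad v ∨ not (does (Φ f v ≟s A)))
      go : ∀ x → all g vs ≡ x → optimal A ≡ true
      go false q = found (isOdd v) refl (proj₂ (proj₂ (all-false⁻ g vs q)))
        where
        v = proj₁ (all-false⁻ g vs q)
        found : ∀ o → isOdd v ≡ o → not o ∨ (bad v ∨ not (does (Φ f v ≟s A))) ≡ false → optimal A ≡ true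
        found true o r = fnd (bad v) refl (Φ f v ≟s A) r
          where
          fnd : ∀ x → bad v ≡ x → ∀ (y : Dec (Φ f v ≡ A)) → x ∨ not (does y) ≡ false → optimal A ≡ true
          fnd false bv (yes eq) _ = subst (λ a → optimal a ≡ true) (trans (sym (Φ-odd v o)) eq)
            (proj₁ (∧-true {optimal (nbrs f v)} (trans (sym (Data.Bool.Properties.not-involutive _)) (cong not bv))))
      go true q = ⊥-elim (<⇒≱ small (begin
        m ^ d                ≡⟨ sym N+N ⟩
        N + N                ≤⟨ +-mono-≤ N≤ N≤ ⟩
        (D₁ e′ + b e′) + (D₁ e′ + b e′) ≡⟨ cong (D₁ e′ + b e′ +_) (sym (+-identityʳ _)) ⟩
        2 * (D₁ e′ + b e′) ∎))
        where
        open ≤-Reasoning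
        pt : ∀ v → ⟦ isOdd v ⟧ ≤ off v + ⟦ isOdd v ∧ bad v ⟧
        pt v = f′ (isOdd v) (bad v) (not (does (Φ f v ≟s A))) (all-true⁻ g q (∈-elts (System.E sys) v))
          where
          f′ : ∀ o x y → not o ∨ (x ∨ y) ≡ true → ⟦ o ⟧ ≤ ⟦ y ⟧ + ⟦ o ∧ x ⟧
          f′ false x     y    _ = z≤n
          f′ true  true  y    _ = m≤n+m 1 ⟦ y ⟧
          f′ true  false true _ = s≤s z≤n
        N≤ : N ≤ D₁ e′ + b e′
        N≤ = ≤-trans (∑-mono vs pt) (≤-trans (≤-reflexive (∑-+ vs off (λ v → ⟦ isOdd v ∧ bad v ⟧))) (+-mono-≤ ∑off≤ β⁻≤b))

    count : (Vertex m d → Bool) → ℕ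
    count = countV m d

    count≡ : ∀ P → count P ≡ ∑ vs (λ v → ⟦ P v ⟧)
    count≡ P = length-filter P vs

    via-off : ∀ P → (∀ v → P v ≡ true → Φ f v ≡ A → ⊥) → count P ≤ D₁ e′
    via-off P h = ≤-trans (≤-reflexive (count≡ P)) (≤-trans (∑-mono vs (λ v → bounded v (h v))) ∑off≤)

    isEven⇒ : ∀ (v : Vertex m d) → isEven v ≡ true → isOdd v ≡ false
    isEven⇒ v q = cong not q

    -- An even `v` with phase `A` is a neighbour of `hs v`, whose palette is `A`, so its colour
    -- belongs to `A`.
    count₁ : count (λ v → isEven v ∧ not (lookup A (f v))) ≤ D₁ e′
    count₁ = via-off _ (λ v q eq → let (ev , na) = ∧-true {isEven v} q in
      true≢false (trans (cong (λ a → lookup a (f v)) (trans (sym eq) (Φ-even v (isEven⇒ v ev)))) (pal-∈ torusAdj f {hs v} {v} (trans (adj-sym (hs v) v) (Ordering.adj-π O↑ v)))) (not-true na))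

    appear : ∀ B v → allColorsAppear B f v ≡ true ⊎ ∃[ a ] (lookup B a ≡ true × lookup (nbrs f v) a ≡ false)
    appear B v = go (allColorsAppear B f v) refl
      where
      go : ∀ x → allColorsAppear B f v ≡ x → allColorsAppear B f v ≡ true ⊎ ∃[ a ] (lookup B a ≡ true × lookup (nbrs f v) a ≡ false)
      go true  q = inj₁ q
      go false q = hlp (all-false⁻ _ (allFin n) q)
        where
        hlp : ∃[ a ] (a ∈ allFin n × not (lookup B a) ∨ any (λ z → torusAdj v z ∧ eqFin (f z) a) vs ≡ false) →
              allColorsAppear B f v ≡ true ⊎ ∃[ a ] (lookup B a ≡ true × lookup (nbrs f v) a ≡ false)
        hlp (a , _ , r) = inj₂ (a , proj₁ (⇒-false {lookup B a} r) , trans (Vec.lookup∘tabulate _ a) (proj₂ (⇒-false {lookup B a} r)))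

    count₃ : count (λ w → isOdd w ∧ not (allColorsAppear A f w)) ≤ D₁ e′
    count₃ = via-off _ (λ v q eq → let (o , na) = ∧-true {isOdd v} q in hlp v o (not-true na) eq (appear A v))
      where
      hlp : ∀ (v : Vertex m d) → isOdd v ≡ true → allColorsAppear A f v ≡ false → Φ f v ≡ A → allColorsAppear A f v ≡ true ⊎ ∃[ a ] (lookup A a ≡ true × lookup (nbrs f v) a ≡ false) → ⊥
      hlp v o na eq (inj₁ q) = true≢false q na
      hlp v o na eq (inj₂ (a , p , q)) = true≢false (trans (cong (λ z → lookup z a) (trans (sym (Φ-odd v o)) eq)) p) q

    module _ (hom : ∀ u v → torusAdj u v ≡ true → H (f u) (f v) ≡ true) where
      count₂ : count (λ v → isOdd v ∧ not (lookup (comm A) (f v))) ≤ D₁ e′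
      count₂ = via-off _ (λ v q eq → let (o , na) = ∧-true {isOdd v} q in
        true≢false (trans (cong (λ a → lookup (comm a) (f v)) (trans (sym eq) (Φ-odd v o))) (own f hom v)) (not-true na))

    -- If a colour of `comm A` is absent around `w`, then either some neighbour has another phase,
    -- and each such vertex is counted at most `δ` times, or all neighbours could have taken the
    -- colour and none did, which is a miss.
    count₄ : misses f < Ξ e′ → count (λ w → isEven w ∧ not (allColorsAppear (comm A) f w)) ≤ d * (m * D₁ e′) + Ξ e′
    count₄ mis = begin
      count (λ w → isEven w ∧ not (allColorsAppear (comm A) f w))
        ≡⟨ count≡ _ ⟩
      ∑ vs (λ w → ⟦ isEven w ∧ not (allColorsAppear (comm A) f w) ⟧)
        ≤⟨ ∑-mono vs pt ⟩
      ∑ vs (λ w → ∑ vs (λ v → ⟦ torusAdj w v ⟧ * off v) + ∑ (allFin n) (λ b → ⟦ not (isOdd w) ∧ missed w b f ⟧))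
        ≡⟨ ∑-+ vs (λ w → ∑ vs (λ v → ⟦ torusAdj w v ⟧ * off v)) _ ⟩
      ∑ vs (λ w → ∑ vs (λ v → ⟦ torusAdj w v ⟧ * off v)) + misses f
        ≡⟨ cong (_+ misses f) (trans (∑-swap vs vs _) (trans (∑-cong vs (λ v → trans (∑-*ʳ vs (off v) _) (cong (_* off v) (trans (∑-cong vs (λ w → cong ⟦_⟧ (adj-sym w v))) (deg v))))) (∑-*ˡ vs δ off))) ⟩
      δ * ∑ vs off + misses f
        ≤⟨ +-mono-≤ (*-mono-≤ δ≤dm ∑off≤) (<⇒≤ mis) ⟩
      d * m * D₁ e′ + Ξ e′
        ≡⟨ cong (_+ Ξ e′) (*-assoc d m (D₁ e′)) ⟩
      d * (m * D₁ e′) + Ξ e′ ∎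
      where
      open ≤-Reasoning
      pt : ∀ w → ⟦ isEven w ∧ not (allColorsAppear (comm A) f w) ⟧ ≤ ∑ vs (λ v → ⟦ torusAdj w v ⟧ * off v) + ∑ (allFin n) (λ b → ⟦ not (isOdd w) ∧ missed w b f ⟧)
      pt w = go (isEven w) refl (appear (comm A) w)
        where
        go : ∀ ev → isEven w ≡ ev → allColorsAppear (comm A) f w ≡ true ⊎ ∃[ a ] (lookup (comm A) a ≡ true × lookup (nbrs f w) a ≡ false) →
             ⟦ ev ∧ not (allColorsAppear (comm A) f w) ⟧ ≤ ∑ vs (λ v → ⟦ torusAdj w v ⟧ * off v) + ∑ (allFin n) (λ b → ⟦ not (isOdd w) ∧ missed w b f ⟧)
        go false _ _ = z≤n
        go true  ev (inj₁ q) = ≤-trans (≤-reflexive (cong (λ x → ⟦ not x ⟧) q)) z≤n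
        go true  ev (inj₂ (a , a∈ , a∉)) = ≤-trans (⟦⟧≤1 (not (allColorsAppear (comm A) f w))) (miss (missed w a f) refl)
          where
          miss : ∀ x → missed w a f ≡ x → 1 ≤ ∑ vs (λ v → ⟦ torusAdj w v ⟧ * off v) + ∑ (allFin n) (λ b → ⟦ not (isOdd w) ∧ missed w b f ⟧)
          miss true q = ≤-trans (≤-trans (≤-reflexive (sym (cong₂ (λ x y → ⟦ not x ∧ y ⟧) (isEven⇒ w ev) q)))
            (≤∑ (FinEnum n) (λ b → ⟦ not (isOdd w) ∧ missed w b f ⟧) a)) (m≤n+m _ _)
          miss false q = ≤-trans (≤-trans (cell (off-cases v)) (≤∑ (System.E sys) (λ v → ⟦ torusAdj w v ⟧ * off v) v)) (m≤m+n _ _)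
            where
            v = proj₁ (all-false⁻ _ vs q)
            r = proj₂ (proj₂ (all-false⁻ _ vs q))
            av : torusAdj w v ≡ true
            av = proj₁ (⇒-false {torusAdj w v} r)
            ov : isOdd v ≡ true
            ov = trans (adj-odd {v} {w} (trans (adj-sym v w) av)) (cong not (isEven⇒ w ev))
            fv≢a : eqFin (f v) a ≡ false
            fv≢a = ¬true (λ q → true≢false (subst (λ z → lookup (nbrs f w) z ≡ true) (Fin.toℕ-injective {i = f v} {a} (≡ᵇ-true q)) (pal-∈ torusAdj f {w} {v} av)) a∉)
            cell : Φ f v ≡ A ⊎ off v ≡ 1 → 1 ≤ ⟦ torusAdj w v ⟧ * off v
            cell (inj₂ q) = ≤-reflexive (sym (cong₂ (λ x y → ⟦ x ⟧ * y) av q))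
            cell (inj₁ q) = ⊥-elim (true≢false (cong₂ (λ x y → x ∧ not y) (trans (cong (λ z → lookup (comm z) a) (trans (sym (Φ-odd v ov)) q)) a∈) fv≢a) (proj₂ (⇒-false {torusAdj w v} r)))


-- The weight of the exceptional class

markov : ∀ (xs : List X) (g w : X → ℕ) t → t * ∑ xs (λ x → ⟦ t ≤ᵇ g x ⟧ * w x) ≤ ∑ xs (λ x → g x * w x)
markov xs g w t = ≤-trans (≤-reflexive (sym (∑-*ˡ xs t _))) (∑-mono xs (λ x → pt (g x) (w x) (t ≤ᵇ g x) refl))
  where
  pt : ∀ a b c → (t ≤ᵇ a) ≡ c → t * (⟦ c ⟧ * b) ≤ a * b
  pt a b false _ = ≤-trans (≤-reflexive (*-zeroʳ t)) z≤n
  pt a b true  e = *-mono-≤ (≤ᵇ⇒≤ t a (≡⇒T e)) (≤-reflexive (+-identityʳ b))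

-- The `d`-th power of `1 - 1 / Λ ≤ (1 - 1 / (2 Λ)) ^ 2`; the remaining `δ - d` factors `L / Λ` are
-- at most 1.
gap : ∀ L d δ → d ≤ δ → (suc (suc (2 * L)) * suc (suc (2 * L))) ^ d * L ^ δ ≤ (suc (2 * L) * suc (2 * L)) ^ d * suc L ^ δ
gap L d δ d≤δ = hlp (m≤n⇒∃[o]m+o≡n d≤δ)
  where
  open ≤-Reasoning
  r = suc (suc (2 * L))
  p = suc (2 * L)
  rp : r * r * L ≤ p * p * suc L
  rp = ≤-trans (m≤m+n (r * r * L) (suc L)) (≤-reflexive (l₁ L))
    where
    l₁ : ∀ l → suc (suc (2 * l)) * suc (suc (2 * l)) * l + suc l ≡ suc (2 * l) * suc (2 * l) * suc l
    l₁ = solve-∀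
  hlp : ∃[ t ] d + t ≡ δ → (r * r) ^ d * L ^ δ ≤ (p * p) ^ d * suc L ^ δ
  hlp (t , refl) = begin
    (r * r) ^ d * L ^ (d + t)        ≡⟨ split (r * r) L ⟩
    (r * r * L) ^ d * L ^ t          ≤⟨ *-mono-≤ (^-monoˡ-≤ d rp) (^-monoˡ-≤ t (n≤1+n L)) ⟩
    (p * p * suc L) ^ d * suc L ^ t  ≡⟨ sym (split (p * p) (suc L)) ⟩
    (p * p) ^ d * suc L ^ (d + t) ∎
    where
    split : ∀ a b → a ^ d * b ^ (d + t) ≡ (a * b) ^ d * b ^ t
    split a b = trans (cong (a ^ d *_) (^-distribˡ-+-* b d t)) (trans (sym (*-assoc (a ^ d) (b ^ d) (b ^ t))) (cong (_* b ^ t) (sym (*-^ a b d))))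

-- By `gap` the expected number of misses carries the factor `(p / r) ^ d` twice: one is spent on
-- the threshold `t`, the other remains.
rare : ∀ n m L d δ t W Q Z → 1 ≤ n → 1 ≤ m → d ≤ δ → n * (m * suc (2 * L)) ^ d ≤ t * suc (suc (2 * L)) ^ d → t * W ≤ Q →
       Q * suc L ^ δ ≤ m ^ d * (n * (L ^ δ * Z)) → W * suc (suc (2 * L)) ^ d ≤ suc (2 * L) ^ d * Z
rare n m L d δ t W Q Z 1≤n 1≤m d≤δ ht hW hQ = *-cancelˡ (n * (m ^ d * p ^ d) * Λ ^ δ)
  (*-mono-≤ (*-mono-≤ 1≤n (*-mono-≤ (1≤^ d 1≤m) (1≤^ d (s≤s z≤n)))) (1≤^ δ (s≤s z≤n))) (begin
    n * (m ^ d * p ^ d) * Λ ^ δ * (W * r ^ d)     ≡⟨ cong (λ z → n * z * Λ ^ δ * (W * r ^ d)) (sym (*-^ m p d)) ⟩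
    n * (m * p) ^ d * Λ ^ δ * (W * r ^ d)         ≤⟨ *-monoˡ-≤ (W * r ^ d) (*-monoˡ-≤ (Λ ^ δ) ht) ⟩
    t * r ^ d * Λ ^ δ * (W * r ^ d)               ≡⟨ l₁ t (r ^ d) (Λ ^ δ) W ⟩
    r ^ d * r ^ d * (t * W * Λ ^ δ)               ≤⟨ *-monoʳ-≤ (r ^ d * r ^ d) (≤-trans (*-monoˡ-≤ (Λ ^ δ) hW) hQ) ⟩
    r ^ d * r ^ d * (m ^ d * (n * (L ^ δ * Z)))   ≡⟨ l₂ (r ^ d) (m ^ d) n (L ^ δ) Z ⟩
    n * m ^ d * Z * (r ^ d * r ^ d * L ^ δ)       ≡⟨ cong (λ z → n * m ^ d * Z * (z * L ^ δ)) (sym (*-^ r r d)) ⟩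
    n * m ^ d * Z * ((r * r) ^ d * L ^ δ)         ≤⟨ *-monoʳ-≤ (n * m ^ d * Z) (gap L d δ d≤δ) ⟩
    n * m ^ d * Z * ((p * p) ^ d * Λ ^ δ)         ≡⟨ cong (λ z → n * m ^ d * Z * (z * Λ ^ δ)) (*-^ p p d) ⟩
    n * m ^ d * Z * (p ^ d * p ^ d * Λ ^ δ)       ≡⟨ l₃ n (m ^ d) (p ^ d) (Λ ^ δ) Z ⟩
    n * (m ^ d * p ^ d) * Λ ^ δ * (p ^ d * Z) ∎)
  where
  open ≤-Reasoning
  Λ = suc L
  p = suc (2 * L)
  r = suc p
  l₁ : ∀ t r l w → t * r * l * (w * r) ≡ r * r * (t * w * l)
  l₁ = solve-∀
  l₂ : ∀ r m n l z → r * r * (m * (n * (l * z))) ≡ n * m * z * (r * r * l)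
  l₂ = solve-∀
  l₃ : ∀ n m p l z → n * m * z * (p * p * l) ≡ n * (m * p) * l * (p * z)
  l₃ = solve-∀

-- The four heavy parts decay at the rate `1 / 2`, which is at most `p / r`.
five-parts : ∀ L d h₁ h₂ h₃ h₄ W Z → 2 ^ d * h₁ ≤ Z → 2 ^ d * h₂ ≤ Z → 2 ^ d * h₃ ≤ Z → 2 ^ d * h₄ ≤ Z →
             W * suc (suc (2 * L)) ^ d ≤ suc (2 * L) ^ d * Z →
             (h₁ + h₂ + h₃ + h₄ + W) * suc (suc (2 * L)) ^ d ≤ 5 * (suc (2 * L) ^ d * Z)
five-parts L d h₁ h₂ h₃ h₄ W Z b₁ b₂ b₃ b₄ bW = ≤-trans (≤-reflexive (l₁ h₁ h₂ h₃ h₄ W (r ^ d)))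
  (≤-trans (+-mono-≤ (+-mono-≤ (+-mono-≤ (+-mono-≤ (lift b₁) (lift b₂)) (lift b₃)) (lift b₄)) bW) (≤-reflexive (l₂ (p ^ d * Z))))
  where
  p = suc (2 * L)
  r = suc p
  l₁ : ∀ a b c e w r → (a + b + c + e + w) * r ≡ a * r + b * r + c * r + e * r + w * r
  l₁ = solve-∀
  l₂ : ∀ x → x + x + x + x + x ≡ 5 * x
  l₂ = solve-∀
  lift : ∀ {h} → 2 ^ d * h ≤ Z → h * r ^ d ≤ p ^ d * Z
  lift {h} b = ≤-trans (*-monoʳ-≤ h (≤-trans (^-monoˡ-≤ d r≤2p) (≤-reflexive (*-^ 2 p d))))
    (≤-trans (≤-reflexive (l₃ h (2 ^ d) (p ^ d))) (*-monoʳ-≤ (p ^ d) b))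
    where
    r≤2p : r ≤ 2 * p
    r≤2p = ≤-trans (m≤m+n r (2 * L)) (≤-reflexive (l₄ L))
      where
      l₄ : ∀ l → suc (suc (2 * l)) + 2 * l ≡ 2 * suc (2 * l)
      l₄ = solve-∀
    l₃ : ∀ h a b → h * (a * b) ≡ b * (a * h)
    l₃ = solve-∀

-- The labelling and the theorem

findᵇ-just : ∀ (p : X → Bool) xs {x} → findᵇ p xs ≡ just x → p x ≡ true
findᵇ-just p (y ∷ xs) e with p y in q
findᵇ-just p (y ∷ xs) refl | true  = q
findᵇ-just p (y ∷ xs) e    | false = findᵇ-just p xs e

findᵇ-found : ∀ (p : X → Bool) {xs x} → x ∈ xs → p x ≡ true → is-nothing (findᵇ p xs) ≡ false
findᵇ-found p {y ∷ _} m e with p y in q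
findᵇ-found p m           e | true  = refl
findᵇ-found p (here refl) e | false = ⊥-elim (true≢false e q)
findᵇ-found p (there m)   e | false = findᵇ-found p m e

-- The weights are those of the theorem, multiplied by a common denominator.
record Labelled (n : ℕ) (H : Adj n) (wgt : Fin n → ℕ) (m d k : ℕ) : Set where
  σ : Subset n → ℕ
  σ A = ∑ (allFin n) (λ c → if lookup A c then wgt c else 0)

  total : (Coloring n m d → Bool) → ℕ
  total Q = ∑ (allColorings n m d) (λ f → if isHom H m d f ∧ Q f then ∏ (allVerts m d) (λ v → wgt (f v)) else 0)

  field
    lab     : Coloring n m d → Maybe (Subset n × Subset n)
    maximal : ∀ f → isHom H m d f ≡ true → ∀ A B → lab f ≡ just (A , B) →
              A ∼[ H ] B × (∀ A′ B′ → A′ ∼[ H ] B′ → σ A′ * σ B′ ≤ σ A * σ B)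
    light   : total (λ f → is-nothing (lab f)) ^ k * 2 ^ d ≤ total (λ _ → true) ^ k
    counts  : ∀ f → isHom H m d f ≡ true → ∀ A B → lab f ≡ just (A , B) →
              (countV m d (λ v → isEven v ∧ not (lookup A (f v))) * k ^ d ≤ (m * k ∸ 1) ^ d)
              × (countV m d (λ v → isOdd v ∧ not (lookup B (f v))) * k ^ d ≤ (m * k ∸ 1) ^ d)
              × (countV m d (λ w → isOdd w ∧ not (allColorsAppear A f w)) * k ^ d ≤ (m * k ∸ 1) ^ d)
              × (countV m d (λ w → isEven w ∧ not (allColorsAppear B f w)) * k ^ d ≤ (m * k ∸ 1) ^ d)

module Labelling (k M : ℕ) (m≡ : suc (suc k) ≡ M + M) (n : ℕ) (H : Adj n) (H-sym : ∀ i j → H i j ≡ H j i)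
                 (wgt : Fin n → ℕ) (1≤wgt : ∀ c → 1 ≤ wgt c) (e′ : ℕ) (f₀ : Coloring n (suc (suc k)) (2 + e′))
                 (1≤n : 1 ≤ n) (K : ℕ) (1≤K : 1 ≤ K)
                 (small : Numbers.Ψ k M m≡ n H wgt 1≤wgt e′ * K ^ (2 + e′) ≤ (suc (suc k) * K ∸ 1) ^ (2 + e′)) where
  open Cycle k M m≡ using (m; κ-1)
  open Torus.Sys k M m≡ n H H-sym wgt 1≤wgt (suc e′) using (sys)
  open System sys using (vs; Col; δ; adj-sym; adj-odd)
  open Core sys (suc κ-1) using (L; comm; σ; optimal; optimal⇒; comm-adj; σσ≤η′; subsets; pal-∈)
  open Weights sys (suc κ-1) using (weight; nbrs)
  open Numbers k M m≡ n H wgt 1≤wgt using (b; D₁; Ξ; Ψ; Ψ≡; ≤Ξ)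
  open Dimension k M m≡ n H H-sym wgt 1≤wgt e′ f₀
    using (d; fs; d≤δ; Light; module E↑; module E↓; module E↑′; module E↓′; optimal-A; count₁; count₂; count₃; count₄; own)
  open Dimension.Par k M m≡ n H H-sym wgt 1≤wgt e′ f₀ using (Zn; misses; ∑misses)

  product : Col → ℕ
  product f = ∏ vs (λ v → wgt (f v))

  hom⁻ : ∀ f → isHom H m d f ≡ true → ∀ u v → torusAdj u v ≡ true → H (f u) (f v) ≡ true
  hom⁻ f h u v a = trans (cong (λ x → not x ∨ H (f u) (f v)) (sym a))
    (all-true⁻ (λ v → not (torusAdj u v) ∨ H (f u) (f v)) (all-true⁻ (λ u → all (λ v → not (torusAdj u v) ∨ H (f u) (f v)) vs) h (∈-elts (System.E sys) u)) (∈-elts (System.E sys) v))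

  weight-hom : ∀ f → isHom H m d f ≡ true → weight f ≡ product f
  weight-hom f h = ∏-cong vs (λ v → pt (isOdd v) (own f (hom⁻ f h) v))
    where
    pt : ∀ o {x y} → x ≡ true → (if o then (if x then y else 0) else y) ≡ y
    pt true  refl = refl
    pt false _    = refl

  -- A violated edge has one odd end, by symmetry of `H` either one, and the colour there lies
  -- outside the common neighbourhood of its palette.
  weight-nonhom : ∀ f → isHom H m d f ≡ false → weight f ≡ 0
  weight-nonhom f h = hlp (all-false⁻ _ vs h)
    where
    hlp : ∃[ u ] (u ∈ vs × all (λ v → not (torusAdj u v) ∨ H (f u) (f v)) vs ≡ false) → weight f ≡ 0
    hlp (u , _ , h′) = hlp₂ (all-false⁻ _ vs h′)
      where
      zero-at : ∀ u v → torusAdj u v ≡ true → isOdd v ≡ true → H (f u) (f v) ≡ false → weight f ≡ 0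
      zero-at u v a o q = ∏-zero (System.E sys) (λ v → if isOdd v then (if lookup (comm (nbrs f v)) (f v) then wgt (f v) else 0) else wgt (f v)) v
        (trans (if-true {b = isOdd v} o) (if-false {b = lookup (comm (nbrs f v)) (f v)}
          (¬true (λ c → true≢false (comm-adj (nbrs f v) (pal-∈ torusAdj f {v} {u} (trans (adj-sym v u) a)) c) q))))
      hlp₂ : ∃[ v ] (v ∈ vs × not (torusAdj u v) ∨ H (f u) (f v) ≡ false) → weight f ≡ 0
      hlp₂ (v , _ , q) = go (isOdd v) refl
        where
        a : torusAdj u v ≡ true
        a = proj₁ (⇒-false {torusAdj u v} q)
        nh : H (f u) (f v) ≡ false
        nh = proj₂ (⇒-false {torusAdj u v} q)
        go : ∀ o → isOdd v ≡ o → weight f ≡ 0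
        go true  o = zero-at u v a o nh
        go false o = zero-at v u (trans (adj-sym v u) a) (trans (adj-odd {u} {v} a) (cong not o)) (trans (H-sym (f v) (f u)) nh)

  few : ℕ → Bool
  few x = x * K ^ d ≤ᵇ (m * K ∸ 1) ^ d

  ≤Ψ⇒few : ∀ {x} → x ≤ Ψ e′ → few x ≡ true
  ≤Ψ⇒few {x} h = T⇒≡ (≤⇒≤ᵇ (≤-trans (*-monoˡ-≤ (K ^ d) h) small))

  few⇒ : ∀ x → few x ≡ true → x * K ^ d ≤ (m * K ∸ 1) ^ d
  few⇒ x e = ≤ᵇ⇒≤ (x * K ^ d) ((m * K ∸ 1) ^ d) (≡⇒T e)

  exceptions₁ exceptions₂ exceptions₃ exceptions₄ : Col → Subset n → ℕ
  exceptions₁ f A = countV m d (λ v → isEven v ∧ not (lookup A (f v)))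
  exceptions₂ f B = countV m d (λ v → isOdd v ∧ not (lookup B (f v)))
  exceptions₃ f A = countV m d (λ w → isOdd w ∧ not (allColorsAppear A f w))
  exceptions₄ f B = countV m d (λ w → isEven w ∧ not (allColorsAppear B f w))

  -- All required properties are decidable, so a label is found by search and has them by
  -- construction; the dominant palette shows that the search succeeds for typical colourings.
  fits : Col → Subset n → Bool
  fits f A = optimal A ∧ (few (exceptions₁ f A) ∧ (few (exceptions₂ f (comm A)) ∧ (few (exceptions₃ f A) ∧ few (exceptions₄ f (comm A)))))

  lab : Col → Maybe (Subset n × Subset n)
  lab f = maybe′ (λ A → just (A , comm A)) nothing (findᵇ (fits f) subsets)

  lab-just : ∀ f A B → lab f ≡ just (A , B) → fits f A ≡ true × B ≡ comm A
  lab-just f A B e = go (findᵇ (fits f) subsets) refl e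
    where
    go : ∀ x → findᵇ (fits f) subsets ≡ x → maybe′ (λ A → just (A , comm A)) nothing x ≡ just (A , B) → fits f A ≡ true × B ≡ comm A
    go (just .A) q refl = findᵇ-just (fits f) subsets q , refl

  few-exceptions : ∀ f A B → lab f ≡ just (A , B) →
                   (exceptions₁ f A * K ^ d ≤ (m * K ∸ 1) ^ d) × (exceptions₂ f B * K ^ d ≤ (m * K ∸ 1) ^ d)
                   × (exceptions₃ f A * K ^ d ≤ (m * K ∸ 1) ^ d) × (exceptions₄ f B * K ^ d ≤ (m * K ∸ 1) ^ d)
  few-exceptions f A B e = go (lab-just f A B e)
    where
    go : fits f A ≡ true × B ≡ comm A →
         (exceptions₁ f A * K ^ d ≤ (m * K ∸ 1) ^ d) × (exceptions₂ f B * K ^ d ≤ (m * K ∸ 1) ^ d)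
         × (exceptions₃ f A * K ^ d ≤ (m * K ∸ 1) ^ d) × (exceptions₄ f B * K ^ d ≤ (m * K ∸ 1) ^ d)
    go (h , refl) = few⇒ (exceptions₁ f A) (proj₁ h₁) , few⇒ (exceptions₂ f (comm A)) (proj₁ h₂) , few⇒ (exceptions₃ f A) (proj₁ h₃) , few⇒ (exceptions₄ f (comm A)) (proj₂ h₃)
      where
      h₁ = ∧-true {few (exceptions₁ f A)} (proj₂ (∧-true {optimal A} h))
      h₂ = ∧-true {few (exceptions₂ f (comm A))} (proj₂ h₁)
      h₃ = ∧-true {few (exceptions₃ f A)} (proj₂ h₂)

  lab-maximal : ∀ f A B → lab f ≡ just (A , B) →
                A ∼[ H ] B × (∀ A′ B′ → A′ ∼[ H ] B′ → σ A′ * σ B′ ≤ σ A * σ B)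
  lab-maximal f A B e = go (lab-just f A B e)
    where
    go : fits f A ≡ true × B ≡ comm A → A ∼[ H ] B × (∀ A′ B′ → A′ ∼[ H ] B′ → σ A′ * σ B′ ≤ σ A * σ B)
    go (h , refl) = (λ a b p q → comm-adj A p q) ,
      λ A′ B′ h′ → ≤-trans (σσ≤η′ A′ B′ h′) (≤-reflexive (sym (optimal⇒ {A} (proj₁ (∧-true {optimal A} h)))))

  Ψ≤ : Ψ e′ ≤ m ^ d
  Ψ≤ = *-cancelˡ (K ^ d) (1≤^ d 1≤K) (≤-trans (≤-reflexive (*-comm (K ^ d) (Ψ e′)))
    (≤-trans small (≤-trans (^-monoˡ-≤ d (m∸n≤m (m * K) 1)) (≤-reflexive (trans (*-^ m K d) (*-comm (m ^ d) (K ^ d)))))))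

  off≤Ψ : suc (2 * (D₁ e′ + b e′)) ≤ Ψ e′
  off≤Ψ = ≤-trans (m≤m+n _ _) (≤-reflexive (sym (Ψ≡ e′)))

  D₁≤Ψ : D₁ e′ ≤ Ψ e′
  D₁≤Ψ = ≤-trans (≤-trans (m≤m+n (D₁ e′) (b e′)) (≤-trans (m≤m+n _ _) (n≤1+n _))) off≤Ψ

  missed≤Ψ : d * (m * D₁ e′) + Ξ e′ ≤ Ψ e′
  missed≤Ψ = ≤-trans (m≤n+m (d * (m * D₁ e′) + Ξ e′) (suc (2 * (D₁ e′ + b e′)))) (≤-reflexive (sym (Ψ≡ e′)))

  labelled : ∀ f → isHom H m d f ≡ true → Light f → misses f < Ξ e′ → is-nothing (lab f) ≡ false
  labelled f h light mis = go (findᵇ (fits f) subsets) (findᵇ-found (fits f) (∈-elts (SubsetEnum n) A) fit)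
    where
    go : ∀ x → is-nothing x ≡ false → is-nothing (maybe′ (λ A → just (A , comm A)) nothing x) ≡ false
    go (just _) _ = refl
    A : Subset n
    A = Dimension.A k M m≡ n H H-sym wgt 1≤wgt e′ f₀ f light
    fit : fits f A ≡ true
    fit = cong₂ _∧_ (optimal-A f light (≤-trans off≤Ψ Ψ≤)) (cong₂ _∧_ (≤Ψ⇒few (≤-trans (count₁ f light) D₁≤Ψ))
      (cong₂ _∧_ (≤Ψ⇒few (≤-trans (count₂ f light (hom⁻ f h)) D₁≤Ψ)) (cong₂ _∧_ (≤Ψ⇒few (≤-trans (count₃ f light) D₁≤Ψ))
        (≤Ψ⇒few (≤-trans (count₄ f light mis) missed≤Ψ)))))

  heavies : Col → ℕ
  heavies f = E↑.heavy f + E↓.heavy f + E↑′.heavy f + E↓′.heavy f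

  unlabelled : Col → ℕ
  unlabelled f = if isHom H m d f ∧ is-nothing (lab f) then product f else 0

  -- A homomorphism without label is heavy in one of the four orders or has many misses, so at least
  -- one summand on the right carries its full weight.
  unlabelled≤ : ∀ f → unlabelled f ≤ heavies f * weight f + ⟦ Ξ e′ ≤ᵇ misses f ⟧ * weight f
  unlabelled≤ f = go (isHom H m d f) refl (E↑.heavy f) refl (E↓.heavy f) refl (E↑′.heavy f) refl (E↓′.heavy f) refl (Ξ e′ ≤ᵇ misses f) refl
    where
    bound : ∀ h x → 1 ≤ h + x → isHom H m d f ≡ true → (if true ∧ is-nothing (lab f) then product f else 0) ≤ h * weight f + x * weight f
    bound h x p q = ≤-trans (if≤ (is-nothing (lab f))) (≤-trans (≤-reflexive (sym (trans (*-identityˡ (weight f)) (weight-hom f q))))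
      (≤-trans (*-monoˡ-≤ (weight f) p) (≤-reflexive (*-distribʳ-+ (weight f) h x))))
      where
      if≤ : ∀ c → (if c then product f else 0) ≤ product f
      if≤ true  = ≤-refl
      if≤ false = z≤n
    go : ∀ o → isHom H m d f ≡ o → ∀ a → E↑.heavy f ≡ a → ∀ b → E↓.heavy f ≡ b → ∀ c → E↑′.heavy f ≡ c → ∀ e → E↓′.heavy f ≡ e →
         ∀ x → (Ξ e′ ≤ᵇ misses f) ≡ x →
         (if o ∧ is-nothing (lab f) then product f else 0) ≤ (a + b + c + e) * weight f + ⟦ x ⟧ * weight f
    go false _ _ _ _ _ _ _ _ _ _ _ = z≤n
    go true q (suc a) _ b _ c _ e _ x _ = bound (suc a + b + c + e) ⟦ x ⟧ (s≤s z≤n) q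
    go true q zero _ (suc b) _ c _ e _ x _ = bound (suc b + c + e) ⟦ x ⟧ (s≤s z≤n) q
    go true q zero _ zero _ (suc c) _ e _ x _ = bound (suc c + e) ⟦ x ⟧ (s≤s z≤n) q
    go true q zero _ zero _ zero _ (suc e) _ x _ = bound (suc e) ⟦ x ⟧ (s≤s z≤n) q
    go true q zero _ zero _ zero _ zero _ true _ = bound 0 1 ≤-refl q
    go true q zero ea zero eb zero ec zero ee false ex =
      ≤-trans (≤-reflexive (if-false {b = is-nothing (lab f)} (labelled f q (record { l↑ = ea ; l↓ = eb ; l↑′ = ec ; l↓′ = ee })
        (≰⇒> (λ h → true≢false (T⇒≡ (≤⇒≤ᵇ h)) ex))))) z≤n

  ∑unlabelled : ∑ fs unlabelled * suc (suc (2 * L)) ^ d ≤ 5 * (suc (2 * L) ^ d * Zn)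
  ∑unlabelled = ≤-trans (*-monoˡ-≤ (suc (suc (2 * L)) ^ d) (≤-trans (∑-mono fs unlabelled≤) (≤-reflexive split)))
    (five-parts L d (∑ fs (λ f → E↑.heavy f * weight f)) (∑ fs (λ f → E↓.heavy f * weight f)) (∑ fs (λ f → E↑′.heavy f * weight f))
      (∑ fs (λ f → E↓′.heavy f * weight f)) W Zn E↑.heavy-sum E↓.heavy-sum E↑′.heavy-sum E↓′.heavy-sum
      (rare n m L d δ (Ξ e′) W (∑ fs (λ f → misses f * weight f)) Zn 1≤n (s≤s z≤n) d≤δ (≤Ξ e′) (markov fs misses weight (Ξ e′))
        (≤-trans ∑misses (≤-reflexive (cong (_* (n * (L ^ δ * Zn))) (length-allVerts m d))))))
    where
    W : ℕ
    W = ∑ fs (λ f → ⟦ Ξ e′ ≤ᵇ misses f ⟧ * weight f)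
    five : ∀ {A : Set} (l : List A) (a b c e x w : A → ℕ) → ∑ l (λ f → (a f + b f + c f + e f) * w f + x f * w f)
           ≡ ∑ l (λ f → a f * w f) + ∑ l (λ f → b f * w f) + ∑ l (λ f → c f * w f) + ∑ l (λ f → e f * w f) + ∑ l (λ f → x f * w f)
    five []      a b c e x w = refl
    five (f ∷ l) a b c e x w = trans (cong ((a f + b f + c f + e f) * w f + x f * w f +_) (five l a b c e x w))
      (lem (a f) (b f) (c f) (e f) (x f) (w f) (∑ l (λ f → a f * w f)) (∑ l (λ f → b f * w f)) (∑ l (λ f → c f * w f)) (∑ l (λ f → e f * w f)) (∑ l (λ f → x f * w f)))
      where
      lem : ∀ a b c e x w A B C E Ξ → (a + b + c + e) * w + x * w + (A + B + C + E + Ξ)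
            ≡ a * w + A + (b * w + B) + (c * w + C) + (e * w + E) + (x * w + Ξ)
      lem = solve-∀
    split : ∑ fs (λ f → heavies f * weight f + ⟦ Ξ e′ ≤ᵇ misses f ⟧ * weight f)
            ≡ ∑ fs (λ f → E↑.heavy f * weight f) + ∑ fs (λ f → E↓.heavy f * weight f) + ∑ fs (λ f → E↑′.heavy f * weight f) + ∑ fs (λ f → E↓′.heavy f * weight f) + W
    split = five fs E↑.heavy E↓.heavy E↑′.heavy E↓′.heavy (λ f → ⟦ Ξ e′ ≤ᵇ misses f ⟧) weight

  Zn≤ : Zn ≤ ∑ fs (λ f → if isHom H m d f ∧ true then product f else 0)
  Zn≤ = ∑-mono fs (λ f → pt f (isHom H m d f) refl)
    where
    pt : ∀ f x → isHom H m d f ≡ x → weight f ≤ (if x ∧ true then product f else 0)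
    pt f true  q = ≤-reflexive (weight-hom f q)
    pt f false q = ≤-reflexive (weight-nonhom f q)

  all-homs : ℕ
  all-homs = ∑ fs (λ f → if isHom H m d f ∧ true then product f else 0)

  few-unlabelled : 8 * suc (2 * L) ≤ d → 2 * suc (suc (2 * L)) ≤ K → (∑ fs unlabelled) ^ K * 2 ^ d ≤ all-homs ^ K
  few-unlabelled 8p≤d 2r≤K = ≤-trans (final-power (suc (2 * L)) K d (∑ fs unlabelled) Zn (s≤s z≤n) 8p≤d 2r≤K ∑unlabelled) (^-monoˡ-≤ K Zn≤)

  labelling : 8 * suc (2 * L) ≤ d → 2 * suc (suc (2 * L)) ≤ K → Labelled n H wgt m d K
  labelling 8p≤d 2r≤K = record
    { lab     = lab
    ; maximal = λ f _ → lab-maximal f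
    ; light   = few-unlabelled 8p≤d 2r≤K
    ; counts  = λ f _ → few-exceptions f
    }

-- The torus has a vertex, so without colours there are no colourings and the total weight of the
-- exceptional class is 0.
no-colours : ∀ H wgt k d → Labelled 0 H wgt (suc k) d 1
no-colours H wgt k d = record
  { lab     = λ _ → nothing
  ; maximal = λ f _ _ _ ()
  ; light   = ≤-trans (*-monoˡ-≤ (2 ^ d) (^-monoˡ-≤ 1 none)) z≤n
  ; counts  = λ f _ _ _ ()
  }
  where
  impossible : Coloring 0 (suc k) d → ⊥
  impossible f = case f (Data.Vec.replicate d zero) of λ ()
  none : ∑ (allColorings 0 (suc k) d) (λ f → if isHom H (suc k) d f ∧ true then ∏ (allVerts (suc k) d) (λ v → wgt (f v)) else 0) ≤ 0
  none = ≤-trans (∑-mono (allColorings 0 (suc k) d) (λ f → ⊥-elim (impossible f))) (≤-reflexive (∑-0 (allColorings 0 (suc k) d)))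

-- The same constant serves the counts and the exceptional weight. Raising it from `k₀` only weakens
-- the counts, and `2 (p + 1)` is what `final-power` requires; likewise `d` must exceed `8 p` and be
-- at least 2.
labelled : ∀ k M (m≡ : suc (suc k) ≡ M + M) n-1 (H : Adj (suc n-1)) (H-sym : ∀ i j → H i j ≡ H j i)
           (wgt : Fin (suc n-1) → ℕ) (1≤wgt : ∀ c → 1 ≤ wgt c) k₀ d₀ → 1 ≤ k₀ →
           Growth.Small k (Numbers.Ψ k M m≡ (suc n-1) H wgt 1≤wgt) k₀ d₀ →
           let p = Numbers.p k M m≡ (suc n-1) H wgt 1≤wgt in
           ∀ d → 2 + (d₀ + 8 * p) ≤ d → Labelled (suc n-1) H wgt (suc (suc k)) d (k₀ + 2 * suc p)
labelled k M m≡ n-1 H H-sym wgt 1≤wgt k₀ d₀ 1≤k₀ small (suc (suc e′)) (s≤s (s≤s h)) =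
  Labelling.labelling k M m≡ (suc n-1) H H-sym wgt 1≤wgt e′ (λ _ → zero) (s≤s z≤n) rate (≤-trans 1≤k₀ k₀≤)
    (Growth.small-mono k {Numbers.Ψ k M m≡ (suc n-1) H wgt 1≤wgt} {k₀} {d₀} rate 1≤k₀ k₀≤ small e′ (≤-trans (≤-trans (m≤m+n d₀ (8 * p)) h) (m≤n+m e′ 2)))
    (≤-trans (≤-trans (m≤n+m (8 * p) d₀) h) (m≤n+m e′ 2)) (m≤n+m (2 * suc p) k₀)
  where
  p rate : ℕ
  p    = Numbers.p k M m≡ (suc n-1) H wgt 1≤wgt
  rate = k₀ + 2 * suc p
  k₀≤ : k₀ ≤ rate
  k₀≤ = m≤m+n k₀ (2 * suc p)

even-torus : ∀ n (H : Adj n) → (∀ i j → H i j ≡ H j i) → (wgt : Fin n → ℕ) → (∀ c → 1 ≤ wgt c) →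
             ∀ m → 2 ≤ m → 2 ∣ m → ∃[ k ] (1 ≤ k × ∃[ d₀ ] (∀ d → d₀ ≤ d → Labelled n H wgt m d k))
even-torus zero     H H-sym wgt 1≤wgt (suc (suc k)) _ _             = 1 , ≤-refl , 0 , λ d _ → no-colours H wgt (suc k) d
even-torus zero     H H-sym wgt 1≤wgt (suc zero)    (s≤s ()) _
even-torus (suc n)  H H-sym wgt 1≤wgt (suc zero)    (s≤s ()) _
even-torus (suc n)  H H-sym wgt 1≤wgt (suc (suc k)) _ (divides M e) = go (Growth.small k (Numbers.exp-Ψ k M m≡ (suc n) H wgt 1≤wgt))
  where
  m≡ : suc (suc k) ≡ M + M
  m≡ = trans e (trans (*-comm M 2) (cong (M +_) (+-identityʳ M)))
  go : ∃[ k₀ ] ∃[ d₀ ] (1 ≤ k₀ × Growth.Small k (Numbers.Ψ k M m≡ (suc n) H wgt 1≤wgt) k₀ d₀) →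
       ∃[ k′ ] (1 ≤ k′ × ∃[ d₀ ] (∀ d → d₀ ≤ d → Labelled (suc n) H wgt (suc (suc k)) d k′))
  go (k₀ , d₀ , 1≤k₀ , small) = _ , ≤-trans 1≤k₀ (m≤m+n k₀ _) , _ , labelled k M m≡ n H H-sym wgt 1≤wgt k₀ d₀ 1≤k₀ small

theorem1p1 :
    (n : ℕ) (H : Adj n) → (∀ i j → H i j ≡ H j i) →
    (lam : Fin n → ℚ) → (∀ i → 0ℚ ℚ.< lam i) →
    (m : ℕ) → 2 ≤ m → 2 ∣ m →
    Σ ℕ λ k → (1 ≤ k × Σ ℕ λ d₀ → (∀ (d : ℕ) → d₀ ≤ d →
      Σ (Coloring n m d → Maybe (Subset n × Subset n)) λ lab → (
        -- lab : Hom(T_{m,d},H) → {0} ∪ M_Λ(H)  (nothing = class D_Λ(0))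
        (∀ (f : Coloring n m d) → isHom H m d f ≡ true →
           ∀ AB → lab f ≡ just AB → InM H lam AB)
        -- 1. w(D(0)) ≤ 2^(-d/k) Z
        × (powℚ (wtHom H lam m d (λ f → is-nothing (lab f))) k ℚ.* ((ℤ.+ (2 ^ d)) ℚ./ 1)
             ℚ.≤ powℚ (Z H lam m d) k)
        -- 2. all counts ≤ (m - 1/k)^d
        × (∀ (f : Coloring n m d) → isHom H m d f ≡ true →
             ∀ (A B : Subset n) → lab f ≡ just (A , B) →
               (countV m d (λ v → isEven v ∧ not (lookup A (f v))) * k ^ d ≤ (m * k ∸ 1) ^ d)
             × (countV m d (λ v → isOdd v ∧ not (lookup B (f v))) * k ^ d ≤ (m * k ∸ 1) ^ d)
             × (countV m d (λ w → isOdd w ∧ not (allColorsAppear A f w)) * k ^ d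
                  ≤ (m * k ∸ 1) ^ d)
             × (countV m d (λ w → isEven w ∧ not (allColorsAppear B f w)) * k ^ d
                  ≤ (m * k ∸ 1) ^ d)))))
theorem1p1 n H H-sym lam lam>0 m 2≤m 2∣m = clear (common n lam lam>0)
  where
  clear : ∃[ D ] Σ (Fin n → ℕ) (λ a → 1 ≤ D × (∀ i → 1 ≤ a i) × (∀ i → a i over D is lam i)) → _
  clear (D , a , 1≤D , 1≤a , rep) = descale (even-torus n H H-sym a 1≤a m 2≤m 2∣m)
    where
    open Scaled lam D 1≤D a rep
    descale : ∃[ k ] (1 ≤ k × ∃[ d₀ ] (∀ d → d₀ ≤ d → Labelled n H a m d k)) → _
    descale (k , 1≤k , d₀ , h) = k , 1≤k , d₀ , λ d d₀≤d → let open Labelled (h d d₀≤d) in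
      lab ,
      (λ { f hom (A , B) e → inM H A B (proj₁ (maximal f hom A B e)) (proj₂ (maximal f hom A B e)) }) ,
      -- All colourings have weights of the same degree in `lam`, so both sides share the
      -- denominator `D ^ (m ^ d)`, raised to the power `k`.
      over-power (total (λ f → is-nothing (lab f))) (total (λ _ → true)) k d (1≤^ (length (allVerts m d)) 1≤D)
        (over-wtHom H m d (λ f → is-nothing (lab f))) (over-wtHom H m d (λ _ → true)) light ,
      counts
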